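{- Let $T$ be a string of length $n$ over an ordered alphabet of size $\sigma$, such that $T$ ends with a unique terminal symbol $\$$ (i.e. $T[n]=\$$ and $T[i]\neq\$$ for $1\le i<n$). There is an online algorithm that reads $T$ from right to left and constructs the linear-size suffix trie $\mathsf{LST}(T)$ in $O(n\log\sigma)$ time and $O(n)$ space.
   Context: Notation: $T[i]$ is the $i$-th symbol of $T$, $T[i:j]=T[i]\cdots T[j]$ (empty if $i>j$), $T[i:]=T[i:n]$ where $n=|T|$. The suffix trie $\mathsf{STrie}(T)$ is the trie of all suffixes of $T$; its nodes are identified with the substrings of $T$ (the root is the empty string $\varepsilon$), and a node $Ua$ ($a$ a symbol) is the child of $U$ along an edge labeled $a$. The suffix link of a nonempty node $U$ is $\mathsf{slink}(U)=U[2:|U|]$. The suffix tree $\mathsf{STree}(T)$ is the path-compressed version whose nodes are the root, the nodes of $\mathsf{STrie}(T)$ with at least two children, and all nodes representing suffixes of $T$ (also non-branching ones). The linear-size suffix trie $\mathsf{LST}(T)$ has as nodes the following subset of the nodes of $\mathsf{STrie}(T)$: type-1 nodes, which are the nodes of $\mathsf{STrie}(T)$ that are also nodes of $\mathsf{STree}(T)$; and type-2 nodes, which are the nodes of $\mathsf{STrie}(T)$ that are not type-1 and whose suffix link points to a type-1 node. A node $U$ of $\mathsf{LST}(T)$ is the parent of a node $V$ if $U$ is the nearest proper ancestor of $V$ in $\mathsf{STrie}(T)$ that is a node of $\mathsf{LST}(T)$. The edge $(U,V)$ is labeled by the single symbol labeling the first edge on the path from $U$ to $V$ in $\mathsf{STrie}(T)$,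 and $V$ carries a $+$ sign (is a $+$-node) if that path has length more than one. The structure also includes the suffix links of its nodes. (It does not include the so-called fast links.) Online, right to left: the algorithm reads $T[n],T[n-1],\dots,T[1]$ one symbol at a time; when $T[i]$ is read it updates $\mathsf{LST}(T[i+1:])$ to $\mathsf{LST}(T[i:])$; previously read symbols are not accessed. Time and space are measured in the standard RAM model (space in words); $\log\sigma$ is read as $\max\{1,\log\sigma\}$. -}

module Defs where

open import Data.Bool using (Bool; true; false; if_then_else_)
open import Data.Fin using (Fin)
open import Data.List using (List; []; _∷_; _++_; _∷ʳ_)
open import Data.List.Membership.Propositional using (_∈_; _∉_)
open import Data.List.Relation.Binary.Infix.Heterogeneous using (Infix)
open import Data.List.Relation.Binary.Prefix.Heterogeneous using (Prefix)
open import Data.List.Relation.Binary.Suffix.Heterogeneous using (Suffix)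
open import Data.List.Relation.Unary.AllPairs using (AllPairs)
open import Data.Nat using (ℕ; _+_; _*_; _∸_; _^_)
  renaming (_<_ to _<ℕ_; _<?_ to _<ℕ?_; _≟_ to _≟ℕ_)
open import Data.Product using (∃; ∃₂; _×_; _,_; proj₁)
open import Data.Sum using (_⊎_)
open import Data.Vec using (Vec; lookup; replicate; _[_]≔_)
open import Function.Bundles using (_↔_; _⇔_)
open import Relation.Binary.PropositionalEquality using (_≡_; _≢_)
open import Relation.Binary.Structures using (IsStrictTotalOrder)
open import Relation.Nullary using (¬_)
open import Relation.Nullary.Decidable using (⌊_⌋)

record OrderedAlphabet (σ : ℕ) : Set₁ where
  infix 4 _<_
  field
    Symbol             : Set
    _<_                : Symbol → Symbol → Set
    isStrictTotalOrder : IsStrictTotalOrder _≡_ _<_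
    size               : Symbol ↔ Fin σ

  open IsStrictTotalOrder isStrictTotalOrder public using (_≟_; _<?_)

EndsWithUniqueTerminal : {A : Set} → List A → Set
EndsWithUniqueTerminal T = ∃₂ λ U $ → T ≡ U ∷ʳ $ × $ ∉ U

module LinearSizeSuffixTrie {A : Set} (T : List A) where

  STrieNode : List A → Set
  STrieNode U = Infix _≡_ U T

  Branching : List A → Set
  Branching U = ∃₂ λ a b → a ≢ b × STrieNode (U ∷ʳ a) × STrieNode (U ∷ʳ b)

  STreeNode : List A → Set
  STreeNode U = STrieNode U × (U ≡ [] ⊎ Branching U ⊎ Suffix _≡_ U T)

  Type1 : List A → Set
  Type1 U = STrieNode U × STreeNode U

  -- A type-2 node is nonempty, hence of the form a ∷ V with suffix link V.
  Type2 : List A → Set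
  Type2 U = STrieNode U × ¬ Type1 U × ∃₂ λ a V → U ≡ a ∷ V × Type1 V

  Node : List A → Set
  Node U = Type1 U ⊎ Type2 U

  ProperAncestor : List A → List A → Set
  ProperAncestor U V = ∃₂ λ a W → V ≡ U ++ a ∷ W

  IsParent : List A → List A → Set
  IsParent U V =
    Node U × Node V × ProperAncestor U V ×
    (∀ X → Node X → ProperAncestor X V → Prefix _≡_ X U)

  -- The edge from U to U ++ a ∷ W is labeled a; its lower end is a
  -- +-node precisely when W is nonempty.
  Edge : List A → A → List A → Set
  Edge U a W = IsParent U (U ++ a ∷ W)

-- Programs mention no alphabet, so a single program serves all of them.
-- A program with k registers is given in structured form.

data Op : Set where
  add sub mul : Op

data Instr (k : ℕ) : Set where
  const : Fin k → ℕ → Instr k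
  move  : Fin k → Fin k → Instr k
  arith : Op → Fin k → Fin k → Fin k → Instr k
  load  : Fin k → Fin k → Instr k
  store : Fin k → Fin k → Instr k

data Test (k : ℕ) : Set where
  less equal : Fin k → Fin k → Test k

infixr 5 _⨾_

data Program (k : ℕ) : Set where
  skip   : Program k
  instr  : Instr k → Program k
  _⨾_    : Program k → Program k → Program k
  branch : Test k → Program k → Program k → Program k
  while  : Test k → Program k → Program k

-- `setup` runs once before anything is read; `update` runs once per
-- symbol, which it finds in the register `input`.  The register `output`
-- holds the address of the root of the structure being maintained.
record OnlineAlgorithm : Set where
  field
    registers    : ℕ
    setup update : Program registers
    input output : Fin registers

⟦_⟧ : Op → ℕ → ℕ → ℕ
⟦ add ⟧ = _+_
⟦ sub ⟧ = _∸_
⟦ mul ⟧ = _*_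

-- A machine whose memory has the `space` addresses
-- 0 , … , space ∸ 1 and whose words hold a number of `width` bits or an
-- alphabet symbol.  Symbols can be copied and compared, nothing else.
-- An instruction with an address or a result out of range has no
-- execution.

module Machine {σ : ℕ} (Σ : OrderedAlphabet σ) (space width : ℕ) where

  open OrderedAlphabet Σ

  data Word : Set where
    num : ℕ → Word
    sym : Symbol → Word

  record State (k : ℕ) : Set where
    constructor ⟨_,_⟩
    field
      regs : Vec Word k
      mem  : ℕ → Word

  open State public

  initial : ∀ {k} → State k
  initial {k} = ⟨ replicate k (num 0) , (λ _ → num 0) ⟩

  _⟨_⟩≔_ : (ℕ → Word) → ℕ → Word → (ℕ → Word)
  (M ⟨ p ⟩≔ x) q = if ⌊ p ≟ℕ q ⌋ then x else M q

  _[_]↦_ : ∀ {k} → State k → ℕ → Word → Set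
  s [ p ]↦ x = p <ℕ space × mem s p ≡ x

  data Step {k : ℕ} : Instr k → State k → State k → Set where
    const : ∀ {R M} {r : Fin k} {m} →
            m <ℕ 2 ^ width →
            Step (const r m) ⟨ R , M ⟩ ⟨ R [ r ]≔ num m , M ⟩
    move  : ∀ {R M} {r i : Fin k} →
            Step (move r i) ⟨ R , M ⟩ ⟨ R [ r ]≔ lookup R i , M ⟩
    arith : ∀ {R M} {o} {r i j : Fin k} {m n} →
            lookup R i ≡ num m → lookup R j ≡ num n →
            ⟦ o ⟧ m n <ℕ 2 ^ width →
            Step (arith o r i j) ⟨ R , M ⟩ ⟨ R [ r ]≔ num (⟦ o ⟧ m n) , M ⟩
    load  : ∀ {R M} {r i : Fin k} {p} →
            lookup R i ≡ num p → p <ℕ space →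
            Step (load r i) ⟨ R , M ⟩ ⟨ R [ r ]≔ M p , M ⟩
    store : ∀ {R M} {i j : Fin k} {p} →
            lookup R i ≡ num p → p <ℕ space →
            Step (store i j) ⟨ R , M ⟩ ⟨ R , M ⟨ p ⟩≔ lookup R j ⟩

  data Outcome {k : ℕ} (R : Vec Word k) : Test k → Bool → Set where
    lessNum  : ∀ {i j m n} → lookup R i ≡ num m → lookup R j ≡ num n →
               Outcome R (less i j) ⌊ m <ℕ? n ⌋
    lessSym  : ∀ {i j a b} → lookup R i ≡ sym a → lookup R j ≡ sym b →
               Outcome R (less i j) ⌊ a <? b ⌋
    equalNum : ∀ {i j m n} → lookup R i ≡ num m → lookup R j ≡ num n →
               Outcome R (equal i j) ⌊ m ≟ℕ n ⌋
    equalSym : ∀ {i j a b} → lookup R i ≡ sym a → lookup R j ≡ sym b →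
               Outcome R (equal i j) ⌊ a ≟ b ⌋

  -- Exec c s t s′: from s, the program c halts in s′ after t steps.
  data Exec {k : ℕ} : Program k → State k → ℕ → State k → Set where
    skip        : ∀ {s} → Exec skip s 0 s
    instr       : ∀ {i s s′} → Step i s s′ → Exec (instr i) s 1 s′
    _⨾_         : ∀ {c d s s′ s″ t t′} → Exec c s t s′ → Exec d s′ t′ s″ →
                  Exec (c ⨾ d) s (t + t′) s″
    branchTrue  : ∀ {b c d s s′ t} → Outcome (regs s) b true →
                  Exec c s t s′ → Exec (branch b c d) s (1 + t) s′
    branchFalse : ∀ {b c d s s′ t} → Outcome (regs s) b false →
                  Exec d s t s′ → Exec (branch b c d) s (1 + t) s′
    whileTrue   : ∀ {b c s s′ s″ t t′} → Outcome (regs s) b true →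
                  Exec c s t s′ → Exec (while b c) s′ t′ s″ →
                  Exec (while b c) s (1 + t + t′) s″
    whileFalse  : ∀ {b c s} → Outcome (regs s) b false →
                  Exec (while b c) s 1 s

  -- Dictionary s p xs: p is the address of a binary tree with in-order
  -- sequence of entries xs.  A tree record consists of a symbol, a value
  -- and the addresses of two subtrees; the empty tree has address 0.
  data Dictionary {k : ℕ} (s : State k) : ℕ → List (Symbol × ℕ) → Set where
    empty : Dictionary s 0 []
    node  : ∀ {p a v l r xs ys} → p ≢ 0 →
            s [ p ]↦ sym a →
            s [ 1 + p ]↦ num v →
            s [ 2 + p ]↦ num l →
            s [ 3 + p ]↦ num r →
            Dictionary s l xs →
            Dictionary s r ys →
            Dictionary s p (xs ++ (a , v) ∷ ys)

  Sorted : List (Symbol × ℕ) → Set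
  Sorted = AllPairs (λ x y → proj₁ x < proj₁ y)

  plusSign : List Symbol → ℕ
  plusSign []      = 0
  plusSign (_ ∷ _) = 1

  -- The record of a node holds the address of a search tree with its
  -- outgoing edges, the address of its suffix link and its + sign, in
  -- this order.  The last two are unconstrained at the root, which has
  -- neither.  The algorithm may keep further data elsewhere.
  record StoresLST {k : ℕ} (s : State k) (root : Fin k) (T : List Symbol)
         : Set where
    open LinearSizeSuffixTrie T
    field
      address   : List Symbol → ℕ
      nonnull   : ∀ {U} → Node U → address U ≢ 0
      injective : ∀ {U V} → Node U → Node V → address U ≡ address V → U ≡ V
      atRoot    : lookup (regs s) root ≡ num (address [])
      children  : ∀ {U} → Node U → ∃₂ λ d xs →
                  s [ address U ]↦ num d ×
                  Dictionary s d xs ×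
                  Sorted xs ×
                  (∀ a v → (a , v) ∈ xs ⇔
                           (∃ λ W → Edge U a W × v ≡ address (U ++ a ∷ W)))
      slink     : ∀ {a U} → Node (a ∷ U) →
                  s [ 1 + address (a ∷ U) ]↦ num (address U)
      plus      : ∀ {U a W} → Edge U a W →
                  s [ 2 + address (U ++ a ∷ W) ]↦ num (plusSign W)

  -- Constructs alg T t s: reading T from its last symbol to its first
  -- takes t steps in total and ends in s, and the LST of each nonempty
  -- suffix of T is stored as soon as that suffix has been read.
  module _ (alg : OnlineAlgorithm) where
    open OnlineAlgorithm alg

    data Constructs : List Symbol → ℕ → State registers → Set where
      start : ∀ {t s} → Exec setup initial t s → Constructs [] t s
      read  : ∀ {a T R M t t′ s} →
              Constructs T t ⟨ R , M ⟩ →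
              Exec update ⟨ R [ input ]≔ sym a , M ⟩ t′ s →
              StoresLST s output (a ∷ T) →
              Constructs (a ∷ T) (t + (1 + t′)) s

{-# OPTIONS --safe #-}
module Submission where

-- Prepending a letter a to T adds to the type-1 nodes only a ∷ T itself and
-- h, the longest prefix of a ∷ T that occurs in T; h is either the root or
-- a ∷ u for the lowest type-1 ancestor u of the leaf T with a Weiner link
-- (an inverse suffix link) for a.  So h is found, as in Weiner's algorithm,
-- by climbing from T through its type-1 ancestors, and those below u get a
-- Weiner link for a.  If h was not a type-1 node before, its Weiner links
-- are copies of those of the next type-1 node below it.  The number of
-- type-1 ancestors of the current leaf is the potential that pays for the
-- climbs, and every copied link is paid for by the node it leads to; there
-- are at most 1 + 3n nodes, since a type-2 node is the shortest suffix of
-- some prefix of the text that is not a type-1 node.  Outgoing edges and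
-- Weiner links are kept in AA-trees, whence the factor log σ.

open import Defs
open import Data.Bool using (Bool; false; if_then_else_; true)
open import Data.Empty using (⊥; ⊥-elim)
open import Data.Fin using (Fin; _↑ʳ_; _↑ˡ_; fromℕ<; splitAt; suc; toℕ; zero)
open import Data.Fin.Properties using (injective⇒≤; splitAt-↑ʳ; splitAt-↑ˡ; toℕ-fromℕ<; toℕ<n)
import Data.Fin.Properties as Fin
open import Data.List using (List; []; _++_; _∷_; _∷ʳ_; length; map; take)
open import Data.List.Membership.Propositional using (_∈_; _∉_)
open import Data.List.Membership.Propositional.Properties using (∈-++⁺ʳ; ∈-++⁺ˡ; ∈-++⁻; ∈-lookup; ∈-map⁺; ∈-map⁻)
open import Data.List.Properties using (++-assoc; ++-cancelˡ; ++-identityʳ; length-++; length-map; ∷-injective; ∷-injectiveʳ; ≡-dec)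
open import Data.List.Relation.Binary.Infix.Heterogeneous as Infix using (Infix)
open import Data.List.Relation.Binary.Permutation.Propositional using (_↭_; module PermutationReasoning; ↭-reflexive; ↭-sym; ↭-trans)
open import Data.List.Relation.Binary.Permutation.Propositional.Properties using (All-resp-↭; shift; shifts; ∈-resp-↭)
open import Data.List.Relation.Binary.Pointwise as Pointwise using (Pointwise; Pointwise-≡⇒≡; []; _∷_; ≡⇒Pointwise-≡)
open import Data.List.Relation.Binary.Prefix.Heterogeneous as Prefix using (Prefix)
open import Data.List.Relation.Binary.Suffix.Heterogeneous as Suffix using (Suffix)
open import Data.List.Relation.Unary.All as All using (All; []; _∷_)
open import Data.List.Relation.Unary.All.Properties using (++⁻ʳ; ++⁻ˡ) renaming (++⁺ to All-++⁺)
open import Data.List.Relation.Unary.AllPairs as AllPairs using (AllPairs; []; _∷_)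
import Data.List.Relation.Unary.AllPairs.Properties as AllPairs
open import Data.List.Relation.Unary.Any using (here; index; there)
open import Data.List.Relation.Unary.Any.Properties using (lookup-index)
open import Data.Maybe using (Maybe; just; nothing)
open import Data.Nat using (>-nonZero; _*_; _+_; _<?_; _<_; _<ᵇ_; _^_; _∸_; _≟_; _≤_; _⊔_; suc; s≤s; zero; z≤n; ℕ; ⌈_/2⌉; ⌊_/2⌋)
open import Data.Nat.DivMod using ([m+kn]%n≡m%n; _%_; m*n%n≡0; m<n⇒m%n≡m)
open import Data.Nat.Induction using (<-rec; <-wellFounded)
open import Data.Nat.Logarithm using (⌈log₂2*n⌉≡1+⌈log₂n⌉; ⌈log₂2^n⌉≡n; ⌈log₂_⌉; ⌈log₂⌈n/2⌉⌉≡⌈log₂n⌉∸1; ⌈log₂⌉-mono-≤)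
open import Data.Nat.Properties
open import Data.Nat.Tactic.RingSolver using (solve-∀)
open import Data.Product using (_,_; _×_; proj₁; proj₂; ∃; ∃₂)
open import Data.Sum as Sum using (_⊎_; inj₁; inj₂)
open import Data.Sum.Properties using (inj₁-injective; inj₂-injective)
open import Data.Unit using (tt; ⊤)
open import Data.Vec.Properties using (lookup-replicate; lookup∘update; lookup∘update′)
open import Function using (_$_; _∘_)
open import Function.Bundles using (Inverse; _⇔_; mk⇔)
open import Induction.WellFounded using (Acc; acc)
open import Relation.Binary.Definitions using (DecidableEquality; tri<; tri>; tri≈)
open import Relation.Binary.PropositionalEquality
open import Relation.Binary.Structures using (IsStrictTotalOrder)
open import Relation.Nullary using (Dec; no; yes; ¬_)
open import Relation.Nullary.Decidable using (dec-false; dec-true; does; isYes; isYes≗does; map′)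
open import Algebra.Properties.CommutativeSemigroup +-commutativeSemigroup using (interchange)

-- No edge is ever searched for. A new node `b ∷ v` other than the leaf splits the edge that enters
-- `b ∷ x`, where x is a type-1 node next below v, and `b ∷ x` is already at hand. The upper half of
-- the edge keeps its entry in the dictionary of the parent, which is merely redirected to the new
-- node, so a split costs one insertion, that of a Weiner link.
--
-- What does have to be found is the type-1 node next below h. Every node stores it in its field
-- `down`, a type-1 node pointing to itself. When h, with type-1 parent P, becomes a type-1 node,
-- `down` changes exactly for the nodes strictly below P down to h. They have the form `a ∷ v` with
-- v of type 1, so they are reached by Weiner links with the letter a from type-1 ancestors of u.
-- This second climb has at most 1 + depth u - depth P steps, and the new leaf has the depth of P up
-- to a constant: the potential pays again.
--
-- Programs are verified on an abstract heap of records, where straight-line code runs by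
-- computation, together with ghost data that name each record by its string.

module Tuples where

  -- Nested pairs rather than vectors: by η, reading a closed index after
  -- writing a closed index computes even in a tuple variable.  The record
  -- around the pairs lets Agda infer A and n.
  Pairs : Set → ℕ → Set
  Pairs A zero    = ⊤
  Pairs A (suc n) = A × Pairs A n

  record Tup (A : Set) (n : ℕ) : Set where
    constructor ⟪_⟫
    field
      pairs : Pairs A n

  open Tup public

  module _ {A : Set} where

    getP : ∀ {n} → Pairs A n → Fin n → A
    getP t zero    = proj₁ t
    getP t (suc i) = getP (proj₂ t) i

    putP : ∀ {n} → Pairs A n → Fin n → A → Pairs A n
    putP t zero    x = x , proj₂ t
    putP t (suc i) x = proj₁ t , putP (proj₂ t) i x

    constantP : ∀ n → A → Pairs A n
    constantP zero    x = tt
    constantP (suc n) x = x , constantP n x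

    overwriteP : ∀ m {n} → Pairs A m → Pairs A (m + n) → Pairs A (m + n)
    overwriteP zero    s t = t
    overwriteP (suc m) s t = proj₁ s , overwriteP m (proj₂ s) (proj₂ t)

    frontP : ∀ m {n} → Pairs A (m + n) → Pairs A m
    frontP zero    t = tt
    frontP (suc m) t = proj₁ t , frontP m (proj₂ t)

    get-putP : ∀ {n} (t : Pairs A n) i {x} → getP (putP t i x) i ≡ x
    get-putP t zero    = refl
    get-putP t (suc i) = get-putP (proj₂ t) i

    get-putP′ : ∀ {n} (t : Pairs A n) i j {x} → i ≢ j → getP (putP t i x) j ≡ getP t j
    get-putP′ t zero    zero    i≢j = ⊥-elim (i≢j refl)
    get-putP′ t zero    (suc j) i≢j = refl
    get-putP′ t (suc i) zero    i≢j = refl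
    get-putP′ t (suc i) (suc j) i≢j = get-putP′ (proj₂ t) i j (λ eq → i≢j (cong suc eq))

    get-constantP : ∀ {n} (i : Fin n) {x : A} → getP (constantP n x) i ≡ x
    get-constantP zero    = refl
    get-constantP (suc i) = get-constantP i

    get : ∀ {n} → Tup A n → Fin n → A
    get t i = getP (pairs t) i

    put : ∀ {n} → Tup A n → Fin n → A → Tup A n
    put t i x = ⟪ putP (pairs t) i x ⟫

    constant : ∀ n → A → Tup A n
    constant n x = ⟪ constantP n x ⟫

    overwrite : ∀ {m n} → Tup A m → Tup A (m + n) → Tup A (m + n)
    overwrite {m} s t = ⟪ overwriteP m (pairs s) (pairs t) ⟫

    front : ∀ m {n} → Tup A (m + n) → Tup A m
    front m t = ⟪ frontP m (pairs t) ⟫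

    get-put : ∀ {n} (t : Tup A n) i {x} → get (put t i x) i ≡ x
    get-put t = get-putP (pairs t)

    get-put′ : ∀ {n} (t : Tup A n) i j {x} → i ≢ j → get (put t i x) j ≡ get t j
    get-put′ t = get-putP′ (pairs t)

    get-constant : ∀ {n} (i : Fin n) {x : A} → get (constant n x) i ≡ x
    get-constant = get-constantP

  infixl 9 _[_↦_]

  _[_↦_] : {B : Set} → (ℕ → B) → ℕ → B → (ℕ → B)
  (f [ p ↦ x ]) q = if does (p ≟ q) then x else f q

  ↦-same : ∀ {B : Set} (f : ℕ → B) p {x} → (f [ p ↦ x ]) p ≡ x
  ↦-same f p rewrite dec-true (p ≟ p) refl = refl

  ↦-other : ∀ {B : Set} (f : ℕ → B) {p q x} → p ≢ q → (f [ p ↦ x ]) q ≡ f q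
  ↦-other f {p} {q} p≢q rewrite dec-false (p ≟ q) p≢q = refl

open Tuples

-- A command language over records, compiled to machine programs

module Commands where

  #num #sym #nf #sf : ℕ
  #num = 24
  #sym = 6
  #nf  = 15
  #sf  = 2

  NumReg SymReg NumField SymField : Set
  NumReg   = Fin #num
  SymReg   = Fin #sym
  NumField = Fin #nf
  SymField = Fin #sf

  -- Closed indices: the bound has a shape from which unification finds `n`.
  ix : ∀ m {n} → Fin (m + suc n)
  ix zero    = zero
  ix (suc m) = suc (ix m)

  infixr 5 _⨟_

  data Cond : Set where
    nonzero : NumReg → Cond
    eqN ltN : NumReg → NumReg → Cond
    eqS ltS : SymReg → SymReg → Cond

  -- Numbers and symbols live in separate registers and fields. A numeric register or field of a
  -- represented state always holds a number, so arithmetic and addressing never get stuck on a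
  -- symbol. A symbol register may still hold the number 0 with which it starts.
  data Cmd : Set where
    nop  : Cmd
    _⨟_  : Cmd → Cmd → Cmd
    lit  : NumReg → ℕ → Cmd
    mov  : NumReg → NumReg → Cmd
    inc  : NumReg → ℕ → NumReg → Cmd
    ld   : NumReg → NumField → NumReg → Cmd
    st   : NumField → NumReg → NumReg → Cmd
    st0  : NumField → NumReg → Cmd
    movS : SymReg → SymReg → Cmd
    ldS  : SymReg → SymField → NumReg → Cmd
    stS  : SymField → NumReg → SymReg → Cmd
    test : Cond → Cmd → Cmd → Cmd
    loop : Cond → Cmd → Cmd

  offset : NumField → ℕ
  offset f = suc (toℕ f)

  -- Offset 0 is the key of a search tree record, offset 17 the edge label.
  offsetS : SymField → ℕ
  offsetS zero    = 0
  offsetS (suc f) = 17 + toℕ f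

  -- Two hidden registers: a scratch register for addresses, and one that
  -- always holds 0.
  #reg : ℕ
  #reg = 2 + (#num + #sym)

  scratch null : Fin #reg
  scratch = zero
  null    = suc zero

  numReg : NumReg → Fin #reg
  numReg r = suc (suc (r ↑ˡ #sym))

  symReg : SymReg → Fin #reg
  symReg r = suc (suc (#num ↑ʳ r))

  compileCond : Cond → Test #reg
  compileCond (nonzero r) = less null (numReg r)
  compileCond (eqN r q)   = equal (numReg r) (numReg q)
  compileCond (ltN r q)   = less (numReg r) (numReg q)
  compileCond (eqS r q)   = equal (symReg r) (symReg q)
  compileCond (ltS r q)   = less (symReg r) (symReg q)

  locate : ℕ → NumReg → Program #reg
  locate n p = instr (const scratch n) ⨾ instr (arith add scratch scratch (numReg p))

  compile : Cmd → Program #reg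
  compile nop          = skip
  compile (c ⨟ d)      = compile c ⨾ compile d
  compile (lit r n)    = instr (const (numReg r) n)
  compile (mov r q)    = instr (move (numReg r) (numReg q))
  compile (inc r n q)  = instr (const scratch n) ⨾ instr (arith add (numReg r) scratch (numReg q))
  compile (ld r f p)   = locate (offset f) p ⨾ instr (load (numReg r) scratch)
  compile (st f p r)   = locate (offset f) p ⨾ instr (store scratch (numReg r))
  compile (st0 f p)    = locate (offset f) p ⨾ instr (store scratch null)
  compile (movS r q)   = instr (move (symReg r) (symReg q))
  compile (ldS r f p)  = locate (offsetS f) p ⨾ instr (load (symReg r) scratch)
  compile (stS f p r)  = locate (offsetS f) p ⨾ instr (store scratch (symReg r))
  compile (test b c d) = branch (compileCond b) (compile c) (compile d)
  compile (loop b c)   = while (compileCond b) (compile c)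

open Commands

-- The programs

module Programs where

  key slab : SymField
  key  = ix 0
  slab = ix 1

  -- The order is dictated by `StoresLST`: `val`, `left` and `right′` get the offsets 1, 2, 3 behind
  -- the key, as in a dictionary record, and `croot`, `slink` and `plus′` the offsets 6, 7, 8, so
  -- that a node with record p has the official address 6 + p. Of the others, `wroot` is the search
  -- tree of the Weiner links, `whead` and `wnext` chain the same links into a list, `sp` is the
  -- type-1 parent, `crec` the record of the incoming edge, and `lev` and `up` serve the search
  -- trees.
  val left right′ lev up croot slink plus′ len wroot sp down whead wnext crec : NumField
  val    = ix 0
  left   = ix 1
  right′ = ix 2
  lev    = ix 3
  up     = ix 4
  croot  = ix 5
  slink  = ix 6
  plus′  = ix 7
  len    = ix 8
  wroot  = ix 9
  sp     = ix 10
  down   = ix 11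
  whead  = ix 12
  wnext  = ix 13
  crec   = ix 14

  cur par top ch aux lvl res nxt : NumReg
  cur = ix 0
  par = ix 1
  top = ix 2
  ch  = ix 3
  aux = ix 4
  lvl = ix 5
  res = ix 6
  nxt = ix 7

  sk sx : SymReg
  sk = ix 0
  sx = ix 1

  findBody find : Cmd
  findBody =
    ldS sx key cur ⨟
    test (eqS sk sx) (mov res cur ⨟ lit cur 0 ⨟ nop)
      (test (ltS sk sx) (ld cur left cur ⨟ nop) (ld cur right′ cur ⨟ nop))
  find = lit res 0 ⨟ loop (nonzero cur) findBody

  -- Without recursion, the descent leaves its path in the `up` fields and the ascent follows them
  -- back, comparing keys once more to learn on which side it comes up. Null needs no test: record 0
  -- reads as a record of level 0.
  skewCmd splitCmd descend ascend insert : Cmd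
  skewCmd =
    ld ch left top ⨟ ld aux lev ch ⨟
    test (eqN aux lvl)
      (ld aux right′ ch ⨟ st left top aux ⨟ st right′ ch top ⨟ mov top ch ⨟ nop)
      nop
  splitCmd =
    ld ch right′ top ⨟ ld aux right′ ch ⨟ ld aux lev aux ⨟
    test (eqN aux lvl)
      (ld aux left ch ⨟ st right′ top aux ⨟ st left ch top ⨟
       inc aux 1 lvl ⨟ st lev ch aux ⨟ mov top ch ⨟ nop)
      nop
  descend =
    ldS sx key cur ⨟ st up cur par ⨟ mov par cur ⨟
    test (ltS sk sx) (ld cur left cur ⨟ nop) (ld cur right′ cur ⨟ nop)
  ascend =
    ldS sx key par ⨟ ld nxt up par ⨟ ld lvl lev par ⨟
    test (ltS sk sx) (st left par top ⨟ nop) (st right′ par top ⨟ nop) ⨟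
    mov top par ⨟ mov par nxt ⨟ skewCmd ⨟ splitCmd
  -- Expects the root in cur and the record to insert in top, and leaves
  -- the new root in top.
  insert =
    lit par 0 ⨟ loop (nonzero cur) descend ⨟
    st0 left top ⨟ st0 right′ top ⨟ lit aux 1 ⨟ st lev top aux ⨟
    loop (nonzero par) ascend

  tip next out vr ur hr wr xr yr cr pr above qr t₁ t₂ t₃ : NumReg
  tip = ix 8
  next  = ix 9
  out   = ix 10
  vr    = ix 11
  ur    = ix 12
  hr    = ix 13
  wr    = ix 14
  xr    = ix 15
  yr    = ix 16
  cr    = ix 17
  pr    = ix 18
  above = ix 19
  qr    = ix 20
  t₁    = ix 21
  t₂    = ix 22
  t₃    = ix 23

  inp lab g₁ g₂ : SymReg
  inp = ix 2
  lab = ix 3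
  g₁  = ix 4
  g₂  = ix 5

  -- t₂ := 1 if the node of length t₂ is more than one letter above the
  -- node of length t₁, and 0 otherwise.
  plusFlag : Cmd
  plusFlag = inc t₂ 1 t₂ ⨟ test (ltN t₂ t₁) (lit t₂ 1 ⨟ nop) (lit t₂ 0 ⨟ nop)

  -- create: the new node yr, with suffix link vr and first letter sk.
  -- splice: link yr into the edge to wr, where xr is the suffix link of wr
  -- and above the length of the parent of wr.
  -- attach: link yr as a leaf below hr, by an edge with label lab.
  create spliceEdge spliceChild spliceAbove spliceBelow splice attachEdge attachPlus attachChild attach : Cmd
  create =
    mov yr next ⨟ inc next 64 next ⨟
    ld t₁ len vr ⨟ inc t₁ 1 t₁ ⨟ st len yr t₁ ⨟
    inc t₁ 6 vr ⨟ st slink yr t₁ ⨟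
    stS key yr sk ⨟
    ld t₁ whead vr ⨟ st0 whead yr ⨟ st wnext yr t₁ ⨟ st whead vr yr ⨟
    ld cur wroot vr ⨟ mov top yr ⨟ insert ⨟
    st0 wroot yr ⨟ st wroot vr top ⨟ nop
  spliceEdge =
    ld t₁ crec wr ⨟ st crec yr t₁ ⨟ inc t₂ 6 yr ⨟ st val t₁ t₂ ⨟
    inc t₁ 32 yr ⨟ st crec wr t₁ ⨟ inc t₂ 6 wr ⨟ st val t₁ t₂ ⨟ nop
  spliceChild =
    ldS g₁ slab xr ⨟ stS key t₁ g₁ ⨟ stS slab yr g₁ ⨟
    st croot yr t₁ ⨟ st0 left t₁ ⨟ st0 right′ t₁ ⨟ lit t₂ 1 ⨟ st lev t₁ t₂ ⨟ nop
  spliceAbove =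
    ld t₁ down wr ⨟ st down yr t₁ ⨟
    ld t₁ len vr ⨟ mov t₂ above ⨟ plusFlag ⨟ st plus′ yr t₂ ⨟ nop
  spliceBelow =
    ld t₁ len xr ⨟ ld t₂ len vr ⨟ plusFlag ⨟ st plus′ wr t₂ ⨟ nop
  splice = spliceEdge ⨟ spliceChild ⨟ spliceAbove ⨟ spliceBelow
  attachEdge =
    inc t₁ 32 yr ⨟ st crec yr t₁ ⨟ inc t₂ 6 yr ⨟ st val t₁ t₂ ⨟ stS key t₁ lab ⨟
    stS slab yr lab ⨟ st sp yr hr ⨟ st down yr yr ⨟ nop
  attachPlus =
    mov t₃ t₁ ⨟ ld t₂ len ur ⨟ ld t₁ len vr ⨟ plusFlag ⨟ st plus′ yr t₂ ⨟ nop
  attachChild =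
    movS sk lab ⨟ ld cur croot hr ⨟ mov top t₃ ⨟ insert ⨟
    st0 croot yr ⨟ st croot hr top ⨟ movS sk inp ⨟ nop
  attach = attachEdge ⨟ attachPlus ⨟ attachChild

  -- Climb from the current leaf to its lowest type-1 ancestor ur that has a
  -- Weiner link hr with the letter inp; lab labels the last step.
  grow addLeaf climbBody climb redirectBody redirect growAllBody growAll : Cmd
  grow = create ⨟ splice
  addLeaf = create ⨟ attach

  climbBody =
    ld cur wroot vr ⨟ find ⨟
    test (nonzero res)
      (mov hr res ⨟ mov ur vr ⨟ lit vr 0 ⨟ nop)
      (ldS lab slab vr ⨟ ld vr sp vr ⨟ nop)
  climb =
    mov vr tip ⨟ movS sk inp ⨟ lit hr 0 ⨟ lit ur 0 ⨟
    loop (nonzero vr) climbBody ⨟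
    -- If the climb leaves the tree, h is the root, which has address 64, and the edge to the new
    -- leaf is labeled by the letter just read.
    test (nonzero hr) nop (lit hr 64 ⨟ movS lab inp ⨟ nop)

  redirectBody =
    ld cur wroot vr ⨟ find ⨟ ld t₁ down res ⨟
    test (eqN t₁ cr) (st down res hr ⨟ ld vr sp vr ⨟ nop) (lit vr 0 ⨟ nop)
  redirect = ld vr sp ur ⨟ loop (nonzero vr) redirectBody

  growAllBody = ldS sk key qr ⨟ mov wr qr ⨟ grow ⨟ ld qr wnext qr ⨟ nop
  growAll =
    ld above len pr ⨟ mov vr hr ⨟ mov xr cr ⨟ ld qr whead cr ⨟
    loop (nonzero qr) growAllBody

  -- `promote` is for an h that is not yet a type-1 node: it inserts h between P and C in the tree
  -- of type-1 nodes, redirects the `down` fields and copies the Weiner links of C. `growPath`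
  -- climbs from T again, now splitting the edge to the new leaf once for every type-1 ancestor v
  -- below u; since `t₃` holds the length of `a ∷ v` and `above` that of h, the loop stops at u by
  -- comparing the two.
  promoteHead promote growPathHead growPathBody growPath update setup : Cmd
  promoteHead =
    ld pr sp cr ⨟ ldS g₁ slab hr ⨟ ldS g₂ slab cr ⨟ stS slab hr g₂ ⨟ stS slab cr g₁ ⨟
    st sp hr pr ⨟ st sp cr hr ⨟ st down hr hr ⨟ nop
  promote = promoteHead ⨟ redirect ⨟ growAll ⨟ movS sk inp ⨟ nop

  growPathHead =
    mov xr vr ⨟ mov wr yr ⨟ mov tip yr ⨟ ld above len ur ⨟ ld vr sp xr ⨟ ld t₃ len vr ⨟ nop
  growPathBody =
    grow ⨟ mov xr vr ⨟ mov wr yr ⨟ ld vr sp vr ⨟ ld t₃ len vr ⨟ nop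
  growPath = growPathHead ⨟ loop (ltN above t₃) growPathBody

  update =
    climb ⨟ ld cr down hr ⨟ test (eqN cr hr) nop promote ⨟
    mov vr tip ⨟ addLeaf ⨟ growPath

  setup =
    lit tip 64 ⨟ lit t₁ 1 ⨟ st len tip t₁ ⨟ st down tip tip ⨟
    inc next 64 tip ⨟ inc out 6 tip ⨟ nop

open Programs

module Algorithm where

  algorithm : OnlineAlgorithm
  algorithm = record
    { registers = #reg
    ; setup     = compile setup
    ; update    = compile update
    ; input     = symReg inp
    ; output    = numReg out
    }

open Algorithm

-- AA-trees: rebalancing, height and order

module AATrees where

  -- A tree of record addresses, with the level stored in each record.
  data Tree : Set where
    leaf : Tree
    node : Tree → ℕ → ℕ → Tree → Tree

  rootOf level : Tree → ℕ
  rootOf leaf           = 0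
  rootOf (node _ p _ _) = p
  level leaf           = 0
  level (node _ _ k _) = k

  right : Tree → Tree
  right leaf           = leaf
  right (node _ _ _ r) = r

  inorder : Tree → List ℕ
  inorder leaf           = []
  inorder (node l p _ r) = inorder l ++ p ∷ inorder r

  skew split fix : Tree → Tree
  skew (node (node a q j b) p k r) with j ≟ k
  ... | yes _ = node a q j (node b p k r)
  ... | no  _ = node (node a q j b) p k r
  skew t = t
  split (node a p k (node b q j c)) with level c ≟ k
  ... | yes _ = node (node a p k b) q (suc k) c
  ... | no  _ = node a p k (node b q j c)
  split t = t
  fix t = split (skew t)

  skew-id : ∀ {l p k r} → level l ≢ k → skew (node l p k r) ≡ node l p k r
  skew-id {leaf} _ = refl
  skew-id {node a q j b} {k = k} j≢k with j ≟ k
  ... | yes j≡k = ⊥-elim (j≢k j≡k)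
  ... | no  _   = refl

  skew-rotates : ∀ {a q b p k r} → skew (node (node a q k b) p k r) ≡ node a q k (node b p k r)
  skew-rotates {k = k} with k ≟ k
  ... | yes _   = refl
  ... | no  k≢k = ⊥-elim (k≢k refl)

  split-id : ∀ {l p k r} → level (right r) ≢ k → split (node l p k r) ≡ node l p k r
  split-id {r = leaf} _ = refl
  split-id {k = k} {node b q j c} c≢k with level c ≟ k
  ... | yes c≡k = ⊥-elim (c≢k c≡k)
  ... | no  _   = refl

  split-rotates : ∀ {a p k b q j c} → level c ≡ k →
                  split (node a p k (node b q j c)) ≡ node (node a p k b) q (suc k) c
  split-rotates {k = k} {c = c} c≡k with level c ≟ k
  ... | yes _   = refl
  ... | no  c≢k = ⊥-elim (c≢k c≡k)

  inorder-skew : ∀ t → inorder (skew t) ≡ inorder t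
  inorder-skew leaf = refl
  inorder-skew (node leaf p k r) = refl
  inorder-skew (node (node a q j b) p k r) with j ≟ k
  ... | yes _ = sym (++-assoc (inorder a) (q ∷ inorder b) (p ∷ inorder r))
  ... | no  _ = refl

  inorder-split : ∀ t → inorder (split t) ≡ inorder t
  inorder-split leaf = refl
  inorder-split (node a p k leaf) = refl
  inorder-split (node a p k (node b q j c)) with level c ≟ k
  ... | yes _ = ++-assoc (inorder a) (p ∷ inorder b) (q ∷ inorder c)
  ... | no  _ = refl

  inorder-fix : ∀ t → inorder (fix t) ≡ inorder t
  inorder-fix t = trans (inorder-split (skew t)) (inorder-skew t)

  -- An AA-tree of level k is a 2-3 tree of height k in which a ternary node is written as two
  -- binary nodes of equal level, the second being the right child of the first.
  data AA : ℕ → Tree → Set where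
    leaf : AA 0 leaf
    two  : ∀ {k l p r} → AA k l → AA k r → AA (suc k) (node l p (suc k) r)
    three : ∀ {k l p m q r} → AA k l → AA k m → AA k r →
            AA (suc k) (node l p (suc k) (node m q (suc k) r))

  -- If an insertion raises the level, the new root is binary. A binary parent can therefore absorb
  -- it, and a ternary parent splits and passes on a binary root of its own.
  data Enlarged (k : ℕ) : Tree → Set where
    stay : ∀ {t} → AA k t → Enlarged k t
    raise : ∀ {l p r} → AA k l → AA k r → Enlarged k (node l p (suc k) r)

  level-AA : ∀ {k t} → AA k t → level t ≡ k
  level-AA leaf = refl
  level-AA (two _ _) = refl
  level-AA (three _ _ _) = refl

  level≢ : ∀ {k t} → AA k t → level t ≢ suc k
  level≢ a eq = 1+n≢n (sym (trans (sym (level-AA a)) eq))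

  right≢ : ∀ {k t} → AA k t → level (right t) ≢ suc k
  right≢ leaf ()
  right≢ (two _ r)     eq = <⇒≢ (≤-trans (n<1+n _) (n≤1+n _)) (trans (sym (level-AA r)) eq)
  right≢ (three _ _ _) eq = 1+n≢n (sym eq)

  -- Ins Lt Gt z t t′: the record z is attached below a leaf of t, which is
  -- reached by going left at records in Lt and right at records in Gt.
  data Ins (Lt Gt : ℕ → Set) (z : ℕ) : Tree → Tree → Set where
    here  : Ins Lt Gt z leaf (node leaf z 1 leaf)
    goLeft  : ∀ {l l′ p k r} → Lt p → Ins Lt Gt z l l′ → Ins Lt Gt z (node l p k r) (fix (node l′ p k r))
    goRight : ∀ {l p k r r′} → Gt p → Ins Lt Gt z r r′ → Ins Lt Gt z (node l p k r) (fix (node l p k r′))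

  private
    fix-id : ∀ {l p k r} → level l ≢ k → level (right r) ≢ k → fix (node l p k r) ≡ node l p k r
    fix-id {l} {p} {k} {r} l≢ r≢ = trans (cong split (skew-id {l} {p} {k} {r} l≢)) (split-id {l} {p} {k} {r} r≢)

    fix-skew : ∀ {a q b p k r} → level r ≢ k →
               fix (node (node a q k b) p k r) ≡ node a q k (node b p k r)
    fix-skew r≢ = trans (cong split skew-rotates) (split-id r≢)

    fix-split : ∀ {l p k b q j c} → level l ≢ k → level c ≡ k →
                fix (node l p k (node b q j c)) ≡ node (node l p k b) q (suc k) c
    fix-split l≢ c≡ = trans (cong split (skew-id l≢)) (split-rotates c≡)

    fix-both : ∀ {a q b p k r} → level r ≡ k →
               fix (node (node a q k b) p k r) ≡ node (node a q k b) p (suc k) r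
    fix-both r≡ = trans (cong split skew-rotates) (split-rotates r≡)

  module _ {Lt Gt : ℕ → Set} {z : ℕ} where

    ins-AA : ∀ {k t t′} → AA k t → Ins Lt Gt z t t′ → Enlarged k t′
    -- A binary node absorbs a raised child by becoming ternary, so its level stays. Stated
    -- separately because the lower half of a ternary node is itself a binary node of the same
    -- level, into which an insertion may go.
    ins-two : ∀ {k l p r t′} → AA k l → AA k r → Ins Lt Gt z (node l p (suc k) r) t′ → AA (suc k) t′

    ins-two x y (goLeft _ i) with ins-AA x i
    ... | stay x′ = subst (AA _) (sym (fix-id (level≢ x′) (right≢ y))) (two x′ y)
    ... | raise u v  = subst (AA _) (sym (fix-skew (level≢ y))) (three u v y)
    ins-two x y (goRight _ i) with ins-AA y i
    ... | stay y′ = subst (AA _) (sym (fix-id (level≢ x) (right≢ y′))) (two x y′)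
    ... | raise u v  = subst (AA _) (sym (fix-id (level≢ x) (level≢ v))) (three x u v)

    ins-AA leaf here = raise leaf leaf
    ins-AA (two x y) i = stay (ins-two x y i)
    ins-AA (three x y w) (goLeft _ i) with ins-AA x i
    ... | stay x′ = subst (Enlarged _) (sym (fix-id (level≢ x′) (level≢ w))) (stay (three x′ y w))
    ... | raise u v  = subst (Enlarged _) (sym (fix-both refl)) (raise (two u v) (two y w))
    ins-AA (three x y w) (goRight _ i) with ins-two y w i
    ... | two y′ w′ = subst (Enlarged _) (sym (fix-id (level≢ x) (level≢ w′))) (stay (three x y′ w′))
    ... | three y′ w₁ w₂ = subst (Enlarged _) (sym (fix-split (level≢ x) refl)) (raise (two x y′) (two w₁ w₂))

  balanced : ∀ {k t} → Enlarged k t → ∃₂ λ k′ (_ : k′ ≤ suc k) → AA k′ t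
  balanced (stay a) = _ , n≤1+n _ , a
  balanced (raise l r) = _ , ≤-refl , two l r

  height : Tree → ℕ
  height leaf           = 0
  height (node l _ _ r) = suc (height l ⊔ height r)

  height≤ : ∀ {k t} → AA k t → height t ≤ 2 * k
  height≤ leaf = z≤n
  height≤ {suc k} (two {l = l′} {r = r′} l r) = begin
    suc (height l′ ⊔ height r′) ≤⟨ s≤s (⊔-lub (height≤ l) (height≤ r)) ⟩
    suc (2 * k)               ≤⟨ n≤1+n _ ⟩
    2 + 2 * k                 ≡⟨ *-suc 2 k ⟨
    2 * suc k                 ∎
    where open ≤-Reasoning
  height≤ {suc k} (three {l = l} {m = m} {r = r} x y z) = begin
    suc (height l ⊔ suc (height m ⊔ height r))
      ≤⟨ s≤s (⊔-lub (≤-trans (height≤ x) (n≤1+n _)) (s≤s (⊔-lub (height≤ y) (height≤ z)))) ⟩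
    2 + 2 * k                 ≡⟨ *-suc 2 k ⟨
    2 * suc k                 ∎
    where open ≤-Reasoning

  private
    twice : ∀ {k m n} → 2 ^ k ≤ suc m → 2 ^ k ≤ suc n → 2 ^ suc k ≤ suc (m + suc n)
    twice {k} {m} {n} p q = begin
      2 * 2 ^ k           ≡⟨ cong (2 ^ k +_) (+-identityʳ (2 ^ k)) ⟩
      2 ^ k + 2 ^ k       ≤⟨ +-mono-≤ p q ⟩
      suc m + suc n       ∎
      where open ≤-Reasoning

  size≥ : ∀ {k t} → AA k t → 2 ^ k ≤ suc (length (inorder t))
  size≥ leaf = ≤-refl
  size≥ {suc k} (two {l = l} {p} {r} x y) rewrite length-++ (inorder l) {p ∷ inorder r} = twice {k} (size≥ x) (size≥ y)
  size≥ {suc k} (three {l = l} {p} {m} {q} {r} x y z)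
    rewrite length-++ (inorder l) {p ∷ inorder m ++ q ∷ inorder r} | length-++ (inorder m) {q ∷ inorder r} =
    twice {k} (size≥ x) (≤-trans (size≥ y) (s≤s (m≤m+n _ _)))

  AllPairs-split : ∀ {A : Set} {R : A → A → Set} xs {x ys} → AllPairs R (xs ++ x ∷ ys) →
                   AllPairs R xs × All (λ y → R y x) xs × All (R x) ys × AllPairs R ys
  AllPairs-split [] (r ∷ rs) = [] , [] , r , rs
  AllPairs-split (y ∷ xs) (r ∷ rs) with AllPairs-split xs rs
  ... | xs′ , lt , gt , ys′ = ++⁻ˡ xs r ∷ xs′ , All.head (++⁻ʳ xs r) ∷ lt , gt , ys′

  -- A strict order on records that is compatible with the directions.
  module _ {Lt Gt : ℕ → Set} {_≺_ : ℕ → ℕ → Set} {z : ℕ}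
           (Lt-mono : ∀ {p q} → Lt p → p ≺ q → Lt q) (Gt-mono : ∀ {p q} → Gt q → p ≺ q → Gt p) where

    ins-inorder : ∀ {t t′} → Ins Lt Gt z t t′ → AllPairs _≺_ (inorder t) →
      ∃₂ λ xs ys → inorder t ≡ xs ++ ys × inorder t′ ≡ xs ++ z ∷ ys × All Gt xs × All Lt ys
    ins-inorder here _ = [] , [] , refl , refl , [] , []
    ins-inorder (goLeft {l} {l′} {p} {k} {r} lt i) sorted with AllPairs-split (inorder l) sorted
    ... | sl , _ , p< , _ with ins-inorder i sl
    ... | xs , ys , eq , eq′ , gs , ls =
      xs , ys ++ p ∷ inorder r ,
      trans (cong (_++ p ∷ inorder r) eq) (++-assoc xs ys _) ,
      trans (inorder-fix (node l′ p k r)) (trans (cong (_++ p ∷ inorder r) eq′) (++-assoc xs (z ∷ ys) _)) ,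
      gs , All-++⁺ ls (lt ∷ All.map (Lt-mono lt) p<)
    ins-inorder (goRight {l} {p} {k} {r} {r′} gt i) sorted with AllPairs-split (inorder l) sorted
    ... | _ , <p , _ , sr with ins-inorder i sr
    ... | xs , ys , eq , eq′ , gs , ls =
      inorder l ++ p ∷ xs , ys ,
      trans (cong (λ zs → inorder l ++ p ∷ zs) eq) (sym (++-assoc (inorder l) (p ∷ xs) ys)) ,
      trans (inorder-fix (node l p k r′)) (trans (cong (λ zs → inorder l ++ p ∷ zs) eq′) (sym (++-assoc (inorder l) (p ∷ xs) (z ∷ ys)))) ,
      All-++⁺ (All.map (Gt-mono gt) <p) (gt ∷ gs) , ls

open AATrees

-- Pigeonhole principle and logarithms

module Counting where

  open import Data.List using (lookup)

  lookup-injective : ∀ {A : Set} {xs : List A} → AllPairs _≢_ xs →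
                     ∀ i j → lookup xs i ≡ lookup xs j → i ≡ j
  lookup-injective {xs = x ∷ xs} _ zero zero _ = refl
  lookup-injective {xs = x ∷ xs} (p ∷ _) zero (suc j) eq = ⊥-elim (All.lookup p (∈-lookup {xs = xs} j) eq)
  lookup-injective {xs = x ∷ xs} (p ∷ _) (suc i) zero eq = ⊥-elim (All.lookup p (∈-lookup {xs = xs} i) (sym eq))
  lookup-injective {xs = x ∷ xs} (_ ∷ ps) (suc i) (suc j) eq = cong suc (lookup-injective ps i j eq)

  pigeonhole : ∀ {A : Set} {n} (F : A → Fin n → Set) (xs : List A) → AllPairs _≢_ xs →
               All (λ x → ∃ (F x)) xs → (∀ {x y i} → F x i → F y i → x ≡ y) → length xs ≤ n
  pigeonhole F xs distinct total injective = injective⇒≤ {f = λ i → proj₁ (at i)} λ {i} {j} eq →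
    lookup-injective distinct i j (injective (proj₂ (at i)) (subst (F (lookup xs j)) (sym eq) (proj₂ (at j))))
    where
    at : ∀ i → ∃ (F (lookup xs i))
    at i = All.lookup total (∈-lookup {xs = xs} i)

  n≤2^⌈log₂n⌉ : ∀ n → n ≤ 2 ^ ⌈log₂ n ⌉
  n≤2^⌈log₂n⌉ = <-rec _ go
    where
    go : ∀ n → (∀ {m} → m < n → m ≤ 2 ^ ⌈log₂ m ⌉) → n ≤ 2 ^ ⌈log₂ n ⌉
    go 0 _ = z≤n
    go 1 _ = ≤-refl
    go n@(suc (suc m)) rec = begin
      n                             ≡⟨ ⌊n/2⌋+⌈n/2⌉≡n n ⟨
      ⌊ n /2⌋ + ⌈ n /2⌉             ≤⟨ +-monoˡ-≤ ⌈ n /2⌉ (⌊n/2⌋≤⌈n/2⌉ n) ⟩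
      ⌈ n /2⌉ + ⌈ n /2⌉             ≡⟨ cong (⌈ n /2⌉ +_) (+-identityʳ ⌈ n /2⌉) ⟨
      2 * ⌈ n /2⌉                   ≤⟨ *-monoʳ-≤ 2 (rec (⌈n/2⌉<n m)) ⟩
      2 ^ suc ⌈log₂ ⌈ n /2⌉ ⌉       ≡⟨ cong (2 ^_) log ⟩
      2 ^ ⌈log₂ n ⌉                 ∎
      where
      open ≤-Reasoning
      log : suc ⌈log₂ ⌈ n /2⌉ ⌉ ≡ ⌈log₂ n ⌉
      log = trans (cong suc (⌈log₂⌈n/2⌉⌉≡⌈log₂n⌉∸1 n))
        (m+[n∸m]≡n (≤-trans (≤-reflexive (sym (⌈log₂2^n⌉≡n 1))) (⌈log₂⌉-mono-≤ (s≤s (s≤s (z≤n {m}))))))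

  2^≤⇒≤log : ∀ {k n} → 1 ≤ n → 2 ^ k ≤ suc n → k ≤ suc ⌈log₂ n ⌉
  2^≤⇒≤log {k} {n} 1≤n 2^k≤ = begin
    k                   ≡⟨ ⌈log₂2^n⌉≡n k ⟨
    ⌈log₂ (2 ^ k) ⌉     ≤⟨ ⌈log₂⌉-mono-≤ (≤-trans 2^k≤ (≤-trans (+-monoˡ-≤ n 1≤n) (≤-reflexive (cong (n +_) (sym (+-identityʳ n)))))) ⟩
    ⌈log₂ (2 * n) ⌉     ≡⟨ ⌈log₂2*n⌉≡1+⌈log₂n⌉ n {{>-nonZero 1≤n}} ⟩
    suc ⌈log₂ n ⌉       ∎
    where open ≤-Reasoning

  n<2^n : ∀ n → n < 2 ^ n
  n<2^n zero    = ≤-refl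
  n<2^n (suc n) = begin
    suc (suc n)         ≤⟨ s≤s (n<2^n n) ⟩
    1 + 2 ^ n           ≤⟨ +-monoˡ-≤ (2 ^ n) (≤-trans (s≤s z≤n) (n<2^n n)) ⟩
    2 ^ n + 2 ^ n       ≡⟨ cong (2 ^ n +_) (+-identityʳ (2 ^ n)) ⟨
    2 * 2 ^ n           ∎
    where open ≤-Reasoning

open Counting

-- Prefix orders

module Strings where

  module _ {A : Set} where

    private
      variable
        a b : A
        x y z u v : List A

    infix 4 _≼_ _≺_

    data _≼_ : List A → List A → Set where
      []  : [] ≼ z
      _∷_ : ∀ a → x ≼ z → a ∷ x ≼ a ∷ z

    data _≺_ : List A → List A → Set where
      []  : [] ≺ a ∷ z
      _∷_ : ∀ a → x ≺ z → a ∷ x ≺ a ∷ z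

    ≼-refl : x ≼ x
    ≼-refl {[]}    = []
    ≼-refl {a ∷ x} = a ∷ ≼-refl

    ≼-trans : x ≼ y → y ≼ z → x ≼ z
    ≼-trans []      _       = []
    ≼-trans (a ∷ p) (_ ∷ q) = a ∷ ≼-trans p q

    ≺⇒≼ : x ≺ y → x ≼ y
    ≺⇒≼ []      = []
    ≺⇒≼ (a ∷ p) = a ∷ ≺⇒≼ p

    ≺-≼-trans : x ≺ y → y ≼ z → x ≺ z
    ≺-≼-trans []      (_ ∷ _) = []
    ≺-≼-trans (a ∷ p) (_ ∷ q) = a ∷ ≺-≼-trans p q

    ≼-≺-trans : x ≼ y → y ≺ z → x ≺ z
    ≼-≺-trans []      []      = []
    ≼-≺-trans []      (_ ∷ _) = []
    ≼-≺-trans (a ∷ p) (_ ∷ q) = a ∷ ≼-≺-trans p q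

    ≺-irrefl : ¬ x ≺ x
    ≺-irrefl (_ ∷ p) = ≺-irrefl p

    ≼-antisym : x ≼ y → y ≼ x → x ≡ y
    ≼-antisym []      []      = refl
    ≼-antisym (a ∷ p) (_ ∷ q) = cong (a ∷_) (≼-antisym p q)

    ≼-split : x ≼ y → x ≡ y ⊎ x ≺ y
    ≼-split {y = []}    [] = inj₁ refl
    ≼-split {y = _ ∷ _} [] = inj₂ []
    ≼-split (a ∷ p) = Sum.map (cong (a ∷_)) (a ∷_) (≼-split p)

    compareUnder : x ≼ z → y ≼ z → x ≼ y ⊎ y ≺ x
    compareUnder []      _       = inj₁ []
    compareUnder (_ ∷ _) []      = inj₂ []
    compareUnder (a ∷ p) (_ ∷ q) = Sum.map (a ∷_) (a ∷_) (compareUnder p q)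

    ≼-length : x ≼ y → length x ≤ length y
    ≼-length []      = z≤n
    ≼-length (_ ∷ p) = s≤s (≼-length p)

    ≺-length : x ≺ y → length x < length y
    ≺-length []      = s≤s z≤n
    ≺-length (_ ∷ p) = s≤s (≺-length p)

    ≼-++ : ∀ x {u} → x ≼ x ++ u
    ≼-++ []      = []
    ≼-++ (a ∷ x) = a ∷ ≼-++ x

    ≺-++ : ∀ x {c u} → x ≺ x ++ c ∷ u
    ≺-++ []      = []
    ≺-++ (a ∷ x) = a ∷ ≺-++ x

    ≼⇒++ : x ≼ z → ∃ λ u → z ≡ x ++ u
    ≼⇒++ []      = _ , refl
    ≼⇒++ (a ∷ p) with ≼⇒++ p
    ... | u , refl = u , refl

    ≺⇒++ : x ≺ z → ∃₂ λ c u → z ≡ x ++ c ∷ u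
    ≺⇒++ []      = _ , _ , refl
    ≺⇒++ (a ∷ p) with ≺⇒++ p
    ... | c , u , refl = c , u , refl

    ≼-tail : a ∷ x ≼ b ∷ y → x ≼ y
    ≼-tail (_ ∷ p) = p

    same-next : ∀ x {c u d v} → x ++ c ∷ u ≼ z → x ++ d ∷ v ≼ z → c ≡ d
    same-next []      (_ ∷ _) (_ ∷ _) = refl
    same-next (a ∷ x) (_ ∷ p) (_ ∷ q) = same-next x p q

    -- For the set of all nodes this is the parent relation of the trie, and for the set of type-1
    -- nodes that of the suffix tree.
    Nearest : (List A → Set) → List A → List A → Set
    Nearest P x z = P x × x ≺ z × (∀ {y} → P y → y ≺ z → y ≼ x)

    nearest-unique : ∀ {P} → Nearest P x z → Nearest P y z → x ≡ y
    nearest-unique (px , x≺ , x-max) (py , y≺ , y-max) = ≼-antisym (y-max px x≺) (x-max py y≺)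

open Strings

-- Counting distinguished prefixes: the potential

module Depth where

  weight : Bool → ℕ
  weight true  = 1
  weight false = 0

  weight≤1 : ∀ β → weight β ≤ 1
  weight≤1 true  = ≤-refl
  weight≤1 false = z≤n

  weight-mono : ∀ {β γ} → (β ≡ true → γ ≡ true) → weight β ≤ weight γ
  weight-mono {true}  f rewrite f refl = ≤-refl
  weight-mono {false} f = z≤n

  module _ {A : Set} where

    private
      variable
        P Q : List A → Bool
        x y h : List A

    -- With membership in the set of type-1 nodes for `P`, this is the potential: the number of
    -- type-1 ancestors of a node, itself included. A Boolean predicate makes the count computable.
    #prefixes : (List A → Bool) → List A → ℕ
    #prefixes P []      = weight (P [])
    #prefixes P (a ∷ x) = weight (P []) + #prefixes (P ∘ (a ∷_)) x

    #prefixes-mono : (∀ {t} → P t ≡ true → Q t ≡ true) → ∀ x → #prefixes P x ≤ #prefixes Q x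
    #prefixes-mono f []      = weight-mono f
    #prefixes-mono f (a ∷ x) = +-mono-≤ (weight-mono f) (#prefixes-mono f x)

    -- Dropping the first letter maps the nonempty counted prefixes injectively to counted prefixes;
    -- only the empty prefix is lost. This is the depth estimate for suffix links that underlies
    -- Weiner's analysis.
    #prefixes-cons : ∀ {a} → (∀ {t} → P (a ∷ t) ≡ true → P t ≡ true) → ∀ x → #prefixes P (a ∷ x) ≤ suc (#prefixes P x)
    #prefixes-cons {P = P} closed x = +-mono-≤ (weight≤1 (P [])) (#prefixes-mono closed x)

    #prefixes-insert : ∀ {P Q} h → (∀ {t} → Q t ≡ true → P t ≡ true ⊎ t ≡ h) → ∀ x → #prefixes Q x ≤ suc (#prefixes P x)
    #prefixes-insert {P} {Q} h f [] = ≤-trans (weight≤1 (Q [])) (s≤s z≤n)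
    #prefixes-insert {P} {Q} [] f (a ∷ x) = +-mono-≤ (≤-trans (weight≤1 (Q [])) (s≤s z≤n))
      (#prefixes-mono drop x)
      where
      drop : ∀ {t} → Q (a ∷ t) ≡ true → P (a ∷ t) ≡ true
      drop q with f q
      ... | inj₁ p = p
    #prefixes-insert {P} {Q} (b ∷ h) f (a ∷ x) = ≤-trans
      (+-mono-≤ (weight-mono drop) (#prefixes-insert {P ∘ (a ∷_)} {Q ∘ (a ∷_)} h under x))
      (≤-reflexive (+-suc (weight (P [])) (#prefixes (P ∘ (a ∷_)) x)))
      where
      drop : Q [] ≡ true → P [] ≡ true
      drop q with f q
      ... | inj₁ p = p
      under : ∀ {t} → Q (a ∷ t) ≡ true → P (a ∷ t) ≡ true ⊎ t ≡ h
      under q with f q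
      ... | inj₁ p = inj₁ p
      ... | inj₂ refl = inj₂ refl

    #prefixes-alone : ∀ x → P x ≡ true → (∀ {t} → P t ≡ true → t ≺ x → ⊥) → #prefixes P x ≡ 1
    #prefixes-alone []      p none = cong weight p
    #prefixes-alone {P = P} (a ∷ x) p none with P [] in eq
    ... | true  = ⊥-elim (none eq [])
    ... | false = #prefixes-alone x p λ q t≺x → none q (a ∷ t≺x)

    #prefixes-nearest : P x ≡ true → Nearest (λ t → P t ≡ true) y x → #prefixes P x ≡ suc (#prefixes P y)
    #prefixes-nearest {P = P} {x = c ∷ x} px (py , [] , max) = trans
      (cong₂ _+_ (cong weight py) (#prefixes-alone x px λ q t≺x → absurd (max q (c ∷ t≺x)))) (cong suc (sym (cong weight py)))
      where
      absurd : ∀ {t} → ¬ c ∷ t ≼ []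
      absurd ()
    #prefixes-nearest {P = P} {x = c ∷ x} px (py , _∷_ {x = y} _ y≺x , max) = trans
      (cong (weight (P []) +_) (#prefixes-nearest {P ∘ (c ∷_)} px (py , y≺x , λ q t≺x → ≼-tail (max q (c ∷ t≺x)))))
      (+-suc (weight (P [])) (#prefixes (P ∘ (c ∷_)) y))

open Depth

-- Type-1 nodes when a letter is prepended

module Semantics where

  module _ {A : Set} where

    private
      variable
        a b c : A
        x y z s T : List A

    -- `Suff`, `Occ` and `Type1′` recast suffixes, nodes of the suffix trie and type-1 nodes as
    -- inductive families over plain prefixes, which suits matching. They are translated back only
    -- when the stored structure is compared with the specification.
    data Suff : List A → List A → Set where
      here  : Suff T T
      there : Suff s T → Suff s (a ∷ T)

    data Occ : List A → List A → Set where
      here  : x ≼ T → Occ x T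
      there : Occ x T → Occ x (a ∷ T)

    data Type1′ (T : List A) : List A → Set where
      root   : Type1′ T []
      branch : a ≢ b → Occ (x ∷ʳ a) T → Occ (x ∷ʳ b) T → Type1′ T x
      suffix : Suff x T → Type1′ T x

    occ-prefix : x ≼ y → Occ y T → Occ x T
    occ-prefix x≼y (here y≼T) = here (≼-trans x≼y y≼T)
    occ-prefix x≼y (there o)  = there (occ-prefix x≼y o)

    occ-tail : Occ (b ∷ x) T → Occ x T
    occ-tail (here (_ ∷ x≼)) = there (here x≼)
    occ-tail (there o)       = there (occ-tail o)

    occ-length : Occ x T → length x ≤ length T
    occ-length (here x≼T) = ≼-length x≼T
    occ-length (there o)  = ≤-trans (occ-length o) (n≤1+n _)

    occ-suffix : Occ x T → ∃ λ s → Suff s T × x ≼ s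
    occ-suffix (here x≼T) = _ , here , x≼T
    occ-suffix (there o)  = let s , s-suff , x≼s = occ-suffix o in s , there s-suff , x≼s

    suffix-occ : Suff s T → x ≼ s → Occ x T
    suffix-occ here       x≼T = here x≼T
    suffix-occ (there sf) x≼s = there (suffix-occ sf x≼s)

    suff-tail : Suff (b ∷ x) T → Suff x T
    suff-tail here       = there here
    suff-tail (there sf) = there (suff-tail sf)

    type1-tail : Type1′ T (b ∷ x) → Type1′ T x
    type1-tail (branch a≢b o o′) = branch a≢b (occ-tail o) (occ-tail o′)
    type1-tail (suffix sf)       = suffix (suff-tail sf)

    type1-mono : Type1′ T x → Type1′ (a ∷ T) x
    type1-mono root              = root
    type1-mono (branch a≢b o o′) = branch a≢b (there o) (there o′)
    type1-mono (suffix sf)       = suffix (there sf)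

    type1-occ : Type1′ T x → Occ x T
    type1-occ root           = here []
    type1-occ (branch _ o _) = occ-prefix (≼-++ _) o
    type1-occ (suffix sf)    = suffix-occ sf ≼-refl

    data Terminated (ω : A) : List A → Set where
      end : Terminated ω (ω ∷ [])
      _∷_ : a ≢ ω → Terminated ω T → Terminated ω (a ∷ T)

    terminal∈ : ∀ {ω} → Terminated ω T → Suff (b ∷ s) T → ω ∈ b ∷ s
    terminal∈ end       here               = here refl
    terminal∈ end       (there ())
    terminal∈ (_ ∷ t)   (there sf)         = terminal∈ t sf
    terminal∈ (a≢ω ∷ t) here               = there (last t)
      where
      last : ∀ {ω T} → Terminated ω T → ω ∈ T
      last end     = here refl
      last (_ ∷ t) = there (last t)

    terminal-whole : ∀ {ω} → Terminated ω T → x ≼ T → ω ∈ x → x ≡ T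
    terminal-whole end       (_ ∷ [])  (here refl) = refl
    terminal-whole end       (_ ∷ []) (there ())
    terminal-whole (a≢ω ∷ t) (_ ∷ x≼)  (here refl) = ⊥-elim (a≢ω refl)
    terminal-whole (a≢ω ∷ t) (a ∷ x≼)  (there ω∈)  = cong (a ∷_) (terminal-whole t x≼ ω∈)

    private
      following : x ≺ y → ∃ λ c → x ∷ʳ c ≼ y
      following []      = _ , (_ ∷ [])
      following (a ∷ p) = let c , q = following p in c , (a ∷ q)

      following-unique : x ∷ʳ c ≼ z → x ∷ʳ b ≼ z → c ≡ b
      following-unique {x = x} = same-next x

      length-∷ʳ : ∀ (x : List A) {c} → length (x ∷ʳ c) ≡ suc (length x)
      length-∷ʳ x {c} = trans (length-++ x) (+-comm (length x) 1)

    -- A proper prefix of a ∷ T is never a suffix of T, so its occurrences in T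
    -- can be extended to the right.
    extends : ∀ {ω} → Terminated ω (a ∷ T) → x ≺ T → Occ (a ∷ x) T → ∃ λ e → Occ (a ∷ x ∷ʳ e) T
    extends (a≢ω ∷ t) x≺T o with occ-suffix o
    ... | s , sf , ax≼s with ≼-split ax≼s
    ... | inj₂ ax≺s = let e , q = following ax≺s in e , suffix-occ sf q
    ... | inj₁ refl with terminal∈ t sf
    ...   | here refl = ⊥-elim (a≢ω refl)
    ...   | there ω∈  with terminal-whole t (≺⇒≼ x≺T) ω∈
    ...     | refl = ⊥-elim (≺-irrefl x≺T)

    -- Let f follow v in T, and e follow some occurrence of `a ∷ v` in T. If e = f, then v can be
    -- prolonged; otherwise v is branching. So the longest v is a type-1 node, and a bound for the
    -- type-1 nodes is one for all prefixes of T. For this reason a climb through type-1 ancestors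
    -- alone does not miss h.
    longest : ∀ {ω k} → Terminated ω (a ∷ T) →
              (∀ {v} → Type1′ T v → v ≼ T → Occ (a ∷ v) T → length v < k) →
              ∀ v r → T ≡ v ++ r → Occ (a ∷ v) T → length v < k
    longest term bound v [] T≡ o =
      ⊥-elim (<-irrefl refl (subst (λ u → length v < length u) (trans T≡ (++-identityʳ v)) (occ-length o)))
    longest {a} {T} {k = k} term bound v (f ∷ r) T≡ o with extends term (subst (v ≺_) (sym T≡) (≺-++ v)) o
    ... | e , oe with length v <? k
    ... | yes lt = lt
    ... | no ≮k = bound (branch e≢f (occ-tail oe) (here vf≼T)) (≼-trans (≼-++ v) vf≼T) o
      where
      T≡′ : T ≡ (v ∷ʳ f) ++ r
      T≡′ = trans T≡ (sym (++-assoc v (f ∷ []) r))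
      vf≼T : v ∷ʳ f ≼ T
      vf≼T = subst (v ∷ʳ f ≼_) (sym T≡′) (≼-++ (v ∷ʳ f))
      e≢f : e ≢ f
      e≢f refl = ≮k (≤-trans (n≤1+n _) (subst (_< k) (length-∷ʳ v) (longest term bound (v ∷ʳ f) r T≡′ oe)))

    -- The head of `a ∷ T` in Weiner's sense, called h throughout.
    record Head (a : A) (T h : List A) : Set where
      field
        occurs : Occ h T
        prefix : h ≼ a ∷ T
        max    : ∀ {y} → y ≼ a ∷ T → Occ y T → y ≼ h

    module _ {h : List A} (head : Head a T h) where
      open Head head

      head≺ : h ≺ a ∷ T
      head≺ with ≼-split prefix
      ... | inj₂ h≺ = h≺
      ... | inj₁ refl = ⊥-elim (<-irrefl refl (occ-length occurs))

      -- A node x that becomes branching has one extension along `a ∷ T` and another inside T, hence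
      -- is a prefix of h. If it were a proper prefix, its extension along `a ∷ T` would be a prefix
      -- of h as well and occur in T, so x would have been branching before.
      type1-cons : Type1′ (a ∷ T) x → Type1′ T x ⊎ x ≡ h ⊎ x ≡ a ∷ T
      type1-cons root = inj₁ root
      type1-cons (suffix here) = inj₂ (inj₂ refl)
      type1-cons (suffix (there sf)) = inj₁ (suffix sf)
      type1-cons (branch c≢d (there o) (there o′)) = inj₁ (branch c≢d o o′)
      type1-cons (branch c≢d (here p) (here p′)) = ⊥-elim (c≢d (following-unique p p′))
      type1-cons {x} (branch {c} {d} c≢d (here p) (there o′)) with ≼-split (max (≼-trans (≼-++ x) p) (occ-prefix (≼-++ x) o′))
      ... | inj₁ x≡h = inj₂ (inj₁ x≡h)
      ... | inj₂ x≺h with following x≺h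
      ...   | e , xe≼h with following-unique (≼-trans xe≼h prefix) p
      ...     | refl = inj₁ (branch c≢d (occ-prefix xe≼h occurs) o′)
      type1-cons {x} (branch {c} {d} c≢d (there o′) (here p)) with ≼-split (max (≼-trans (≼-++ x) p) (occ-prefix (≼-++ x) o′))
      ... | inj₁ x≡h = inj₂ (inj₁ x≡h)
      ... | inj₂ x≺h with following x≺h
      ...   | e , xe≼h with following-unique (≼-trans xe≼h prefix) p
      ...     | refl = inj₁ (branch c≢d o′ (occ-prefix xe≼h occurs))

    -- Some letter e follows an occurrence of h inside T, by uniqueness of the terminal, and some f
    -- follows h along `a ∷ T`. By maximality of h these differ.
    type1-head : ∀ {h ω} → Head a T h → Terminated ω (a ∷ T) → Type1′ (a ∷ T) h
    type1-head {h = []} head term = root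
    type1-head {a = a} {h = b ∷ v} head term with head≺ head
    ... | _ ∷ v≺T with extends term v≺T (Head.occurs head) | following v≺T
    ...   | e , oe | f , vf≼ = branch e≢f (there oe) (here (a ∷ vf≼))
      where
      e≢f : e ≢ f
      e≢f refl = <-irrefl refl (subst (_≤ length (a ∷ v)) (length-∷ʳ (a ∷ v)) (≼-length (Head.max head (a ∷ vf≼) oe)))

open Semantics

-- Bounding the number of nodes

module Capacity where

  open import Data.List using (lookup)

  module _ {A : Set} where

    private
      variable
        b : A
        x y v W Q : List A

    private
      take-≼ : x ≼ W → take (length x) W ≡ x
      take-≼ []      = refl
      take-≼ (a ∷ p) = cong (a ∷_) (take-≼ p)

    ends-at : Occ (b ∷ v) W → ∃ λ m → m < length W × Suff (b ∷ v) (take (suc m) W)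
    ends-at (here p@(b ∷ q)) = _ , ≼-length p , subst (Suff _) (sym (take-≼ p)) here
    ends-at (there o) = let m , m< , sf = ends-at o in suc m , s≤s m< , there sf

    module _ {ss : List (List A)} (closed : ∀ {b v} → b ∷ v ∈ ss → v ∈ ss) where

      suffix-closed : Suff x v → v ∈ ss → x ∈ ss
      suffix-closed here       v∈ = v∈
      suffix-closed (there sf) v∈ = suffix-closed sf (closed v∈)

      -- The string b ∷ v is the shortest suffix of Q outside ss.
      shortest-unique : ∀ {b v b′ v′} → Suff (b ∷ v) Q → Suff (b′ ∷ v′) Q → v ∈ ss → v′ ∈ ss →
                        b ∷ v ∉ ss → b′ ∷ v′ ∉ ss → b ∷ v ≡ b′ ∷ v′
      shortest-unique here       here        _  _   _  _   = refl
      shortest-unique here       (there sf′) v∈ _   _  x′∉ = ⊥-elim (x′∉ (suffix-closed sf′ v∈))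
      shortest-unique (there sf) here        _  v′∈ x∉ _   = ⊥-elim (x∉ (suffix-closed sf v′∈))
      shortest-unique (there sf) (there sf′) v∈ v′∈ x∉ x′∉ = shortest-unique sf sf′ v∈ v′∈ x∉ x′∉

      Slot : (W : List A) → List A → Fin (length ss + length W) → Set
      Slot W x i = (∃ λ k → lookup ss k ≡ x × i ≡ k ↑ˡ length W) ⊎
        (∃₂ λ b v → ∃ λ k → x ≡ b ∷ v × v ∈ ss × x ∉ ss × Suff x (take (suc (toℕ k)) W) × i ≡ length ss ↑ʳ k)

      slot-injective : ∀ {x y i} → Slot W x i → Slot W y i → x ≡ y
      slot-injective {W = W} (inj₁ (k , x≡ , refl)) (inj₁ (k′ , y≡ , eq))
        with inj₁-injective (trans (sym (splitAt-↑ˡ (length ss) k (length W))) (trans (cong (splitAt (length ss)) eq) (splitAt-↑ˡ (length ss) k′ (length W))))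
      ... | refl = trans (sym x≡) y≡
      slot-injective {W = W} (inj₁ (k , x≡ , refl)) (inj₂ (_ , _ , k′ , _ , _ , _ , _ , eq))
        with trans (sym (splitAt-↑ˡ (length ss) k (length W))) (trans (cong (splitAt (length ss)) eq) (splitAt-↑ʳ (length ss) (length W) k′))
      ... | ()
      slot-injective {W = W} (inj₂ (_ , _ , k′ , _ , _ , _ , _ , refl)) (inj₁ (k , x≡ , eq))
        with trans (sym (splitAt-↑ˡ (length ss) k (length W))) (trans (cong (splitAt (length ss)) (sym eq)) (splitAt-↑ʳ (length ss) (length W) k′))
      ... | ()
      slot-injective {W = W} (inj₂ (_ , _ , k , refl , v∈ , x∉ , sf , refl)) (inj₂ (_ , _ , k′ , refl , v′∈ , y∉ , sf′ , eq))
        with inj₂-injective (trans (sym (splitAt-↑ʳ (length ss) (length W) k)) (trans (cong (splitAt (length ss)) eq) (splitAt-↑ʳ (length ss) (length W) k′)))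
      ... | refl = shortest-unique sf sf′ v∈ v′∈ x∉ y∉

      module _ (_≟_ : DecidableEquality (List A)) where

        capacity : ∀ W xs → AllPairs _≢_ xs →
          (∀ {x} → x ∈ xs → x ∈ ss ⊎ (∃₂ λ b v → x ≡ b ∷ v × v ∈ ss × Occ x W)) →
          length xs ≤ length ss + length W
        capacity W xs distinct cover = pigeonhole (Slot W) xs distinct (All.tabulate λ x∈ → slot (cover x∈)) slot-injective
          where
          open import Data.List.Membership.DecPropositional _≟_ using (_∈?_)
          slot : ∀ {x} → x ∈ ss ⊎ (∃₂ λ b v → x ≡ b ∷ v × v ∈ ss × Occ x W) → ∃ (Slot W x)
          slot (inj₁ x∈) = _ , inj₁ (index x∈ , sym (lookup-index x∈) , refl)
          slot {x} (inj₂ (b , v , refl , v∈ , o)) with x ∈? ss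
          ... | yes x∈ = _ , inj₁ (index x∈ , sym (lookup-index x∈) , refl)
          ... | no x∉ = let m , m< , sf = ends-at o in
            _ , inj₂ (b , v , fromℕ< m< , refl , v∈ , x∉ ,
              subst (λ n → Suff x (take (suc n) W)) (sym (toℕ-fromℕ< m<)) sf , refl)

open Capacity

-- Arithmetic of the amortized cost

module Amortization where

  -- Here i, r, M and G count the steps of the climb, the redirected nodes, the copied links and the
  -- nodes put on the new path; D and D′ are the potential before and after, d the depth of u. The
  -- potential is taken twice because i and G may each be as large as the fall from D to d. The 13
  -- is 1 + 1 + 1 for the two climbs and the constant part, and 5 + 5 because the third hypothesis
  -- is used a second time to bound D′ itself.
  potential≤ : ∀ {i r G D D′ d} M → i + d ≤ 1 + D → G + d ≤ 1 + D → r + D′ ≤ 5 + d →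
               (1 + i + r + M + G) + 2 * D′ ≤ 2 * D + M + 13
  potential≤ {i} {r} {G} {D} {D′} {d} M i≤ G≤ r≤ = +-cancelʳ-≤ (2 * d) _ _ (begin
    (1 + i + r + M + G) + 2 * D′ + 2 * d                ≡⟨ regroup i r M G D′ d ⟩
    (i + d) + (G + d) + (r + D′) + D′ + (M + 1)         ≤⟨ +-monoˡ-≤ (M + 1) (+-mono-≤ (+-mono-≤ (+-mono-≤ i≤ G≤) r≤) (≤-trans (m≤n+m D′ r) r≤)) ⟩
    (1 + D) + (1 + D) + (5 + d) + (5 + d) + (M + 1)     ≡⟨ collect D d M ⟩
    2 * D + M + 13 + 2 * d                              ∎)
    where
    open ≤-Reasoning
    regroup : ∀ i r M G D′ d → (1 + i + r + M + G) + 2 * D′ + 2 * d ≡ (i + d) + (G + d) + (r + D′) + D′ + (M + 1)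
    regroup = solve-∀
    collect : ∀ D d M → (1 + D) + (1 + D) + (5 + d) + (5 + d) + (M + 1) ≡ 2 * D + M + 13 + 2 * d
    collect = solve-∀

  module _ {Λ : ℕ} (1≤Λ : 1 ≤ Λ) where

    affine≤ : ∀ a b c → a + b ≤ c → a + b * Λ ≤ c * Λ
    affine≤ a b c a+b≤c = begin
      a + b * Λ        ≤⟨ +-monoˡ-≤ (b * Λ) (≤-trans (≤-reflexive (sym (*-identityʳ a))) (*-monoʳ-≤ a 1≤Λ)) ⟩
      a * Λ + b * Λ    ≡⟨ *-distribʳ-+ Λ a b ⟨
      (a + b) * Λ      ≤⟨ *-monoˡ-≤ Λ a+b≤c ⟩
      c * Λ            ∎
      where open ≤-Reasoning

    -- 740 · Λ bounds the time of one iteration of each loop, and of all the rest.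
    cost≤ : ∀ i r M G →
      (8 + (11 + 38 * Λ) * i) + (3 + ((1 + (38 + (14 + 38 * Λ) * r + (122 + 293 * Λ) * M)) +
        ((103 + 586 * Λ) + (123 + 293 * Λ) * G))) + 1 ≤ 740 * Λ * (1 + i + r + M + G)
    cost≤ i r M G = begin
      (8 + (11 + 38 * Λ) * i) + (3 + ((1 + (38 + (14 + 38 * Λ) * r + (122 + 293 * Λ) * M)) +
        ((103 + 586 * Λ) + (123 + 293 * Λ) * G))) + 1
        ≡⟨ regroup ((11 + 38 * Λ) * i) ((14 + 38 * Λ) * r) ((122 + 293 * Λ) * M) (586 * Λ) ((123 + 293 * Λ) * G) ⟩
      (154 + 586 * Λ) + (11 + 38 * Λ) * i + (14 + 38 * Λ) * r + (122 + 293 * Λ) * M + (123 + 293 * Λ) * G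
        ≤⟨ +-mono-≤ (+-mono-≤ (+-mono-≤ (+-mono-≤ (affine≤ 154 586 740 ≤-refl)
             (*-monoˡ-≤ i (affine≤ 11 38 740 (m≤m+n 49 691))))
             (*-monoˡ-≤ r (affine≤ 14 38 740 (m≤m+n 52 688))))
             (*-monoˡ-≤ M (affine≤ 122 293 740 (m≤m+n 415 325))))
             (*-monoˡ-≤ G (affine≤ 123 293 740 (m≤m+n 416 324))) ⟩
      740 * Λ + 740 * Λ * i + 740 * Λ * r + 740 * Λ * M + 740 * Λ * G
        ≡⟨ factor (740 * Λ) i r M G ⟩
      740 * Λ * (1 + i + r + M + G) ∎
      where
      open ≤-Reasoning
      regroup : ∀ x y z l w → (8 + x) + (3 + ((1 + (38 + y + z)) + ((103 + l) + w))) + 1 ≡ (154 + l) + x + y + z + w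
      regroup = solve-∀
      factor : ∀ k i r M G → k + k * i + k * r + k * M + k * G ≡ k * (1 + i + r + M + G)
      factor = solve-∀

    amortized≤ : ∀ {i r G D D′ d} M → i + d ≤ 1 + D → G + d ≤ 1 + D → r + D′ ≤ 5 + d →
      (8 + (11 + 38 * Λ) * i) + (3 + ((1 + (38 + (14 + 38 * Λ) * r + (122 + 293 * Λ) * M)) +
        ((103 + 586 * Λ) + (123 + 293 * Λ) * G))) + 1 + 740 * Λ * (2 * D′) ≤ 740 * Λ * (2 * D + M + 13)
    amortized≤ {i} {r} {G} {D} {D′} {d} M i≤ G≤ r≤ = begin
      _ + 740 * Λ * (2 * D′) ≤⟨ +-monoˡ-≤ (740 * Λ * (2 * D′)) (cost≤ i r M G) ⟩
      740 * Λ * (1 + i + r + M + G) + 740 * Λ * (2 * D′) ≡⟨ *-distribˡ-+ (740 * Λ) (1 + i + r + M + G) (2 * D′) ⟨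
      740 * Λ * ((1 + i + r + M + G) + 2 * D′) ≤⟨ *-monoʳ-≤ (740 * Λ) (potential≤ M i≤ G≤ r≤) ⟩
      740 * Λ * (2 * D + M + 13) ∎
      where open ≤-Reasoning

open Amortization

-- Bundled, so that terms carry one parameter instead of ten.
record Setting : Set₁ where
  field
    {σ}                : ℕ
    Σ                  : OrderedAlphabet σ
    space width blocks : ℕ
    fits               : blocks * 32 ≤ space
    wide               : space ≤ 2 ^ width
    roomy              : 128 ≤ space
    n                  : ℕ
    -- At most 1 + 3 n nodes take two blocks each. The first pair of blocks is left to null, and
    -- strictness keeps even the next free address in range.
    enough             : (2 + 3 * n) * 2 < blocks

module OnMachine (setting : Setting) where

  open Setting setting
  open OrderedAlphabet Σ using (Symbol; size; isStrictTotalOrder) renaming (_<_ to _⊏_; _<?_ to _⊏?_; _≟_ to _≟S_)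
  open IsStrictTotalOrder isStrictTotalOrder using (compare) renaming (trans to ⊏-trans; irrefl to ⊏-irrefl)

  -- Program logic: timed triples over an abstract heap

  module Triples where

    open import Data.Bool using (Bool; T; false; true)
    open import Data.Vec using (Vec; _[_]≔_; lookup)

    open Machine Σ space width public
      renaming (sym to letter)

    -- The memory as a heap of records of 32 words at the multiples of 32.
    record HState : Set where
      constructor hstate
      field
        rn : Tup ℕ #num
        rs : Tup Word #sym
        hn : Tup (ℕ → ℕ) #nf
        hs : Tup (ℕ → Word) #sf

    open HState public

    Block : ℕ → Set
    Block p = ∃ λ i → i < blocks × p ≡ i * 32

    -- The scratch register and the words that belong to no field are unconstrained, so compiled
    -- code may leave anything there.
    record Refines (s : HState) (σ : State #reg) : Set where
      field
        nullOk : lookup (State.regs σ) null ≡ num 0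
        rnOk   : ∀ r → lookup (State.regs σ) (numReg r) ≡ num (get (rn s) r)
        rsOk   : ∀ r → lookup (State.regs σ) (symReg r) ≡ get (rs s) r
        hnOk   : ∀ f {p} → Block p → State.mem σ (offset f + p) ≡ num (get (hn s) f p)
        hsOk   : ∀ f {p} → Block p → State.mem σ (offsetS f + p) ≡ get (hs s) f p

    open Refines

    -- Total correctness with a time bound. The precondition is that the abstract state is `s`
    -- itself, so that executing straight-line code symbolically produces the next state as a term.
    -- The record wrapper lets unification recover the parameters.
    record Triple (c : Cmd) (s : HState) (b : ℕ) (Q : HState → Set) : Set where
      constructor triple
      field
        run : ∀ {σ} → Refines s σ →
          ∃₂ λ t σ′ → ∃ λ s′ → Exec (compile c) σ t σ′ × t ≤ b × Refines s′ σ′ × Q s′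

    open Triple public

    numReg-injective : ∀ {r q} → numReg r ≡ numReg q → r ≡ q
    numReg-injective {r} {q} eq = Fin.↑ˡ-injective #sym r q (Fin.suc-injective (Fin.suc-injective eq))

    symReg-injective : ∀ {r q} → symReg r ≡ symReg q → r ≡ q
    symReg-injective {r} {q} eq = Fin.↑ʳ-injective #num r q (Fin.suc-injective (Fin.suc-injective eq))

    numReg≢symReg : ∀ r q → numReg r ≢ symReg q
    numReg≢symReg r q eq = <⇒≢ below (cong toℕ (Fin.suc-injective (Fin.suc-injective eq)))
      where
      below : toℕ (r ↑ˡ #sym) < toℕ (#num ↑ʳ q)
      below = subst₂ _<_ (sym (Fin.toℕ-↑ˡ r #sym)) (sym (Fin.toℕ-↑ʳ #num q))
                (≤-trans (Fin.toℕ<n r) (m≤m+n #num (toℕ q)))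

    offset<32 : ∀ f → offset f < 32
    offset<32 f = s≤s (≤-trans (Fin.toℕ<n f) (m≤m+n 15 16))

    offsetS<32 : ∀ f → offsetS f < 32
    offsetS<32 zero    = s≤s z≤n
    offsetS<32 (suc f) = +-monoʳ-< 17 (≤-trans (Fin.toℕ<n f) (m≤m+n 1 14))

    offset-injective : ∀ {f g} → offset f ≡ offset g → f ≡ g
    offset-injective eq = Fin.toℕ-injective (suc-injective eq)

    offsetS-injective : ∀ {f g} → offsetS f ≡ offsetS g → f ≡ g
    offsetS-injective {zero}  {zero}  eq = refl
    offsetS-injective {suc f} {suc g} eq =
      cong suc (Fin.toℕ-injective (+-cancelˡ-≡ 17 _ _ eq))

    offset≢offsetS : ∀ f g → offset f ≢ offsetS g
    offset≢offsetS f zero    ()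
    offset≢offsetS f (suc g) eq =
      <⇒≢ (≤-trans (s≤s (Fin.toℕ<n f)) (≤-trans (m≤m+n 16 1) (m≤m+n 17 (toℕ g)))) eq

    inSpace : ∀ {o p} → o < 32 → Block p → o + p < space
    inSpace {o} o<32 (i , i<b , refl) =
      ≤-trans (+-monoˡ-≤ (i * 32) o<32) (≤-trans (*-monoˡ-≤ 32 i<b) fits)

    inWidth : ∀ {n} → n < space → n < 2 ^ width
    inWidth n< = ≤-trans n< wide

    -- Records start at multiples of 32 and offsets are smaller than 32, so the remainder modulo 32
    -- gives the offset. Hence a write to one field leaves all other fields and records alone.
    aligned : ∀ {o o′ p p′} → o < 32 → o′ < 32 → Block p → Block p′ →
              o + p ≡ o′ + p′ → o ≡ o′ × p ≡ p′
    aligned {o} {o′} o< o′< (i , _ , refl) (j , _ , refl) eq = o≡ , p≡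
      where
      open ≡-Reasoning
      o≡ : o ≡ o′
      o≡ = begin
        o                  ≡⟨ m<n⇒m%n≡m o< ⟨
        o % 32             ≡⟨ [m+kn]%n≡m%n o i 32 ⟨
        (o + i * 32) % 32  ≡⟨ cong (_% 32) eq ⟩
        (o′ + j * 32) % 32 ≡⟨ [m+kn]%n≡m%n o′ j 32 ⟩
        o′ % 32            ≡⟨ m<n⇒m%n≡m o′< ⟩
        o′                 ∎
      p≡ : i * 32 ≡ j * 32
      p≡ = +-cancelˡ-≡ o _ _ (trans eq (cong (_+ j * 32) (sym o≡)))

    isYes-true : ∀ {A : Set} (a? : Dec A) → A → isYes a? ≡ true
    isYes-true a? a = trans (isYes≗does a?) (dec-true a? a)

    isYes-false : ∀ {A : Set} (a? : Dec A) → ¬ A → isYes a? ≡ false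
    isYes-false a? ¬a = trans (isYes≗does a?) (dec-false a? ¬a)

    written : ∀ M p {x} → (M ⟨ p ⟩≔ x) p ≡ x
    written M p rewrite isYes-true (p ≟ p) refl = refl

    unwritten : ∀ M {p q x} → p ≢ q → (M ⟨ p ⟩≔ x) q ≡ M q
    unwritten M {p} {q} p≢q rewrite isYes-false (p ≟ q) p≢q = refl

    module _ {s : HState} {R : Vec Word #reg} {M : ℕ → Word} (ok : Refines s ⟨ R , M ⟩) where

      refines-scratch : ∀ {x} → Refines s ⟨ R [ scratch ]≔ x , M ⟩
      refines-scratch = record
        { nullOk = trans (lookup∘update′ (λ ()) R _) (nullOk ok)
        ; rnOk   = λ r → trans (lookup∘update′ (λ ()) R _) (rnOk ok r)
        ; rsOk   = λ r → trans (lookup∘update′ (λ ()) R _) (rsOk ok r)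
        ; hnOk   = hnOk ok
        ; hsOk   = hsOk ok
        }

      refines-num : ∀ r {x} → Refines (record s { rn = put (rn s) r x }) ⟨ R [ numReg r ]≔ num x , M ⟩
      refines-num r {x} = record
        { nullOk = trans (lookup∘update′ (λ ()) R _) (nullOk ok)
        ; rnOk   = go
        ; rsOk   = λ q → trans (lookup∘update′ (numReg≢symReg r q ∘ sym) R _) (rsOk ok q)
        ; hnOk   = hnOk ok
        ; hsOk   = hsOk ok
        }
        where
        go : ∀ q → lookup (R [ numReg r ]≔ num x) (numReg q) ≡ num (get (put (rn s) r x) q)
        go q with r Fin.≟ q
        ... | yes refl = trans (lookup∘update (numReg r) R _) (cong num (sym (get-put (rn s) r)))
        ... | no r≢q   = trans (lookup∘update′ (r≢q ∘ sym ∘ numReg-injective) R _)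
                           (trans (rnOk ok q) (cong num (sym (get-put′ (rn s) r q r≢q))))

      refines-sym : ∀ r {x} → Refines (record s { rs = put (rs s) r x }) ⟨ R [ symReg r ]≔ x , M ⟩
      refines-sym r {x} = record
        { nullOk = trans (lookup∘update′ (λ ()) R _) (nullOk ok)
        ; rnOk   = λ q → trans (lookup∘update′ (numReg≢symReg q r) R _) (rnOk ok q)
        ; rsOk   = go
        ; hnOk   = hnOk ok
        ; hsOk   = hsOk ok
        }
        where
        go : ∀ q → lookup (R [ symReg r ]≔ x) (symReg q) ≡ get (put (rs s) r x) q
        go q with r Fin.≟ q
        ... | yes refl = trans (lookup∘update (symReg r) R _) (sym (get-put (rs s) r))
        ... | no r≢q   = trans (lookup∘update′ (r≢q ∘ sym ∘ symReg-injective) R _)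
                           (trans (rsOk ok q) (sym (get-put′ (rs s) r q r≢q)))

      refines-heap : ∀ f {p x} → Block p →
        Refines (record s { hn = put (hn s) f (get (hn s) f [ p ↦ x ]) })
                ⟨ R , M ⟨ offset f + p ⟩≔ num x ⟩
      refines-heap f {p} {x} bp = record
        { nullOk = nullOk ok
        ; rnOk   = rnOk ok
        ; rsOk   = rsOk ok
        ; hnOk   = go
        ; hsOk   = λ g {q} bq → trans
            (unwritten M λ eq → offset≢offsetS f g (proj₁ (aligned (offset<32 f) (offsetS<32 g) bp bq eq)))
            (hsOk ok g bq)
        }
        where
        go : ∀ g {q} → Block q → (M ⟨ offset f + p ⟩≔ num x) (offset g + q) ≡
                                 num (get (put (hn s) f (get (hn s) f [ p ↦ x ])) g q)
        go g {q} bq with f Fin.≟ g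
        ... | no f≢g = trans
            (unwritten M λ eq → f≢g (offset-injective (proj₁ (aligned (offset<32 f) (offset<32 g) bp bq eq))))
            (trans (hnOk ok g bq) (cong (λ h → num (h q)) (sym (get-put′ (hn s) f g f≢g))))
        ... | yes refl rewrite get-put (hn s) f {get (hn s) f [ p ↦ x ]} with p ≟ q
        ...   | yes refl = trans (written M _) (cong num (sym (↦-same (get (hn s) f) p)))
        ...   | no p≢q   = trans
            (unwritten M λ eq → p≢q (proj₂ (aligned (offset<32 f) (offset<32 f) bp bq eq)))
            (trans (hnOk ok f bq) (cong num (sym (↦-other (get (hn s) f) p≢q))))

      refines-heapS : ∀ f {p x} → Block p →
        Refines (record s { hs = put (hs s) f (get (hs s) f [ p ↦ x ]) })
                ⟨ R , M ⟨ offsetS f + p ⟩≔ x ⟩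
      refines-heapS f {p} {x} bp = record
        { nullOk = nullOk ok
        ; rnOk   = rnOk ok
        ; rsOk   = rsOk ok
        ; hnOk   = λ g {q} bq → trans
            (unwritten M λ eq → offset≢offsetS g f (sym (proj₁ (aligned (offsetS<32 f) (offset<32 g) bp bq eq))))
            (hnOk ok g bq)
        ; hsOk   = go
        }
        where
        go : ∀ g {q} → Block q → (M ⟨ offsetS f + p ⟩≔ x) (offsetS g + q) ≡
                                 get (put (hs s) f (get (hs s) f [ p ↦ x ])) g q
        go g {q} bq with f Fin.≟ g
        ... | no f≢g = trans
            (unwritten M λ eq → f≢g (offsetS-injective (proj₁ (aligned (offsetS<32 f) (offsetS<32 g) bp bq eq))))
            (trans (hsOk ok g bq) (cong (λ h → h q) (sym (get-put′ (hs s) f g f≢g))))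
        ... | yes refl rewrite get-put (hs s) f {get (hs s) f [ p ↦ x ]} with p ≟ q
        ...   | yes refl = trans (written M _) (sym (↦-same (get (hs s) f) p))
        ...   | no p≢q   = trans
            (unwritten M λ eq → p≢q (proj₂ (aligned (offsetS<32 f) (offsetS<32 f) bp bq eq)))
            (trans (hsOk ok f bq) (sym (↦-other (get (hs s) f) p≢q)))

    -- All numbers written in the programs are below 128, which is checked by evaluation in the
    -- implicit argument.
    literal : ∀ {n} → {T (n <ᵇ 128)} → n < 2 ^ width
    literal {n} {n<} = inWidth (≤-trans (<ᵇ⇒< n 128 n<) roomy)

    locates : ∀ {s R M} {o} {r} → Refines s ⟨ R , M ⟩ → o < 32 → Block (get (rn s) r) →
      ∃ λ R′ → Exec (locate o r) ⟨ R , M ⟩ 2 ⟨ R′ , M ⟩ × Refines s ⟨ R′ , M ⟩ ×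
               lookup R′ scratch ≡ num (o + get (rn s) r)
    locates {s} {R} {o = o} {r} ok o< bp = _ ,
      instr (const (inWidth (≤-trans o< (≤-trans (m≤m+n 32 96) roomy)))) ⨾
      instr (arith (lookup∘update scratch R _) (rnOk (refines-scratch ok) r) (inWidth (inSpace o< bp))) ,
      refines-scratch (refines-scratch ok) ,
      lookup∘update scratch (R [ scratch ]≔ num o) _

    private
      variable
        s : HState
        b b′ : ℕ
        Q Q′ : HState → Set
        c d : Cmd
        e : Cond

    nop⟩ : Q s → Triple nop s 0 Q
    nop⟩ q .run ok = _ , _ , _ , skip , z≤n , ok , q

    infixr 2 _⟫_

    _⟫_ : Triple c s b Q′ → (∀ {s′} → Q′ s′ → Triple d s′ b′ Q) → Triple (c ⨟ d) s (b + b′) Q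
    (f ⟫ g) .run ok with run f ok
    ... | _ , _ , _ , e₁ , t₁ , ok₁ , q₁ with run (g q₁) ok₁
    ... | _ , _ , _ , e₂ , t₂ , ok₂ , q₂ = _ , _ , _ , e₁ ⨾ e₂ , +-mono-≤ t₁ t₂ , ok₂ , q₂

    weaken : b ≤ b′ → Triple c s b Q → Triple c s b′ Q
    weaken b≤ f .run ok with run f ok
    ... | _ , _ , _ , e , t , ok′ , q = _ , _ , _ , e , ≤-trans t b≤ , ok′ , q

    mapT : (∀ {s′} → Q s′ → Q′ s′) → Triple c s b Q → Triple c s b Q′
    mapT m f .run ok with run f ok
    ... | _ , _ , _ , e , t , ok′ , q = _ , _ , _ , e , t , ok′ , m q

    private
      -- Every instruction rule takes a triple for the remaining commands, started in the updated
      -- state. A block is then verified by one chain of `$` along the program text, and its time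
      -- bound adds up by computation.
      primitively : ∀ c → (∀ {R M} → Refines s ⟨ R , M ⟩ → ∃₂ λ σ′ s′ →
                      Exec (compile c) ⟨ R , M ⟩ b σ′ × Refines s′ σ′ × Triple d s′ b′ Q) →
                    Triple (c ⨟ d) s (b + b′) Q
      primitively {b = b} c f .run ok with f ok
      ... | _ , _ , e₁ , ok₁ , g with run g ok₁
      ... | _ , _ , _ , e₂ , t₂ , ok₂ , q₂ = _ , _ , _ , e₁ ⨾ e₂ , +-monoʳ-≤ b t₂ , ok₂ , q₂

      refines-num≡ : ∀ {R M r w x} → w ≡ num x → Refines s ⟨ R , M ⟩ →
        Refines (record s { rn = put (rn s) r x }) ⟨ R [ numReg r ]≔ w , M ⟩
      refines-num≡ {r = r} refl ok = refines-num ok r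

      refines-sym≡ : ∀ {R M r w x} → w ≡ x → Refines s ⟨ R , M ⟩ →
        Refines (record s { rs = put (rs s) r x }) ⟨ R [ symReg r ]≔ w , M ⟩
      refines-sym≡ {r = r} refl ok = refines-sym ok r

      refines-heap≡ : ∀ {R M f p w x} → Block p → w ≡ num x → Refines s ⟨ R , M ⟩ →
        Refines (record s { hn = put (hn s) f (get (hn s) f [ p ↦ x ]) }) ⟨ R , M ⟨ offset f + p ⟩≔ w ⟩
      refines-heap≡ {f = f} bp refl ok = refines-heap ok f bp

      refines-heapS≡ : ∀ {R M f p w x} → Block p → w ≡ x → Refines s ⟨ R , M ⟩ →
        Refines (record s { hs = put (hs s) f (get (hs s) f [ p ↦ x ]) }) ⟨ R , M ⟨ offsetS f + p ⟩≔ w ⟩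
      refines-heapS≡ {f = f} bp refl ok = refines-heapS ok f bp

    lit⟩ : ∀ {r n} → {T (n <ᵇ 128)} → Triple d (record s { rn = put (rn s) r n }) b Q →
           Triple (lit r n ⨟ d) s (1 + b) Q
    lit⟩ {r = r} {n} {n<} f = primitively (lit r n) λ ok → _ , _ ,
      instr (const (literal {n} {n<})) , refines-num ok r , f

    mov⟩ : ∀ {r q} → Triple d (record s { rn = put (rn s) r (get (rn s) q) }) b Q →
           Triple (mov r q ⨟ d) s (1 + b) Q
    mov⟩ {r = r} {q} f = primitively (mov r q) λ ok → _ , _ , instr move , refines-num≡ (rnOk ok q) ok , f

    inc⟩ : ∀ {r n q} → {T (n <ᵇ 128)} → n + get (rn s) q < space →
           Triple d (record s { rn = put (rn s) r (n + get (rn s) q) }) b Q →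
           Triple (inc r n q ⨟ d) s (2 + b) Q
    inc⟩ {r = r} {n} {q} {n<} bound f = primitively (inc r n q) λ {R} ok → _ , _ ,
      instr (const (literal {n} {n<})) ⨾
        instr (arith (lookup∘update scratch R _) (rnOk (refines-scratch ok) q) (inWidth bound)) ,
      refines-num (refines-scratch ok) r , f

    ld⟩ : ∀ {r f p} → Block (get (rn s) p) →
          Triple d (record s { rn = put (rn s) r (get (hn s) f (get (rn s) p)) }) b Q →
          Triple (ld r f p ⨟ d) s (3 + b) Q
    ld⟩ {r = r} {f} {p} bp g = primitively (ld r f p) λ ok →
      let _ , e , ok′ , eq = locates {r = p} ok (offset<32 f) bp in _ , _ ,
      e ⨾ instr (load eq (inSpace (offset<32 f) bp)) , refines-num≡ (hnOk ok f bp) ok′ , g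

    st⟩ : ∀ {f p r} → Block (get (rn s) p) →
          Triple d (record s { hn = put (hn s) f (get (hn s) f [ get (rn s) p ↦ get (rn s) r ]) }) b Q →
          Triple (st f p r ⨟ d) s (3 + b) Q
    st⟩ {f = f} {p} {r} bp g = primitively (st f p r) λ ok →
      let _ , e , ok′ , eq = locates {r = p} ok (offset<32 f) bp in _ , _ ,
      e ⨾ instr (store eq (inSpace (offset<32 f) bp)) , refines-heap≡ bp (rnOk ok′ r) ok′ , g

    st0⟩ : ∀ {f p} → Block (get (rn s) p) →
           Triple d (record s { hn = put (hn s) f (get (hn s) f [ get (rn s) p ↦ 0 ]) }) b Q →
           Triple (st0 f p ⨟ d) s (3 + b) Q
    st0⟩ {f = f} {p} bp g = primitively (st0 f p) λ ok →
      let _ , e , ok′ , eq = locates {r = p} ok (offset<32 f) bp in _ , _ ,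
      e ⨾ instr (store eq (inSpace (offset<32 f) bp)) , refines-heap≡ bp (nullOk ok′) ok′ , g

    movS⟩ : ∀ {r q} → Triple d (record s { rs = put (rs s) r (get (rs s) q) }) b Q →
            Triple (movS r q ⨟ d) s (1 + b) Q
    movS⟩ {r = r} {q} f = primitively (movS r q) λ ok → _ , _ , instr move , refines-sym≡ (rsOk ok q) ok , f

    ldS⟩ : ∀ {r f p} → Block (get (rn s) p) →
           Triple d (record s { rs = put (rs s) r (get (hs s) f (get (rn s) p)) }) b Q →
           Triple (ldS r f p ⨟ d) s (3 + b) Q
    ldS⟩ {r = r} {f} {p} bp g = primitively (ldS r f p) λ ok →
      let _ , e , ok′ , eq = locates {r = p} ok (offsetS<32 f) bp in _ , _ ,
      e ⨾ instr (load eq (inSpace (offsetS<32 f) bp)) , refines-sym≡ (hsOk ok f bp) ok′ , g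

    stS⟩ : ∀ {f p r} → Block (get (rn s) p) →
           Triple d (record s { hs = put (hs s) f (get (hs s) f [ get (rn s) p ↦ get (rs s) r ]) }) b Q →
           Triple (stS f p r ⨟ d) s (3 + b) Q
    stS⟩ {f = f} {p} {r} bp g = primitively (stS f p r) λ ok →
      let _ , e , ok′ , eq = locates {r = p} ok (offsetS<32 f) bp in _ , _ ,
      e ⨾ instr (store eq (inSpace (offsetS<32 f) bp)) , refines-heapS≡ bp (rsOk ok′ r) ok′ , g

    data Eval (s : HState) : Cond → Bool → Set where
      isNonzero : ∀ {r} → get (rn s) r ≢ 0 → Eval s (nonzero r) true
      isZero  : ∀ {r} → get (rn s) r ≡ 0 → Eval s (nonzero r) false
      isEq      : ∀ {r q} → get (rn s) r ≡ get (rn s) q → Eval s (eqN r q) true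
      isNeq     : ∀ {r q} → get (rn s) r ≢ get (rn s) q → Eval s (eqN r q) false
      isLt      : ∀ {r q} → get (rn s) r < get (rn s) q → Eval s (ltN r q) true
      isNlt     : ∀ {r q} → ¬ get (rn s) r < get (rn s) q → Eval s (ltN r q) false
      isEqS     : ∀ {r q x y} → get (rs s) r ≡ letter x → get (rs s) q ≡ letter y → x ≡ y → Eval s (eqS r q) true
      isNeqS    : ∀ {r q x y} → get (rs s) r ≡ letter x → get (rs s) q ≡ letter y → x ≢ y → Eval s (eqS r q) false
      isLtS     : ∀ {r q x y} → get (rs s) r ≡ letter x → get (rs s) q ≡ letter y → x ⊏ y → Eval s (ltS r q) true
      isNltS    : ∀ {r q x y} → get (rs s) r ≡ letter x → get (rs s) q ≡ letter y → ¬ x ⊏ y → Eval s (ltS r q) false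

    outcome : ∀ {s σ e β} → Refines s σ → Eval s e β → Outcome (State.regs σ) (compileCond e) β
    outcome ok (isNonzero {r} x≢0) = subst (Outcome _ _) (isYes-true (_ <? _) (n≢0⇒n>0 x≢0)) (lessNum (nullOk ok) (rnOk ok r))
    outcome ok (isZero {r} x≡0) = subst (Outcome _ _) (isYes-false (_ <? _) (λ 0<x → <⇒≢ 0<x (sym x≡0))) (lessNum (nullOk ok) (rnOk ok r))
    outcome ok (isEq {r} {q} x) = subst (Outcome _ _) (isYes-true (_ ≟ _) x) (equalNum (rnOk ok r) (rnOk ok q))
    outcome ok (isNeq {r} {q} x) = subst (Outcome _ _) (isYes-false (_ ≟ _) x) (equalNum (rnOk ok r) (rnOk ok q))
    outcome ok (isLt {r} {q} x) = subst (Outcome _ _) (isYes-true (_ <? _) x) (lessNum (rnOk ok r) (rnOk ok q))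
    outcome ok (isNlt {r} {q} x) = subst (Outcome _ _) (isYes-false (_ <? _) x) (lessNum (rnOk ok r) (rnOk ok q))
    outcome ok (isEqS {r} {q} x y z) = subst (Outcome _ _) (isYes-true (_ ≟S _) z) (equalSym (trans (rsOk ok r) x) (trans (rsOk ok q) y))
    outcome ok (isNeqS {r} {q} x y z) = subst (Outcome _ _) (isYes-false (_ ≟S _) z) (equalSym (trans (rsOk ok r) x) (trans (rsOk ok q) y))
    outcome ok (isLtS {r} {q} x y z) = subst (Outcome _ _) (isYes-true (_ ⊏? _) z) (lessSym (trans (rsOk ok r) x) (trans (rsOk ok q) y))
    outcome ok (isNltS {r} {q} x y z) = subst (Outcome _ _) (isYes-false (_ ⊏? _) z) (lessSym (trans (rsOk ok r) x) (trans (rsOk ok q) y))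

    then⟩ : Eval s e true → Triple c s b Q → Triple (test e c d) s (1 + b) Q
    then⟩ ev f .run ok with run f ok
    ... | _ , _ , _ , x , t , ok′ , q = _ , _ , _ , branchTrue (outcome ok ev) x , s≤s t , ok′ , q

    else⟩ : Eval s e false → Triple d s b Q → Triple (test e c d) s (1 + b) Q
    else⟩ ev f .run ok with run f ok
    ... | _ , _ , _ , x , t , ok′ , q = _ , _ , _ , branchFalse (outcome ok ev) x , s≤s t , ok′ , q

    again⟩ : Eval s e true → Triple c s b Q′ → (∀ {s′} → Q′ s′ → Triple (loop e c) s′ b′ Q) →
             Triple (loop e c) s (1 + b + b′) Q
    again⟩ ev f g .run ok with run f ok
    ... | _ , _ , _ , x , t , ok₁ , q₁ with run (g q₁) ok₁
    ... | _ , _ , _ , y , u , ok₂ , q₂ =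
      _ , _ , _ , whileTrue (outcome ok ev) x y , s≤s (+-mono-≤ t u) , ok₂ , q₂

    exit⟩ : Eval s e false → Q s → Triple (loop e c) s 1 Q
    exit⟩ ev q .run ok = _ , _ , _ , whileFalse (outcome ok ev) , ≤-refl , ok , q

    loop≤ : ∀ {b m n} → m < n → suc b + (1 + suc b * m) ≤ 1 + suc b * n
    loop≤ {b} {m} {n} m<n = begin
      suc b + (1 + suc b * m) ≡⟨ +-suc (suc b) (suc b * m) ⟩
      1 + (suc b + suc b * m) ≡⟨ cong suc (*-suc (suc b) m) ⟨
      1 + suc b * suc m       ≤⟨ s≤s (*-monoʳ-≤ (suc b) m<n) ⟩
      1 + suc b * n           ∎
      where open ≤-Reasoning

  open Triples

  -- Search in a tree of records

  module Dictionaries where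

    record Shape : Set where
      constructor shape
      field
        lefts rights levels : ℕ → ℕ

    open Shape

    shapeOf : HState → Shape
    shapeOf s = shape (get (hn s) left) (get (hn s) right′) (get (hn s) lev)

    reshape : HState → Shape → HState
    reshape s S = record s { hn = put (put (put (hn s) left (lefts S)) right′ (rights S)) lev (levels S) }

    -- The first eight numeric registers and the register sx are scratch
    -- registers of the dictionary operations.
    retemps : Tup ℕ 8 → Tup ℕ #num → Tup ℕ #num
    retemps = overwrite {m = 8} {16}

    retemp : HState → Tup ℕ 8 → Word → HState
    retemp s j w = record s { rn = retemps j (rn s) ; rs = put (rs s) sx w }

    temps : HState → Tup ℕ 8
    temps s = front 8 {16} (rn s)

    tpar ttop tres : Fin 8
    tpar = ix 1
    ttop = ix 2
    tres = ix 6

    data Rep (S : Shape) : Tree → Set where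
      leaf : Rep S leaf
      node : ∀ {l p k r} → Block p → p ≢ 0 → lefts S p ≡ rootOf l → rights S p ≡ rootOf r →
             levels S p ≡ k → Rep S l → Rep S r → Rep S (node l p k r)

    keys : HState → ℕ → Word
    keys s = get (hs s) key

    Keyed : (ℕ → Word) → ℕ → Set
    Keyed K p = ∃ λ x → K p ≡ letter x

    _≺⟨_⟩_ : ℕ → (ℕ → Word) → ℕ → Set
    p ≺⟨ K ⟩ q = ∃₂ λ x y → K p ≡ letter x × K q ≡ letter y × x ⊏ y

    letter-injective : ∀ {x y} → letter x ≡ letter y → x ≡ y
    letter-injective refl = refl

    Found : (ℕ → Word) → Symbol → List ℕ → ℕ → Set
    Found K a ps r = (r ≡ 0 × (∀ {p} → p ∈ ps → K p ≢ letter a)) ⊎ (r ∈ ps × K r ≡ letter a)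

    module _ {a : Symbol} where

      findLoop : ∀ s t → get (rs s) sk ≡ letter a → Rep (shapeOf s) t → get (rn s) cur ≡ rootOf t →
        get (rn s) res ≡ 0 → (∀ {p} → p ∈ inorder t → Keyed (keys s) p) → AllPairs _≺⟨ keys s ⟩_ (inorder t) →
        Triple (loop (nonzero cur) findBody) s (1 + 9 * height t)
          (λ s′ → ∃₂ λ j w → s′ ≡ retemp s j w × Found (keys s) a (inorder t) (get j tres))
      findLoop s leaf ska rep cur≡ res≡ keyed sorted =
        exit⟩ (isZero cur≡) (temps s , get (rs s) sx , refl , inj₁ (res≡ , λ ()))
      findLoop s (node l p k r) ska (node bp p≢0 L≡ R≡ _ repl repr) refl res≡ keyed sorted
        with keyed (∈-++⁺ʳ (inorder l) (here refl)) | AllPairs-split (inorder l) sorted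
      ... | x , kx | sl , <p , p< , sr with compare a x
      ... | tri≈ _ a≡x _ = weaken (≤-trans (m≤m+n 8 2) (s≤s (*-monoʳ-≤ 9 (s≤s z≤n)))) $
        again⟩ {Q′ = _≡ s₁} (isNonzero p≢0)
          (ldS⟩ bp $ then⟩ (isEqS ska kx a≡x) $ mov⟩ $ lit⟩ $ nop⟩ refl)
          λ { refl → exit⟩ (isZero refl) (temps s₁ , get (rs s₁) sx , refl ,
                       inj₂ (∈-++⁺ʳ (inorder l) (here refl) , trans kx (cong letter (sym a≡x)))) }
        where
        s₁ = record s { rn = put (put (rn s) res (get (rn s) cur)) cur 0
                      ; rs = put (rs s) sx (get (hs s) key (get (rn s) cur)) }
      ... | tri< a⊏x a≢x _ = weaken (loop≤ {8} (s≤s (m≤m⊔n (height l) (height r)))) $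
        again⟩ {Q′ = _≡ s₁} (isNonzero p≢0)
          (ldS⟩ bp $ else⟩ (isNeqS ska kx a≢x) $ then⟩ (isLtS ska kx a⊏x) $ ld⟩ bp $ nop⟩ refl)
          λ { refl → mapT finish (findLoop s₁ l ska repl L≡ res≡ (keyed ∘ ∈-++⁺ˡ) sl) }
        where
        s₁ = record s { rn = put (rn s) cur (get (hn s) left (get (rn s) cur))
                      ; rs = put (rs s) sx (get (hs s) key (get (rn s) cur)) }
        finish : ∀ {s′} → (∃₂ λ j w → s′ ≡ retemp s₁ j w × Found (keys s₁) a (inorder l) (get j tres)) →
                 ∃₂ λ j w → s′ ≡ retemp s j w × Found (keys s) a (inorder l ++ p ∷ inorder r) (get j tres)
        finish (j , w , refl , inj₂ (p∈ , kp)) = j , w , refl , inj₂ (∈-++⁺ˡ p∈ , kp)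
        finish (j , w , refl , inj₁ (r≡ , none)) = j , w , refl , inj₁ (r≡ , none′)
          where
          none′ : ∀ {q} → q ∈ inorder l ++ p ∷ inorder r → get (hs s) key q ≢ letter a
          none′ {q} q∈ kq with ∈-++⁻ (inorder l) q∈
          ... | inj₁ q∈l = none q∈l kq
          ... | inj₂ (here refl) = a≢x (letter-injective (trans (sym kq) kx))
          ... | inj₂ (there q∈r) with All.lookup p< q∈r
          ...   | _ , _ , kp , kq′ , lt with letter-injective (trans (sym kx) kp) | letter-injective (trans (sym kq) kq′)
          ...   | refl | refl = ⊏-irrefl refl (⊏-trans a⊏x lt)
      ... | tri> ¬a⊏x a≢x x⊏a = weaken (loop≤ {8} (s≤s (m≤n⊔m (height l) (height r)))) $
        again⟩ {Q′ = _≡ s₁} (isNonzero p≢0)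
          (ldS⟩ bp $ else⟩ (isNeqS ska kx a≢x) $ else⟩ (isNltS ska kx ¬a⊏x) $ ld⟩ bp $ nop⟩ refl)
          λ { refl → mapT finish (findLoop s₁ r ska repr R≡ res≡ (keyed ∘ ∈-++⁺ʳ (inorder l) ∘ there) sr) }
        where
        s₁ = record s { rn = put (rn s) cur (get (hn s) right′ (get (rn s) cur))
                      ; rs = put (rs s) sx (get (hs s) key (get (rn s) cur)) }
        finish : ∀ {s′} → (∃₂ λ j w → s′ ≡ retemp s₁ j w × Found (keys s₁) a (inorder r) (get j tres)) →
                 ∃₂ λ j w → s′ ≡ retemp s j w × Found (keys s) a (inorder l ++ p ∷ inorder r) (get j tres)
        finish (j , w , refl , inj₂ (p∈ , kp)) = j , w , refl , inj₂ (∈-++⁺ʳ (inorder l) (there p∈) , kp)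
        finish (j , w , refl , inj₁ (r≡ , none)) = j , w , refl , inj₁ (r≡ , none′)
          where
          none′ : ∀ {q} → q ∈ inorder l ++ p ∷ inorder r → get (hs s) key q ≢ letter a
          none′ {q} q∈ kq with ∈-++⁻ (inorder l) q∈
          ... | inj₂ (here refl) = a≢x (letter-injective (trans (sym kq) kx))
          ... | inj₂ (there q∈r) = none q∈r kq
          ... | inj₁ q∈l with All.lookup <p q∈l
          ...   | _ , _ , kq′ , kp , lt with letter-injective (trans (sym kx) kp) | letter-injective (trans (sym kq) kq′)
          ...   | refl | refl = ⊏-irrefl refl (⊏-trans lt x⊏a)

  open Dictionaries

  -- Insertion into a tree of records

  module Insertion where

    open Shape

    Distinct : List ℕ → Set
    Distinct = AllPairs _≢_

    apart : ∀ {xs ys x y} → Distinct (xs ++ ys) → x ∈ xs → y ∈ ys → x ≢ y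
    apart {x ∷ xs} (p ∷ _)  (here refl) y∈ = All.lookup p (∈-++⁺ʳ xs y∈)
    apart {x ∷ xs} (_ ∷ ps) (there x∈)  y∈ = apart ps x∈ y∈

    distinctˡ : ∀ {xs ys} → Distinct (xs ++ ys) → Distinct xs
    distinctˡ {[]}     _        = []
    distinctˡ {x ∷ xs} (p ∷ ps) = ++⁻ˡ xs p ∷ distinctˡ ps

    distinctʳ : ∀ xs {ys} → Distinct (xs ++ ys) → Distinct ys
    distinctʳ []       ps       = ps
    distinctʳ (x ∷ xs) (_ ∷ ps) = distinctʳ xs ps

    Same : Shape → Shape → ℕ → Set
    Same S S′ q = lefts S′ q ≡ lefts S q × rights S′ q ≡ rights S q × levels S′ q ≡ levels S q

    same-trans : ∀ {S S′ S″ q} → Same S S′ q → Same S′ S″ q → Same S S″ q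
    same-trans (a , b , c) (a′ , b′ , c′) = trans a′ a , trans b′ b , trans c′ c

    rep-frame : ∀ {S S′ t} → Rep S t → (∀ {q} → q ∈ inorder t → Same S S′ q) → Rep S′ t
    rep-frame leaf _ = leaf
    rep-frame (node {l} bp p≢0 L R V rl rr) same with same (∈-++⁺ʳ (inorder l) (here refl))
    ... | l≡ , r≡ , v≡ = node bp p≢0 (trans l≡ L) (trans r≡ R) (trans v≡ V)
      (rep-frame rl (same ∘ ∈-++⁺ˡ)) (rep-frame rr (same ∘ ∈-++⁺ʳ (inorder l) ∘ there))

    rep-nonzero : ∀ {S t q} → Rep S t → q ∈ inorder t → q ≢ 0
    rep-nonzero (node {l} _ p≢0 _ _ _ rl rr) q∈ with ∈-++⁻ (inorder l) q∈
    ... | inj₁ q∈l = rep-nonzero rl q∈l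
    ... | inj₂ (here refl) = p≢0
    ... | inj₂ (there q∈r) = rep-nonzero rr q∈r

    rep-block : ∀ {S t q} → Rep S t → q ∈ inorder t → Block q
    rep-block (node {l} bp _ _ _ _ rl rr) q∈ with ∈-++⁻ (inorder l) q∈
    ... | inj₁ q∈l = rep-block rl q∈l
    ... | inj₂ (here refl) = bp
    ... | inj₂ (there q∈r) = rep-block rr q∈r

    block0 : ∀ {p} → Block p → Block 0
    block0 (i , i< , _) = 0 , ≤-trans (s≤s z≤n) i< , refl

    rootBlock : ∀ {S t p} → Block p → Rep S t → Block (rootOf t)
    rootBlock bp leaf = block0 bp
    rootBlock _ (node bp _ _ _ _ _ _) = bp

    -- Record 0 is a sentinel. `skewCmd` and `splitCmd` may read levels through null pointers, and
    -- the level 0 found there never equals that of a genuine node.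
    NullOk : Shape → Set
    NullOk S = rights S 0 ≡ 0 × levels S 0 ≡ 0

    rep-level : ∀ {S t} → NullOk S → Rep S t → levels S (rootOf t) ≡ level t
    rep-level (_ , v0) leaf = v0
    rep-level _ (node _ _ _ _ V _ _) = V

    Fixed : HState → Tree → Tree → HState → Set
    Fixed s t t′ s′ = ∃₂ λ x y → ∃ λ S′ →
      s′ ≡ reshape (record s { rn = put (put (put (rn s) ch x) aux y) top (rootOf t′) }) S′ ×
      Rep S′ t′ × (∀ q → q ∉ inorder t → Same (shapeOf s) S′ q)

    skewT : ∀ {s l p k r} → get (rn s) top ≡ p → get (rn s) lvl ≡ k → k ≢ 0 → NullOk (shapeOf s) →
      Rep (shapeOf s) (node l p k r) → Distinct (inorder (node l p k r)) →
      Triple skewCmd s 17 (Fixed s (node l p k r) (skew (node l p k r)))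
    skewT {s} {leaf} refl lvl≡ k≢0 (_ , v0) rep@(node bp _ L≡ _ _ _ _) _ =
      weaken (m≤m+n 7 10) $
      ld⟩ bp $ ld⟩ (subst Block (sym L≡) (block0 bp)) $
      else⟩ (isNeq λ eq → k≢0 (trans (sym (trans (sym (trans (cong (get (hn s) lev) L≡) v0)) (trans eq lvl≡))) refl)) $
      nop⟩ (_ , _ , shapeOf s , refl , rep , λ _ _ → refl , refl , refl)
    skewT {s} {node a q j b} {p} {k} {r} refl lvl≡ k≢0 _ rep@(node bp p≢0 refl R≡ V≡ (node bq q≢0 La Rb refl ra rb) rr) dist
      with j ≟ k
    ... | no j≢k = weaken (m≤m+n 7 10) $
      ld⟩ bp $ ld⟩ bq $
      else⟩ (isNeq λ eq → j≢k (trans eq lvl≡)) $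
      nop⟩ (_ , _ , shapeOf s , refl , rep , λ _ _ → refl , refl , refl)
    ... | yes j≡k =
      ld⟩ bp $ ld⟩ bq $
      then⟩ (isEq (trans j≡k (sym lvl≡))) $
      ld⟩ bq $ st⟩ bp $ st⟩ bq $ mov⟩ $
      nop⟩ (_ , _ , S′ , refl ,
        node bq q≢0 (trans (↦-other L p≢q) La) (↦-same R q) refl
          (rep-frame ra λ x∈ → other (apart dist (∈-++⁺ˡ x∈) (here refl)) (apart dl x∈ (here refl)))
          (node bp p≢0 (trans (↦-same L p) Rb) (trans (↦-other R (p≢q ∘ sym)) R≡) V≡
            (rep-frame rb λ x∈ → other (apart dist (∈-++⁺ʳ (inorder a) (there x∈)) (here refl))
                                       (apart {q ∷ []} (distinctʳ (inorder a) dl) (here refl) x∈ ∘ sym))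
            (rep-frame rr λ x∈ → other (apart {p ∷ []} (distinctʳ (inorder a ++ q ∷ inorder b) dist) (here refl) x∈ ∘ sym)
                                       (apart dist q∈l (there x∈) ∘ sym))) ,
        λ _ x∉ → other (λ { refl → x∉ (∈-++⁺ʳ (inorder a ++ q ∷ inorder b) (here refl)) })
                     (λ { refl → x∉ (∈-++⁺ˡ q∈l) }))
      where
      L = get (hn s) left
      R = get (hn s) right′
      S′ = shape (L [ p ↦ get (hn s) right′ q ]) (R [ q ↦ p ]) (get (hn s) lev)
      q∈l : q ∈ inorder a ++ q ∷ inorder b
      q∈l = ∈-++⁺ʳ (inorder a) (here refl)
      dl = distinctˡ dist
      p≢q : p ≢ q
      p≢q = apart dist q∈l (here refl) ∘ sym
      other : ∀ {x} → x ≢ p → x ≢ q → Same (shapeOf s) S′ x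
      other x≢p x≢q = ↦-other L (x≢p ∘ sym) , ↦-other R (x≢q ∘ sym) , refl

    splitT : ∀ {s l p k r} → get (rn s) top ≡ p → get (rn s) lvl ≡ k → k ≢ 0 → suc k < space → NullOk (shapeOf s) →
      Rep (shapeOf s) (node l p k r) → Distinct (inorder (node l p k r)) →
      Triple splitCmd s 25 (Fixed s (node l p k r) (split (node l p k r)))
    splitT {s} {r = leaf} refl lvl≡ k≢0 _ (r0 , v0) rep@(node bp _ _ R≡ _ _ _) _ =
      weaken (m≤m+n 10 15) $
      ld⟩ bp $ ld⟩ (subst Block (sym R≡) (block0 bp)) $
      ld⟩ (subst Block (sym right0) (block0 bp)) $
      else⟩ (isNeq λ eq → k≢0 (trans (sym (trans eq lvl≡)) (trans (cong (get (hn s) lev) right0) v0))) $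
      nop⟩ (_ , _ , shapeOf s , refl , rep , λ _ _ → refl , refl , refl)
      where
      right0 : get (hn s) right′ (get (hn s) right′ (get (rn s) top)) ≡ 0
      right0 = trans (cong (get (hn s) right′) R≡) r0
    splitT {s} {a} {p} {k} {node b q j c} refl lvl≡ k≢0 k< nul rep@(node bp p≢0 L≡ refl refl ra (node bq q≢0 Lb Rc refl rb rc)) dist
      with level c ≟ k
    ... | no c≢k = weaken (m≤m+n 10 15) $
      ld⟩ bp $ ld⟩ bq $ ld⟩ (subst Block (sym Rc) (rootBlock bp rc)) $
      else⟩ (isNeq λ eq → c≢k (trans (sym (trans (cong (get (hn s) lev) Rc) (rep-level nul rc))) (trans eq lvl≡))) $
      nop⟩ (_ , _ , shapeOf s , refl , rep , λ _ _ → refl , refl , refl)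
    ... | yes c≡k =
      ld⟩ bp $ ld⟩ bq $ ld⟩ (subst Block (sym Rc) (rootBlock bp rc)) $
      then⟩ (isEq (trans (trans (trans (cong (get (hn s) lev) Rc) (rep-level nul rc)) c≡k) (sym lvl≡))) $
      ld⟩ bq $ st⟩ bp $ st⟩ bq $ inc⟩ (subst (λ n → suc n < space) (sym lvl≡) k<) $ st⟩ bq $ mov⟩ $
      nop⟩ (_ , _ , S′ , refl ,
        node bq q≢0 (↦-same L q) (trans (↦-other R p≢q) Rc) (trans (↦-same V q) (cong suc lvl≡))
          (node bp p≢0 (trans (↦-other L (p≢q ∘ sym)) L≡) (trans (↦-same R p) Lb) (↦-other V (p≢q ∘ sym))
            (rep-frame ra λ x∈ → other (apart dist x∈ (here refl)) (apart dist x∈ q∈))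
            (rep-frame rb λ x∈ → other (apart {p ∷ []} dpr (here refl) (∈-++⁺ˡ x∈) ∘ sym) (apart dr x∈ (here refl))))
          (rep-frame rc λ x∈ → other (apart {p ∷ []} dpr (here refl) (∈-++⁺ʳ (inorder b) (there x∈)) ∘ sym)
                                     (apart {q ∷ []} (distinctʳ (inorder b) dr) (here refl) x∈ ∘ sym)) ,
        λ _ x∉ → other (λ { refl → x∉ (∈-++⁺ʳ (inorder a) (here refl)) })
                     (λ { refl → x∉ (∈-++⁺ʳ (inorder a) q∈) }))
      where
      L = get (hn s) left
      R = get (hn s) right′
      V = get (hn s) lev
      S′ = shape (L [ q ↦ p ]) (R [ p ↦ get (hn s) left q ]) (V [ q ↦ suc (get (rn s) lvl) ])
      q∈ : q ∈ p ∷ inorder b ++ q ∷ inorder c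
      q∈ = there (∈-++⁺ʳ (inorder b) (here refl))
      dpr = distinctʳ (inorder a) dist
      dr = distinctʳ (p ∷ []) dpr
      p≢q : p ≢ q
      p≢q = apart {p ∷ []} dpr (here refl) (∈-++⁺ʳ (inorder b) (here refl))
      other : ∀ {x} → x ≢ p → x ≢ q → Same (shapeOf s) S′ x
      other x≢p x≢q = ↦-other L (x≢q ∘ sym) , ↦-other R (x≢p ∘ sym) , ↦-other V (x≢q ∘ sym)

    skew-node : ∀ l p k r → ∃₂ λ l′ p′ → ∃ λ r′ → skew (node l p k r) ≡ node l′ p′ k r′
    skew-node leaf p k r = _ , _ , _ , refl
    skew-node (node a q j b) p k r with j ≟ k
    ... | yes refl = _ , _ , _ , refl
    ... | no  _    = _ , _ , _ , refl

    nullOk-same : ∀ {S S′} → NullOk S → Same S S′ 0 → NullOk S′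
    nullOk-same (r0 , v0) (_ , r≡ , v≡) = trans r≡ r0 , trans v≡ v0

    fixT : ∀ {s l p k r} → get (rn s) top ≡ p → get (rn s) lvl ≡ k → k ≢ 0 → suc k < space → NullOk (shapeOf s) →
      Rep (shapeOf s) (node l p k r) → Distinct (inorder (node l p k r)) →
      Triple (skewCmd ⨟ splitCmd) s 42 (Fixed s (node l p k r) (fix (node l p k r)))
    fixT {s} {l} {p} {k} {r} top≡ lvl≡ k≢0 k< nul rep dist =
      skewT {s} top≡ lvl≡ k≢0 nul rep dist ⟫ continue
      where
      t = node l p k r
      continue : ∀ {s′} → Fixed s t (skew t) s′ → Triple splitCmd s′ 25 (Fixed s t (fix t))
      continue (x , y , S′ , refl , rep′ , same) with skew (node l p k r) | skew-node l p k r | inorder-skew (node l p k r)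
      ... | _ | l′ , p′ , r′ , refl | in≡ =
        mapT (λ { (x , y , S″ , refl , rep″ , same″) →
                 _ , _ , _ , refl , rep″ , λ q q∉ → same-trans {shapeOf s} {S′} {S″} {q} (same q q∉) (same″ q (q∉ ∘ subst (q ∈_) in≡)) })
          (splitT refl lvl≡ k≢0 k<
            (nullOk-same {shapeOf s} {S′} nul (same 0 λ 0∈ → rep-nonzero rep 0∈ refl)) rep′ (subst Distinct (sym in≡) dist))

    -- A zipper, the abstract counterpart of the `up` pointers left by the descent. Only the
    -- distinctness of the records matters along the way, hence the permutations in place of exact
    -- orders below.
    data Frame : Set where
      onLeft  : (p k : ℕ) (r : Tree) → Frame
      onRight : (l : Tree) (p k : ℕ) → Frame

    fill : Frame → Tree → Tree
    fill (onLeft p k r)  t = node t p k r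
    fill (onRight l p k) t = node l p k t

    plug : List Frame → Tree → Tree
    plug []      t = t
    plug (f ∷ c) t = plug c (fill f t)

    recs : List Frame → List ℕ
    recs []                = []
    recs (onLeft p k r ∷ c)  = p ∷ inorder r ++ recs c
    recs (onRight l p k ∷ c) = p ∷ inorder l ++ recs c

    fill-↭ : ∀ f t c → inorder (fill f t) ++ recs c ↭ inorder t ++ recs (f ∷ c)
    fill-↭ (onLeft p k r) t c = ↭-reflexive (++-assoc (inorder t) (p ∷ inorder r) (recs c))
    fill-↭ (onRight l p k) t c = begin
      (inorder l ++ p ∷ inorder t) ++ recs c  ≡⟨ ++-assoc (inorder l) (p ∷ inorder t) (recs c) ⟩
      inorder l ++ (p ∷ inorder t) ++ recs c  ↭⟨ shifts (inorder l) (p ∷ inorder t) ⟩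
      p ∷ inorder t ++ inorder l ++ recs c    ↭⟨ shift p (inorder t) _ ⟨
      inorder t ++ p ∷ inorder l ++ recs c    ∎
      where open PermutationReasoning

    plug-↭ : ∀ c t → inorder (plug c t) ↭ inorder t ++ recs c
    plug-↭ []      t = ↭-reflexive (sym (++-identityʳ (inorder t)))
    plug-↭ (f ∷ c) t = ↭-trans (plug-↭ c (fill f t)) (fill-↭ f t c)

    plug-height : ∀ c t → length c + height t ≤ height (plug c t)
    plug-height []      t = ≤-refl
    plug-height (f ∷ c) t = begin
      suc (length c + height t)   ≡⟨ +-suc (length c) (height t) ⟨
      length c + suc (height t)   ≤⟨ +-monoʳ-≤ (length c) (deeper f) ⟩
      length c + height (fill f t) ≤⟨ plug-height c (fill f t) ⟩
      height (plug c (fill f t))  ∎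
      where
      open ≤-Reasoning
      deeper : ∀ f → suc (height t) ≤ height (fill f t)
      deeper (onLeft p k r)  = s≤s (m≤m⊔n (height t) (height r))
      deeper (onRight l p k) = s≤s (m≤n⊔m (height l) (height t))

    distinct-resp : ∀ {xs ys} → xs ↭ ys → Distinct xs → Distinct ys
    distinct-resp _↭_.refl ds = ds
    distinct-resp (_↭_.prep x π) (d ∷ ds) = All-resp-↭ π d ∷ distinct-resp π ds
    distinct-resp (_↭_.swap x y π) ((x≢y ∷ dx) ∷ dy ∷ ds) =
      ((x≢y ∘ sym) ∷ All-resp-↭ π dy) ∷ All-resp-↭ π dx ∷ distinct-resp π ds
    distinct-resp (_↭_.trans π ρ) ds = distinct-resp ρ (distinct-resp π ds)

    -- Level 0 belongs to null, and `splitCmd` computes k + 1, which has to fit into a word.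
    Leveled : ℕ → Set
    Leveled k = k ≢ 0 × suc k < space

    data AllLeveled : Tree → Set where
      leaf : AllLeveled leaf
      node : ∀ {l p k r} → Leveled k → AllLeveled l → AllLeveled r → AllLeveled (node l p k r)

    setUp : HState → (ℕ → ℕ) → HState
    setUp s U = record s { hn = put (hn s) up U }

    module _ (s₀ : HState) (a : Symbol) where

      Before After : ℕ → Set
      Before p = ∃ λ x → get (hs s₀) key p ≡ letter x × a ⊏ x
      After  p = ∃ λ x → get (hs s₀) key p ≡ letter x × ¬ a ⊏ x

      -- The child pointer towards the hole is left open, since the ascent overwrites it with the
      -- root of the rebalanced subtree.
      data CtxRep (S : Shape) (U : ℕ → ℕ) : List Frame → ℕ → Set where
        []    : CtxRep S U [] 0
        leftOf  : ∀ {p k r c} → Block p → p ≢ 0 → rights S p ≡ rootOf r → levels S p ≡ k → Leveled k → Rep S r →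
                Before p → CtxRep S U c (U p) → CtxRep S U (onLeft p k r ∷ c) p
        rightOf : ∀ {p k l c} → Block p → p ≢ 0 → lefts S p ≡ rootOf l → levels S p ≡ k → Leveled k → Rep S l →
                After p → CtxRep S U c (U p) → CtxRep S U (onRight l p k ∷ c) p

      ctx-frame : ∀ {S U S′ U′ c p} → CtxRep S U c p →
                  (∀ {q} → q ∈ recs c → Same S S′ q × U′ q ≡ U q) → CtxRep S′ U′ c p
      ctx-frame [] _ = []
      ctx-frame {U = U} {S′} {U′} (leftOf {p} {r = r} {c = c} bp p≢0 R V lv rr b ctx) same with same (here refl)
      ... | (_ , r≡ , v≡) , u≡ = leftOf bp p≢0 (trans r≡ R) (trans v≡ V) lv
        (rep-frame rr λ q∈ → proj₁ (same (there (∈-++⁺ˡ q∈)))) b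
        (subst (CtxRep S′ U′ c) (sym u≡) (ctx-frame ctx λ q∈ → same (there (∈-++⁺ʳ (inorder r) q∈))))
      ctx-frame {U = U} {S′} {U′} (rightOf {p} {l = l} {c = c} bp p≢0 L V lv rl b ctx) same with same (here refl)
      ... | (l≡ , _ , v≡) , u≡ = rightOf bp p≢0 (trans l≡ L) (trans v≡ V) lv
        (rep-frame rl λ q∈ → proj₁ (same (there (∈-++⁺ˡ q∈)))) b
        (subst (CtxRep S′ U′ c) (sym u≡) (ctx-frame ctx λ q∈ → same (there (∈-++⁺ʳ (inorder l) q∈))))

      Descended : HState → Tree → HState → Set
      Descended s t s′ = ∃₂ λ j w → ∃₂ λ U c → s′ ≡ setUp (retemp s j w) U ×
        get j ttop ≡ get (rn s) top × CtxRep (shapeOf s) U c (get j tpar) × t ≡ plug c leaf ×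
        Distinct (recs c)

      descendLoop : ∀ s t c → hs s ≡ hs s₀ → get (rs s) sk ≡ letter a → Rep (shapeOf s) t → AllLeveled t →
        CtxRep (shapeOf s) (get (hn s) up) c (get (rn s) par) → get (rn s) cur ≡ rootOf t →
        (∀ {p} → p ∈ inorder t → Keyed (keys s₀) p) → Distinct (inorder t ++ recs c) →
        Triple (loop (nonzero cur) descend) s (1 + 12 * height t)
          (λ s′ → Descended s (plug c t) s′)
      descendLoop s leaf c refl ska _ _ ctx cur≡ keyed dist =
        exit⟩ (isZero cur≡) (temps s , get (rs s) sx , get (hn s) up , c , refl , refl , ctx , refl , dist)
      descendLoop s (node l p k r) c refl ska (node bp p≢0 L≡ R≡ V≡ repl repr) (node lv lvl′ lvr) ctx refl keyed dist
        with keyed (∈-++⁺ʳ (inorder l) (here refl))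
      ... | x , kx with a ⊏? x
      ... | yes a⊏x = weaken (loop≤ {11} (s≤s (m≤m⊔n (height l) (height r)))) $
        again⟩ {Q′ = _≡ s₁} (isNonzero p≢0)
          (ldS⟩ bp $ st⟩ bp $ mov⟩ $ then⟩ (isLtS ska kx a⊏x) $ ld⟩ bp $ nop⟩ refl)
          λ { refl → mapT (λ { (j , w , U , c′ , refl , rest) → j , w , U , c′ , refl , rest })
                       (descendLoop s₁ l (onLeft p k r ∷ c) refl ska repl lvl′
                         (leftOf bp p≢0 R≡ V≡ lv repr (x , kx , a⊏x) ctx′) L≡ (keyed ∘ ∈-++⁺ˡ)
                         (distinct-resp (fill-↭ (onLeft p k r) l c) dist)) }
        where
        U₁ = get (hn s) up [ p ↦ get (rn s) par ]
        s₁ = setUp (record s { rn = put (put (rn s) par p) cur (get (hn s) left p)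
                             ; rs = put (rs s) sx (get (hs s) key p) }) U₁
        ctx′ : CtxRep (shapeOf s) U₁ c (U₁ p)
        ctx′ = subst (CtxRep (shapeOf s) U₁ c) (sym (↦-same (get (hn s) up) p))
          (ctx-frame ctx λ q∈ → (refl , refl , refl) , ↦-other (get (hn s) up)
            (apart dist (∈-++⁺ʳ (inorder l) (here refl)) q∈))
      ... | no ¬a⊏x = weaken (loop≤ {11} (s≤s (m≤n⊔m (height l) (height r)))) $
        again⟩ {Q′ = _≡ s₁} (isNonzero p≢0)
          (ldS⟩ bp $ st⟩ bp $ mov⟩ $ else⟩ (isNltS ska kx ¬a⊏x) $ ld⟩ bp $ nop⟩ refl)
          λ { refl → mapT (λ { (j , w , U , c′ , refl , rest) → j , w , U , c′ , refl , rest })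
                       (descendLoop s₁ r (onRight l p k ∷ c) refl ska repr lvr
                         (rightOf bp p≢0 L≡ V≡ lv repl (x , kx , ¬a⊏x) ctx′) R≡ (keyed ∘ ∈-++⁺ʳ (inorder l) ∘ there)
                         (distinct-resp (fill-↭ (onRight l p k) r c) dist)) }
        where
        U₁ = get (hn s) up [ p ↦ get (rn s) par ]
        s₁ = setUp (record s { rn = put (put (rn s) par p) cur (get (hn s) right′ p)
                             ; rs = put (rs s) sx (get (hs s) key p) }) U₁
        ctx′ : CtxRep (shapeOf s) U₁ c (U₁ p)
        ctx′ = subst (CtxRep (shapeOf s) U₁ c) (sym (↦-same (get (hn s) up) p))
          (ctx-frame ctx λ q∈ → (refl , refl , refl) , ↦-other (get (hn s) up)
            (apart dist (∈-++⁺ʳ (inorder l) (here refl)) q∈))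

      Inserted : HState → Tree → List ℕ → HState → Set
      Inserted s t ps s′ = ∃₂ λ j w → ∃ λ U → ∃₂ λ S t′ → s′ ≡ reshape (setUp (retemp s j w) U) S ×
        get j ttop ≡ rootOf t′ × Rep S t′ × Ins Before After (get (rn s) top) t t′ ×
        (∀ q → q ∉ ps → Same (shapeOf s) S q)

      Ascended : HState → ℕ → Tree → List ℕ → HState → Set
      Ascended s z t ps s′ = ∃₂ λ j w → ∃₂ λ S t′ → s′ ≡ reshape (retemp s j w) S ×
        get j ttop ≡ rootOf t′ × Rep S t′ × Ins Before After z t t′ ×
        (∀ q → q ∉ ps → Same (shapeOf s) S q)

      ascendLoop : ∀ s c {t t′ z} → hs s ≡ hs s₀ → get (rs s) sk ≡ letter a → Ins Before After z t t′ →
        NullOk (shapeOf s) → Rep (shapeOf s) t′ → get (rn s) top ≡ rootOf t′ →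
        CtxRep (shapeOf s) (get (hn s) up) c (get (rn s) par) → Distinct (inorder t′ ++ recs c) →
        Triple (loop (nonzero par) ascend) s (1 + 58 * length c) (Ascended s z (plug c t) (inorder t′ ++ recs c))
      ascendLoop s [] refl ska ins nul rep top≡ ctx dist with get (rn s) par in par≡ | ctx
      ... | _ | [] = exit⟩ (isZero par≡)
        (temps s , get (rs s) sx , shapeOf s , _ , refl , top≡ , rep , ins , λ _ _ → refl , refl , refl)
      ascendLoop s (onLeft _ k r ∷ c) {t} {t′} {z} refl ska ins nul rep top≡ (leftOf bp p≢0 R≡ V≡ lv rr b@(x , kx , a⊏x) ctx′) dist =
        weaken (loop≤ {57} ≤-refl) $
        again⟩ {b = 57} (isNonzero p≢0)
          (ldS⟩ bp $ ld⟩ bp $ ld⟩ bp $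
           (_⟫_ {b = 4} {Q′ = _≡ s₁} (then⟩ (isLtS ska kx a⊏x) $ st⟩ bp $ nop⟩ refl) λ { refl → mov⟩ $ mov⟩ $
            fixT {s₂} refl V≡ (proj₁ lv) (proj₂ lv) nul₂ rep₂ dist₂ }))
          λ { (_ , _ , S′ , refl , rep′ , same′) →
              mapT (λ { (j , w , S″ , t″ , refl , j≡ , rep″ , ins″ , same″) →
                       j , w , S″ , t″ , refl , j≡ , rep″ , ins″ , λ q q∉ →
                       same-trans {shapeOf s} {S′} {S″} {q}
                         (same-trans {shapeOf s} {shapeOf s₂} {S′} {q}
                           (stored λ { refl → q∉ (∈-resp-↭ π (∈-++⁺ˡ p∈)) })
                           (same′ q (q∉ ∘ ∈-resp-↭ π ∘ ∈-++⁺ˡ)))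
                         (same″ q λ q∈ → q∉ (∈-resp-↭ π (subst (λ ps → q ∈ ps ++ recs c) (inorder-fix (node t′ p k r)) q∈))) })
                (ascendLoop _ c refl ska (goLeft b ins) (nullOk-same {shapeOf s₂} {S′} nul₂ (same′ 0 λ 0∈ → rep-nonzero rep₂ 0∈ refl))
                  rep′ refl
                  (ctx-frame ctx′ λ {q} q∈ →
                    same-trans {shapeOf s} {shapeOf s₂} {S′} {q}
                      (stored λ { refl → apart dist₁ p∈ q∈ refl })
                      (same′ q λ q∈′ → apart dist₁ q∈′ q∈ refl) , refl)
                  (subst (λ ps → Distinct (ps ++ recs c)) (sym (inorder-fix (node t′ p k r))) dist₁)) }
        where
        p = get (rn s) par
        s₁ = record s
          { rn = put (put (rn s) nxt (get (hn s) up p)) lvl (get (hn s) lev p)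
          ; rs = put (rs s) sx (get (hs s) key p)
          ; hn = put (hn s) left (get (hn s) left [ p ↦ get (rn s) top ]) }
        s₂ = record s₁ { rn = put (put (rn s₁) top p) par (get (hn s) up p) }
        π = fill-↭ (onLeft p k r) t′ c
        p∈ : p ∈ inorder (node t′ p k r)
        p∈ = ∈-++⁺ʳ (inorder t′) (here refl)
        dist₁ = distinct-resp (↭-sym π) dist
        dist₂ : Distinct (inorder (node t′ p k r))
        dist₂ = distinctˡ dist₁
        stored : ∀ {q} → q ≢ p → Same (shapeOf s) (shapeOf s₂) q
        stored q≢p = ↦-other (get (hn s) left) (q≢p ∘ sym) , refl , refl
        nul₂ : NullOk (shapeOf s₂)
        nul₂ = nul
        rep₂ : Rep (shapeOf s₂) (node t′ p k r)
        rep₂ = node bp p≢0 (trans (↦-same (get (hn s) left) p) top≡) R≡ V≡ (rep-frame rep λ q∈ → stored (apart dist₂ q∈ (here refl)))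
                 (rep-frame rr λ q∈ → stored (apart {p ∷ []} (distinctʳ (inorder t′) dist₂) (here refl) q∈ ∘ sym))
      ascendLoop s (onRight l _ k ∷ c) {t} {t′} {z} refl ska ins nul rep top≡ (rightOf bp p≢0 L≡ V≡ lv rl b@(x , kx , ¬a⊏x) ctx′) dist =
        weaken (loop≤ {57} ≤-refl) $
        again⟩ {b = 57} (isNonzero p≢0)
          (ldS⟩ bp $ ld⟩ bp $ ld⟩ bp $
           (_⟫_ {b = 4} {Q′ = _≡ s₁} (else⟩ (isNltS ska kx ¬a⊏x) $ st⟩ bp $ nop⟩ refl) λ { refl → mov⟩ $ mov⟩ $
            fixT {s₂} refl V≡ (proj₁ lv) (proj₂ lv) nul₂ rep₂ dist₂ }))
          λ { (_ , _ , S′ , refl , rep′ , same′) →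
              mapT (λ { (j , w , S″ , t″ , refl , j≡ , rep″ , ins″ , same″) →
                       j , w , S″ , t″ , refl , j≡ , rep″ , ins″ , λ q q∉ →
                       same-trans {shapeOf s} {S′} {S″} {q}
                         (same-trans {shapeOf s} {shapeOf s₂} {S′} {q}
                           (stored λ { refl → q∉ (∈-resp-↭ π (∈-++⁺ˡ p∈)) })
                           (same′ q (q∉ ∘ ∈-resp-↭ π ∘ ∈-++⁺ˡ)))
                         (same″ q λ q∈ → q∉ (∈-resp-↭ π (subst (λ ps → q ∈ ps ++ recs c) (inorder-fix (node l p k t′)) q∈))) })
                (ascendLoop _ c refl ska (goRight b ins) (nullOk-same {shapeOf s₂} {S′} nul₂ (same′ 0 λ 0∈ → rep-nonzero rep₂ 0∈ refl))
                  rep′ refl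
                  (ctx-frame ctx′ λ {q} q∈ →
                    same-trans {shapeOf s} {shapeOf s₂} {S′} {q}
                      (stored λ { refl → apart dist₁ p∈ q∈ refl })
                      (same′ q λ q∈′ → apart dist₁ q∈′ q∈ refl) , refl)
                  (subst (λ ps → Distinct (ps ++ recs c)) (sym (inorder-fix (node l p k t′))) dist₁)) }
        where
        p = get (rn s) par
        s₁ = record s
          { rn = put (put (rn s) nxt (get (hn s) up p)) lvl (get (hn s) lev p)
          ; rs = put (rs s) sx (get (hs s) key p)
          ; hn = put (hn s) right′ (get (hn s) right′ [ p ↦ get (rn s) top ]) }
        s₂ = record s₁ { rn = put (put (rn s₁) top p) par (get (hn s) up p) }
        π = fill-↭ (onRight l p k) t′ c
        p∈ : p ∈ inorder (node l p k t′)
        p∈ = ∈-++⁺ʳ (inorder l) (here refl)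
        dist₁ = distinct-resp (↭-sym π) dist
        dist₂ : Distinct (inorder (node l p k t′))
        dist₂ = distinctˡ dist₁
        stored : ∀ {q} → q ≢ p → Same (shapeOf s) (shapeOf s₂) q
        stored q≢p = refl , ↦-other (get (hn s) right′) (q≢p ∘ sym) , refl
        nul₂ : NullOk (shapeOf s₂)
        nul₂ = (trans (↦-other (get (hn s) right′) p≢0) (proj₁ nul) , proj₂ nul)
        rep₂ : Rep (shapeOf s₂) (node l p k t′)
        rep₂ = node bp p≢0 L≡ (trans (↦-same (get (hn s) right′) p) top≡) V≡ (rep-frame rl λ q∈ → stored (apart dist₂ q∈ (here refl)))
                 (rep-frame rep λ q∈ → stored (apart {p ∷ []} (distinctʳ (inorder l) dist₂) (here refl) q∈ ∘ sym))

      insertT : ∀ s t → hs s ≡ hs s₀ → get (rs s) sk ≡ letter a → NullOk (shapeOf s) →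
        Rep (shapeOf s) t → AllLeveled t → get (rn s) cur ≡ rootOf t →
        (∀ {p} → p ∈ inorder t → Keyed (keys s₀) p) → Distinct (inorder t) →
        Block (get (rn s) top) → get (rn s) top ≢ 0 → get (rn s) top ∉ inorder t →
        Triple insert s (13 + 70 * height t) (Inserted s t (get (rn s) top ∷ inorder t))
      insertT s t refl ska nul rep lvd cur≡ keyed dist bz z≢0 z∉ =
        weaken (≤-reflexive time) $
        lit⟩ $ descendLoop s₁ t [] refl ska rep lvd [] cur≡ keyed (subst Distinct (sym (++-identityʳ (inorder t))) dist) ⟫ continue
        where
        z = get (rn s) top
        s₁ = record s { rn = put (rn s) par 0 }
        h = height t
        time : 1 + ((1 + 12 * h) + (10 + (1 + 58 * h))) ≡ 13 + 70 * h
        time = cong (2 +_) (trans (+-comm (12 * h) (11 + 58 * h)) (cong (11 +_) (sym (*-distribʳ-+ h 58 12))))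
        continue : ∀ {s′} → Descended s₁ t s′ → Triple _ s′ (10 + (1 + 58 * h)) (Inserted s t (z ∷ inorder t))
        continue {s′} (j@(⟪ _ , j₁ , _ , j₃ , _ ⟫) , w , U , c , refl , refl , ctx , t≡ , dist′) =
          weaken (+-monoʳ-≤ 11 (*-monoʳ-≤ 58 (≤-trans (m≤m+n (length c) 0) (subst (λ u → length c + 0 ≤ height u) (sym t≡) (plug-height c leaf))))) $
          st0⟩ bz $ st0⟩ bz $ lit⟩ $ st⟩ bz $
          mapT finish $
          ascendLoop s₂ c {leaf} {node leaf z 1 leaf} refl ska here nul₂
            (node bz z≢0 (↦-same L z) (↦-same R z) (↦-same V z) leaf leaf) refl
            (ctx-frame ctx λ q∈ → stored (λ { refl → z∉recs q∈ }) , refl)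
            (All.tabulate (λ {q} q∈ z≡q → z∉recs (subst (_∈ recs c) (sym z≡q) q∈)) ∷ dist′)
          where
          L = get (hn s) left
          R = get (hn s) right′
          V = get (hn s) lev
          s₂ = record s′ { rn = put (rn s′) aux 1
                         ; hn = put (put (put (hn s′) left (L [ z ↦ 0 ])) right′ (R [ z ↦ 0 ])) lev (V [ z ↦ 1 ]) }
          π : inorder t ↭ recs c
          π = subst (λ u → inorder u ↭ recs c) (sym t≡) (plug-↭ c leaf)
          z∉recs : z ∉ recs c
          z∉recs = z∉ ∘ ∈-resp-↭ (↭-sym π)
          stored : ∀ {q} → q ≢ z → Same (shapeOf s) (shapeOf s₂) q
          stored q≢z = ↦-other L (q≢z ∘ sym) , ↦-other R (q≢z ∘ sym) , ↦-other V (q≢z ∘ sym)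
          nul₂ : NullOk (shapeOf s₂)
          nul₂ = nullOk-same {shapeOf s} {shapeOf s₂} nul (stored (z≢0 ∘ sym))
          finish : ∀ {s″} → Ascended s₂ z (plug c leaf) (z ∷ recs c) s″ → Inserted s t (z ∷ inorder t) s″
          finish (j′ , w′ , S , t′ , refl , top≡ , rep′ , ins , same) =
            j′ , w′ , U , S , t′ , refl , top≡ , rep′ , subst (λ u → Ins Before After z u t′) (sym t≡) ins ,
            λ q q∉ → same-trans {shapeOf s} {shapeOf s₂} {S} {q} (stored λ { refl → q∉ (here refl) })
                       (same q λ { (here refl) → q∉ (here refl) ; (there q∈) → q∉ (there (∈-resp-↭ (↭-sym π) q∈)) })

  open Insertion

  -- Dictionaries as sets of records

  module DictSpec where

    open Shape

    -- The set `M` of records is what the invariants of the trie speak about; the tree is hidden in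
    -- the record, so rebalancing is invisible to them.
    record Dict (S : Shape) (K : ℕ → Word) (p : ℕ) (M : ℕ → Set) : Set where
      field
        tree     : Tree
        depth    : ℕ
        root≡    : p ≡ rootOf tree
        rep      : Rep S tree
        aa       : AA depth tree
        keyed    : ∀ {q} → q ∈ inorder tree → Keyed K q
        sorted   : AllPairs _≺⟨ K ⟩_ (inorder tree)
        sound    : ∀ {q} → q ∈ inorder tree → M q
        complete : ∀ {q} → M q → q ∈ inorder tree

    open Dict

    private
      variable
        S S′ : Shape
        K K′ : ℕ → Word
        M M′ : ℕ → Set
        p : ℕ

    dict-empty : (∀ q → ¬ M q) → Dict S K 0 M
    dict-empty none = record
      { tree = leaf ; depth = 0 ; root≡ = refl ; rep = leaf ; aa = leaf ; keyed = λ () ; sorted = []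
      ; sound = λ () ; complete = λ m → ⊥-elim (none _ m) }

    dict-singleton : Block p → p ≢ 0 → lefts S p ≡ 0 → rights S p ≡ 0 → levels S p ≡ 1 → Keyed K p →
                     M p → (∀ q → M q → q ≡ p) → Dict S K p M
    dict-singleton bp p≢0 L R V k m only = record
      { tree = node leaf _ 1 leaf ; depth = 1 ; root≡ = refl ; rep = node bp p≢0 L R V leaf leaf
      ; aa = two leaf leaf ; keyed = λ { (here refl) → k } ; sorted = [] ∷ []
      ; sound = λ { (here refl) → m } ; complete = λ m → here (only _ m) }

    dict-ext : (∀ q → M q → M′ q) → (∀ q → M′ q → M q) → Dict S K p M → Dict S K p M′
    dict-ext f g d = record
      { tree = tree d ; depth = depth d ; root≡ = root≡ d ; rep = rep d ; aa = aa d ; keyed = keyed d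
      ; sorted = sorted d ; sound = λ q∈ → f _ (sound d q∈) ; complete = λ m → complete d (g _ m) }

    dict-frame : Dict S K p M → (∀ q → M q → Same S S′ q) → (∀ q → M q → K′ q ≡ K q) → Dict S′ K′ p M
    dict-frame {K = K} {K′ = K′} d same keys≡ = record
      { tree = tree d ; depth = depth d ; root≡ = root≡ d
      ; rep = rep-frame (rep d) λ q∈ → same _ (sound d q∈) ; aa = aa d
      ; keyed = λ q∈ → let x , kx = keyed d q∈ in x , trans (keys≡ _ (sound d q∈)) kx
      ; sorted = resort (sorted d) (λ q∈ → keys≡ _ (sound d q∈))
      ; sound = sound d ; complete = complete d }
      where
      resort : ∀ {ps} → AllPairs _≺⟨ K ⟩_ ps → (∀ {q} → q ∈ ps → K′ q ≡ K q) → AllPairs _≺⟨ K′ ⟩_ ps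
      resort [] _ = []
      resort (a ∷ as) same =
        All.tabulate (λ q∈ → let x , y , kx , ky , lt = All.lookup a q∈ in
          x , y , trans (same (here refl)) kx , trans (same (there q∈)) ky , lt)
        ∷ resort as (same ∘ there)

    opaque
      -- Opaque, so that time bounds remain polynomials in an atom.
      Λ : ℕ
      Λ = 1 ⊔ ⌈log₂ σ ⌉

      Λ≡ : Λ ≡ 1 ⊔ ⌈log₂ σ ⌉
      Λ≡ = refl

    1≤Λ : 1 ≤ Λ
    1≤Λ = subst (1 ≤_) (sym Λ≡) (m≤m⊔n 1 ⌈log₂ σ ⌉)

    ≺⇒≢ : ∀ {q r} → q ≺⟨ K ⟩ r → q ≢ r
    ≺⇒≢ (x , y , kx , ky , lt) refl with letter-injective (trans (sym kx) ky)
    ... | refl = ⊏-irrefl refl lt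

    dict-distinct : (d : Dict S K p M) → Distinct (inorder (tree d))
    dict-distinct d = AllPairs.map ≺⇒≢ (sorted d)

    private
      keys-distinct : ∀ {qs} → AllPairs _≺⟨ K ⟩_ qs → ∀ {q r x} → q ∈ qs → r ∈ qs → K q ≡ letter x → K r ≡ letter x → q ≡ r
      keys-distinct (a ∷ as) (here refl) (here refl) _ _ = refl
      keys-distinct (a ∷ as) (there q∈) (there r∈) kq kr = keys-distinct as q∈ r∈ kq kr
      keys-distinct (a ∷ as) (here refl) (there r∈) kq kr with All.lookup a r∈
      ... | _ , _ , kx , ky , lt with letter-injective (trans (sym kx) kq) | letter-injective (trans (sym ky) kr)
      ... | refl | refl = ⊥-elim (⊏-irrefl refl lt)
      keys-distinct (a ∷ as) (there q∈) (here refl) kq kr with All.lookup a q∈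
      ... | _ , _ , kx , ky , lt with letter-injective (trans (sym kx) kr) | letter-injective (trans (sym ky) kq)
      ... | refl | refl = ⊥-elim (⊏-irrefl refl lt)

      size≤σ : (d : Dict S K p M) → length (inorder (tree d)) ≤ σ
      size≤σ {K = K} d = pigeonhole (λ q i → q ∈ qs × ∃ λ x → K q ≡ letter x × Inverse.to size x ≡ i)
        qs (dict-distinct d)
        (All.tabulate λ q∈ → let x , kx = keyed d q∈ in _ , q∈ , x , kx , refl)
        λ { (q∈ , x , kx , refl) (r∈ , y , ky , eq) → keys-distinct (sorted d) q∈ r∈ kx
              (trans ky (cong letter (to-injective eq))) }
        where
        qs = inorder (tree d)
        to-injective : ∀ {x y} → Inverse.to size y ≡ Inverse.to size x → y ≡ x
        to-injective {x} {y} eq = trans (sym (Inverse.strictlyInverseʳ size y))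
          (trans (cong (Inverse.from size) eq) (Inverse.strictlyInverseʳ size x))

      -- The alphabet may be far larger than the memory. That levels fit into a word is therefore
      -- derived from the number of records and not from σ.
      size≤blocks : (d : Dict S K p M) → length (inorder (tree d)) ≤ blocks
      size≤blocks d = pigeonhole (λ q i → q ≡ toℕ i * 32) (inorder (tree d)) (dict-distinct d)
        (All.tabulate λ q∈ → let i , i< , eq = rep-block (rep d) q∈ in
          fromℕ< i< , trans eq (cong (_* 32) (sym (toℕ-fromℕ< i<))))
        λ x≡ y≡ → trans x≡ (sym y≡)

      -- The letter serves as evidence for 1 ≤ σ, without which the logarithm bounds nothing.
      depth≤Λ : Symbol → (d : Dict S K p M) → depth d ≤ 2 * Λ
      depth≤Λ x d = begin
        depth d              ≤⟨ 2^≤⇒≤log σ≥1 (≤-trans (size≥ (aa d)) (s≤s (size≤σ d))) ⟩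
        1 + ⌈log₂ σ ⌉        ≤⟨ +-mono-≤ 1≤Λ (subst (⌈log₂ σ ⌉ ≤_) (sym Λ≡) (m≤n⊔m 1 ⌈log₂ σ ⌉)) ⟩
        Λ + Λ                ≡⟨ cong (Λ +_) (+-identityʳ Λ) ⟨
        2 * Λ                ∎
        where
        open ≤-Reasoning
        σ≥1 : 1 ≤ σ
        σ≥1 = ≤-trans (s≤s z≤n) (toℕ<n (Inverse.to size x))

      height≤Λ : Symbol → (d : Dict S K p M) → height (tree d) ≤ 4 * Λ
      height≤Λ x d = ≤-trans (height≤ (aa d)) (≤-trans (*-monoʳ-≤ 2 (depth≤Λ x d)) (≤-reflexive (sym (*-assoc 2 2 Λ))))

      -- With heights at most 4 Λ, the 2 + 9 h steps of a search become 38 Λ and the 13 + 70 h steps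
      -- of an insertion 293 Λ, the two constants that recur in all later time bounds.
      linear≤ : ∀ {h} c d → h ≤ 4 * Λ → c + d * h ≤ (c + d * 4) * Λ
      linear≤ {h} c d h≤ = begin
        c + d * h            ≤⟨ +-mono-≤ (≤-trans (≤-reflexive (sym (*-identityʳ c))) (*-monoʳ-≤ c 1≤Λ)) (*-monoʳ-≤ d h≤) ⟩
        c * Λ + d * (4 * Λ)  ≡⟨ cong (c * Λ +_) (*-assoc d 4 Λ) ⟨
        c * Λ + d * 4 * Λ    ≡⟨ *-distribʳ-+ Λ c (d * 4) ⟨
        (c + d * 4) * Λ      ∎
        where open ≤-Reasoning

    AllPairs-insert : ∀ {A : Set} {R : A → A → Set} xs {ys z} → AllPairs R (xs ++ ys) →
                      All (λ x → R x z) xs → All (R z) ys → AllPairs R (xs ++ z ∷ ys)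
    AllPairs-insert [] rs _ gt = gt ∷ rs
    AllPairs-insert (x ∷ xs) (r ∷ rs) (x<z ∷ lt) gt =
      All-++⁺ (++⁻ˡ xs r) (x<z ∷ ++⁻ʳ xs r) ∷ AllPairs-insert xs rs lt gt

    FoundIn : (ℕ → Word) → Symbol → (ℕ → Set) → ℕ → Set
    FoundIn K a M r = (r ≡ 0 × (∀ q → M q → K q ≢ letter a)) ⊎ (M r × K r ≡ letter a)

    findT : ∀ s {a M} → Dict (shapeOf s) (keys s) (get (rn s) cur) M → get (rs s) sk ≡ letter a →
      Triple find s (38 * Λ) (λ s′ → ∃₂ λ j w → s′ ≡ retemp s j w × FoundIn (keys s) a M (get j tres))
    findT s {a} {M} d ska = weaken (linear≤ 2 9 (height≤Λ a d)) $
      lit⟩ $ mapT finish (findLoop (record s { rn = put (rn s) res 0 }) (tree d) ska (rep d) (root≡ d) refl (keyed d) (sorted d))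
      where
      finish : ∀ {s′} → (∃₂ λ j w → s′ ≡ retemp (record s { rn = put (rn s) res 0 }) j w × Found (keys s) a (inorder (tree d)) (get j tres)) →
               ∃₂ λ j w → s′ ≡ retemp s j w × FoundIn (keys s) a M (get j tres)
      finish (j , w , refl , inj₁ (r≡ , none)) = j , w , refl , inj₁ (r≡ , λ q m → none (complete d m))
      finish (j , w , refl , inj₂ (r∈ , kr)) = j , w , refl , inj₂ (sound d r∈ , kr)

    InsertedIn : HState → (ℕ → Set) → HState → Set
    InsertedIn s M s′ = ∃₂ λ j w → ∃₂ λ U S → s′ ≡ reshape (setUp (retemp s j w) U) S ×
      Dict S (keys s) (get j ttop) (λ q → q ≡ get (rn s) top ⊎ M q) ×
      (∀ q → q ≢ get (rn s) top → ¬ M q → Same (shapeOf s) S q)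

    insertInT : ∀ s {a M} → Dict (shapeOf s) (keys s) (get (rn s) cur) M → get (rs s) sk ≡ letter a →
      NullOk (shapeOf s) → Block (get (rn s) top) → get (rn s) top ≢ 0 → keys s (get (rn s) top) ≡ letter a →
      (∀ q → M q → keys s q ≢ letter a) → Triple insert s (293 * Λ) (InsertedIn s M)
    insertInT s {a} {M} d ska nul bz z≢0 kz fresh = weaken (linear≤ 13 70 (height≤Λ a d)) $
      mapT finish $
      insertT s a s (tree d) refl ska nul (rep d) (leveled (aa d) ≤-refl) (root≡ d) (keyed d) (dict-distinct d) bz z≢0
        (λ z∈ → fresh z (sound d z∈) kz)
      where
      z = get (rn s) top
      deep : suc (depth d) < space
      deep = begin-strict
        suc (depth d)     ≤⟨ n<2^n (depth d) ⟩
        2 ^ depth d       ≤⟨ size≥ (aa d) ⟩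
        suc (length (inorder (tree d))) ≤⟨ s≤s (size≤blocks d) ⟩
        suc blocks        <⟨ s≤s (s≤s (≤-reflexive (sym (+-identityʳ blocks)))) ⟩
        2 + 1 * blocks    ≤⟨ +-monoˡ-≤ (1 * blocks) (*-monoʳ-≤ 2 (≤-trans (s≤s z≤n) (proj₁ (proj₂ bz)))) ⟩
        2 * blocks + 1 * blocks ≡⟨ *-distribʳ-+ blocks 2 1 ⟨
        3 * blocks        ≤⟨ *-monoˡ-≤ blocks (m≤m+n 3 29) ⟩
        32 * blocks       ≡⟨ *-comm 32 blocks ⟩
        blocks * 32       ≤⟨ fits ⟩
        space             ∎
        where open ≤-Reasoning
      leveled : ∀ {k t} → AA k t → k ≤ depth d → AllLeveled t
      leveled leaf _ = leaf
      leveled {suc k} (two l r) k≤ = node ((λ ()) , ≤-trans (s≤s (s≤s k≤)) deep)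
        (leveled l (≤-trans (n≤1+n k) k≤)) (leveled r (≤-trans (n≤1+n k) k≤))
      leveled {suc k} (three l m r) k≤ = node lv (leveled l k≤′) (node lv (leveled m k≤′) (leveled r k≤′))
        where
        k≤′ = ≤-trans (n≤1+n k) k≤
        lv = (λ ()) , ≤-trans (s≤s (s≤s k≤)) deep
      finish : ∀ {s′} → Inserted s a s (tree d) (z ∷ inorder (tree d)) s′ → InsertedIn s M s′
      finish (j , w , U , S , t′ , refl , top≡ , rep′ , ins , same)
        with ins-inorder {_≺_ = _≺⟨ keys s ⟩_}
               (λ { (x , kx , a⊏x) (x′ , y , kx′ , ky , lt) → y , ky ,
                    ⊏-trans a⊏x (subst (_⊏ y) (letter-injective (trans (sym kx′) kx)) lt) })
               (λ { (x , kx , ¬a⊏x) (y , x′ , ky , kx′ , lt) → y , ky ,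
                    λ a⊏y → ¬a⊏x (subst (a ⊏_) (letter-injective (trans (sym kx′) kx)) (⊏-trans a⊏y lt)) })
               ins (sorted d)
      ... | xs , ys , in≡ , in≡′ , gts , lts with balanced (ins-AA (aa d) ins)
      ... | k′ , _ , aa′ = j , w , U , S , refl ,
        record { tree = t′ ; depth = k′ ; root≡ = top≡ ; rep = rep′ ; aa = aa′
               ; keyed = λ q∈ → keyed′ (from q∈)
               ; sorted = subst (AllPairs _≺⟨ keys s ⟩_) (sym in≡′)
                   (AllPairs-insert xs (subst (AllPairs _≺⟨ keys s ⟩_) in≡ (sorted d))
                     (All.tabulate λ q∈ → before (All.lookup gts q∈) (subst (_ ∈_) (sym in≡) (∈-++⁺ˡ q∈)))
                     (All.map (λ { (y , ky , lt) → a , y , kz , ky , lt }) lts))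
               ; sound = λ q∈ → sound′ (from q∈) ; complete = to } ,
        λ q q≢z ¬m → same q λ { (here q≡z) → q≢z q≡z ; (there q∈) → ¬m (sound d q∈) }
        where
        from : ∀ {q} → q ∈ inorder t′ → q ≡ z ⊎ q ∈ inorder (tree d)
        from {q} q∈ with ∈-++⁻ xs (subst (q ∈_) in≡′ q∈)
        ... | inj₁ q∈xs = inj₂ (subst (q ∈_) (sym in≡) (∈-++⁺ˡ q∈xs))
        ... | inj₂ (here q≡z) = inj₁ q≡z
        ... | inj₂ (there q∈ys) = inj₂ (subst (q ∈_) (sym in≡) (∈-++⁺ʳ xs q∈ys))
        keyed′ : ∀ {q} → q ≡ z ⊎ q ∈ inorder (tree d) → Keyed (keys s) q
        keyed′ (inj₁ refl) = a , kz
        keyed′ (inj₂ q∈)   = keyed d q∈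
        sound′ : ∀ {q} → q ≡ z ⊎ q ∈ inorder (tree d) → q ≡ z ⊎ M q
        sound′ (inj₁ q≡z) = inj₁ q≡z
        sound′ (inj₂ q∈)  = inj₂ (sound d q∈)
        before : ∀ {q} → After s a q → q ∈ inorder (tree d) → q ≺⟨ keys s ⟩ z
        before {q} (x , kx , ¬a⊏x) q∈ with compare x a
        ... | tri< x⊏a _ _ = x , a , kx , kz , x⊏a
        ... | tri≈ _ refl _ = ⊥-elim (fresh q (sound d q∈) kx)
        ... | tri> _ _ a⊏x = ⊥-elim (¬a⊏x a⊏x)
        to : ∀ {q} → q ≡ z ⊎ M q → q ∈ inorder t′
        to {q} (inj₁ refl) = subst (z ∈_) (sym in≡′) (∈-++⁺ʳ xs (here refl))
        to {q} (inj₂ m) with ∈-++⁻ xs (subst (q ∈_) in≡ (complete d m))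
        ... | inj₁ q∈xs = subst (q ∈_) (sym in≡′) (∈-++⁺ˡ q∈xs)
        ... | inj₂ q∈ys = subst (q ∈_) (sym in≡′) (∈-++⁺ʳ xs (there q∈ys))

  open DictSpec

  -- The node set on the heap: Weiner links and edges

  module Structure where

    open Shape

    -- The part of a state on which the invariants depend: neither registers nor the `up` pointers,
    -- which every insertion overwrites.
    record Fields : Set where
      field
        treesₕ : Shape
        keyₕ slabₕ : ℕ → Word
        valₕ crootₕ slinkₕ plusₕ lenₕ wrootₕ spₕ downₕ wheadₕ wnextₕ crecₕ : ℕ → ℕ

    open Fields

    fieldsOf : HState → Fields
    fieldsOf s = record
      { treesₕ = shapeOf s ; keyₕ = get (hs s) key ; slabₕ = get (hs s) slab ; valₕ = get (hn s) val
      ; crootₕ = get (hn s) croot ; slinkₕ = get (hn s) slink ; plusₕ = get (hn s) plus′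
      ; lenₕ = get (hn s) len ; wrootₕ = get (hn s) wroot ; spₕ = get (hn s) sp ; downₕ = get (hn s) down
      ; wheadₕ = get (hn s) whead ; wnextₕ = get (hn s) wnext ; crecₕ = get (hn s) crec }

    Str : Set
    Str = List Symbol

    -- Ghost data: the machine knows the addresses but never stores the strings. The newest node
    -- comes first, and the length of the list determines the next free address.
    NodeList : Set
    NodeList = List (Str × ℕ)

    private
      variable
        ns : NodeList
        F : Fields
        x y z v : Str
        a b c : Symbol
        p q r : ℕ

    In : NodeList → Str → Set
    In ns x = ∃ λ p → (x , p) ∈ ns

    -- Node i owns two records: one at nodeAddr i and, 32 words later, the one
    -- that represents it in the dictionary of outgoing edges of its parent.
    -- Address 0 is kept free for null.
    opaque
      nodeAddr : ℕ → ℕ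
      nodeAddr i = suc i * 64

      nodeAddr-suc : ∀ i → 64 + nodeAddr i ≡ nodeAddr (suc i)
      nodeAddr-suc i = refl

      nodeAddr-zero : nodeAddr 0 ≡ 64
      nodeAddr-zero = refl

      nodeAddr-injective : ∀ {i j} → nodeAddr i ≡ nodeAddr j → i ≡ j
      nodeAddr-injective {i} {j} eq = suc-injective (*-cancelʳ-≡ (suc i) (suc j) 64 eq)

      nodeAddr≢0 : ∀ {i} → nodeAddr i ≢ 0
      nodeAddr≢0 ()

      nodeAddr≢rec : ∀ {i j} → nodeAddr i ≢ 32 + nodeAddr j
      nodeAddr≢rec {i} {j} eq = contra (begin
        0                       ≡⟨ m*n%n≡0 (suc i) 64 ⟨
        (suc i * 64) % 64       ≡⟨ cong (_% 64) eq ⟩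
        (32 + suc j * 64) % 64  ≡⟨ [m+kn]%n≡m%n 32 (suc j) 64 ⟩
        32                      ∎)
        where
        open ≡-Reasoning
        contra : 0 ≢ 32
        contra ()

      nodeAddr-block : ∀ {i n} → suc n * 2 < blocks → i < n → Block (nodeAddr i)
      nodeAddr-block {i} room i< =
        suc i * 2 , ≤-trans (*-monoˡ-< 2 (s≤s i<)) (<⇒≤ room) , sym (*-assoc (suc i) 2 32)

      recAddr-block : ∀ {i n} → suc n * 2 < blocks → i < n → Block (32 + nodeAddr i)
      recAddr-block {i} room i< =
        suc (suc i * 2) , ≤-trans (s≤s (s≤s (*-monoˡ-≤ 2 i<))) (<⇒≤ room) , cong (32 +_) (sym (*-assoc (suc i) 2 32))

      nodeAddr<space : ∀ {n} → suc n * 2 < blocks → nodeAddr n < space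
      nodeAddr<space {n} room = ≤-trans (≤-reflexive (cong suc (sym (*-assoc (suc n) 2 32))))
        (≤-trans (*-monoˡ-< 32 room) fits)

    AddrN AddrR : NodeList → ℕ → Set
    AddrN ns p = ∃ λ i → i < length ns × p ≡ nodeAddr i
    AddrR ns r = ∃ λ i → i < length ns × r ≡ 32 + nodeAddr i

    newN newR : NodeList → ℕ
    newN ns = nodeAddr (length ns)
    newR ns = 32 + newN ns

    addrN-wk : ∀ ns e {p} → AddrN ns p → AddrN (e ∷ ns) p
    addrN-wk _ _ (i , i< , eq) = i , ≤-trans i< (n≤1+n _) , eq

    addrR-wk : ∀ ns e {r} → AddrR ns r → AddrR (e ∷ ns) r
    addrR-wk _ _ (i , i< , eq) = i , ≤-trans i< (n≤1+n _) , eq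

    addrN-new : ∀ ns e → AddrN (e ∷ ns) (newN ns)
    addrN-new ns _ = _ , ≤-refl , refl

    addrR-new : ∀ ns e → AddrR (e ∷ ns) (newR ns)
    addrR-new ns _ = _ , ≤-refl , refl

    addrN≢new : ∀ ns {p} → AddrN ns p → p ≢ newN ns
    addrN≢new ns (i , i< , refl) eq = <⇒≢ i< (nodeAddr-injective eq)

    addrR≢new : ∀ ns {r} → AddrR ns r → r ≢ newR ns
    addrR≢new ns (i , i< , refl) eq = <⇒≢ i< (nodeAddr-injective (+-cancelˡ-≡ 32 _ _ eq))

    addrN≢addrR : ∀ ns ms {p r} → AddrN ns p → AddrR ms r → p ≢ r
    addrN≢addrR _ _ (i , _ , refl) (j , _ , refl) = nodeAddr≢rec

    addrN≢0 : ∀ ns {p} → AddrN ns p → p ≢ 0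
    addrN≢0 _ (_ , _ , refl) = nodeAddr≢0

    addrR≢0 : ∀ ns {r} → AddrR ns r → r ≢ 0
    addrR≢0 _ (_ , _ , refl) ()

    Room : NodeList → Set
    Room ns = suc (length ns) * 2 < blocks

    blockN : ∀ ns {p} → Room ns → AddrN ns p → Block p
    blockN _ room (i , i< , refl) = nodeAddr-block room i<

    blockR : ∀ ns {r} → Room ns → AddrR ns r → Block r
    blockR _ room (i , i< , refl) = recAddr-block room i<

    data Linked (next : ℕ → ℕ) : List ℕ → ℕ → Set where
      []  : Linked next [] 0
      _∷_ : ∀ {ps p} → p ≢ 0 → Linked next ps (next p) → Linked next (p ∷ ps) p

    linked-frame : ∀ {next next′ ps p} → Linked next ps p → (∀ {q} → q ∈ ps → next′ q ≡ next q) → Linked next′ ps p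
    linked-frame [] _ = []
    linked-frame {next′ = next′} (_∷_ {ps} p≢0 l) same =
      p≢0 ∷ subst (Linked next′ ps) (sym (same (here refl))) (linked-frame l (same ∘ there))

    WLink : NodeList → Str → ℕ → Set
    WLink ns x q = ∃ λ b → (b ∷ x , q) ∈ ns

    -- The Weiner links of a node are kept twice: in a search tree for access by letter, and in a
    -- list, which is what the copying of all links runs through.
    record WList (ns : NodeList) (F : Fields) (x : Str) (p : ℕ) : Set where
      field
        items    : List ℕ
        linked   : Linked (wnextₕ F) items (wheadₕ F p)
        distinct : Distinct items
        sound    : ∀ {q} → q ∈ items → WLink ns x q
        complete : ∀ {q} → WLink ns x q → q ∈ items

    -- Separate from `Children`, because a freshly created node already has its place among the
    -- Weiner links while its edge is still missing.
    record Links (ns : NodeList) (F : Fields) : Set where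
      field
        functional : (x , p) ∈ ns → (x , q) ∈ ns → p ≡ q
        injective  : (x , p) ∈ ns → (y , p) ∈ ns → x ≡ y
        address    : (x , p) ∈ ns → AddrN ns p
        slinkOk    : (b ∷ x , p) ∈ ns → ∃ λ q → (x , q) ∈ ns × slinkₕ F p ≡ 6 + q
        -- The stored length of x is the true length of `b ∷ x` for any letter b, which is how it is
        -- used: the length of a node above its Weiner links is read off without a correction. Null,
        -- with stored length 0, acts as a node above the root whose Weiner link is the root, so the
        -- stored length of the register `ur` equals the length of h in all cases.
        lenOk      : (x , p) ∈ ns → lenₕ F p ≡ suc (length x)
        keyOk      : (b ∷ x , p) ∈ ns → keyₕ F p ≡ letter b
        wdict      : (x , p) ∈ ns → Dict (treesₕ F) (keyₕ F) (wrootₕ F p) (WLink ns x)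
        wlist      : (x , p) ∈ ns → WList ns F x p
        nullTrees  : NullOk (treesₕ F)
        nullLen    : lenₕ F 0 ≡ 0

    Child : NodeList → Str → Str → Set
    Child ns = Nearest (In ns)

    -- A node belongs to two search trees at once, with different keys: by its first letter to the
    -- Weiner links of its suffix link, and by its edge label to the children of its parent. The
    -- first uses the main record of the node, the second this extra one, which can moreover pass
    -- from node to node.
    IsCrec : NodeList → Fields → Str → ℕ → Set
    IsCrec ns F x r = ∃₂ λ z q → Child ns x z × (z , q) ∈ ns × crecₕ F q ≡ r

    record Children (ns : NodeList) (F : Fields) : Set where
      field
        crecAt : (b ∷ x , p) ∈ ns → AddrR ns (crecₕ F p)
        valOk  : (b ∷ x , p) ∈ ns → valₕ F (crecₕ F p) ≡ 6 + p
        cdict  : (x , p) ∈ ns → Dict (treesₕ F) (keyₕ F) (crootₕ F p) (IsCrec ns F x)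
        edge   : ∀ {u} → Child ns x (x ++ c ∷ u) → (x ++ c ∷ u , q) ∈ ns →
                 keyₕ F (crecₕ F q) ≡ letter c × plusₕ F q ≡ plusSign u

    open Links
    open Children

    created : Fields → ℕ → ℕ → Word → ℕ → Shape → Fields
    created F p pv ℓ d S = record F
      { treesₕ = S
      ; keyₕ   = keyₕ F [ p ↦ ℓ ]
      ; slinkₕ = slinkₕ F [ p ↦ 6 + pv ]
      ; lenₕ   = lenₕ F [ p ↦ suc (lenₕ F pv) ]
      ; wrootₕ = wrootₕ F [ p ↦ 0 ] [ pv ↦ d ]
      ; wheadₕ = wheadₕ F [ p ↦ 0 ] [ pv ↦ p ]
      ; wnextₕ = wnextₕ F [ p ↦ wheadₕ F pv ] }

    module Create (lk : Links ns F) {pv : ℕ} (v∈ : (v , pv) ∈ ns) (b : Symbol) (new : ¬ In ns (b ∷ v))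
                  {d : ℕ} {S : Shape}
                  (dict : Dict S (keyₕ F [ newN ns ↦ letter b ]) d (λ q → q ≡ newN ns ⊎ WLink ns v q))
                  (same : ∀ q → q ≢ newN ns → ¬ WLink ns v q → Same (treesₕ F) S q) where

      private
        pn = newN ns
        F′ = created F pn pv (letter b) d S
        ns′ : NodeList
        ns′ = (b ∷ v , pn) ∷ ns

        old≢ : (x , p) ∈ ns → pn ≢ p
        old≢ x∈ eq = addrN≢new ns (address lk x∈) (sym eq)

        wlink-old : x ≢ v → WLink ns′ x q → WLink ns x q
        wlink-old x≢v (_ , here refl)   = ⊥-elim (x≢v refl)
        wlink-old x≢v (b′ , there bx∈) = b′ , bx∈

        wlink≢ : x ≢ v → WLink ns x q → ¬ WLink ns v q
        wlink≢ x≢v (_ , bx∈) (_ , bv∈) with injective lk bx∈ bv∈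
        ... | refl = x≢v refl

        wlink-none : ∀ q → ¬ WLink ns′ (b ∷ v) q
        wlink-none q (b′ , there bbv∈) with slinkOk lk bbv∈
        ... | _ , bv∈ , _ = new (_ , bv∈)

        apply-wroot : (x , p) ∈ ns → p ≢ pv → wrootₕ F′ p ≡ wrootₕ F p
        apply-wroot x∈ p≢ = trans (↦-other (wrootₕ F [ pn ↦ 0 ]) (p≢ ∘ sym)) (↦-other (wrootₕ F) (old≢ x∈))

        apply-whead : (x , p) ∈ ns → p ≢ pv → wheadₕ F′ p ≡ wheadₕ F p
        apply-whead x∈ p≢ = trans (↦-other (wheadₕ F [ pn ↦ 0 ]) (p≢ ∘ sym)) (↦-other (wheadₕ F) (old≢ x∈))

      links : Links ns′ F′
      links .functional (here refl) (here refl) = refl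
      links .functional (here refl) (there x∈)  = ⊥-elim (new (_ , x∈))
      links .functional (there x∈)  (here refl) = ⊥-elim (new (_ , x∈))
      links .functional (there x∈)  (there x∈′) = functional lk x∈ x∈′
      links .injective (here refl) (here refl) = refl
      links .injective (here refl) (there y∈)  = ⊥-elim (old≢ y∈ refl)
      links .injective (there x∈)  (here refl) = ⊥-elim (old≢ x∈ refl)
      links .injective (there x∈)  (there y∈)  = injective lk x∈ y∈
      links .address (here refl) = addrN-new ns (b ∷ v , pn)
      links .address (there x∈)  = addrN-wk ns (b ∷ v , pn) (address lk x∈)
      links .slinkOk (here refl) = pv , there v∈ , ↦-same (slinkₕ F) pn
      links .slinkOk (there bx∈) with slinkOk lk bx∈
      ... | q , x∈ , eq = q , there x∈ , trans (↦-other (slinkₕ F) (old≢ bx∈)) eq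
      links .lenOk (here refl) = trans (↦-same (lenₕ F) pn) (cong suc (lenOk lk v∈))
      links .lenOk (there x∈)  = trans (↦-other (lenₕ F) (old≢ x∈)) (lenOk lk x∈)
      links .keyOk (here refl) = ↦-same (keyₕ F) pn
      links .keyOk (there bx∈) = trans (↦-other (keyₕ F) (old≢ bx∈)) (keyOk lk bx∈)
      links .wdict (here refl) =
        subst (λ t → Dict S (keyₕ F′) t (WLink ns′ (b ∷ v)))
          (sym (trans (↦-other (wrootₕ F [ pn ↦ 0 ]) (old≢ v∈ ∘ sym)) (↦-same (wrootₕ F) pn)))
          (dict-empty wlink-none)
      links .wdict {x = x} {p = p} (there x∈) with p ≟ pv
      ... | yes refl with injective lk x∈ v∈
      ...   | refl = subst (λ t → Dict S (keyₕ F′) t (WLink ns′ v)) (sym (↦-same (wrootₕ F [ pn ↦ 0 ]) pv))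
        (dict-ext (λ { q (inj₁ refl) → b , here refl ; q (inj₂ (b′ , m)) → b′ , there m })
                  (λ { q (_ , here refl) → inj₁ refl ; q (b′ , there m) → inj₂ (b′ , m) }) dict)
      links .wdict {x = x} {p = p} (there x∈) | no p≢ =
        subst (λ t → Dict S (keyₕ F′) t (WLink ns′ x)) (sym (apply-wroot x∈ p≢))
          (dict-ext (λ { q (b′ , m) → b′ , there m }) (λ q → wlink-old x≢v)
            (dict-frame (wdict lk x∈) (λ q m → same q (addrN≢new ns (address lk (proj₂ m))) (wlink≢ x≢v m))
              (λ q m → ↦-other (keyₕ F) (old≢ (proj₂ m)))))
        where
        x≢v : x ≢ v
        x≢v refl = p≢ (functional lk x∈ v∈)
      links .wlist (here refl) = record
        { items = []
        ; linked = subst (Linked (wnextₕ F′) [])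
            (sym (trans (↦-other (wheadₕ F [ pn ↦ 0 ]) (old≢ v∈ ∘ sym)) (↦-same (wheadₕ F) pn))) []
        ; distinct = [] ; sound = λ () ; complete = λ m → ⊥-elim (wlink-none _ m) }
      links .wlist {x = x} {p = p} (there x∈) with p ≟ pv
      ... | yes refl with injective lk x∈ v∈
      ...   | refl = let open WList (wlist lk v∈) in record
        { items = pn ∷ items
        ; linked = subst (Linked (wnextₕ F′) (pn ∷ items)) (sym (↦-same (wheadₕ F [ pn ↦ 0 ]) pv))
            (addrN≢0 ns′ (addrN-new ns (b ∷ v , pn)) ∷ subst (Linked (wnextₕ F′) items) (sym (↦-same (wnextₕ F) pn))
              (linked-frame linked λ q∈ → ↦-other (wnextₕ F) (old≢ (proj₂ (sound q∈)))))
        ; distinct = All.tabulate (λ q∈ → old≢ (proj₂ (sound q∈))) ∷ distinct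
        ; sound = λ { (here refl) → b , here refl ; (there q∈) → let b′ , m = sound q∈ in b′ , there m }
        ; complete = λ { (_ , here refl) → here refl ; (b′ , there m) → there (complete (b′ , m)) } }
      links .wlist {x = x} {p = p} (there x∈) | no p≢ = let open WList (wlist lk x∈) in record
        { items = items
        ; linked = subst (Linked (wnextₕ F′) items) (sym (apply-whead x∈ p≢))
            (linked-frame linked λ q∈ → ↦-other (wnextₕ F) (old≢ (proj₂ (sound q∈))))
        ; distinct = distinct
        ; sound = λ q∈ → let b′ , m = sound q∈ in b′ , there m
        ; complete = complete ∘ wlink-old λ { refl → p≢ (functional lk x∈ v∈) } }
      links .nullTrees = nullOk-same {treesₕ F} {S} (nullTrees lk)
        (same 0 (addrN≢0 ns′ (addrN-new ns (b ∷ v , pn)) ∘ sym) λ m → addrN≢0 ns (address lk (proj₂ m)) refl)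
      links .nullLen = trans (↦-other (lenₕ F) (addrN≢0 ns′ (addrN-new ns (b ∷ v , pn)))) (nullLen lk)

      children : Children ns F → Children ns F′
      children ch .crecAt = crecAt ch
      children ch .valOk = valOk ch
      children ch .cdict {x = x} x∈ = dict-frame (cdict ch x∈)
        (λ { r m → same r (rec≢ m ∘ sym) (λ wl → addrN≢addrR ns ns (address lk (proj₂ wl)) (rec m) refl) })
        (λ r m → ↦-other (keyₕ F) (rec≢ m))
        where
        rec : IsCrec ns F x r → AddrR ns r
        rec ([] , _ , (_ , () , _) , _)
        rec (_ ∷ _ , _ , _ , z∈ , refl) = crecAt ch z∈
        rec≢ : IsCrec ns F x r → pn ≢ r
        rec≢ m = addrN≢addrR ns′ ns (addrN-new ns (b ∷ v , pn)) (rec m)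
      -- The split on `x` exposes the first letter of `x ++ c ∷ u`, since `crecAt` speaks of
      -- nonempty strings.
      children ch .edge {x = []} {c = c} child q∈ =
        let k , f = edge ch child q∈ in trans (↦-other (keyₕ F) (addrN≢addrR ns′ ns (addrN-new ns (b ∷ v , pn)) (crecAt ch q∈))) k , f
      children ch .edge {x = _ ∷ _} child q∈ =
        let k , f = edge ch child q∈ in trans (↦-other (keyₕ F) (addrN≢addrR ns′ ns (addrN-new ns (b ∷ v , pn)) (crecAt ch q∈))) k , f

    -- Rewriting child records does not disturb the Weiner links.
    module _ {F′ : Fields} (lk : Links ns F)
             (same : ∀ p → AddrN ns p ⊎ p ≡ 0 → Same (treesₕ F) (treesₕ F′) p)
             (sameKey : ∀ p → AddrN ns p → keyₕ F′ p ≡ keyₕ F p)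
             (slink≡ : slinkₕ F′ ≡ slinkₕ F) (len≡ : lenₕ F′ ≡ lenₕ F) (wroot≡ : wrootₕ F′ ≡ wrootₕ F)
             (whead≡ : wheadₕ F′ ≡ wheadₕ F) (wnext≡ : wnextₕ F′ ≡ wnextₕ F) where

      links-frame : Links ns F′
      links-frame .functional = functional lk
      links-frame .injective = injective lk
      links-frame .address = address lk
      links-frame .slinkOk rewrite slink≡ = slinkOk lk
      links-frame .lenOk rewrite len≡ = lenOk lk
      links-frame .keyOk x∈ = trans (sameKey _ (address lk x∈)) (keyOk lk x∈)
      links-frame .wdict x∈ rewrite wroot≡ = dict-frame (wdict lk x∈)
        (λ q m → same q (inj₁ (address lk (proj₂ m)))) (λ q m → sameKey q (address lk (proj₂ m)))
      links-frame .wlist x∈ = let open WList (wlist lk x∈) in record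
        { items = items ; linked = subst₂ (λ f g → Linked f items (g _)) (sym wnext≡) (sym whead≡) linked
        ; distinct = distinct ; sound = sound ; complete = complete }
      links-frame .nullTrees = nullOk-same {treesₕ F} {treesₕ F′} (nullTrees lk) (same 0 (inj₂ refl))
      links-frame .nullLen rewrite len≡ = nullLen lk

    isCrec-addr : Children ns F → IsCrec ns F x r → AddrR ns r
    isCrec-addr ch ([] , _ , (_ , () , _) , _)
    isCrec-addr ch (_ ∷ _ , _ , _ , z∈ , refl) = crecAt ch z∈

    child-nonempty : Child ns x z → ∃₂ λ b z′ → z ≡ b ∷ z′
    child-nonempty {z = []} (_ , () , _)
    child-nonempty {z = b ∷ z} _ = b , z , refl

    -- The new node takes over the edge record of the node below it, so tree and keys in the
    -- dictionary of the parent stay as they are and only one value changes. The node below receives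
    -- the fresh record, which alone forms the dictionary of the new node.
    spliced : Fields → ℕ → ℕ → Word → ℕ → ℕ → Fields
    spliced F p pw ℓ f g = record F
      { treesₕ = shape (lefts (treesₕ F) [ 32 + p ↦ 0 ]) (rights (treesₕ F) [ 32 + p ↦ 0 ]) (levels (treesₕ F) [ 32 + p ↦ 1 ])
      ; keyₕ   = keyₕ F [ 32 + p ↦ ℓ ]
      ; slabₕ  = slabₕ F [ p ↦ ℓ ]
      ; valₕ   = valₕ F [ crecₕ F pw ↦ 6 + p ] [ 32 + p ↦ 6 + pw ]
      ; crecₕ  = crecₕ F [ p ↦ crecₕ F pw ] [ pw ↦ 32 + p ]
      ; crootₕ = crootₕ F [ p ↦ 32 + p ]
      ; plusₕ  = plusₕ F [ p ↦ f ] [ pw ↦ g ]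
      ; downₕ  = downₕ F [ p ↦ downₕ F pw ] }

    -- The new node b ∷ v is inserted in the middle of the edge from z to b ∷ w.
    module Splice {ns : NodeList} {F : Fields} {b : Symbol} {v w z : Str} {c : Symbol} {u : Str} {pw f g : ℕ}
                  (lk : Links ((b ∷ v , newN ns) ∷ ns) F) (ch : Children ns F) (room : Room ((b ∷ v , newN ns) ∷ ns))
                  (new : ¬ In ns (b ∷ v)) (w∈ : (b ∷ w , pw) ∈ ns) (z↑w : Child ns z (b ∷ w))
                  (z≺y : z ≺ b ∷ v) (w≡ : w ≡ v ++ c ∷ u)
                  (under : ∀ {t} → In ns t → b ∷ v ≺ t → b ∷ w ≼ t)
                  (f≡ : ∀ {d t} → b ∷ v ≡ z ++ d ∷ t → f ≡ plusSign t) (g≡ : g ≡ plusSign u) where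

      private
        pn = newN ns
        r₀ = crecₕ F pw
        r₁ = newR ns
        F′ = spliced F pn pw (letter c) f g
        yₙ = b ∷ v
        ns′ : NodeList
        ns′ = (yₙ , pn) ∷ ns

        y≺w : yₙ ≺ b ∷ w
        y≺w = b ∷ subst (v ≺_) (sym w≡) (≺-++ v)

        pn-addr : AddrN ns′ pn
        pn-addr = addrN-new ns (yₙ , pn)
        r₁-addr : AddrR ns′ r₁
        r₁-addr = addrR-new ns (yₙ , pn)
        r₀-addr : AddrR ns r₀
        r₀-addr = crecAt ch w∈

        oldN : (x , p) ∈ ns → p ≢ pn
        oldN x∈ refl = new (subst (In ns) (injective lk (there x∈) (here refl)) (_ , x∈))
        rec≢ : AddrR ns r → r₁ ≢ r
        rec≢ a eq = addrR≢new ns a (sym eq)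

        restrict : x ≢ yₙ → In ns′ x → In ns x
        restrict x≢y (_ , here refl) = ⊥-elim (x≢y refl)
        restrict _   (p , there x∈)  = p , x∈

        extend : In ns x → In ns′ x
        extend (p , x∈) = p , there x∈

        y↑w : Child ns′ yₙ (b ∷ w)
        y↑w = (pn , here refl) , y≺w , λ where
          (_ , here refl) _  → ≼-refl
          (p , there t∈) t≺w → ≺⇒≼ (≼-≺-trans (proj₂ (proj₂ z↑w) (p , t∈) t≺w) z≺y)

        z↑y : Child ns′ z yₙ
        z↑y = extend (proj₁ z↑w) , z≺y , λ where
          (_ , here refl) y≺y → ⊥-elim (≺-irrefl y≺y)
          (p , there t∈) t≺y → proj₂ (proj₂ z↑w) (p , t∈) (≺-≼-trans t≺y (≺⇒≼ y≺w))

        below-yₙ : ∀ {t q} → Child ns′ yₙ t → (t , q) ∈ ns′ → t ≡ b ∷ w × q ≡ pw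
        below-yₙ (_ , y≺y , _) (here refl) = ⊥-elim (≺-irrefl y≺y)
        below-yₙ (_ , y≺t , max) (there t∈) with ≼-split (under (_ , t∈) y≺t)
        ... | inj₁ refl = refl , functional lk (there t∈) (there w∈)
        ... | inj₂ w≺t  = ⊥-elim (≺-irrefl (≺-≼-trans y≺w (max (pw , there w∈) w≺t)))

        keep : ∀ {x t q} → (t , q) ∈ ns → q ≢ pw → Child ns x t → Child ns′ x t
        keep {x} {t} t∈ q≢ (x∈ , x≺t , max) = extend x∈ , x≺t , max′
          where
          max′ : ∀ {s} → In ns′ s → s ≺ t → s ≼ x
          max′ (p , there s∈) s≺t = max (p , s∈) s≺t
          max′ (_ , here refl) y≺t with ≼-split (under (_ , t∈) y≺t)
          ... | inj₁ refl = ⊥-elim (q≢ (functional lk (there t∈) (there w∈)))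
          ... | inj₂ w≺t  = ≼-trans (≺⇒≼ y≺w) (max (pw , w∈) w≺t)

        unkeep : ∀ {x t} → x ≢ yₙ → Child ns′ x t → Child ns x t
        unkeep x≢y (x∈ , x≺t , max) = restrict x≢y x∈ , x≺t , λ s∈ → max (extend s∈)

        crec-new : crecₕ F′ pn ≡ r₀
        crec-new = trans (↦-other (crecₕ F [ pn ↦ r₀ ]) (oldN w∈)) (↦-same (crecₕ F) pn)
        crec-w : crecₕ F′ pw ≡ r₁
        crec-w = ↦-same (crecₕ F [ pn ↦ r₀ ]) pw
        crec-old : (x , p) ∈ ns → p ≢ pw → crecₕ F′ p ≡ crecₕ F p
        crec-old x∈ p≢ = trans (↦-other (crecₕ F [ pn ↦ r₀ ]) (p≢ ∘ sym)) (↦-other (crecₕ F) (oldN x∈ ∘ sym))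
        plus-old : (x , p) ∈ ns → p ≢ pw → plusₕ F′ p ≡ plusₕ F p
        plus-old x∈ p≢ = trans (↦-other (plusₕ F [ pn ↦ f ]) (p≢ ∘ sym)) (↦-other (plusₕ F) (oldN x∈ ∘ sym))

        sameTrees : r₁ ≢ q → Same (treesₕ F) (treesₕ F′) q
        sameTrees r₁≢ = ↦-other (lefts (treesₕ F)) r₁≢ , ↦-other (rights (treesₕ F)) r₁≢ , ↦-other (levels (treesₕ F)) r₁≢

        addr-same : AddrN ns′ p ⊎ p ≡ 0 → r₁ ≢ p
        addr-same (inj₁ a)    = addrN≢addrR ns′ ns′ a r₁-addr ∘ sym
        addr-same (inj₂ refl) = addrR≢0 ns′ r₁-addr

      links : Links ns′ F′
      links = links-frame lk (λ p a → sameTrees (addr-same a)) (λ p a → ↦-other (keyₕ F) (addr-same (inj₁ a)))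
                refl refl refl refl refl

      children : Children ns′ F′
      children .crecAt (here refl) = subst (AddrR ns′) (sym crec-new) (addrR-wk ns (yₙ , pn) r₀-addr)
      children .crecAt {p = p} (there x∈) with p ≟ pw
      ... | yes refl = subst (AddrR ns′) (sym crec-w) r₁-addr
      ... | no p≢    = subst (AddrR ns′) (sym (crec-old x∈ p≢)) (addrR-wk ns (yₙ , pn) (crecAt ch x∈))
      children .valOk (here refl) = trans (cong (valₕ F′) crec-new)
        (trans (↦-other (valₕ F [ r₀ ↦ 6 + pn ]) (rec≢ r₀-addr)) (↦-same (valₕ F) r₀))
      children .valOk {p = p} (there x∈) with p ≟ pw
      ... | yes refl = trans (cong (valₕ F′) crec-w) (↦-same (valₕ F [ r₀ ↦ 6 + pn ]) r₁)
      -- By `valOk` the child record determines the child, so the record of another node cannot be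
      -- the one whose value was overwritten.
      ... | no p≢    = trans (cong (valₕ F′) (crec-old x∈ p≢))
        (trans (↦-other (valₕ F [ r₀ ↦ 6 + pn ]) (rec≢ (crecAt ch x∈)))
          (trans (↦-other (valₕ F) (λ eq → p≢ (+-cancelˡ-≡ 6 _ _ (trans (sym (valOk ch x∈)) (trans (cong (valₕ F) (sym eq)) (valOk ch w∈))))))
            (valOk ch x∈)))
      children .cdict (here refl) =
        subst (λ t → Dict (treesₕ F′) (keyₕ F′) t (IsCrec ns′ F′ yₙ)) (sym (↦-same (crootₕ F) pn))
          (dict-singleton (blockR ns′ room r₁-addr) (addrR≢0 ns′ r₁-addr)
            (↦-same (lefts (treesₕ F)) r₁) (↦-same (rights (treesₕ F)) r₁) (↦-same (levels (treesₕ F)) r₁)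
            (c , ↦-same (keyₕ F) r₁)
            (b ∷ w , pw , y↑w , there w∈ , crec-w)
            λ { r (t , q , y↑t , t∈ , refl) → trans (cong (crecₕ F′) (proj₂ (below-yₙ y↑t t∈))) crec-w })
      children .cdict {x = x} {p = p} (there x∈) =
        subst (λ t → Dict (treesₕ F′) (keyₕ F′) t (IsCrec ns′ F′ x)) (sym (↦-other (crootₕ F) (oldN x∈ ∘ sym)))
          (dict-ext to from (dict-frame (cdict ch x∈)
            (λ r m → sameTrees (rec≢ (isCrec-addr ch m))) (λ r m → ↦-other (keyₕ F) (rec≢ (isCrec-addr ch m)))))
        where
        x≢y : x ≢ yₙ
        x≢y refl = new (_ , x∈)
        to : ∀ r → IsCrec ns F x r → IsCrec ns′ F′ x r
        to r (t , q , x↑t , t∈ , refl) with q ≟ pw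
        ... | no q≢ = t , q , keep t∈ q≢ x↑t , there t∈ , crec-old t∈ q≢
        ... | yes refl with injective lk (there t∈) (there w∈)
        ...   | refl with nearest-unique x↑t z↑w
        ...     | refl = yₙ , pn , z↑y , here refl , crec-new
        from : ∀ r → IsCrec ns′ F′ x r → IsCrec ns F x r
        from r (_ , _ , x↑y , here refl , refl) with nearest-unique x↑y z↑y
        ... | refl = b ∷ w , pw , z↑w , w∈ , sym crec-new
        from r (t , q , x↑t , there t∈ , refl) with q ≟ pw
        ... | no q≢ = t , q , unkeep x≢y x↑t , t∈ , sym (crec-old t∈ q≢)
        ... | yes refl with injective lk (there t∈) (there w∈)
        ...   | refl = ⊥-elim (x≢y (nearest-unique x↑t y↑w))
      children .edge {x = x} {c = d} {u = t} x↑ (here eq) with cong proj₁ eq | cong proj₂ eq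
      ... | y≡ | refl with nearest-unique (subst (Child ns′ x) y≡ x↑) z↑y
      ...   | refl = trans (trans (cong (keyₕ F′) crec-new) (↦-other (keyₕ F) (rec≢ r₀-addr))) (proj₁ (edge ch (subst (Child ns x) w≡′ z↑w) (subst (λ s → (s , pw) ∈ ns) w≡′ w∈))) ,
                     trans (↦-other (plusₕ F [ pn ↦ f ]) (oldN w∈)) (trans (↦-same (plusₕ F) pn) (f≡ (sym y≡)))
        where
        w≡′ : b ∷ w ≡ x ++ d ∷ (t ++ c ∷ u)
        w≡′ = trans (cong (b ∷_) w≡) (trans (cong (_++ c ∷ u) (sym y≡)) (++-assoc x (d ∷ t) (c ∷ u)))
      children .edge {x = x} {c = d} {q = q} {u = t} x↑ (there t∈) with q ≟ pw
      ... | yes refl with injective lk (there t∈) (there w∈)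
      ...   | t≡ with nearest-unique (subst (Child ns′ x) t≡ x↑) y↑w
      ...     | refl with ++-cancelˡ yₙ _ _ (trans t≡ (cong (b ∷_) w≡))
      ...       | refl = trans (cong (keyₕ F′) crec-w) (↦-same (keyₕ F) r₁) , trans (↦-same (plusₕ F [ pn ↦ f ]) pw) g≡
      children .edge {x = x} {c = d} {q = q} {u = t} x↑ (there t∈) | no q≢ =
        let x↑′ = unkeep x≢y x↑
            k , f = edge ch x↑′ t∈ in
        trans (cong (keyₕ F′) (crec-old t∈ q≢)) (trans (↦-other (keyₕ F) (rec≢ (isCrec-addr ch (_ , _ , x↑′ , t∈ , refl)))) k) ,
        trans (plus-old t∈ q≢) f
        where
        x≢y : x ≢ yₙ
        x≢y refl = q≢ (proj₂ (below-yₙ x↑ (there t∈)))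

    attached : Fields → ℕ → ℕ → Word → ℕ → ℕ → Shape → Fields
    attached F p ph ℓ f d S = record F
      { treesₕ = S
      ; keyₕ   = keyₕ F [ 32 + p ↦ ℓ ]
      ; slabₕ  = slabₕ F [ p ↦ ℓ ]
      ; valₕ   = valₕ F [ 32 + p ↦ 6 + p ]
      ; crecₕ  = crecₕ F [ p ↦ 32 + p ]
      ; crootₕ = crootₕ F [ p ↦ 0 ] [ ph ↦ d ]
      ; plusₕ  = plusₕ F [ p ↦ f ]
      ; spₕ    = spₕ F [ p ↦ ph ]
      ; downₕ  = downₕ F [ p ↦ p ] }

    -- The new node l is attached as a leaf below h.
    module Attach {ns : NodeList} {F : Fields} {l h : Str} {c : Symbol} {u : Str} {ph f d : ℕ} {S : Shape}
                  (lk : Links ((l , newN ns) ∷ ns) F) (ch : Children ns F)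
                  (h∈ : (h , ph) ∈ ns) (l≡ : l ≡ h ++ c ∷ u)
                  (nearest : ∀ {t} → In ns t → t ≺ l → t ≼ h)
                  (below : ∀ {t} → In ns t → ¬ l ≺ t) (new : ¬ In ns l) (f≡ : f ≡ plusSign u)
                  (dict : Dict S (keyₕ F [ newR ns ↦ letter c ]) d (λ q → q ≡ newR ns ⊎ IsCrec ns F h q))
                  (same : ∀ q → q ≢ newR ns → ¬ IsCrec ns F h q → Same (treesₕ F) S q) where

      private
        pn = newN ns
        r₁ = newR ns
        F′ = attached F pn ph (letter c) f d S
        ns′ : NodeList
        ns′ = (l , pn) ∷ ns

        pn-addr : AddrN ns′ pn
        pn-addr = addrN-new ns (l , pn)
        r₁-addr : AddrR ns′ r₁
        r₁-addr = addrR-new ns (l , pn)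

        oldN : (x , p) ∈ ns → p ≢ pn
        oldN x∈ refl = new (subst (In ns) (injective lk (there x∈) (here refl)) (_ , x∈))
        rec≢ : AddrR ns r → r₁ ≢ r
        rec≢ a eq = addrR≢new ns a (sym eq)

        extend : In ns x → In ns′ x
        extend (p , x∈) = p , there x∈

        h↑l : Child ns′ h l
        h↑l = (ph , there h∈) , subst (h ≺_) (sym l≡) (≺-++ h) , λ where
          (_ , here refl) l≺l → ⊥-elim (≺-irrefl l≺l)
          (p , there t∈) t≺l → nearest (p , t∈) t≺l

        keep : ∀ {x t} → In ns t → Child ns x t → Child ns′ x t
        keep t∈ (x∈ , x≺t , max) = extend x∈ , x≺t , λ where
          (_ , here refl) l≺t → ⊥-elim (below t∈ l≺t)
          (p , there s∈) s≺t → max (p , s∈) s≺t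

        unkeep : ∀ {x t} → x ≢ l → Child ns′ x t → Child ns x t
        unkeep x≢l ((_ , here refl) , _ , _) = ⊥-elim (x≢l refl)
        unkeep x≢l ((p , there x∈) , x≺t , max) = (p , x∈) , x≺t , λ s∈ → max (extend s∈)

        crec-old : (x , p) ∈ ns → crecₕ F′ p ≡ crecₕ F p
        crec-old x∈ = ↦-other (crecₕ F) (oldN x∈ ∘ sym)

        addr-same : AddrN ns′ p ⊎ p ≡ 0 → r₁ ≢ p
        addr-same (inj₁ a)    = addrN≢addrR ns′ ns′ a r₁-addr ∘ sym
        addr-same (inj₂ refl) = addrR≢0 ns′ r₁-addr

        addr-crec : AddrN ns′ p ⊎ p ≡ 0 → ¬ IsCrec ns F h p
        addr-crec (inj₁ a) m    = addrN≢addrR ns′ ns a (isCrec-addr ch m) refl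
        addr-crec (inj₂ refl) m = addrR≢0 ns (isCrec-addr ch m) refl

        none-below : ∀ r → ¬ IsCrec ns′ F′ l r
        none-below r (_ , _ , (_ , l≺l , _) , here refl , _) = ≺-irrefl l≺l
        none-below r (_ , _ , (_ , l≺t , _) , there t∈ , _)  = below (_ , t∈) l≺t

      links : Links ns′ F′
      links = links-frame lk (λ p a → same p (addr-same a ∘ sym) (addr-crec a)) (λ p a → ↦-other (keyₕ F) (addr-same (inj₁ a)))
                refl refl refl refl refl

      children : Children ns′ F′
      children .crecAt (here refl) = subst (AddrR ns′) (sym (↦-same (crecₕ F) pn)) r₁-addr
      children .crecAt (there x∈) = subst (AddrR ns′) (sym (crec-old x∈)) (addrR-wk ns (l , pn) (crecAt ch x∈))
      children .valOk (here refl) = trans (cong (valₕ F′) (↦-same (crecₕ F) pn)) (↦-same (valₕ F) r₁)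
      children .valOk (there x∈) = trans (cong (valₕ F′) (crec-old x∈)) (trans (↦-other (valₕ F) (rec≢ (crecAt ch x∈))) (valOk ch x∈))
      children .cdict (here refl) =
        subst (λ t → Dict S (keyₕ F′) t (IsCrec ns′ F′ l))
          (sym (trans (↦-other (crootₕ F [ pn ↦ 0 ]) (oldN h∈)) (↦-same (crootₕ F) pn)))
          (dict-empty none-below)
      children .cdict {x = x} {p = p} (there x∈) with p ≟ ph
      ... | yes refl with injective lk (there x∈) (there h∈)
      ...   | refl = subst (λ t → Dict S (keyₕ F′) t (IsCrec ns′ F′ h)) (sym (↦-same (crootₕ F [ pn ↦ 0 ]) ph)) (dict-ext to from dict)
        where
        to : ∀ r → r ≡ r₁ ⊎ IsCrec ns F h r → IsCrec ns′ F′ h r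
        to r (inj₁ refl) = l , pn , h↑l , here refl , ↦-same (crecₕ F) pn
        to r (inj₂ (t , q , h↑t , t∈ , eq)) = t , q , keep (q , t∈) h↑t , there t∈ , trans (crec-old t∈) eq
        from : ∀ r → IsCrec ns′ F′ h r → r ≡ r₁ ⊎ IsCrec ns F h r
        from r (_ , _ , _ , here refl , eq) = inj₁ (trans (sym eq) (↦-same (crecₕ F) pn))
        from r (t , q , h↑t , there t∈ , eq) =
          inj₂ (t , q , unkeep (λ { refl → new (ph , h∈) }) h↑t , t∈ , trans (sym (crec-old t∈)) eq)
      children .cdict {x = x} {p = p} (there x∈) | no p≢ =
        subst (λ t → Dict S (keyₕ F′) t (IsCrec ns′ F′ x))
          (sym (trans (↦-other (crootₕ F [ pn ↦ 0 ]) (p≢ ∘ sym)) (↦-other (crootₕ F) (oldN x∈ ∘ sym))))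
          (dict-ext to from (dict-frame (cdict ch x∈)
            (λ r m → same r (rec≢ (isCrec-addr ch m) ∘ sym) (apart′ m))
            (λ r m → ↦-other (keyₕ F) (rec≢ (isCrec-addr ch m)))))
        where
        x≢h : x ≢ h
        x≢h refl = p≢ (functional lk (there x∈) (there h∈))
        -- The value of a child record identifies the child, and the child has only one parent, so
        -- dictionaries of different nodes share no record and an insertion into one leaves the
        -- others intact.
        apart′ : IsCrec ns F x r → ¬ IsCrec ns F h r
        apart′ (t , q , x↑t , t∈ , refl) (t′ , q′ , h↑t′ , t∈′ , eq) with child-nonempty x↑t | child-nonempty h↑t′
        ... | _ , _ , refl | _ , _ , refl
          with +-cancelˡ-≡ 6 _ _ (trans (sym (valOk ch t∈′)) (trans (cong (valₕ F) eq) (valOk ch t∈)))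
        ... | refl with injective lk (there t∈) (there t∈′)
        ... | refl = x≢h (nearest-unique x↑t h↑t′)
        to : ∀ r → IsCrec ns F x r → IsCrec ns′ F′ x r
        to r (t , q , x↑t , t∈ , eq) = t , q , keep (q , t∈) x↑t , there t∈ , trans (crec-old t∈) eq
        from : ∀ r → IsCrec ns′ F′ x r → IsCrec ns F x r
        from r (_ , _ , x↑l , here refl , _) = ⊥-elim (x≢h (nearest-unique x↑l h↑l))
        from r (t , q , x↑t , there t∈ , eq) =
          t , q , unkeep (λ { refl → new (p , x∈) }) x↑t , t∈ , trans (sym (crec-old t∈)) eq
      children .edge {x = x} {c = e} x↑ (here eq) with cong proj₁ eq | cong proj₂ eq
      ... | t≡ | refl with nearest-unique (subst (Child ns′ x) t≡ x↑) h↑l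
      ...   | refl with ++-cancelˡ h _ _ (trans t≡ l≡)
      ...     | refl = trans (cong (keyₕ F′) (↦-same (crecₕ F) pn)) (↦-same (keyₕ F) r₁) , trans (↦-same (plusₕ F) pn) f≡
      children .edge {x = x} {q = q} x↑ (there t∈) =
        let x↑′ = unkeep x≢l x↑
            k , g = edge ch x↑′ t∈ in
        trans (cong (keyₕ F′) (crec-old t∈)) (trans (↦-other (keyₕ F) (rec≢ (isCrec-addr ch (_ , _ , x↑′ , t∈ , refl)))) k) ,
        trans (↦-other (plusₕ F) (oldN t∈ ∘ sym)) g
        where
        x≢l : x ≢ l
        x≢l refl = below (q , t∈) (proj₁ (proj₂ x↑))

  open Structure

  -- The tree of the type-1 nodes

  module Spines where

    open Shape

    private
      variable
        ns : NodeList
        ss : List Str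
        x y z t : Str
        a b c : Symbol
        p q r : ℕ
        S D : ℕ → ℕ
        L : ℕ → Word

    -- The type-1 node that every type-1 node below x has to pass.
    Target : List Str → Str → Str → Set
    Target ss x z = z ∈ ss × x ≼ z × (∀ {t} → t ∈ ss → x ≼ t → z ≼ t)

    SpOk : List Str → NodeList → (ℕ → ℕ) → (ℕ → Word) → Str → ℕ → Set
    SpOk ss ns S L x p = (x ≡ [] × S p ≡ 0) ⊎
      (∃₂ λ y c → ∃ λ u → x ≡ y ++ c ∷ u × Nearest (_∈ ss) y x × (y , S p) ∈ ns × L p ≡ letter c)

    -- The label field does double duty. On a type-1 node it is the first letter of the path from
    -- the type-1 parent; on any other node it is the first letter of the path to the target. The
    -- condition here is vacuous on a type-1 node, which is its own target.
    DownOk : List Str → NodeList → (ℕ → Word) → (ℕ → ℕ) → Str → ℕ → Set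
    DownOk ss ns L D x p = ∃ λ z → Target ss x z × (z , D p) ∈ ns × (∀ {c u} → z ≡ x ++ c ∷ u → L p ≡ letter c)

    -- The tree of the type-1 nodes ss: S gives parents, L edge labels, and D
    -- the targets.
    record Spine (ss : List Str) (ns : NodeList) (S : ℕ → ℕ) (L : ℕ → Word) (D : ℕ → ℕ) : Set where
      field
        incl   : x ∈ ss → In ns x
        rootS  : [] ∈ ss
        tailS  : (b ∷ x , p) ∈ ns → x ∈ ss
        spOk   : x ∈ ss → (x , p) ∈ ns → SpOk ss ns S L x p
        downOk : (x , p) ∈ ns → DownOk ss ns L D x p

    open Spine

    target-self : x ∈ ss → Target ss x z → z ≡ x
    target-self x∈ (z∈ , x≼z , min) = ≼-antisym (min x∈ ≼-refl) x≼z

    ¬self-++ : ¬ x ≡ x ++ c ∷ z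
    ¬self-++ {x} eq = ≺-irrefl (subst (x ≺_) (sym eq) (≺-++ x))

    -- No node lies strictly between `b ∷ v` and `b ∷ w`, and `b ∷ v` itself is not of type 1, so
    -- both have the same target and the pointer can be copied.
    spine-splice : ∀ {v w u pw pn} → Spine ss ns S L D → (∀ {p} → (b ∷ v , p) ∈ ns → ⊥) →
      (∀ {x p} → (x , p) ∈ ns → pn ≢ p) →
      v ∈ ss → (b ∷ w , pw) ∈ ns → w ≡ v ++ c ∷ u → (∀ {t} → In ns t → b ∷ v ≺ t → b ∷ w ≼ t) →
      Spine ss ((b ∷ v , pn) ∷ ns) S (L [ pn ↦ letter c ]) (D [ pn ↦ D pw ])
    spine-splice {ss} {ns} {S} {L} {D} {b} {c} {v} {w} {u} {pw} {pn} spine new pn≢ v∈ w∈ w≡ under = record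
      { incl = λ x∈ → let p , x∈ns = incl spine x∈ in p , there x∈ns
      ; rootS = rootS spine
      ; tailS = λ { (here refl) → v∈ ; (there x∈) → tailS spine x∈ }
      ; spOk = sp′
      ; downOk = down′ }
      where
      sp′ : x ∈ ss → (x , p) ∈ (b ∷ v , pn) ∷ ns → SpOk ss ((b ∷ v , pn) ∷ ns) S (L [ pn ↦ letter c ]) x p
      sp′ x∈ (here refl) = ⊥-elim (new (proj₂ (incl spine x∈)))
      sp′ x∈ (there x∈ns) with spOk spine x∈ x∈ns
      ... | inj₁ at-root = inj₁ at-root
      ... | inj₂ (y , d , t , eq , near , y∈ , lab) =
        inj₂ (y , d , t , eq , near , there y∈ , trans (↦-other L (pn≢ x∈ns)) lab)
      down′ : (x , p) ∈ (b ∷ v , pn) ∷ ns → DownOk ss ((b ∷ v , pn) ∷ ns) (L [ pn ↦ letter c ]) (D [ pn ↦ D pw ]) x p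
      down′ (here refl) with downOk spine w∈
      ... | z , (z∈ , w≼z , min) , zp∈ , _ =
        z , (z∈ , ≼-trans v≼w w≼z , λ t∈ v≼t → min t∈ (under (incl spine t∈) (strict t∈ v≼t))) ,
        there (subst (λ p → (z , p) ∈ ns) (sym (↦-same D pn)) zp∈) ,
        λ z≡ → trans (↦-same L pn) (cong letter (same-next (b ∷ v) (subst (_≼ z) (cong (b ∷_) w≡) w≼z) (subst (_≼ z) z≡ ≼-refl)))
        where
        v≼w : b ∷ v ≼ b ∷ w
        v≼w = b ∷ subst (v ≼_) (sym w≡) (≼-++ v)
        strict : t ∈ ss → b ∷ v ≼ t → b ∷ v ≺ t
        strict t∈ v≼t with ≼-split v≼t
        ... | inj₁ refl = ⊥-elim (new (proj₂ (incl spine t∈)))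
        ... | inj₂ v≺t  = v≺t
      down′ (there x∈) with downOk spine x∈
      ... | z , target , z∈ , lab = z , target , there (subst (λ p → (z , p) ∈ ns) (sym (↦-other D (pn≢ x∈))) z∈) ,
        λ z≡ → trans (↦-other L (pn≢ x∈)) (lab z≡)

    spine-attach : ∀ {v h l u ph pn} → Spine ss ns S L D → l ≡ b ∷ v → v ∈ ss → (∀ {p} → (l , p) ∈ ns → ⊥) →
      (∀ {x p} → (x , p) ∈ ns → pn ≢ p) → h ∈ ss → (h , ph) ∈ ns → l ≡ h ++ c ∷ u →
      (∀ {t} → In ns t → t ≺ l → t ≼ h) → (∀ {t} → In ns t → ¬ l ≺ t) →
      Spine (l ∷ ss) ((l , pn) ∷ ns) (S [ pn ↦ ph ]) (L [ pn ↦ letter c ]) (D [ pn ↦ pn ])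
    spine-attach {ss} {ns} {S} {L} {D} {b} {c} {v} {h} {l} {u} {ph} {pn} spine refl v∈ new pn≢ h∈ hp∈ l≡ nearest below = record
      { incl = λ { (here refl) → pn , here refl ; (there x∈) → let p , x∈ns = incl spine x∈ in p , there x∈ns }
      ; rootS = there (rootS spine)
      ; tailS = λ { (here refl) → there v∈ ; (there x∈) → there (tailS spine x∈) }
      ; spOk = sp′
      ; downOk = down′ }
      where
      h≼l : h ≺ l
      h≼l = subst (h ≺_) (sym l≡) (≺-++ h)
      sp′ : x ∈ l ∷ ss → (x , p) ∈ (l , pn) ∷ ns → SpOk (l ∷ ss) ((l , pn) ∷ ns) (S [ pn ↦ ph ]) (L [ pn ↦ letter c ]) x p
      sp′ (there x∈) (here refl) = ⊥-elim (new (proj₂ (incl spine x∈)))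
      sp′ (here refl) (there x∈ns) = ⊥-elim (new x∈ns)
      sp′ (here refl) (here refl) = inj₂ (h , c , u , l≡ , (there h∈ , h≼l , near) ,
        there (subst (λ p → (h , p) ∈ ns) (sym (↦-same S pn)) hp∈) , ↦-same L pn)
        where
        near : t ∈ l ∷ ss → t ≺ l → t ≼ h
        near (here refl) l≺l = ⊥-elim (≺-irrefl l≺l)
        near (there t∈) t≺l = nearest (incl spine t∈) t≺l
      sp′ (there x∈) (there x∈ns) with spOk spine x∈ x∈ns
      ... | inj₁ (eq , s≡0) = inj₁ (eq , trans (↦-other S (pn≢ x∈ns)) s≡0)
      ... | inj₂ (y , d , t , eq , (y∈ , y≺x , max) , yp∈ , lab) =
        inj₂ (y , d , t , eq , (there y∈ , y≺x , λ { (here refl) l≺x → ⊥-elim (below (_ , x∈ns) l≺x) ; (there t∈) → max t∈ }) ,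
          there (subst (λ p → (y , p) ∈ ns) (sym (↦-other S (pn≢ x∈ns))) yp∈) , trans (↦-other L (pn≢ x∈ns)) lab)
      down′ : (x , p) ∈ (l , pn) ∷ ns → DownOk (l ∷ ss) ((l , pn) ∷ ns) (L [ pn ↦ letter c ]) (D [ pn ↦ pn ]) x p
      down′ (here refl) = l , (here refl , ≼-refl , λ _ l≼t → l≼t) , here (cong (l ,_) (↦-same D pn)) ,
        λ eq → ⊥-elim (¬self-++ eq)
      down′ {x} (there x∈) with downOk spine x∈
      ... | z , (z∈ , x≼z , min) , zp∈ , lab =
        z , (there z∈ , x≼z , min′) , there (subst (λ p → (z , p) ∈ ns) (sym (↦-other D (pn≢ x∈))) zp∈) ,
        λ eq → trans (↦-other L (pn≢ x∈)) (lab eq)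
        where
        min′ : t ∈ l ∷ ss → x ≼ t → z ≼ t
        min′ (there t∈) x≼t = min t∈ x≼t
        min′ (here refl) x≼l with ≼-split x≼l
        ... | inj₁ refl = ⊥-elim (new x∈)
        ... | inj₂ x≺l  = ≼-trans (min h∈ (nearest (_ , x∈) x≺l)) (≺⇒≼ h≼l)

    -- The node h below the type-1 node P becomes a type-1 node.
    Retargeted : NodeList → Str → Str → ℕ → (ℕ → ℕ) → (ℕ → ℕ) → Set
    Retargeted ns P h ph D D′ = ∀ x p → (x , p) ∈ ns →
      (P ≺ x × x ≼ h × D′ p ≡ ph) ⊎ (¬ (P ≺ x × x ≼ h) × D′ p ≡ D p)

    module Promote {ss : List Str} {ns : NodeList} {S : ℕ → ℕ} {L : ℕ → Word} {D D′ : ℕ → ℕ}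
                   (spine : Spine ss ns S L D)
                   (functional : ∀ {x p q} → (x , p) ∈ ns → (x , q) ∈ ns → p ≡ q)
                   (injective : ∀ {x y p} → (x , p) ∈ ns → (y , p) ∈ ns → x ≡ y)
                   {h : Str} {ph : ℕ} (h∈ : (h , ph) ∈ ns) (h∉ : h ∉ ss) (tail∈ : ∀ {b v} → h ≡ b ∷ v → v ∈ ss)
                   {C : Str} {pC : ℕ} (C∈ : (C , pC) ∈ ns) (C-target : Target ss h C)
                   {c : Symbol} {u : Str} (C≡ : C ≡ h ++ c ∷ u) (h-label : L ph ≡ letter c)
                   {P : Str} {e : Symbol} {u′ : Str} (P-near : Nearest (_∈ ss) P C) (P∈ : (P , S pC) ∈ ns)
                   (C≡′ : C ≡ P ++ e ∷ u′) (C-label : L pC ≡ letter e)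
                   (retarget : Retargeted ns P h ph D D′) where

      h≺C : h ≺ C
      h≺C = subst (h ≺_) (sym C≡) (≺-++ h)

      P≺h : P ≺ h
      P≺h with compareUnder (≺⇒≼ h≺C) (≺⇒≼ (proj₁ (proj₂ P-near)))
      ... | inj₁ h≼P = ⊥-elim (≺-irrefl (≺-≼-trans (proj₁ (proj₂ P-near)) (proj₂ (proj₂ C-target) (proj₁ P-near) h≼P)))
      ... | inj₂ P≺h = P≺h

      private
        S′ = S [ ph ↦ S pC ] [ pC ↦ ph ]
        -- Labels are swapped. P, h and C lie on one path, so the letter from P towards C is also
        -- that from P towards h; and the former label of h, pointing to its target C, is now the
        -- label of C below its parent h.
        L′ = L [ ph ↦ L pC ] [ pC ↦ L ph ]
        ss′ : List Str
        ss′ = h ∷ ss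

        ph≢pC : ph ≢ pC
        ph≢pC refl with injective h∈ C∈
        ... | refl = ≺-irrefl h≺C

        S-old : p ≢ ph → p ≢ pC → S′ p ≡ S p
        S-old p≢ p≢′ = trans (↦-other (S [ ph ↦ S pC ]) (p≢′ ∘ sym)) (↦-other S (p≢ ∘ sym))
        L-old : p ≢ ph → p ≢ pC → L′ p ≡ L p
        L-old p≢ p≢′ = trans (↦-other (L [ ph ↦ L pC ]) (p≢′ ∘ sym)) (↦-other L (p≢ ∘ sym))

        sp′ : x ∈ ss′ → (x , p) ∈ ns → SpOk ss′ ns S′ L′ x p
        sp′ {p = p} (here refl) x∈ns with functional x∈ns h∈
        ... | refl with ≺⇒++ P≺h
        ...   | e′ , u″ , h≡ = inj₂ (P , e , u″ , trans h≡ (cong (λ a → P ++ a ∷ u″) e′≡e) ,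
          (there (proj₁ P-near) , P≺h , near) ,
          subst (λ q → (P , q) ∈ ns) (sym (trans (↦-other (S [ ph ↦ S pC ]) (ph≢pC ∘ sym)) (↦-same S ph))) P∈ ,
          trans (↦-other (L [ ph ↦ L pC ]) (ph≢pC ∘ sym)) (trans (↦-same L ph) C-label))
          where
          e′≡e : e′ ≡ e
          e′≡e = same-next P (subst (_≼ C) h≡ (≺⇒≼ h≺C)) (subst (_≼ C) C≡′ ≼-refl)
          near : t ∈ ss′ → t ≺ h → t ≼ P
          near (here refl) h≺h = ⊥-elim (≺-irrefl h≺h)
          near (there t∈) t≺h = proj₂ (proj₂ P-near) t∈ (≺-≼-trans t≺h (≺⇒≼ h≺C))
        sp′ {x} {p} (there x∈) x∈ns with p ≟ pC
        ... | yes refl with injective x∈ns C∈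
        ...   | refl = inj₂ (h , c , u , C≡ , (here refl , h≺C , near) ,
          subst (λ q → (h , q) ∈ ns) (sym (↦-same (S [ ph ↦ S pC ]) pC)) h∈ , trans (↦-same (L [ ph ↦ L pC ]) pC) h-label)
          where
          near : t ∈ ss′ → t ≺ C → t ≼ h
          near (here refl) _ = ≼-refl
          near (there t∈) t≺C = ≼-trans (proj₂ (proj₂ P-near) t∈ t≺C) (≺⇒≼ P≺h)
        sp′ {x} {p} (there x∈) x∈ns | no p≢ with spOk spine x∈ x∈ns
        ... | inj₁ (eq , s≡0) = inj₁ (eq , trans (S-old p≢h p≢) s≡0)
          where
          p≢h : p ≢ ph
          p≢h refl = h∉ (subst (_∈ ss) (injective x∈ns h∈) x∈)
        ... | inj₂ (y , d , t , eq , (y∈ , y≺x , max) , yp∈ , lab) =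
          inj₂ (y , d , t , eq , (there y∈ , y≺x , max′) ,
            subst (λ q → (y , q) ∈ ns) (sym (S-old p≢h p≢)) yp∈ , trans (L-old p≢h p≢) lab)
          where
          p≢h : p ≢ ph
          p≢h refl = h∉ (subst (_∈ ss) (injective x∈ns h∈) x∈)
          max′ : ∀ {t} → t ∈ ss′ → t ≺ x → t ≼ y
          max′ (there t∈) t≺x = max t∈ t≺x
          max′ (here refl) h≺x with ≼-split (proj₂ (proj₂ C-target) x∈ (≺⇒≼ h≺x))
          ... | inj₁ refl = ⊥-elim (p≢ (functional x∈ns C∈))
          ... | inj₂ C≺x  = ≼-trans (≺⇒≼ h≺C) (max (proj₁ C-target) C≺x)

        down′ : (x , p) ∈ ns → DownOk ss′ ns L′ D′ x p
        down′ {x} {p} x∈ with downOk spine x∈ | retarget x p x∈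
        ... | z , (z∈ , x≼z , min) , zp∈ , lab | inj₁ (P≺x , x≼h , d≡) =
          h , (here refl , x≼h , min′) , subst (λ q → (h , q) ∈ ns) (sym d≡) h∈ , lab′
          where
          z≡C : z ≡ C
          z≡C with ≼-split (min (proj₁ C-target) (≼-trans x≼h (≺⇒≼ h≺C)))
          ... | inj₁ z≡C = z≡C
          ... | inj₂ z≺C = ⊥-elim (≺-irrefl (≺-≼-trans P≺x (≼-trans x≼z (proj₂ (proj₂ P-near) z∈ z≺C))))
          min′ : t ∈ ss′ → x ≼ t → h ≼ t
          min′ (here refl) _ = ≼-refl
          min′ (there t∈) x≼t = ≼-trans (≺⇒≼ h≺C) (subst (_≼ _) z≡C (min t∈ x≼t))
          lab′ : ∀ {d t} → h ≡ x ++ d ∷ t → L′ p ≡ letter d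
          lab′ {d} {t} h≡ = trans (L-old p≢h p≢C) (lab (trans z≡C (trans C≡ (trans (cong (_++ c ∷ u) h≡) (++-assoc x (d ∷ t) (c ∷ u))))))
            where
            x≺h : x ≺ h
            x≺h = subst (x ≺_) (sym h≡) (≺-++ x)
            p≢h : p ≢ ph
            p≢h refl with injective x∈ h∈
            ... | refl = ≺-irrefl x≺h
            p≢C : p ≢ pC
            p≢C refl with injective x∈ C∈
            ... | refl = ≺-irrefl (≺-≼-trans x≺h (≺⇒≼ h≺C))
        ... | z , (z∈ , x≼z , min) , zp∈ , lab | inj₂ (¬between , d≡) =
          z , (there z∈ , x≼z , min′) , subst (λ q → (z , q) ∈ ns) (sym d≡) zp∈ , lab′
          where
          min′ : t ∈ ss′ → x ≼ t → z ≼ t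
          min′ (there t∈) x≼t = min t∈ x≼t
          min′ (here refl) x≼h with compareUnder x≼h (≺⇒≼ P≺h)
          ... | inj₁ x≼P = ≼-trans (min (proj₁ P-near) x≼P) (≺⇒≼ P≺h)
          ... | inj₂ P≺x = ⊥-elim (¬between (P≺x , x≼h))
          lab′ : ∀ {d t} → z ≡ x ++ d ∷ t → L′ p ≡ letter d
          lab′ z≡ = trans (L-old p≢h p≢C) (lab z≡)
            where
            p≢h : p ≢ ph
            p≢h refl with injective x∈ h∈
            ... | refl = ¬between (P≺h , ≼-refl)
            p≢C : p ≢ pC
            p≢C refl with injective x∈ C∈
            ... | refl = ¬self-++ (trans (sym (target-self (proj₁ C-target) (z∈ , x≼z , min))) z≡)

      promoted : Spine ss′ ns S′ L′ D′
      promoted = record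
        { incl = λ { (here refl) → ph , h∈ ; (there x∈) → incl spine x∈ }
        ; rootS = there (rootS spine)
        ; tailS = λ x∈ → there (tailS spine x∈)
        ; spOk = sp′
        ; downOk = down′ }

  open Spines

  -- Creating a node inside an edge

  module Growth where

    open Shape

    open Fields
    open Links
    open Children
    open Spine

    private
      variable
        ns : NodeList
        ss : List Str
        x y z v : Str
        b : Symbol
        p : ℕ

    record World (ss : List Str) (ns : NodeList) (F : Fields) : Set where
      field
        links    : Links ns F
        children : Children ns F
        spine    : Spine ss ns (spₕ F) (slabₕ F) (downₕ F)

    Short : NodeList → Set
    Short ns = ∀ {x} → In ns x → 3 + length x < space

    -- States after longer blocks are named, so that postconditions can be equations that are
    -- consumed by matching `refl`.
    beforeInsert : HState → HState
    beforeInsert s = record s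
      { rn = put (put (put (put (put (rn s) yr pn) next (64 + pn)) t₁ (get (hn s) whead pv)) cur (get (hn s) wroot pv)) top pn
      ; hn = put (put (put (put (hn s)
               len (get (hn s) len [ pn ↦ suc (get (hn s) len pv) ]))
               slink (get (hn s) slink [ pn ↦ 6 + pv ]))
               wnext (get (hn s) wnext [ pn ↦ get (hn s) whead pv ]))
               whead (get (hn s) whead [ pn ↦ 0 ] [ pv ↦ pn ])
      ; hs = put (hs s) key (get (hs s) key [ pn ↦ get (rs s) sk ]) }
      where
      pn = get (rn s) next
      pv = get (rn s) vr

    afterInsert : HState → Tup ℕ 8 → Word → (ℕ → ℕ) → Shape → HState
    afterInsert s j w U S = record s₂
      { hn = put (hn s₂) wroot (get (hn s₂) wroot [ get (rn s) next ↦ 0 ] [ get (rn s) vr ↦ get j ttop ]) }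
      where s₂ = reshape (setUp (retemp (beforeInsert s) j w) U) S

    Created : HState → Str → NodeList → HState → Set
    Created s v ns s′ = ∃₂ λ j w → ∃₂ λ U S → s′ ≡ afterInsert s j w U S ×
      Dict S (get (hs s) key [ get (rn s) next ↦ get (rs s) sk ]) (get j ttop)
        (λ q → q ≡ get (rn s) next ⊎ WLink ns v q) ×
      (∀ q → q ≢ get (rn s) next → ¬ WLink ns v q → Same (shapeOf s) S q)

    createT : ∀ s → Links ns (fieldsOf s) → (v , get (rn s) vr) ∈ ns → ¬ In ns (b ∷ v) →
      get (rn s) next ≡ newN ns → get (rs s) sk ≡ letter b → Room ((b ∷ v , newN ns) ∷ ns) → Short ns →
      Triple create s (41 + 293 * Λ) (Created s v ns)
    createT {ns} {v} {b} s lk v∈ new next≡ sk≡ room short =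
      weaken (≤-reflexive time) $
      mov⟩ $ inc⟩ (subst (λ n → 64 + n < space) (sym next≡) next<) $
      ld⟩ bv $ inc⟩ len< $ st⟩ bn $
      inc⟩ (inSpace {6} (m≤m+n 7 25) bv) $ st⟩ bn $
      stS⟩ bn $
      ld⟩ bv $ st0⟩ bn $ st⟩ bn $ st⟩ bv $
      ld⟩ bv $ mov⟩ $
      insertInT (beforeInsert s)
        (dict-frame (wdict lk v∈) (λ _ _ → refl , refl , refl) (λ q m → ↦-other (get (hs s) key) (old≢ (proj₂ m))))
        sk≡ (nullTrees lk) bn pn≢0 (trans (↦-same (get (hs s) key) pn) sk≡) fresh
      ⟫ λ { (j , w , U , S , refl , dict , same) →
            st0⟩ bn $ st⟩ bv $ nop⟩ (j , w , U , S , refl , dict , same) }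
      where
      pn = get (rn s) next
      e : Str × ℕ
      e = b ∷ v , newN ns
      bn : Block pn
      bn = subst Block (sym next≡) (blockN (e ∷ ns) room (addrN-new ns e))
      bv : Block (get (rn s) vr)
      bv = blockN (e ∷ ns) room (addrN-wk ns e (address lk v∈))
      pn≢0 : pn ≢ 0
      pn≢0 eq = addrN≢0 (e ∷ ns) (addrN-new ns e) (trans (sym next≡) eq)
      next< : 64 + newN ns < space
      next< = subst (_< space) (sym (nodeAddr-suc (length ns))) (nodeAddr<space room)
      len< : 1 + get (hn s) len (get (rn s) vr) < space
      len< = subst (λ n → 1 + n < space) (sym (lenOk lk v∈)) (≤-trans (n≤1+n _) (short (_ , v∈)))
      old≢ : (x , p) ∈ ns → pn ≢ p
      old≢ x∈ eq = addrN≢new ns (address lk x∈) (trans (sym eq) next≡)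
      fresh : ∀ q → WLink ns v q → (get (hs s) key [ pn ↦ get (rs s) sk ]) q ≢ letter b
      fresh q (b′ , m) eq with letter-injective (trans (sym (trans (↦-other (get (hs s) key) (old≢ m)) (keyOk lk m))) eq)
      ... | refl = new (_ , m)
      time : 35 + (293 * Λ + 6) ≡ 41 + 293 * Λ
      time = cong (35 +_) (+-comm (293 * Λ) 6)

    flagT : ∀ s (u : Str) → get (rn s) t₁ ≡ get (rn s) t₂ + suc (length u) → get (rn s) t₁ < space →
      Triple plusFlag s 4 (_≡ record s { rn = put (rn s) t₂ (plusSign u) })
    flagT s [] eq bound =
      inc⟩ (≤-trans (s≤s (≤-reflexive (sym t₁≡))) bound) $
      else⟩ (isNlt λ lt → <⇒≢ lt (sym t₁≡)) $ lit⟩ $ nop⟩ refl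
      where
      t₁≡ : get (rn s) t₁ ≡ suc (get (rn s) t₂)
      t₁≡ = trans eq (+-comm (get (rn s) t₂) 1)
    flagT s (_ ∷ u) eq bound =
      inc⟩ (<-trans lt bound) $
      then⟩ (isLt lt) $ lit⟩ $ nop⟩ refl
      where
      lt : suc (get (rn s) t₂) < get (rn s) t₁
      lt = ≤-trans (≤-reflexive (+-comm 2 (get (rn s) t₂)))
             (≤-trans (+-monoʳ-≤ (get (rn s) t₂) (s≤s (s≤s z≤n))) (≤-reflexive (sym eq)))

    spliceEdgeS spliceChildS : HState → HState
    spliceEdgeS s = record s
      { rn = put (put (rn s) t₁ (32 + pn)) t₂ (6 + pw)
      ; hn = put (put (hn s) crec (get (hn s) crec [ pn ↦ r₀ ] [ pw ↦ 32 + pn ]))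
               val (get (hn s) val [ r₀ ↦ 6 + pn ] [ 32 + pn ↦ 6 + pw ]) }
      where
      pn = get (rn s) yr
      pw = get (rn s) wr
      r₀ = get (hn s) crec pw
    spliceChildS s = record s
      { rn = put (rn s) t₂ 1
      ; rs = put (rs s) g₁ ℓ
      ; hn = put (put (put (put (hn s) croot (get (hn s) croot [ pn ↦ r₁ ])) left (get (hn s) left [ r₁ ↦ 0 ]))
               right′ (get (hn s) right′ [ r₁ ↦ 0 ])) lev (get (hn s) lev [ r₁ ↦ 1 ])
      ; hs = put (put (hs s) key (get (hs s) key [ r₁ ↦ ℓ ])) slab (get (hs s) slab [ pn ↦ ℓ ]) }
      where
      pn = get (rn s) yr
      r₁ = get (rn s) t₁
      ℓ  = get (hs s) slab (get (rn s) xr)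

    spliceAboveS spliceBelowS : Str → HState → HState
    spliceAboveS t s = record s
      { rn = put (put (rn s) t₁ (get (hn s) len (get (rn s) vr))) t₂ (plusSign t)
      ; hn = put (put (hn s) down (get (hn s) down [ pn ↦ get (hn s) down (get (rn s) wr) ]))
               plus′ (get (hn s) plus′ [ pn ↦ plusSign t ]) }
      where pn = get (rn s) yr
    spliceBelowS u s = record s
      { rn = put (put (rn s) t₁ (get (hn s) len (get (rn s) xr))) t₂ (plusSign u)
      ; hn = put (hn s) plus′ (get (hn s) plus′ [ get (rn s) wr ↦ plusSign u ]) }

    spliceEdgeT : ∀ s → Block (get (rn s) yr) → Block (get (rn s) wr) →
      Block (get (hn s) crec (get (rn s) wr)) → Block (32 + get (rn s) yr) →
      Triple spliceEdge s 21 (_≡ spliceEdgeS s)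
    spliceEdgeT s bn bw b₀ b₁ =
      ld⟩ bw $ st⟩ bn $ inc⟩ (inSpace {6} (m≤m+n 7 25) bn) $ st⟩ b₀ $
      inc⟩ (inSpace {0} (s≤s z≤n) b₁) $ st⟩ bw $ inc⟩ (inSpace {6} (m≤m+n 7 25) bw) $ st⟩ b₁ $ nop⟩ refl

    spliceChildT : ∀ s → Block (get (rn s) yr) → Block (get (rn s) xr) → Block (get (rn s) t₁) →
      Triple spliceChild s 22 (_≡ spliceChildS s)
    spliceChildT s bn bx b₁ =
      ldS⟩ bx $ stS⟩ b₁ $ stS⟩ bn $ st⟩ bn $ st0⟩ b₁ $ st0⟩ b₁ $ lit⟩ $ st⟩ b₁ $ nop⟩ refl

    spliceAboveT : ∀ s t → Block (get (rn s) yr) → Block (get (rn s) wr) → Block (get (rn s) vr) →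
      get (hn s) len (get (rn s) vr) ≡ get (rn s) above + suc (length t) → get (hn s) len (get (rn s) vr) < space →
      Triple spliceAbove s 17 (_≡ spliceAboveS t s)
    spliceAboveT s t bn bw bv eq bound =
      ld⟩ bw $ st⟩ bn $ ld⟩ bv $ mov⟩ $ flagT _ t eq bound ⟫ λ { refl → st⟩ bn $ nop⟩ refl }

    spliceBelowT : ∀ s u → Block (get (rn s) xr) → Block (get (rn s) wr) → Block (get (rn s) vr) →
      get (hn s) len (get (rn s) xr) ≡ get (hn s) len (get (rn s) vr) + suc (length u) →
      get (hn s) len (get (rn s) xr) < space →
      Triple spliceBelow s 13 (_≡ spliceBelowS u s)
    spliceBelowT s u bx bw bv eq bound =
      ld⟩ bx $ ld⟩ bv $ flagT _ u eq bound ⟫ λ { refl → st⟩ bw $ nop⟩ refl }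

    module _ {ss : List Str} {ns : NodeList} {F : Fields} (world : World ss ns F)
             {b c : Symbol} {v x u z : Str} {pv pw d f g : ℕ} {S : Shape} where
      open World world

      -- Register contents enter as variables with equations. Matching these replaces them by the
      -- ghost values for which `Create` and `Splice` are stated.
      growWorld : ∀ {pn ℓb ℓc} → pn ≡ newN ns → ℓb ≡ letter b → ℓc ≡ letter c →
        (v , pv) ∈ ns → v ∈ ss → (b ∷ x , pw) ∈ ns → x ≡ v ++ c ∷ u → ¬ In ns (b ∷ v) →
        Child ns z (b ∷ x) → z ≺ b ∷ v → (∀ {t} → In ns t → b ∷ v ≺ t → b ∷ x ≼ t) →
        Room ((b ∷ v , newN ns) ∷ ns) →
        (∀ {e t} → b ∷ v ≡ z ++ e ∷ t → f ≡ plusSign t) → g ≡ plusSign u →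
        Dict S (keyₕ F [ pn ↦ ℓb ]) d (λ q → q ≡ pn ⊎ WLink ns v q) →
        (∀ q → q ≢ pn → ¬ WLink ns v q → Same (treesₕ F) S q) →
        World ss ((b ∷ v , newN ns) ∷ ns) (spliced (created F pn pv ℓb d S) pn pw ℓc f g)
      growWorld refl refl refl v∈ v∈ss w∈ x≡ new z↑ z≺ under room f≡ g≡ dict same = record
        { links = Splice.links C.links (C.children children) room new w∈ z↑ z≺ x≡ under f≡ g≡
        ; children = Splice.children C.links (C.children children) room new w∈ z↑ z≺ x≡ under f≡ g≡
        ; spine = spine-splice spine (λ x∈ → new (_ , x∈)) (λ x∈ eq → addrN≢new ns (address links x∈) (sym eq))
                    v∈ss w∈ x≡ under }
        where module C = Create links v∈ b new dict same

    Regs : Tup ℕ #num → Tup ℕ 8 → ℕ → ℕ → ℕ → ℕ → Tup ℕ #num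
    Regs r j y n x₁ x₂ = put (put (put (put (retemps j r) yr y) next n) t₁ x₁) t₂ x₂

    record Grown (s : HState) (ss : List Str) (e : Str) (ns : NodeList) (s′ : HState) : Set where
      field
        world : World ss ((e , newN ns) ∷ ns) (fieldsOf s′)
        next≡ : get (rn s′) next ≡ newN ((e , newN ns) ∷ ns)
        yr≡   : get (rn s′) yr ≡ newN ns
        regs≡ : ∃ λ j → ∃₂ λ y n → ∃₂ λ x₁ x₂ → rn s′ ≡ Regs (rn s) j y n x₁ x₂
        syms≡ : ∃₂ λ w w′ → rs s′ ≡ put (put (rs s) sx w) g₁ w′
        wnext≡ : ∀ q → q ≢ newN ns → get (hn s′) wnext q ≡ get (hn s) wnext q

    -- Prepending b carries the path from v to the type-1 node x over to the path from `b ∷ v` to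
    -- `b ∷ x`. The label and the + sign of the lower half of the split edge are therefore read off
    -- from v and x, and those of the upper half from the old edge and from `above`.
    growT : ∀ s {ss ns b c v x u z} → World ss ns (fieldsOf s) →
      (v , get (rn s) vr) ∈ ns → v ∈ ss →
      (x , get (rn s) xr) ∈ ns → x ≡ v ++ c ∷ u → get (hs s) slab (get (rn s) xr) ≡ letter c →
      (b ∷ x , get (rn s) wr) ∈ ns → ¬ In ns (b ∷ v) →
      Child ns z (b ∷ x) → z ≺ b ∷ v → get (rn s) above ≡ length z →
      (∀ {t} → In ns t → b ∷ v ≺ t → b ∷ x ≼ t) →
      get (rn s) next ≡ newN ns → get (rs s) sk ≡ letter b → Room ((b ∷ v , newN ns) ∷ ns) → Short ns →
      Triple grow s (114 + 293 * Λ) (Grown s ss (b ∷ v) ns)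
    growT s {ss} {ns} {b} {c} {v} {x} {u} {z} world v∈ v∈ss x∈ x≡ slab≡ w∈ new z↑ z≺ above≡ under next≡ sk≡ room short
      with ≺⇒++ z≺
    ... | e , t , y≡ =
      weaken (≤-reflexive time) $
      createT s links v∈ new next≡ sk≡ room short ⟫ continue
      where
      open World world
      pn = get (rn s) next
      pv = get (rn s) vr
      px = get (rn s) xr
      pw = get (rn s) wr
      ns′ : NodeList
      ns′ = (b ∷ v , newN ns) ∷ ns
      isBlock : ∀ {y p} → (y , p) ∈ ns → Block p
      isBlock y∈ = blockN ns′ room (addrN-wk ns (b ∷ v , newN ns) (address links y∈))
      bn : Block pn
      bn = subst Block (sym next≡) (blockN ns′ room (addrN-new ns (b ∷ v , newN ns)))
      bw = isBlock w∈
      bx = isBlock x∈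
      bv = isBlock v∈
      b₁ : Block (32 + pn)
      b₁ = subst (λ p → Block (32 + p)) (sym next≡) (blockR ns′ room (addrR-new ns (b ∷ v , newN ns)))
      b₀ : Block (get (hn s) crec pw)
      b₀ = blockR ns′ room (addrR-wk ns (b ∷ v , newN ns) (crecAt children w∈))
      old≢ : ∀ {y p} → (y , p) ∈ ns → pn ≢ p
      old≢ y∈ eq = addrN≢new ns (address links y∈) (trans (sym eq) next≡)
      len-v = lenOk links v∈
      len-x = lenOk links x∈
      x-length : length x ≡ length v + suc (length u)
      x-length = trans (cong length x≡) (length-++ v)
      time : (41 + 293 * Λ) + 73 ≡ 114 + 293 * Λ
      time = +-comm (41 + 293 * Λ) 73
      len-same : ∀ {y p n} → (y , p) ∈ ns → (get (hn s) len [ pn ↦ n ]) p ≡ suc (length y)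
      len-same y∈ = trans (↦-other (get (hn s) len) (old≢ y∈)) (lenOk links y∈)
      flag₁ : ∀ {n} → (get (hn s) len [ pn ↦ n ]) pv ≡ get (rn s) above + suc (length t)
      flag₁ = trans (len-same v∈) (trans (trans (cong length y≡) (length-++ z)) (cong (_+ suc (length t)) (sym above≡)))
      flag₂ : ∀ {n} → (get (hn s) len [ pn ↦ n ]) px ≡ (get (hn s) len [ pn ↦ n ]) pv + suc (length u)
      flag₂ = trans (len-same x∈) (trans (cong suc x-length) (cong (_+ suc (length u)) (sym (len-same v∈))))
      len< : ∀ {y p n} → (y , p) ∈ ns → (get (hn s) len [ pn ↦ n ]) p < space
      len< {y} y∈ = subst (_< space) (sym (len-same y∈)) (≤-trans (m≤n+m (2 + length y) 2) (short (_ , y∈)))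
      continue : ∀ {s₁} → Created s v ns s₁ → Triple splice s₁ 73 (Grown s ss (b ∷ v) ns)
      continue (j , w , U , S , refl , dict , same) =
        spliceEdgeT _ bn bw b₀ b₁ ⟫ λ { refl →
        spliceChildT _ bn bx b₁ ⟫ λ { refl →
        spliceAboveT _ t bn bw bv flag₁ (len< v∈) ⟫ λ { refl →
        mapT (λ { refl → record
          { world = growWorld world next≡ sk≡ slab≡ v∈ v∈ss w∈ x≡ new z↑ z≺ under room
              (λ {e′} {t′} eq → cong plusSign (∷-injectiveʳ (++-cancelˡ z (e ∷ t) (e′ ∷ t′) (trans (sym y≡) eq)))) refl dict same
          ; next≡ = trans (cong (64 +_) next≡) (nodeAddr-suc (length ns))
          ; yr≡ = next≡
          ; regs≡ = j , _ , _ , _ , _ , refl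
          ; syms≡ = _ , _ , refl
          ; wnext≡ = λ q q≢ → ↦-other (get (hn s) wnext) (λ eq → q≢ (trans (sym eq) next≡)) } })
        (spliceBelowT _ u bx bw bv flag₂ (len< x∈)) }}}

  open Growth

  -- Attaching the new leaf

  module Leaves where

    open Shape

    open Fields
    open Links
    open Children
    open Spine

    module _ {ss : List Str} {ns : NodeList} {F : Fields} (world : World ss ns F)
             {b : Symbol} {v : Str} {pv d : ℕ} {S : Shape} where
      open World world

      createWorld : ∀ {pn ℓb} → pn ≡ newN ns → ℓb ≡ letter b → (v , pv) ∈ ns → ¬ In ns (b ∷ v) →
        Dict S (keyₕ F [ pn ↦ ℓb ]) d (λ q → q ≡ pn ⊎ WLink ns v q) →
        (∀ q → q ≢ pn → ¬ WLink ns v q → Same (treesₕ F) S q) →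
        Links ((b ∷ v , newN ns) ∷ ns) (created F pn pv ℓb d S) × Children ns (created F pn pv ℓb d S)
      createWorld refl refl v∈ new dict same =
        let module C = Create links v∈ b new dict same in C.links , C.children children

      leafWorld : ∀ {c h u ph d′ f S′ pn ℓb ℓc} → pn ≡ newN ns → ℓb ≡ letter b → ℓc ≡ letter c →
        Links ((b ∷ v , newN ns) ∷ ns) (created F pn pv ℓb d S) × Children ns (created F pn pv ℓb d S) →
        v ∈ ss → ¬ In ns (b ∷ v) → (h , ph) ∈ ns → h ∈ ss → b ∷ v ≡ h ++ c ∷ u →
        (∀ {t} → In ns t → t ≺ b ∷ v → t ≼ h) → (∀ {t} → In ns t → ¬ b ∷ v ≺ t) → f ≡ plusSign u →
        Dict S′ (keyₕ (created F pn pv ℓb d S) [ 32 + pn ↦ ℓc ]) d′ (λ q → q ≡ 32 + pn ⊎ IsCrec ns (created F pn pv ℓb d S) h q) →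
        (∀ q → q ≢ 32 + pn → ¬ IsCrec ns (created F pn pv ℓb d S) h q → Same S S′ q) →
        World ((b ∷ v) ∷ ss) ((b ∷ v , newN ns) ∷ ns) (attached (created F pn pv ℓb d S) pn ph ℓc f d′ S′)
      leafWorld refl refl refl (lk , ch) v∈ss new h∈ h∈ss l≡ nearest below f≡ dict same = record
        { links = A.links
        ; children = A.children
        ; spine = spine-attach spine refl v∈ss (λ l∈ → new (_ , l∈)) (λ x∈ eq → addrN≢new ns (address links x∈) (sym eq))
                    h∈ss h∈ l≡ nearest below }
        where module A = Attach lk ch h∈ l≡ nearest below new f≡ dict same

    attachEdgeS : HState → HState
    attachEdgeS s = record s
      { rn = put (put (rn s) t₁ (32 + pn)) t₂ (6 + pn)
      ; hn = put (put (put (put (hn s) crec (get (hn s) crec [ pn ↦ 32 + pn ])) val (get (hn s) val [ 32 + pn ↦ 6 + pn ]))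
               sp (get (hn s) sp [ pn ↦ get (rn s) hr ])) down (get (hn s) down [ pn ↦ pn ])
      ; hs = put (put (hs s) key (get (hs s) key [ 32 + pn ↦ ℓ ])) slab (get (hs s) slab [ pn ↦ ℓ ]) }
      where
      pn = get (rn s) yr
      ℓ  = get (rs s) lab
    attachPlusS : Str → HState → HState
    attachPlusS u s = record s
      { rn = put (put (put (rn s) t₃ (get (rn s) t₁)) t₁ (get (hn s) len (get (rn s) vr))) t₂ (plusSign u)
      ; hn = put (hn s) plus′ (get (hn s) plus′ [ get (rn s) yr ↦ plusSign u ]) }

    attachEdgeT : ∀ s → Block (get (rn s) yr) → Block (32 + get (rn s) yr) → Triple attachEdge s 22 (_≡ attachEdgeS s)
    attachEdgeT s bn b₁ =
      inc⟩ (inSpace {0} (s≤s z≤n) b₁) $ st⟩ bn $ inc⟩ (inSpace {6} (m≤m+n 7 25) bn) $ st⟩ b₁ $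
      stS⟩ b₁ $ stS⟩ bn $ st⟩ bn $ st⟩ bn $ nop⟩ refl

    attachPlusT : ∀ s u → Block (get (rn s) yr) → Block (get (rn s) ur) → Block (get (rn s) vr) →
      get (hn s) len (get (rn s) vr) ≡ get (hn s) len (get (rn s) ur) + suc (length u) →
      get (hn s) len (get (rn s) vr) < space → Triple attachPlus s 14 (_≡ attachPlusS u s)
    attachPlusT s u bn bu bv eq bound =
      mov⟩ $ ld⟩ bu $ ld⟩ bv $ flagT _ u eq bound ⟫ λ { refl → st⟩ bn $ nop⟩ refl }

    beforeChildS : HState → HState
    beforeChildS s = record s
      { rn = put (put (rn s) cur (get (hn s) croot (get (rn s) hr))) top (get (rn s) t₃)
      ; rs = put (rs s) sk (get (rs s) lab) }

    attachChildS : HState → Tup ℕ 8 → Word → (ℕ → ℕ) → Shape → HState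
    attachChildS s j w U S = record s₁
      { rs = put (rs s₁) sk (get (rs s) inp)
      ; hn = put (hn s₁) croot (get (hn s₁) croot [ get (rn s) yr ↦ 0 ] [ get (rn s) hr ↦ get j ttop ]) }
      where s₁ = reshape (setUp (retemp (beforeChildS s) j w) U) S

    attachChildT : ∀ s {c M} → Dict (shapeOf s) (keys s) (get (hn s) croot (get (rn s) hr)) M →
      Block (get (rn s) yr) → Block (get (rn s) hr) → get (rs s) lab ≡ letter c → NullOk (shapeOf s) →
      Block (get (rn s) t₃) → get (rn s) t₃ ≢ 0 → keys s (get (rn s) t₃) ≡ letter c →
      (∀ q → M q → keys s q ≢ letter c) →
      Triple attachChild s (12 + 293 * Λ) (λ s′ → ∃₂ λ j w → ∃₂ λ U S → s′ ≡ attachChildS s j w U S ×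
        Dict S (keys s) (get j ttop) (λ q → q ≡ get (rn s) t₃ ⊎ M q) ×
        (∀ q → q ≢ get (rn s) t₃ → ¬ M q → Same (shapeOf s) S q))
    attachChildT s d bn bh lab≡ nul b₃ t₃≢0 k≡ fresh =
      weaken (≤-reflexive (cong (5 +_) (+-comm (293 * Λ) 7))) $
      movS⟩ $ ld⟩ bh $ mov⟩ $
      insertInT (beforeChildS s) d lab≡ nul b₃ t₃≢0 k≡ fresh ⟫ λ { (j , w , U , S , refl , rest) →
      st0⟩ bn $ st⟩ bh $ movS⟩ $ nop⟩ (j , w , U , S , refl , rest) }

    record Leafed (s : HState) (ss : List Str) (l : Str) (ns : NodeList) (s′ : HState) : Set where
      field
        world : World (l ∷ ss) ((l , newN ns) ∷ ns) (fieldsOf s′)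
        next≡ : get (rn s′) next ≡ newN ((l , newN ns) ∷ ns)
        yr≡   : get (rn s′) yr ≡ newN ns
        regs≡ : ∃ λ j → ∃₂ λ y n → ∃₂ λ x₁ x₂ → ∃ λ x₃ → rn s′ ≡ put (Regs (rn s) j y n x₁ x₂) t₃ x₃
        syms≡ : ∃ λ w → rs s′ ≡ put (put (rs s) sx w) sk (get (rs s) inp)

    -- The register `ur` is consulted only for its stored length, which equals the length of h even
    -- when the climb failed and `ur` is null. That no node lies below h in direction c makes the
    -- key new in the dictionary of h.
    addLeafT : ∀ s {ss ns b c v h u} → World ss ns (fieldsOf s) →
      (v , get (rn s) vr) ∈ ns → v ∈ ss → (h , get (rn s) hr) ∈ ns → h ∈ ss →
      ¬ In ns (b ∷ v) → b ∷ v ≡ h ++ c ∷ u →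
      (∀ {t} → In ns t → t ≺ b ∷ v → t ≼ h) → (∀ {t} → In ns t → ¬ b ∷ v ≺ t) → (∀ {t} → ¬ In ns (h ++ c ∷ t)) →
      Block (get (rn s) ur) → get (rn s) ur ≢ newN ns → get (hn s) len (get (rn s) ur) ≡ length h →
      get (rs s) lab ≡ letter c → get (rn s) next ≡ newN ns → get (rs s) sk ≡ letter b →
      Room ((b ∷ v , newN ns) ∷ ns) → Short ns →
      Triple addLeaf s (89 + 586 * Λ) (Leafed s ss (b ∷ v) ns)
    addLeafT s {ss} {ns} {b} {c} {v} {h} {u} world v∈ v∈ss h∈ h∈ss new l≡ nearest below fresh bu ur≢ ur-len lab≡ next≡ sk≡ room short =
      weaken (≤-reflexive time) $
      createT s links v∈ new next≡ sk≡ room short ⟫ continue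
      where
      open World world
      pn = get (rn s) next
      e : Str × ℕ
      e = b ∷ v , newN ns
      ns′ : NodeList
      ns′ = e ∷ ns
      bn : Block pn
      bn = subst Block (sym next≡) (blockN ns′ room (addrN-new ns e))
      b₁ : Block (32 + pn)
      b₁ = subst (λ p → Block (32 + p)) (sym next≡) (blockR ns′ room (addrR-new ns e))
      bv = blockN ns′ room (addrN-wk ns e (address links v∈))
      bh = blockN ns′ room (addrN-wk ns e (address links h∈))
      old≢ : ∀ {y p} → (y , p) ∈ ns → pn ≢ p
      old≢ y∈ eq = addrN≢new ns (address links y∈) (trans (sym eq) next≡)
      rec≢ : ∀ {r} → AddrR ns r → 32 + pn ≢ r
      rec≢ a eq = addrR≢new ns a (trans (sym eq) (cong (32 +_) next≡))
      len-v : ∀ {n} → (get (hn s) len [ pn ↦ n ]) (get (rn s) vr) ≡ suc (length v)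
      len-v = trans (↦-other (get (hn s) len) (old≢ v∈)) (lenOk links v∈)
      flag : ∀ {n} → (get (hn s) len [ pn ↦ n ]) (get (rn s) vr) ≡ (get (hn s) len [ pn ↦ n ]) (get (rn s) ur) + suc (length u)
      flag = trans len-v (trans (trans (cong length l≡) (length-++ h))
        (cong (_+ suc (length u)) (sym (trans (↦-other (get (hn s) len) (λ eq → ur≢ (trans (sym eq) next≡))) ur-len))))
      time : (41 + 293 * Λ) + (22 + (14 + (12 + 293 * Λ))) ≡ 89 + 586 * Λ
      time = trans (+-assoc 41 (293 * Λ) (48 + 293 * Λ)) (cong (41 +_) (trans (sym (+-assoc (293 * Λ) 48 (293 * Λ)))
        (trans (cong (_+ 293 * Λ) (+-comm (293 * Λ) 48)) (cong (48 +_) (sym (*-distribʳ-+ Λ 293 293))))))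
      continue : ∀ {s₁} → Created s v ns s₁ → Triple attach s₁ (22 + (14 + (12 + 293 * Λ))) (Leafed s ss (b ∷ v) ns)
      continue (j , w , U , S , refl , dict , same) =
        attachEdgeT _ bn b₁ ⟫ λ { refl →
        attachPlusT _ u bn bu bv flag (subst (_< space) (sym len-v) (≤-trans (m≤n+m (2 + length v) 2) (short (_ , v∈)))) ⟫ λ { refl →
        mapT (λ { (j′ , w′ , U′ , S′ , refl , dict′ , same′) → record
          { world = leafWorld world next≡ sk≡ lab≡ cw v∈ss new h∈ h∈ss l≡ nearest below refl dict′ same′
          ; next≡ = trans (cong (64 +_) next≡) (nodeAddr-suc (length ns))
          ; yr≡ = next≡
          ; regs≡ = j′ , _ , _ , _ , _ , _ , refl
          ; syms≡ = _ , refl } })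
        (attachChildT _ child bn bh lab≡ (nullTrees (proj₁ cw)) b₁ (λ ()) (trans (↦-same (keyₕ F₁) (32 + pn)) lab≡) fresh′) }}
        where
        F₁ = created (fieldsOf s) pn (get (rn s) vr) (get (rs s) sk) (get j ttop) S
        cw : Links ns′ F₁ × Children ns F₁
        cw = createWorld world next≡ sk≡ v∈ new dict same
        child : Dict S (keyₕ F₁ [ 32 + pn ↦ get (rs s) lab ]) (get (hn s) croot (get (rn s) hr)) (IsCrec ns F₁ h)
        child = dict-frame (cdict (proj₂ cw) h∈) (λ _ _ → refl , refl , refl)
          (λ q m → ↦-other (keyₕ F₁) (rec≢ (isCrec-addr (proj₂ cw) m)))
        fresh′ : ∀ q → IsCrec ns F₁ h q → (keyₕ F₁ [ 32 + pn ↦ get (rs s) lab ]) q ≢ letter c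
        fresh′ q m@(t , p , h↑t , t∈ , refl) k≡ with ≺⇒++ (proj₁ (proj₂ h↑t))
        ... | c′ , u′ , refl
          with letter-injective (trans (sym (trans (↦-other (keyₕ F₁) (rec≢ (isCrec-addr (proj₂ cw) m))) (proj₁ (edge (proj₂ cw) h↑t t∈)))) k≡)
        ... | refl = fresh (p , t∈)

  open Leaves

  -- The climb to the lowest Weiner link

  module Climbing where

    open Shape

    open Fields
    open Links
    open Children
    open Spine

    -- Climb a v i o: a climb from v in search of a Weiner link with the letter
    -- a takes i steps and ends at o, or leaves the tree if o is nothing.
    data Climb (ns : NodeList) (ss : List Str) (a : Symbol) : Str → ℕ → Maybe Str → Set where
      found  : ∀ {v} → In ns (a ∷ v) → Climb ns ss a v 1 (just v)
      exhausted : ¬ In ns (a ∷ []) → Climb ns ss a [] 1 nothing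
      higher : ∀ {v y i o} → ¬ In ns (a ∷ v) → Nearest (_∈ ss) y v → Climb ns ss a y i o → Climb ns ss a v (suc i) o

    ClimbRegs : HState → Tup ℕ 8 → ℕ → ℕ → Tup ℕ #num
    ClimbRegs s j H U = put (put (put (rn (retemp s j (num 0))) hr H) ur U) vr 0

    Reached : NodeList → Symbol → Str → Word → Maybe Str → Word → ℕ → ℕ → Set
    Reached ns a v ℓ nothing  ℓ′ H U = H ≡ 0 × U ≡ 0
    Reached ns a v ℓ (just u) ℓ′ H U = (a ∷ u , H) ∈ ns × (u , U) ∈ ns ×
      ((v ≡ u × ℓ′ ≡ ℓ) ⊎ (∃₂ λ c t → v ≡ u ++ c ∷ t × ℓ′ ≡ letter c))

    Climbed : HState → NodeList → Symbol → Str → Maybe Str → HState → Set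
    Climbed s ns a v o s′ = ∃₂ λ j w → ∃₂ λ H U → ∃ λ ℓ →
      s′ ≡ record s { rn = ClimbRegs s j H U ; rs = put (put (rs s) sx w) lab ℓ } ×
      Reached ns a v (get (rs s) lab) o ℓ H U

    Linked? : NodeList → Symbol → Str → HState → HState → Set
    Linked? ns a x s s′ = ∃₂ λ j w → s′ ≡ retemp s j w ×
      ((¬ In ns (a ∷ x) × get j tres ≡ 0) ⊎ (a ∷ x , get j tres) ∈ ns)

    link⟩ : ∀ {s ns a x d b Q} → Links ns (fieldsOf s) → (x , get (rn s) vr) ∈ ns → get (rs s) sk ≡ letter a → Room ns →
      (∀ {s′} → Linked? ns a x s s′ → Triple d s′ b Q) →
      Triple (ld cur wroot vr ⨟ find ⨟ d) s (3 + (38 * Λ + b)) Q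
    link⟩ {s} {ns} {a} {x} links x∈ sk≡ room k =
      ld⟩ (blockN ns room (address links x∈)) $ findT _ (wdict links x∈) sk≡ ⟫ λ p → k (finish p)
      where
      s₁ = record s { rn = put (rn s) cur (get (hn s) wroot (get (rn s) vr)) }
      finish : ∀ {s′} → (∃₂ λ j w → s′ ≡ retemp s₁ j w × FoundIn (keys s₁) a (WLink ns x) (get j tres)) → Linked? ns a x s s′
      finish (j , w , refl , inj₁ (r≡ , none)) = j , w , refl , inj₁ ((λ { (q , m) → none q (a , m) (keyOk links m) }) , r≡)
      finish (j , w , refl , inj₂ ((b , m) , k≡)) with letter-injective (trans (sym (keyOk links m)) k≡)
      ... | refl = j , w , refl , inj₂ m

    private
      bodyTime : 3 + (38 * Λ + 7) ≡ 10 + 38 * Λ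
      bodyTime = cong (3 +_) (+-comm (38 * Λ) 7)

    missedS : HState → Tup ℕ 8 → Word → HState
    missedS s j w = record s
      { rn = put (rn (retemp s j w)) vr (get (hn s) sp (get (rn s) vr))
      ; rs = put (put (rs s) sx w) lab (get (hs s) slab (get (rn s) vr)) }

    module _ {ns ss a v} (s : HState) (world : World ss ns (fieldsOf s)) (v∈ : (v , get (rn s) vr) ∈ ns)
             (sk≡ : get (rs s) sk ≡ letter a) (room : Room ns) where
      open World world

      Missed Hit : HState → Set
      Missed s′ = ∃₂ λ j w → s′ ≡ missedS s j w
      Hit s′ = ∃₂ λ j w → ∃ λ H → s′ ≡ record s { rn = ClimbRegs s j H (get (rn s) vr) ; rs = put (rs s) sx w } ×
        (a ∷ v , H) ∈ ns

      missT : ¬ In ns (a ∷ v) → Triple climbBody s (10 + 38 * Λ) Missed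
      missT ¬av = weaken (≤-reflexive bodyTime) $ link⟩ links v∈ sk≡ room λ where
        (j , w , refl , inj₂ av∈) → ⊥-elim (¬av (_ , av∈))
        (j , w , refl , inj₁ (_ , r≡0)) → else⟩ (isZero r≡0) $
          ldS⟩ (blockN ns room (address links v∈)) $ ld⟩ (blockN ns room (address links v∈)) $ nop⟩ (j , w , refl)

      hitT : In ns (a ∷ v) → Triple climbBody s (10 + 38 * Λ) Hit
      hitT av = weaken (≤-reflexive bodyTime) $ link⟩ links v∈ sk≡ room λ where
        (j , w , refl , inj₁ (¬av , _)) → ⊥-elim (¬av av)
        (j , w , refl , inj₂ av∈) → weaken (m≤m+n 4 3) $ then⟩ (isNonzero (addrN≢0 ns (address links av∈))) $
          mov⟩ $ mov⟩ $ lit⟩ $ nop⟩ (j , w , _ , refl , av∈)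

    climbLoop : ∀ {ns ss a v i o} → Climb ns ss a v i o → ∀ s → World ss ns (fieldsOf s) →
      (v , get (rn s) vr) ∈ ns → v ∈ ss → get (rs s) sk ≡ letter a → get (rn s) hr ≡ 0 → get (rn s) ur ≡ 0 → Room ns →
      Triple (loop (nonzero vr) climbBody) s (1 + (11 + 38 * Λ) * i) (Climbed s ns a v o)
    climbLoop {ns} (found av) s world v∈ v∈ss sk≡ hr≡ ur≡ room = weaken (loop≤ {10 + 38 * Λ} {0} ≤-refl) $
      again⟩ (isNonzero (addrN≢0 ns (address links v∈))) (hitT s world v∈ sk≡ room av) λ where
        (j , w , H , refl , H∈) → weaken (m≤m+n 1 _) $ exit⟩ (isZero refl)
          (j , w , H , _ , _ , refl , H∈ , v∈ , inj₁ (refl , refl))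
      where open World world
    climbLoop {ns} {ss} (exhausted ¬a) s world v∈ v∈ss sk≡ hr≡ ur≡ room = weaken (loop≤ {10 + 38 * Λ} {0} ≤-refl) $
      again⟩ (isNonzero (addrN≢0 ns (address links v∈))) (missT s world v∈ sk≡ room ¬a) λ where
        (j , w , refl) → weaken (m≤m+n 1 _) $ exit⟩ (isZero (sp≡0 (spOk spine v∈ss v∈)))
          (j , w , _ , _ , _ ,
            cong (λ z → record s { rn = put (rn (retemp s j w)) vr z
                                 ; rs = put (put (rs s) sx w) lab (get (hs s) slab (get (rn s) vr)) })
                 (sp≡0 (spOk spine v∈ss v∈)) , hr≡ , ur≡)
      where
      open World world
      sp≡0 : SpOk ss ns (get (hn s) sp) (get (hs s) slab) [] (get (rn s) vr) → get (hn s) sp (get (rn s) vr) ≡ 0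
      sp≡0 (inj₁ (_ , eq)) = eq
      sp≡0 (inj₂ ([] , _ , _ , () , _))
    climbLoop {ns} {ss} {a} {v} {o = o} (higher {y = y} {i} ¬av near c) s world v∈ v∈ss sk≡ hr≡ ur≡ room =
      weaken (loop≤ {10 + 38 * Λ} {i} ≤-refl) $
      again⟩ (isNonzero (addrN≢0 ns (address links v∈))) (missT s world v∈ sk≡ room ¬av) λ where
        (j , w , refl) → mapT (finish {j} {w}) (climbLoop c (missedS s j w) world (proj₁ parent) (proj₁ near) sk≡ hr≡ ur≡ room)
      where
      open World world
      pv = get (rn s) vr
      parent : (y , get (hn s) sp pv) ∈ ns × (∃₂ λ c u → v ≡ y ++ c ∷ u × get (hs s) slab pv ≡ letter c)
      parent with spOk spine v∈ss v∈
      ... | inj₁ (refl , _) = ⊥-elim (none near)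
        where
        none : ¬ Nearest (_∈ ss) y []
        none (_ , () , _)
      ... | inj₂ (y′ , c , u , v≡ , near′ , y∈ , lab≡) with nearest-unique near near′
      ...   | refl = y∈ , c , u , v≡ , lab≡
      finish : ∀ {j w s′} → Climbed (missedS s j w) ns a y o s′ → Climbed s ns a v o s′
      finish (j′ , w′ , H , U , ℓ , refl , reached) = j′ , w′ , H , U , ℓ , refl , extend o reached
        where
        extend : ∀ o → Reached ns a y (get (hs s) slab pv) o ℓ H U → Reached ns a v (get (rs s) lab) o ℓ H U
        extend nothing  r = r
        extend (just u) (H∈ , U∈ , inj₁ (refl , ℓ≡)) with parent
        ... | _ , c , t , v≡ , lab≡ = H∈ , U∈ , inj₂ (c , t , v≡ , trans ℓ≡ lab≡)
        extend (just u) (H∈ , U∈ , inj₂ (c , t , y≡ , ℓ≡)) with parent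
        ... | _ , c′ , t′ , v≡ , _ =
          H∈ , U∈ , inj₂ (c , t ++ c′ ∷ t′ , trans v≡ (trans (cong (_++ c′ ∷ t′) y≡) (++-assoc u (c ∷ t) (c′ ∷ t′))) , ℓ≡)

  open Climbing

  -- Space: the nodes fit into the memory

  module Invariants where

    open Shape

    open Fields
    open Links
    open Children
    open Spine

    _≟*_ : DecidableEquality Str
    _≟*_ = ≡-dec (OrderedAlphabet._≟_ Σ)

    -- The text W is a parameter of its own: during an update it stays T until the new leaf is made,
    -- and is `a ∷ T` from then on.
    record Sane (W : Str) (ns : NodeList) : Set where
      field
        unique : AllPairs (λ e e′ → proj₁ e ≢ proj₁ e′) ns
        occurs : ∀ {x} → In ns x → Occ x W

    module Bounds {W : Str} {ss : List Str} {ns : NodeList} {F : Fields} (W≤ : length W ≤ n) (ss≤ : length ss ≤ 1 + 2 * n)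
             (world : World ss ns F) (sane : Sane W ns) where
      open World world
      open Sane sane

      private
        Covered : Str → Set
        Covered x = x ∈ ss ⊎ (∃₂ λ b v → x ≡ b ∷ v × v ∈ ss × Occ x W)

        covered : ∀ {x} → In ns x → Covered x
        covered {[]}    _          = inj₁ (rootS spine)
        covered {b ∷ v} (p , bv∈) = inj₂ (b , v , refl , tailS spine bv∈ , occurs (p , bv∈))

        count : ∀ ms → AllPairs (λ e e′ → proj₁ e ≢ proj₁ e′) ms → (∀ {x} → In ms x → Covered x) → length ms ≤ 1 + 3 * n
        count ms distinct cover = begin
          length ms              ≡⟨ length-map proj₁ ms ⟨
          length (map proj₁ ms)  ≤⟨ capacity closed _≟*_ W (map proj₁ ms) (AllPairs.map⁺ distinct)
                                      (λ x∈ → let e , e∈ , eq = ∈-map⁻ proj₁ x∈ in subst Covered (sym eq) (cover (_ , e∈))) ⟩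
          length ss + length W   ≤⟨ +-mono-≤ ss≤ W≤ ⟩
          1 + 2 * n + n          ≡⟨ cong suc (+-comm (2 * n) n) ⟩
          1 + 3 * n              ∎
          where
          open ≤-Reasoning
          closed : ∀ {b v} → b ∷ v ∈ ss → v ∈ ss
          closed bv∈ = tailS spine (proj₂ (incl spine bv∈))

        room-of : ∀ ms → length ms ≤ 1 + 3 * n → Room ms
        room-of ms bound = ≤-trans (s≤s (*-monoˡ-≤ 2 (s≤s bound))) enough

      size-bound : length ns ≤ 1 + 3 * n
      size-bound = count ns unique covered

      room : Room ns
      room = room-of ns size-bound

      short : Short ns
      short {x} x∈ = begin-strict
        3 + length x          ≤⟨ +-monoʳ-≤ 3 (≤-trans (occ-length (occurs x∈)) W≤) ⟩
        3 + n                 ≤⟨ s≤s (+-monoʳ-≤ 2 (m≤m+n n (n + (n + 0)))) ⟩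
        1 + (2 + 3 * n)       ≤⟨ +-monoˡ-≤ (2 + 3 * n) {1} {2 + 3 * n} (s≤s z≤n) ⟩
        (2 + 3 * n) + (2 + 3 * n) ≡⟨ trans (cong ((2 + 3 * n) +_) (sym (+-identityʳ (2 + 3 * n)))) (*-comm 2 (2 + 3 * n)) ⟩
        (2 + 3 * n) * 2       <⟨ enough ⟩
        blocks                ≤⟨ m≤m*n blocks 32 ⟩
        blocks * 32           ≤⟨ fits ⟩
        space                 ∎
        where
        open ≤-Reasoning

      module _ {b : Symbol} {v : Str} {p : ℕ} (new : ¬ In ns (b ∷ v)) (v∈ : v ∈ ss) (o : Occ (b ∷ v) W) where

        sane-cons : Sane W ((b ∷ v , p) ∷ ns)
        sane-cons = record
          { unique = All.tabulate (λ e∈ eq → new (_ , subst (λ x → (x , _) ∈ ns) (sym eq) e∈)) ∷ unique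
          ; occurs = λ { (_ , here refl) → o ; (q , there x∈) → occurs (q , x∈) } }

        room-cons : Room ((b ∷ v , p) ∷ ns)
        room-cons = room-of ((b ∷ v , p) ∷ ns) (count ((b ∷ v , p) ∷ ns) (Sane.unique sane-cons)
          λ { (_ , here refl) → inj₂ (b , v , refl , v∈ , o) ; (q , there x∈) → covered (q , x∈) })

  open Invariants

  -- Redirecting the targets above a new type-1 node

  module Promotion where

    open Shape

    open Fields
    open Links
    open Children
    open Spine

    -- A walk from v that redirects the targets of the nodes between P and a ∷ v.
    data Redirect (ss : List Str) (a : Symbol) (P : Str) : Str → ℕ → Set where
      stop : ∀ {v} → P ≡ a ∷ v → Redirect ss a P v 1
      last : P ≡ [] → Redirect ss a P [] 1
      more : ∀ {v y i} → P ≺ a ∷ v → Nearest (_∈ ss) y v → Redirect ss a P y i → Redirect ss a P v (suc i)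

    data RedirectFrom (ss : List Str) (a : Symbol) (P : Str) : Str → ℕ → Set where
      bottom : P ≡ [] → RedirectFrom ss a P [] 0
      from   : ∀ {u v i} → Nearest (_∈ ss) v u → Redirect ss a P v i → RedirectFrom ss a P u i

    -- One step of the walk: the nodes strictly below x down to h have been treated, and the write
    -- to x extends this range up to P, since no node lies strictly between P and x.
    retarget-step : ∀ {ns P x h q ph D D′} → (∀ {x p q} → (x , p) ∈ ns → (x , q) ∈ ns → p ≡ q) →
      (∀ {x y p} → (x , p) ∈ ns → (y , p) ∈ ns → x ≡ y) →
      (x , q) ∈ ns → x ≼ h → P ≺ x → (∀ {y} → In ns y → P ≺ y → y ≺ x → ⊥) →
      Retargeted ns x h ph D D′ → Retargeted ns P h ph D (D′ [ q ↦ ph ])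
    retarget-step {x = x} {h} {q} {ph} {D} {D′} functional injective x∈ x≼h P≺x gap ret y p y∈ with q ≟ p
    ... | yes refl with injective y∈ x∈
    ...   | refl = inj₁ (P≺x , x≼h , ↦-same D′ q)
    retarget-step {x = x} {h} {q} {ph} {D} {D′} functional injective x∈ x≼h P≺x gap ret y p y∈ | no q≢p with ret y p y∈
    ... | inj₁ (x≺y , y≼h , d≡) = inj₁ (≺-≼-trans P≺x (≺⇒≼ x≺y) , y≼h , trans (↦-other D′ q≢p) d≡)
    ... | inj₂ (out , d≡) = inj₂ (out′ , trans (↦-other D′ q≢p) d≡)
      where
      out′ : ¬ (_ ≺ y × y ≼ h)
      out′ (P≺y , y≼h) with compareUnder y≼h x≼h
      ... | inj₂ x≺y = out (x≺y , y≼h)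
      ... | inj₁ y≼x with ≼-split y≼x
      ...   | inj₁ refl = q≢p (functional x∈ y∈)
      ...   | inj₂ y≺x  = gap (_ , y∈) P≺y y≺x

    redirectedS : HState → Tup ℕ 8 → Word → ℕ → (ℕ → ℕ) → HState
    redirectedS s j w z D = record s
      { rn = put (put (rn (retemp s j w)) t₁ z) vr 0 ; rs = put (rs s) sx w ; hn = put (hn s) down D }

    -- The program cannot compare strings; it decides whether `a ∷ v` is still strictly below P by
    -- comparing its old target with C. Nodes strictly between P and h have target C, while P, being
    -- of type 1, is its own target. The look-up of `a ∷ v` cannot fail, because prefixes of h occur
    -- in the text and v is of type 1.
    module Redirecting {ns : NodeList} {ss : List Str} {a : Symbol} {P h : Str} {ph pC : ℕ} {D₀ S : ℕ → ℕ}
                       (room : Room ns) (tailS : ∀ {b x p} → (b ∷ x , p) ∈ ns → x ∈ ss) (ph∈ : (h , ph) ∈ ns)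
                       (P∈ : In ns P)
                       (between : ∀ {x p} → (x , p) ∈ ns → P ≺ x → x ≺ h → D₀ p ≡ pC)
                       (at : ∀ {p} → (P , p) ∈ ns → D₀ p ≢ pC)
                       (complete : ∀ {v} → v ∈ ss → a ∷ v ≼ h → In ns (a ∷ v))
                       (parent : ∀ {v p} → v ∈ ss → (v , p) ∈ ns → length v < length h →
                         (v ≡ [] × S p ≡ 0) ⊎ (∃ λ y → Nearest (_∈ ss) y v × (y , S p) ∈ ns)) where

      private
        redirectT : ∀ {v i} → Redirect ss a P v i → ∀ s → Links ns (fieldsOf s) → get (rn s) cr ≡ pC → get (rn s) hr ≡ ph →
          get (hn s) sp ≡ S → (v , get (rn s) vr) ∈ ns → v ∈ ss → a ∷ v ≺ h → get (rs s) sk ≡ letter a →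
          Retargeted ns (a ∷ v) h ph D₀ (get (hn s) down) →
          Triple (loop (nonzero vr) redirectBody) s (1 + (14 + 38 * Λ) * i)
            (λ s′ → ∃₂ λ j w → ∃₂ λ z D → s′ ≡ redirectedS s j w z D × Retargeted ns P h ph D₀ D)
        redirectT {v} plan s links cr≡ hr≡ sp≡ v∈ v∈ss av≺h sk≡ ret with complete v∈ss (≺⇒≼ av≺h)
        ... | q , av∈ = go plan
          where
          bv = blockN ns room (address links v∈)
          bq = blockN ns room (address links av∈)
          down-q : get (hn s) down q ≡ D₀ q
          down-q with ret (a ∷ v) q av∈
          ... | inj₁ (av≺av , _) = ⊥-elim (≺-irrefl av≺av)
          ... | inj₂ (_ , d≡) = d≡
          D′ = get (hn s) down [ q ↦ get (rn s) hr ]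
          stepS : Tup ℕ 8 → Word → HState
          stepS j w = record s
            { rn = put (put (rn (retemp s j w)) t₁ (get (hn s) down q)) vr (get (hn s) sp (get (rn s) vr))
            ; rs = put (rs s) sx w ; hn = put (hn s) down D′ }
          stepT : P ≺ a ∷ v → Triple redirectBody s (13 + 38 * Λ) (λ s′ → ∃₂ λ j w → s′ ≡ stepS j w)
          stepT P≺ = weaken (≤-reflexive (cong (3 +_) (+-comm (38 * Λ) 10))) $ link⟩ links v∈ sk≡ room
            λ { (j , w , refl , inj₁ (¬av , _)) → ⊥-elim (¬av (_ , av∈))
              ; (j , w , refl , inj₂ av∈′) → test⟩ j w (functional links av∈′ av∈) }
            where
            test⟩ : ∀ j w → get j tres ≡ q →
              Triple (ld t₁ down res ⨟ test (eqN t₁ cr) (st down res hr ⨟ ld vr sp vr ⨟ nop) (lit vr 0 ⨟ nop))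
                (retemp s j w) 10 (λ s′ → ∃₂ λ j w → s′ ≡ stepS j w)
            test⟩ j@(⟪ _ , _ , _ , _ , _ , _ , _ , _ , _ ⟫) w refl = ld⟩ bq $
              then⟩ (isEq (trans down-q (trans (between av∈ P≺ av≺h) (sym cr≡)))) $ st⟩ bq $ ld⟩ bv $ nop⟩ (j , w , refl)
          stopT : P ≡ a ∷ v → Triple redirectBody s (13 + 38 * Λ)
            (λ s′ → ∃₂ λ j w → ∃ λ z → s′ ≡ redirectedS s j w z (get (hn s) down))
          stopT P≡ = weaken (≤-trans (≤-reflexive (cong (3 +_) (+-comm (38 * Λ) 5))) (+-monoˡ-≤ (38 * Λ) (m≤m+n 8 5))) $
            link⟩ links v∈ sk≡ room
            λ { (j , w , refl , inj₁ (¬av , _)) → ⊥-elim (¬av (_ , av∈))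
              ; (j , w , refl , inj₂ av∈′) → test⟩ j w (functional links av∈′ av∈) }
            where
            test⟩ : ∀ j w → get j tres ≡ q →
              Triple (ld t₁ down res ⨟ test (eqN t₁ cr) (st down res hr ⨟ ld vr sp vr ⨟ nop) (lit vr 0 ⨟ nop))
                (retemp s j w) 5 (λ s′ → ∃₂ λ j w → ∃ λ z → s′ ≡ redirectedS s j w z (get (hn s) down))
            test⟩ j@(⟪ _ , _ , _ , _ , _ , _ , _ , _ , _ ⟫) w refl = ld⟩ bq $
              else⟩ (isNeq λ eq → at (subst (λ x → (x , q) ∈ ns) (sym P≡) av∈) (trans (sym down-q) (trans eq cr≡))) $
              lit⟩ $ nop⟩ (j , w , _ , refl)
          ret′ : ∀ {P′} → P′ ≺ a ∷ v → (∀ {y} → In ns y → P′ ≺ y → y ≺ a ∷ v → ⊥) → Retargeted ns P′ h ph D₀ D′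
          ret′ P≺ gap = subst (λ p → Retargeted ns _ h ph D₀ (get (hn s) down [ q ↦ p ])) (sym hr≡)
            (retarget-step (functional links) (injective links) av∈ (≺⇒≼ av≺h) P≺ gap ret)
          nonzero-v = addrN≢0 ns (address links v∈)
          go : ∀ {i} → Redirect ss a P v i → Triple (loop (nonzero vr) redirectBody) s (1 + (14 + 38 * Λ) * i)
            (λ s′ → ∃₂ λ j w → ∃₂ λ z D → s′ ≡ redirectedS s j w z D × Retargeted ns P h ph D₀ D)
          go (stop P≡) = weaken (loop≤ {13 + 38 * Λ} {0} ≤-refl) $ again⟩ (isNonzero nonzero-v) (stopT P≡)
            λ { (j , w , z , refl) → weaken (m≤m+n 1 _) $ exit⟩ (isZero refl)
              (j , w , z , _ , refl , subst (λ x → Retargeted ns x h ph D₀ (get (hn s) down)) (sym P≡) ret) }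
          go (last refl) = weaken (loop≤ {13 + 38 * Λ} {0} ≤-refl) $ again⟩ (isNonzero nonzero-v) (stepT [])
            λ { (j , w , refl) → weaken (m≤m+n 1 _) $ exit⟩ (isZero sp0)
              (j , w , _ , _ , cong (λ p → record (stepS j w) { rn = put (rn (stepS j w)) vr p }) sp0 , ret′ [] gap) }
            where
            sp0 : get (hn s) sp (get (rn s) vr) ≡ 0
            sp0 with parent v∈ss v∈ (≤-trans (n≤1+n _) (≺-length av≺h))
            ... | inj₁ (_ , S≡) = trans (cong (λ f → f (get (rn s) vr)) sp≡) S≡
            ... | inj₂ (_ , (_ , () , _) , _)
            gap : ∀ {y} → In ns y → [] ≺ y → y ≺ a ∷ [] → ⊥
            gap _ () []
            gap _ _ (_ ∷ ())
          go (more {y = y} {i} P≺ near plan) = weaken (loop≤ {13 + 38 * Λ} {i} ≤-refl) $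
            again⟩ (isNonzero nonzero-v) (stepT P≺)
              λ { (j , w , refl) → mapT (λ { (j′ , w′ , z , D , refl , r) → j′ , w′ , z , D , refl , r }) $
                redirectT plan (stepS j w)
                  (links-frame links (λ _ _ → refl , refl , refl) (λ _ _ → refl) refl refl refl refl refl)
                  cr≡ hr≡ sp≡ y∈ (proj₁ near) (≺-≼-trans (a ∷ proj₁ (proj₂ near)) (≺⇒≼ av≺h)) sk≡
                  (ret′ (a ∷ proj₁ (proj₂ near)) gap) }
            where
            y∈ : (y , get (hn s) sp (get (rn s) vr)) ∈ ns
            y∈ with parent v∈ss v∈ (≤-trans (n≤1+n _) (≺-length av≺h))
            ... | inj₁ (refl , _) = ⊥-elim (none near)
              where
              none : ¬ Nearest (_∈ ss) y []
              none (_ , () , _)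
            ... | inj₂ (y′ , near′ , y′∈) with nearest-unique near near′
            ...   | refl = subst (λ f → (y , f (get (rn s) vr)) ∈ ns) (sym sp≡) y′∈
            gap : ∀ {x} → In ns x → a ∷ y ≺ x → x ≺ a ∷ v → ⊥
            gap (p , x∈) (_ ∷ y≺x) (_ ∷ x≺v) = ≺-irrefl (≺-≼-trans y≺x (proj₂ (proj₂ near) (tailS x∈) x≺v))

      redirectAllT : ∀ {u i} → RedirectFrom ss a P u i → h ≡ a ∷ u → P ≺ h → ∀ s → Links ns (fieldsOf s) →
        get (rn s) cr ≡ pC → get (rn s) hr ≡ ph → get (hn s) sp ≡ S → (u , get (rn s) ur) ∈ ns → u ∈ ss →
        get (rs s) sk ≡ letter a → get (hn s) down ≡ D₀ [ ph ↦ ph ] →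
        Triple redirect s (4 + (14 + 38 * Λ) * i)
          (λ s′ → ∃₂ λ j w → ∃₂ λ z D → s′ ≡ redirectedS s j w z D × Retargeted ns P h ph D₀ D)
      redirectAllT {u} plan refl P≺h s links cr≡ hr≡ sp≡ u∈ u∈ss sk≡ down≡ = ld⟩ (blockN ns room (address links u∈)) $ go plan
        where
        s₁ = record s { rn = put (rn s) vr (get (hn s) sp (get (rn s) ur)) }
        initially : ∀ {P′} → P′ ≺ h → (∀ {y} → In ns y → P′ ≺ y → y ≺ h → ⊥) → Retargeted ns P′ h ph D₀ (get (hn s) down)
        initially P≺ gap = subst (Retargeted ns _ h ph D₀) (sym down≡)
          (retarget-step (functional links) (injective links) ph∈ ≼-refl P≺ gap
            λ _ _ _ → inj₂ ((λ { (h≺x , x≼h) → ≺-irrefl (≺-≼-trans h≺x x≼h) }) , refl))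
        go : ∀ {i} → RedirectFrom ss a P u i → Triple (loop (nonzero vr) redirectBody) s₁ (1 + (14 + 38 * Λ) * i)
          (λ s′ → ∃₂ λ j w → ∃₂ λ z D → s′ ≡ redirectedS s j w z D × Retargeted ns P h ph D₀ D)
        go (bottom refl) = weaken (m≤m+n 1 _) $ exit⟩ (isZero sp0)
          (temps s , get (rs s) sx , get (rn s) t₁ , get (hn s) down ,
           cong (λ p → record s₁ { rn = put (rn s₁) vr p }) sp0 , initially [] gap)
          where
          sp0 : get (hn s) sp (get (rn s) ur) ≡ 0
          sp0 with parent u∈ss u∈ (s≤s z≤n)
          ... | inj₁ (_ , S≡) = trans (cong (λ f → f (get (rn s) ur)) sp≡) S≡
          ... | inj₂ (_ , (_ , () , _) , _)
          gap : ∀ {y} → In ns y → [] ≺ y → y ≺ a ∷ [] → ⊥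
          gap _ () []
          gap _ _ (_ ∷ ())
        go (from {v = v} near plan) = mapT (λ { (j , w , z , D , refl , r) → j , w , z , D , refl , r }) $
          redirectT plan s₁ links cr≡ hr≡ sp≡ v∈ (proj₁ near) (a ∷ proj₁ (proj₂ near)) sk≡ (initially (a ∷ proj₁ (proj₂ near)) gap)
          where
          v∈ : (v , get (hn s) sp (get (rn s) ur)) ∈ ns
          v∈ with parent u∈ss u∈ (s≤s ≤-refl)
          ... | inj₁ (refl , _) = ⊥-elim (none near)
            where
            none : ¬ Nearest (_∈ ss) v []
            none (_ , () , _)
          ... | inj₂ (y′ , near′ , y′∈) with nearest-unique near near′
          ...   | refl = subst (λ f → (v , f (get (rn s) ur)) ∈ ns) (sym sp≡) y′∈
          gap : ∀ {x} → In ns x → a ∷ v ≺ x → x ≺ h → ⊥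
          gap (p , x∈) (_ ∷ v≺x) (_ ∷ x≺u) = ≺-irrefl (≺-≼-trans v≺x (proj₂ (proj₂ near) (tailS x∈) x≺u))

  open Promotion

  -- Copying Weiner links to a new type-1 node

  module Duplication where

    open Shape

    open Fields
    open Links
    open Children
    open Spine

    AllRegs : Tup ℕ #num → Tup ℕ 8 → ℕ → ℕ → ℕ → ℕ → ℕ → ℕ → Tup ℕ #num
    AllRegs r j y m x₁ x₂ q q′ = put (put (Regs r j y m x₁ x₂) wr q) qr q′

    AllSyms : Tup Word #sym → Word → Word → Word → Tup Word #sym
    AllSyms r w w′ k = put (put (put r sk k) sx w) g₁ w′

    record Duplicated (s : HState) (ss : List Str) (h C : Str) (ns : NodeList) (l : List ℕ) (W : Str) (s′ : HState) : Set where
      field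
        nodes  : NodeList
        world  : World ss nodes (fieldsOf s′)
        sane   : Sane W nodes
        next≡  : get (rn s′) next ≡ newN nodes
        regs≡  : ∃ λ j → ∃₂ λ y m → ∃₂ λ x₁ x₂ → ∃₂ λ q q′ → rn s′ ≡ AllRegs (rn s) j y m x₁ x₂ q q′
        syms≡  : ∃₂ λ w w′ → ∃ λ k → rs s′ ≡ AllSyms (rs s) w w′ k
        larger : ∀ {x p} → (x , p) ∈ ns → (x , p) ∈ nodes
        only   : ∀ {x} → In nodes x → In ns x ⊎ (∃ λ b → x ≡ b ∷ h × In ns (b ∷ C))
        all    : ∀ {b q} → q ∈ l → (b ∷ C , q) ∈ ns → In nodes (b ∷ h)
        size   : length nodes ≡ length l + length ns

    -- Inside the text every occurrence of h extends to C, so the letters of the Weiner links due to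
    -- h are those of C. The new node `b ∷ h` lies on the edge from `b ∷ P` to `b ∷ C`, as P, h and
    -- C are consecutive type-1 nodes.
    module Duplicate {ss : List Str} {W h C P u : Str} {c : Symbol}
                     (W≤ : length W ≤ n) (ss≤ : length ss ≤ 1 + 2 * n)
                     (h∈ss : h ∈ ss) (C∈ss : C ∈ ss) (C≡ : C ≡ h ++ c ∷ u) (below-h : ∀ {t} → t ∈ ss → h ≺ t → C ≼ t)
                     (near-C : Nearest (_∈ ss) h C) (near-h : Nearest (_∈ ss) P h) where

      record Pending (ns : NodeList) (l : List ℕ) (s : HState) : Set where
        field
          world    : World ss ns (fieldsOf s)
          sane     : Sane W ns
          next≡    : get (rn s) next ≡ newN ns
          h∈       : (h , get (rn s) vr) ∈ ns
          C∈       : (C , get (rn s) xr) ∈ ns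
          label    : get (hs s) slab (get (rn s) xr) ≡ letter c
          above≡   : get (rn s) above ≡ suc (length P)
          complete : ∀ {b} → In ns (b ∷ C) → In ns (b ∷ P)
          linked   : Linked (get (hn s) wnext) l (get (rn s) qr)
          distinct : Distinct l
          missing  : ∀ {q} → q ∈ l → ∃ λ b → (b ∷ C , q) ∈ ns × ¬ In ns (b ∷ h)

      record Grew (s : HState) (b : Symbol) (ns : NodeList) (s′ : HState) : Set where
        field
          world : World ss ((b ∷ h , newN ns) ∷ ns) (fieldsOf s′)
          next≡ : get (rn s′) next ≡ newN ((b ∷ h , newN ns) ∷ ns)
          regs≡ : ∃ λ j → ∃₂ λ y m → ∃₂ λ x₁ x₂ →
                  rn s′ ≡ AllRegs (rn s) j y m x₁ x₂ (get (rn s) qr) (get (hn s′) wnext (get (rn s) qr))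
          syms≡ : ∃₂ λ w w′ → ∃ λ k → rs s′ ≡ AllSyms (rs s) w w′ k
          wnext≡ : ∀ q → q ≢ newN ns → get (hn s′) wnext q ≡ get (hn s) wnext q

      bodyT : ∀ {ns l s q b} → Pending ns (q ∷ l) s → get (rn s) qr ≡ q → (b ∷ C , q) ∈ ns → ¬ In ns (b ∷ h) →
        Triple growAllBody s (121 + 293 * Λ) (Grew s b ns)
      bodyT {ns} {l} {s} {b = b} pending refl q∈ new = weaken (≤-reflexive (cong (4 +_) (+-comm (114 + 293 * Λ) 3))) $
        ldS⟩ bq $ mov⟩ $
        growT s₁
          world h∈ h∈ss C∈ C≡ label q∈ new parent (b ∷ proj₁ (proj₂ near-h)) above≡ under next≡ (keyOk links q∈)
          (room-cons {p = newN ns} new h∈ss occurs-bh) short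
        ⟫ finish
        where
        open Pending pending
        open World world
        open Bounds W≤ ss≤ world sane
        bq = blockN ns room (address links q∈)
        occurs-bh : Occ (b ∷ h) W
        occurs-bh = occ-prefix (b ∷ ≺⇒≼ (proj₁ (proj₂ near-C))) (Sane.occurs sane (_ , q∈))
        under : ∀ {t} → In ns t → b ∷ h ≺ t → b ∷ C ≼ t
        under (_ , t∈) (_ ∷ h≺t) = b ∷ below-h (tailS spine t∈) h≺t
        parent : Child ns (b ∷ P) (b ∷ C)
        parent = complete (_ , q∈) , (b ∷ ≺-≼-trans (proj₁ (proj₂ near-h)) (≺⇒≼ (proj₁ (proj₂ near-C)))) , max
          where
          max : ∀ {t} → In ns t → t ≺ b ∷ C → t ≼ b ∷ P
          max _ [] = []
          max (p , t∈) (_ ∷ t≺C) with ≼-split (proj₂ (proj₂ near-C) (tailS spine t∈) t≺C)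
          ... | inj₁ refl = ⊥-elim (new (p , t∈))
          ... | inj₂ t≺h  = b ∷ proj₂ (proj₂ near-h) (tailS spine t∈) t≺h
        s₁ = record s { rn = put (rn s) wr (get (rn s) qr) ; rs = put (rs s) sk (get (hs s) key (get (rn s) qr)) }
        finish : ∀ {s′} → Grown s₁ ss (b ∷ h) ns s′ → Triple (ld qr wnext qr ⨟ nop) s′ 3 (Grew s b ns)
        finish {s′} grown with Grown.regs≡ grown | Grown.syms≡ grown
        ... | j , y , m , x₁ , x₂ , r≡ | w , w′ , t≡ =
          ld⟩ (subst Block (sym q≡) bq) $ nop⟩ record
            { world = Grown.world grown ; next≡ = Grown.next≡ grown
            ; regs≡ = j , y , m , x₁ , x₂ , cong₂ (λ r q → put r qr (get (hn s′) wnext q)) r≡ q≡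
            ; syms≡ = w , w′ , _ , t≡ ; wnext≡ = Grown.wnext≡ grown }
          where
          q≡ : get (rn s′) qr ≡ get (rn s) qr
          q≡ = cong (λ r → get r qr) r≡

      allT : ∀ {ns l s} → Pending ns l s → Triple (loop (nonzero qr) growAllBody) s (1 + (122 + 293 * Λ) * length l)
        (Duplicated s ss h C ns l W)
      allT {ns} {[]} {s} pending with get (rn s) qr in qr≡ | Pending.linked pending
      ... | _ | [] = weaken (m≤m+n 1 _) $ exit⟩ (isZero qr≡) record
        { nodes = ns ; world = world ; sane = sane ; next≡ = next≡
        ; regs≡ = temps s , get (rn s) yr , get (rn s) next , get (rn s) t₁ , get (rn s) t₂ , get (rn s) wr , get (rn s) qr , refl
        ; syms≡ = _ , _ , _ , refl ; larger = λ x∈ → x∈ ; only = inj₁ ; all = λ () ; size = refl }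
        where open Pending pending
      allT {ns} {q ∷ l} {s} pending = weaken (loop≤ {121 + 293 * Λ} {length l} ≤-refl) $
        again⟩ (isNonzero λ eq → addrN≢0 ns (address links q∈) (trans (sym qr≡) eq)) (bodyT pending qr≡ q∈ new) continue
        where
        open Pending pending
        open World world
        open Bounds W≤ ss≤ world sane
        unlink : Linked (get (hn s) wnext) (q ∷ l) (get (rn s) qr) → get (rn s) qr ≡ q × Linked (get (hn s) wnext) l (get (hn s) wnext q)
        unlink (_ ∷ lk) = refl , lk
        qr≡ = proj₁ (unlink linked)
        b = proj₁ (missing (here refl))
        q∈ : (b ∷ C , q) ∈ ns
        q∈ = proj₁ (proj₂ (missing (here refl)))
        new : ¬ In ns (b ∷ h)
        new = proj₂ (proj₂ (missing (here refl)))
        occurs-bh : Occ (b ∷ h) W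
        occurs-bh = occ-prefix (b ∷ ≺⇒≼ (proj₁ (proj₂ near-C))) (Sane.occurs sane (_ , q∈))
        ns′ : NodeList
        ns′ = (b ∷ h , newN ns) ∷ ns
        old≢ : ∀ {x p} → (x , p) ∈ ns → p ≢ newN ns
        old≢ x∈ = addrN≢new ns (address links x∈)
        C≢h : C ≢ h
        C≢h refl = ≺-irrefl (proj₁ (proj₂ near-C))
        restrict : ∀ {b′ t} → t ≢ h → In ns′ (b′ ∷ t) → In ns (b′ ∷ t)
        restrict t≢h (_ , here refl) = ⊥-elim (t≢h refl)
        restrict t≢h (p , there t∈)  = p , t∈
        continue : ∀ {s′} → Grew s b ns s′ → Triple (loop (nonzero qr) growAllBody) s′ (1 + (122 + 293 * Λ) * length l)
          (Duplicated s ss h C ns (q ∷ l) W)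
        continue {s′} grew with Grew.regs≡ grew | Grew.syms≡ grew
        ... | j , y , m , x₁ , x₂ , r≡ | w , w′ , k , t≡ =
          mapT finish (allT {ns′} {l} record
            { world = world′
            ; sane = sane-cons new h∈ss occurs-bh
            ; next≡ = Grew.next≡ grew
            ; h∈ = subst (λ p → (h , p) ∈ ns′) (sym (cong (λ r → get r vr) r≡)) (there h∈)
            ; C∈ = C∈′
            ; label = label′
            ; above≡ = trans (cong (λ r → get r above) r≡) above≡
            ; complete = λ bC∈ → let p , bP∈ = complete (restrict C≢h bC∈) in p , there bP∈
            ; linked = subst (Linked (get (hn s′) wnext) l)
                (sym (trans (cong (λ r → get r qr) r≡) (trans (cong (get (hn s′) wnext) qr≡) (Grew.wnext≡ grew q (old≢ q∈)))))
                (linked-frame (proj₂ (unlink linked)) λ q′∈ → Grew.wnext≡ grew _ (old≢ (proj₁ (proj₂ (missing (there q′∈))))))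
            ; distinct = AllPairs.tail distinct
            ; missing = missing′ })
          where
          world′ = Grew.world grew
          C∈′ : (C , get (rn s′) xr) ∈ ns′
          C∈′ = subst (λ p → (C , p) ∈ ns′) (sym (cong (λ r → get r xr) r≡)) (there C∈)
          label′ : get (hs s′) slab (get (rn s′) xr) ≡ letter c
          label′ with spOk (World.spine world′) C∈ss C∈′
          ... | inj₁ (refl , _) = ⊥-elim (none near-C)
            where
            none : ¬ Nearest (_∈ ss) h []
            none (_ , () , _)
          ... | inj₂ (y , c′ , u′ , C≡′ , near , _ , lab≡) with nearest-unique near near-C
          ...   | refl = trans lab≡ (cong letter (proj₁ (∷-injective (++-cancelˡ h _ _ (trans (sym C≡′) C≡)))))
          missing′ : ∀ {q′} → q′ ∈ l → ∃ λ b′ → (b′ ∷ C , q′) ∈ ns′ × ¬ In ns′ (b′ ∷ h)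
          missing′ {q′} q′∈ with missing (there q′∈)
          ... | b′ , q′∈ns , new′ = b′ , there q′∈ns , λ where
            (_ , here refl) → All.lookup (AllPairs.head distinct) q′∈ (functional links q∈ q′∈ns)
            (p , there b′h∈) → new′ (p , b′h∈)
          finish : ∀ {s″} → Duplicated s′ ss h C ns′ l W s″ → Duplicated s ss h C ns (q ∷ l) W s″
          finish dup with Duplicated.regs≡ dup | Duplicated.syms≡ dup
          ... | j′ , y′ , m′ , x₁′ , x₂′ , q₁ , q₂ , r≡′ | w₁ , w₂ , k′ , t≡′ = record
            { nodes = D.nodes ; world = D.world ; sane = D.sane ; next≡ = D.next≡
            ; regs≡ = j′ , y′ , m′ , x₁′ , x₂′ , q₁ , q₂ , trans r≡′ (cong (λ r → AllRegs r j′ y′ m′ x₁′ x₂′ q₁ q₂) r≡)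
            ; syms≡ = w₁ , w₂ , k′ , trans t≡′ (cong (λ r → AllSyms r w₁ w₂ k′) t≡)
            ; larger = λ x∈ → D.larger (there x∈)
            ; only = only′
            ; all = all′
            ; size = trans D.size (+-suc (length l) (length ns)) }
            where
            module D = Duplicated dup
            only′ : ∀ {x} → In D.nodes x → In ns x ⊎ (∃ λ b → x ≡ b ∷ h × In ns (b ∷ C))
            only′ x∈ with D.only x∈
            ... | inj₁ (_ , here refl)  = inj₂ (b , refl , _ , q∈)
            ... | inj₁ (p , there x∈ns) = inj₁ (p , x∈ns)
            ... | inj₂ (b′ , eq , bC∈)  = inj₂ (b′ , eq , restrict C≢h bC∈)
            all′ : ∀ {b′ q′} → q′ ∈ q ∷ l → (b′ ∷ C , q′) ∈ ns → In D.nodes (b′ ∷ h)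
            all′ (there q′∈) bC∈ = D.all q′∈ (there bC∈)
            all′ (here refl) bC∈ with injective links bC∈ q∈
            ... | refl = newN ns , D.larger (here refl)

  open Duplication

  -- Splitting the edge to the new leaf

  module Paths where

    open Shape

    open Fields
    open Links
    open Children
    open Spine

    -- A climb from X that stops below the nodes of length at most k.
    data Path (ss : List Str) (k : ℕ) : Str → ℕ → Set where
      root   : Path ss k [] 0
      stop   : ∀ {X V} → Nearest (_∈ ss) V X → ¬ k < suc (length V) → Path ss k X 0
      higher : ∀ {X V i} → Nearest (_∈ ss) V X → k < suc (length V) → Path ss k V i → Path ss k X (suc i)

    none-above : ∀ {P : Str → Set} {V : Str} → ¬ Nearest P V []
    none-above (_ , () , _)

    module _ {ss : List Str} {T h : Str} {a : Symbol} (W≤ : length (a ∷ T) ≤ n) (ss≤ : length ss ≤ 1 + 2 * n)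
             (head : Head a T h) where
      open Head head using () renaming (prefix to h≼W; max to h-max)

      private
        W : Str
        W = a ∷ T

      -- X is the type-1 node treated last, and `a ∷ X` the newest node. `done` covers the type-1
      -- nodes from X down to T; `only` says that every node not made on this walk (or the leaf)
      -- still occurs in T, so that the edge above `a ∷ X` begins at h all the time.
      record Threaded (X : Str) (ns : NodeList) (s : HState) : Set where
        field
          world  : World ss ns (fieldsOf s)
          sane   : Sane W ns
          next≡  : get (rn s) next ≡ newN ns
          X∈     : (X , get (rn s) xr) ∈ ns
          X∈ss   : X ∈ ss
          X≼T    : X ≼ T
          aX∈    : (a ∷ X , get (rn s) wr) ∈ ns
          vr≡    : get (rn s) vr ≡ get (hn s) sp (get (rn s) xr)
          t₃≡    : get (rn s) t₃ ≡ get (hn s) len (get (rn s) vr)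
          above≡ : get (rn s) above ≡ length h
          sk≡    : get (rs s) sk ≡ letter a
          h∈     : In ns h
          only   : ∀ {t} → In ns t → Occ t T ⊎ (t ≼ W × a ∷ X ≼ t)
          done   : ∀ {v} → v ∈ ss → X ≼ v → v ≼ T → In ns (a ∷ v)

      record Finished (ns : NodeList) (s s′ : HState) : Set where
        field
          nodes  : NodeList
          world  : World ss nodes (fieldsOf s′)
          sane   : Sane W nodes
          next≡  : get (rn s′) next ≡ newN nodes
          tip≡   : get (rn s′) tip ≡ get (rn s) tip
          out≡   : get (rn s′) out ≡ get (rn s) out
          larger : ∀ {x p} → (x , p) ∈ ns → (x , p) ∈ nodes
          longer : length ns ≤ length nodes
          only   : ∀ {t} → In nodes t → Occ t T ⊎ t ≼ W
          done   : ∀ {v} → v ∈ ss → v ≼ T → In nodes (a ∷ v) ⊎ a ∷ v ≼ h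

      module _ {X : Str} {ns : NodeList} {s : HState} (threaded : Threaded X ns s) where
        open Threaded threaded
        open World world
        open Bounds W≤ ss≤ world sane

        finished : (∀ {v} → v ∈ ss → v ≺ X → length (a ∷ v) ≤ length h) → Finished ns s s
        finished upper = record
          { nodes = ns ; world = world ; sane = sane ; next≡ = next≡ ; tip≡ = refl ; out≡ = refl ; larger = λ x∈ → x∈ ; longer = ≤-refl
          ; only = λ t∈ → Sum.map₂ proj₁ (only t∈) ; done = done′ }
          where
          done′ : ∀ {v} → v ∈ ss → v ≼ T → In ns (a ∷ v) ⊎ a ∷ v ≼ h
          done′ {v} v∈ v≼T with compareUnder X≼T v≼T
          ... | inj₁ X≼v = inj₁ (done v∈ X≼v v≼T)
          ... | inj₂ v≺X with compareUnder (a ∷ v≼T) h≼W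
          ...   | inj₁ av≼h = inj₂ av≼h
          ...   | inj₂ h≺av = ⊥-elim (<-irrefl refl (≤-trans (≺-length h≺av) (upper v∈ v≺X)))

        parentOf : ∀ {V} → Nearest (_∈ ss) V X → (V , get (rn s) vr) ∈ ns × (∃₂ λ c u → X ≡ V ++ c ∷ u × get (hs s) slab (get (rn s) xr) ≡ letter c)
        parentOf near with spOk spine X∈ss X∈
        ... | inj₁ (refl , _) = ⊥-elim (none-above near)
        ... | inj₂ (y , c , u , X≡ , near′ , y∈ , lab≡) with nearest-unique near near′
        ...   | refl = subst (λ p → (y , p) ∈ ns) (sym vr≡) y∈ , c , u , X≡ , lab≡

        height-of : ∀ {V} → Nearest (_∈ ss) V X → get (rn s) t₃ ≡ suc (length V)
        height-of near = trans t₃≡ (lenOk links (proj₁ (parentOf near)))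

        module _ {V : Str} (near : Nearest (_∈ ss) V X) (long : length h < suc (length V)) where
          private
            V≺X = proj₁ (proj₂ near)
            V≼T : V ≼ T
            V≼T = ≼-trans (≺⇒≼ V≺X) X≼T
            longer : ∀ {t} → t ≼ W → length h < length t → h ≺ t
            longer t≼W h<t with compareUnder t≼W h≼W
            ... | inj₁ t≼h = ⊥-elim (<-irrefl refl (≤-trans h<t (≼-length t≼h)))
            ... | inj₂ h≺t = h≺t
            h≺aV : h ≺ a ∷ V
            h≺aV = longer (a ∷ V≼T) long
            absent : ¬ Occ (a ∷ V) T
            absent o = ≺-irrefl (≺-≼-trans h≺aV (h-max (a ∷ V≼T) o))
            new : ¬ In ns (a ∷ V)
            new aV∈ with only aV∈
            ... | inj₁ o = absent o
            ... | inj₂ (_ , _ ∷ X≼V) = ≺-irrefl (≺-≼-trans V≺X X≼V)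
            occurs : Occ (a ∷ V) W
            occurs = here (a ∷ V≼T)
            -- A node strictly above `a ∷ X` is an old one, hence occurs in T; being a prefix of
            -- `a ∷ T` too, it is a prefix of h.
            parent : Child ns h (a ∷ X)
            parent = h∈ , ≺-≼-trans h≺aV (a ∷ ≺⇒≼ V≺X) , max
              where
              max : ∀ {t} → In ns t → t ≺ a ∷ X → t ≼ h
              max t∈ t≺ with only t∈
              ... | inj₁ o = h-max (≼-trans (≺⇒≼ t≺) (a ∷ X≼T)) o
              ... | inj₂ (_ , aX≼t) = ⊥-elim (≺-irrefl (≺-≼-trans t≺ aX≼t))
            under : ∀ {t} → In ns t → a ∷ V ≺ t → a ∷ X ≼ t
            under t∈ aV≺t with only t∈
            ... | inj₁ o = ⊥-elim (absent (occ-prefix (≺⇒≼ aV≺t) o))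
            ... | inj₂ (_ , aX≼t) = aX≼t
            ns′ : NodeList
            ns′ = (a ∷ V , newN ns) ∷ ns

          growStepT : Triple growPathBody s (122 + 293 * Λ) (λ s′ → Threaded V ns′ s′ ×
            get (rn s′) tip ≡ get (rn s) tip × get (rn s′) out ≡ get (rn s) out)
          growStepT with parentOf near
          ... | V∈ , c , u , X≡ , lab≡ = weaken (≤-reflexive (+-comm (114 + 293 * Λ) 8)) $
            growT s world V∈ (proj₁ near) X∈ X≡ lab≡ aX∈ new parent h≺aV above≡ under next≡ sk≡
              (room-cons {p = newN ns} new (proj₁ near) occurs) short ⟫ finish
            where
            finish : ∀ {s′} → Grown s ss (a ∷ V) ns s′ →
              Triple (mov xr vr ⨟ mov wr yr ⨟ ld vr sp vr ⨟ ld t₃ len vr ⨟ nop) s′ 8 (λ s″ → Threaded V ns′ s″ ×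
                get (rn s″) tip ≡ get (rn s) tip × get (rn s″) out ≡ get (rn s) out)
            finish {s′} grown with Grown.regs≡ grown | Grown.syms≡ grown
            ... | j , y , m , x₁ , x₂ , r≡ | w , w′ , t≡ =
              mov⟩ $ mov⟩ $ ld⟩ (blockN ns′ room′ (address links′ V∈′)) $ ld⟩ sp-block $
              nop⟩ (record
                { world = world′
                ; sane = sane-cons new (proj₁ near) occurs
                ; next≡ = Grown.next≡ grown
                ; X∈ = V∈′
                ; X∈ss = proj₁ near
                ; X≼T = V≼T
                ; aX∈ = here (cong ((a ∷ V) ,_) (Grown.yr≡ grown))
                ; vr≡ = refl
                ; t₃≡ = refl
                ; above≡ = trans (cong (λ r → get r above) r≡) above≡
                ; sk≡ = trans (cong (λ r → get r sk) t≡) sk≡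
                ; h∈ = let p , h∈ns = h∈ in p , there h∈ns
                ; only = only′
                ; done = done′ } ,
                cong (λ r → get r tip) r≡ , cong (λ r → get r out) r≡)
              where
              world′ = Grown.world grown
              links′ = World.links world′
              room′ : Room ns′
              room′ = room-cons {p = newN ns} new (proj₁ near) occurs
              V∈′ : (V , get (rn s′) vr) ∈ ns′
              V∈′ = subst (λ p → (V , p) ∈ ns′) (sym (cong (λ r → get r vr) r≡)) (there V∈)
              sp-block : Block (get (hn s′) sp (get (rn s′) vr))
              sp-block with spOk (World.spine world′) (proj₁ near) V∈′
              ... | inj₁ (_ , sp≡0) = subst Block (sym sp≡0) (block0 (blockN ns′ room′ (address links′ V∈′)))
              ... | inj₂ (_ , _ , _ , _ , _ , y∈ , _) = blockN ns′ room′ (address links′ y∈)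
              only′ : ∀ {t} → In ns′ t → Occ t T ⊎ (t ≼ W × a ∷ V ≼ t)
              only′ (_ , here refl) = inj₂ (a ∷ V≼T , ≼-refl)
              only′ (p , there t∈) with only (p , t∈)
              ... | inj₁ o = inj₁ o
              ... | inj₂ (t≼W , aX≼t) = inj₂ (t≼W , ≼-trans (a ∷ ≺⇒≼ V≺X) aX≼t)
              done′ : ∀ {v} → v ∈ ss → V ≼ v → v ≼ T → In ns′ (a ∷ v)
              done′ v∈ V≼v v≼T with ≼-split V≼v
              ... | inj₁ refl = _ , here refl
              ... | inj₂ V≺v with compareUnder X≼T v≼T
              ...   | inj₁ X≼v = let p , av∈ = done v∈ X≼v v≼T in p , there av∈
              ...   | inj₂ v≺X = ⊥-elim (≺-irrefl (≺-≼-trans V≺v (proj₂ (proj₂ near) v∈ v≺X)))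

      growPathT : ∀ {X i} → Path ss (length h) X i → ∀ {ns s} → Threaded X ns s →
        Triple (loop (ltN above t₃) growPathBody) s (1 + (123 + 293 * Λ) * i) (Finished ns s)
      growPathT root {ns} {s} th = weaken (m≤m+n 1 _) $ exit⟩ (isNlt absurd) (finished th λ { _ () })
        where
        open Threaded th
        t₃≡0 : get (rn s) t₃ ≡ 0
        t₃≡0 with spOk (World.spine world) X∈ss X∈
        ... | inj₁ (_ , sp≡0) = trans t₃≡ (trans (cong (get (hn s) len) (trans vr≡ sp≡0)) (nullLen (World.links world)))
        ... | inj₂ (_ , _ , _ , _ , near , _) = ⊥-elim (none-above near)
        absurd : ¬ get (rn s) above < get (rn s) t₃
        absurd lt with subst (get (rn s) above <_) t₃≡0 lt
        ... | ()
      growPathT (stop {V = V} near short) {s = s} th = weaken (m≤m+n 1 _) $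
        exit⟩ (isNlt λ lt → short (subst₂ _<_ above≡ (height-of th near) lt))
          (finished th λ v∈ v≺X → ≤-trans (s≤s (≼-length (proj₂ (proj₂ near) v∈ v≺X))) (≮⇒≥ short))
        where open Threaded th
      growPathT (higher {V = V} {i} near long path) {s = s} th = weaken (loop≤ {122 + 293 * Λ} {i} ≤-refl) $
        again⟩ (isLt (subst₂ _<_ (sym above≡) (sym (height-of th near)) long)) (growStepT th near long)
          λ { (th′ , tip≡ , out≡) → mapT (extend tip≡ out≡) (growPathT path th′) }
        where
        open Threaded th
        extend : ∀ {s′ s″ ns′ e} → get (rn s′) tip ≡ get (rn s) tip → get (rn s′) out ≡ get (rn s) out →
          Finished (e ∷ ns′) s′ s″ → Finished ns′ s s″
        extend tip≡ out≡ f = record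
          { nodes = F.nodes ; world = F.world ; sane = F.sane ; next≡ = F.next≡
          ; tip≡ = trans F.tip≡ tip≡ ; out≡ = trans F.out≡ out≡ ; larger = λ x∈ → F.larger (there x∈)
          ; longer = ≤-trans (n≤1+n _) F.longer
          ; only = F.only ; done = F.done }
          where module F = Finished f

  open Paths

  -- Turning h into a type-1 node

  module Promoting where

    open Shape

    open Fields
    open Links
    open Children
    open Spine

    promoteS : HState → HState
    promoteS s = record s
      { rn = put (rn s) pr (get (hn s) sp (get (rn s) cr))
      ; rs = put (put (rs s) g₁ (get (hs s) slab (get (rn s) hr))) g₂ (get (hs s) slab (get (rn s) cr))
      ; hn = put (put (hn s) sp (get (hn s) sp [ ph ↦ get (hn s) sp pC ] [ pC ↦ ph ])) down (get (hn s) down [ ph ↦ ph ])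
      ; hs = put (hs s) slab (get (hs s) slab [ ph ↦ get (hs s) slab pC ] [ pC ↦ get (hs s) slab ph ]) }
      where
      ph = get (rn s) hr
      pC = get (rn s) cr

    promoteHeadT : ∀ s → Block (get (rn s) hr) → Block (get (rn s) cr) → Triple promoteHead s 24 (_≡ promoteS s)
    promoteHeadT s bh bC = ld⟩ bC $ ldS⟩ bh $ ldS⟩ bC $ stS⟩ bh $ stS⟩ bC $ st⟩ bh $ st⟩ bC $ st⟩ bh $ nop⟩ refl

    record Promoted (s : HState) (ss : List Str) (T h : Str) (a : Symbol) (ns : NodeList) (m : ℕ) (s′ : HState) : Set where
      field
        nodes    : NodeList
        world    : World (h ∷ ss) nodes (fieldsOf s′)
        sane     : Sane T nodes
        next≡    : get (rn s′) next ≡ newN nodes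
        tip≡     : get (rn s′) tip ≡ get (rn s) tip
        out≡     : get (rn s′) out ≡ get (rn s) out
        hr≡      : get (rn s′) hr ≡ get (rn s) hr
        ur≡      : get (rn s′) ur ≡ get (rn s) ur
        sk≡      : get (rs s′) sk ≡ letter a
        inp≡     : get (rs s′) inp ≡ letter a
        lab≡     : get (rs s′) lab ≡ get (rs s) lab
        larger   : ∀ {x p} → (x , p) ∈ ns → (x , p) ∈ nodes
        complete : ∀ {b v} → Occ (b ∷ v) T → v ∈ h ∷ ss → In nodes (b ∷ v)
        size     : length nodes ≡ m + length ns

    module _ {ss : List Str} {T u C : Str} {a c : Symbol} {t : Str} {ns : NodeList} (s : HState)
             (T≤ : length T ≤ n) (ss≤ : length ((a ∷ u) ∷ ss) ≤ 1 + 2 * n)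
             (world : World ss ns (fieldsOf s)) (sane : Sane T ns) (next≡ : get (rn s) next ≡ newN ns)
             (complete : ∀ {b v} → Occ (b ∷ v) T → v ∈ ss → In ns (b ∷ v))
             (suffixes : ∀ {x} → Suff x T → x ∈ ss)
             (h∈ : (a ∷ u , get (rn s) hr) ∈ ns) (h∉ : a ∷ u ∉ ss) (u∈ : (u , get (rn s) ur) ∈ ns)
             (C∈ : (C , get (rn s) cr) ∈ ns) (target : Target ss (a ∷ u) C) (C≡ : C ≡ (a ∷ u) ++ c ∷ t)
             (h-label : get (hs s) slab (get (rn s) hr) ≡ letter c)
             (sk≡ : get (rs s) sk ≡ letter a) (inp≡ : get (rs s) inp ≡ letter a) where

      open World world
      open Sane sane

      private
        h : Str
        h = a ∷ u
        ph = get (rn s) hr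
        pC = get (rn s) cr
        h≺C : h ≺ C
        h≺C = subst (h ≺_) (sym C≡) (≺-++ h)
        bounded : length ss ≤ 1 + 2 * n
        bounded = ≤-trans (n≤1+n _) ss≤
        open Bounds T≤ bounded world sane using (room)
        bh = blockN ns room (address links h∈)
        bC = blockN ns room (address links C∈)

      items-of : List ℕ
      items-of = WList.items (wlist links C∈)

      promoteT : ∀ {P e t′ i} → Nearest (_∈ ss) P C → (P , get (hn s) sp pC) ∈ ns → C ≡ P ++ e ∷ t′ →
        get (hs s) slab pC ≡ letter e →
        RedirectFrom ss a P u i →
        Triple promote s (38 + (14 + 38 * Λ) * i + (122 + 293 * Λ) * length items-of) (Promoted s ss T h a ns (length items-of))
      promoteT {P} {e} {t′} {i} P-near P∈ C≡′ C-label plan = weaken (≤-reflexive time) $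
        promoteHeadT s bh bC ⟫ λ { refl →
        R.redirectAllT plan refl P≺h (promoteS s)
          (links-frame links (λ _ _ → refl , refl , refl) (λ _ _ → refl) refl refl refl refl refl)
          refl refl refl u∈ (tailS spine h∈) sk≡ refl ⟫ after }
        where
        S′ = get (hn s) sp [ ph ↦ get (hn s) sp pC ] [ pC ↦ ph ]
        P≺C = proj₁ (proj₂ P-near)
        P≺h : P ≺ h
        P≺h with compareUnder (≺⇒≼ h≺C) (≺⇒≼ P≺C)
        ... | inj₁ h≼P = ⊥-elim (≺-irrefl (≺-≼-trans P≺C (proj₂ (proj₂ target) (proj₁ P-near) h≼P)))
        ... | inj₂ P≺h = P≺h
        between : ∀ {x p} → (x , p) ∈ ns → P ≺ x → x ≺ h → get (hn s) down p ≡ pC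
        between x∈ P≺x x≺h with downOk spine x∈
        ... | z , (z∈ , x≼z , min) , zp∈ , _ with ≼-split (min (proj₁ target) (≺⇒≼ (≺-≼-trans x≺h (≺⇒≼ h≺C))))
        ...   | inj₁ refl = functional links zp∈ C∈
        ...   | inj₂ z≺C = ⊥-elim (≺-irrefl (≺-≼-trans P≺x (≼-trans x≼z (proj₂ (proj₂ P-near) z∈ z≺C))))
        at : ∀ {p} → (P , p) ∈ ns → get (hn s) down p ≢ pC
        at P∈′ d≡ with downOk spine P∈′
        ... | z , tg , zp∈ , _ with target-self (proj₁ P-near) tg
        ...   | refl with injective links (subst (λ p → (P , p) ∈ ns) d≡ zp∈) C∈
        ...     | refl = ≺-irrefl P≺C
        S-old : ∀ {v p} → v ∈ ss → (v , p) ∈ ns → length v < length h → S′ p ≡ get (hn s) sp p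
        S-old {v} {p} v∈ vp∈ v<h = trans (↦-other (get (hn s) sp [ ph ↦ get (hn s) sp pC ]) pC≢p) (↦-other (get (hn s) sp) ph≢p)
          where
          pC≢p : pC ≢ p
          pC≢p refl = <-irrefl refl (<-trans (subst (λ x → length x < length h) (injective links vp∈ C∈) v<h) (≺-length h≺C))
          ph≢p : ph ≢ p
          ph≢p refl = h∉ (subst (_∈ ss) (injective links vp∈ h∈) v∈)
        parent : ∀ {v p} → v ∈ ss → (v , p) ∈ ns → length v < length h →
          (v ≡ [] × S′ p ≡ 0) ⊎ (∃ λ y → Nearest (_∈ ss) y v × (y , S′ p) ∈ ns)
        parent {v} {p} v∈ vp∈ v<h with spOk spine v∈ vp∈
        ... | inj₁ (v≡ , s≡) = inj₁ (v≡ , trans (S-old v∈ vp∈ v<h) s≡)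
        ... | inj₂ (y , _ , _ , _ , near , y∈ , _) = inj₂ (y , near , subst (λ q → (y , q) ∈ ns) (sym (S-old v∈ vp∈ v<h)) y∈)
        module R = Redirecting {ns} {ss} {a} {P} {h} {ph} {pC} {get (hn s) down} {S′} room (tailS spine) h∈ (_ , P∈)
          between at (λ v∈ av≼h → complete (occ-prefix av≼h (occurs (_ , h∈))) v∈) parent
        time : 24 + ((4 + (14 + 38 * Λ) * i) + ((8 + (1 + (122 + 293 * Λ) * length items-of)) + 1)) ≡
               38 + (14 + 38 * Λ) * i + (122 + 293 * Λ) * length items-of
        time = begin
          24 + ((4 + X) + ((8 + (1 + Y)) + 1))  ≡⟨ cong (24 +_) (+-assoc 4 X (8 + (1 + Y) + 1)) ⟩
          28 + (X + (9 + (Y + 1)))              ≡⟨ cong (λ z → 28 + (X + (9 + z))) (+-comm Y 1) ⟩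
          28 + (X + (10 + Y))                   ≡⟨ cong (28 +_) (trans (sym (+-assoc X 10 Y)) (cong (_+ Y) (+-comm X 10))) ⟩
          38 + X + Y                            ∎
          where
          open ≡-Reasoning
          X = (14 + 38 * Λ) * i
          Y = (122 + 293 * Λ) * length items-of
        after : ∀ {s₂} → (∃₂ λ j w → ∃₂ λ z D → s₂ ≡ redirectedS (promoteS s) j w z D × Retargeted ns P h ph (get (hn s) down) D) →
          Triple (growAll ⨟ movS sk inp ⨟ nop) s₂ ((8 + (1 + (122 + 293 * Λ) * length items-of)) + 1)
            (Promoted s ss T h a ns (length items-of))
        after (j , w , z , D , refl , retarget) =
          (ld⟩ (blockN ns room (address links P∈)) $ mov⟩ $ mov⟩ $ ld⟩ bC $ Dup.allT pending)
          ⟫ λ {s′} dup → movS⟩ $ nop⟩ (finish {s′} dup)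
          where
          tail∈ : ∀ {b v} → h ≡ b ∷ v → v ∈ ss
          tail∈ refl = tailS spine h∈
          module Pr = Promote {D′ = D} spine (functional links) (injective links) h∈ h∉ tail∈
            C∈ target C≡ h-label P-near P∈ C≡′ C-label retarget
          s₂ = redirectedS (promoteS s) j w z D
          world₂ : World (h ∷ ss) ns (fieldsOf s₂)
          world₂ = record
            { links = links-frame links (λ _ _ → refl , refl , refl) (λ _ _ → refl) refl refl refl refl refl
            ; children = record { crecAt = crecAt children ; valOk = valOk children ; cdict = cdict children ; edge = edge children }
            ; spine = Pr.promoted }
          near-C : Nearest (_∈ h ∷ ss) h C
          near-C = here refl , h≺C , λ where
            (here refl) _  → ≼-refl
            (there x∈) x≺C → ≼-trans (proj₂ (proj₂ P-near) x∈ x≺C) (≺⇒≼ P≺h)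
          near-h : Nearest (_∈ h ∷ ss) P h
          near-h = there (proj₁ P-near) , P≺h , λ where
            (here refl) h≺h → ⊥-elim (≺-irrefl h≺h)
            (there x∈) x≺h → proj₂ (proj₂ P-near) x∈ (≺-≼-trans x≺h (≺⇒≼ h≺C))
          below-h : ∀ {x} → x ∈ h ∷ ss → h ≺ x → C ≼ x
          below-h (here refl) h≺h = ⊥-elim (≺-irrefl h≺h)
          below-h (there x∈) h≺x = proj₂ (proj₂ target) x∈ (≺⇒≼ h≺x)
          module Dup = Duplicate {W = T} T≤ ss≤ (here refl) (there (proj₁ target)) C≡ below-h near-C near-h
          open WList (wlist links C∈) using (items; linked; distinct)
          s₃ = record s₂ { rn = put (put (put (put (rn s₂) above (get (hn s) len (get (hn s) sp pC))) vr ph) xr pC) qr (get (hn s) whead pC) }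
          pending : Dup.Pending ns items s₃
          pending = record
            { world = world₂ ; sane = sane ; next≡ = next≡ ; h∈ = h∈ ; C∈ = C∈
            ; label = trans (↦-same (get (hs s) slab [ ph ↦ get (hs s) slab pC ]) pC) h-label
            ; above≡ = lenOk links P∈
            ; complete = λ { (_ , bC∈) → complete (occ-prefix (_ ∷ ≺⇒≼ P≺C) (occurs (_ , bC∈))) (proj₁ P-near) }
            ; linked = linked
            ; distinct = distinct
            ; missing = λ q∈ → let b , bC∈ = WList.sound (wlist links C∈) q∈ in b , bC∈ , λ { (_ , bh∈) → h∉ (tailS spine bh∈) } }
          finish : ∀ {s′} → Duplicated s₃ (h ∷ ss) h C ns items T s′ →
            Promoted s ss T h a ns (length items-of) (record s′ { rs = put (rs s′) sk (get (rs s′) inp) })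
          finish dup with Duplicated.regs≡ dup | Duplicated.syms≡ dup
          ... | _ , _ , _ , _ , _ , _ , _ , r≡ | _ , _ , _ , t≡ = record
            { nodes = D.nodes ; world = D.world ; sane = D.sane ; next≡ = D.next≡
            ; tip≡ = cong (λ r → get r tip) r≡ ; out≡ = cong (λ r → get r out) r≡
            ; hr≡ = cong (λ r → get r hr) r≡ ; ur≡ = cong (λ r → get r ur) r≡
            ; sk≡ = trans (cong (λ r → get r inp) t≡) inp≡
            ; inp≡ = trans (cong (λ r → get r inp) t≡) inp≡
            ; lab≡ = cong (λ r → get r lab) t≡
            ; larger = D.larger
            ; complete = complete′
            ; size = D.size }
            where
            module D = Duplicated dup
            complete′ : ∀ {b v} → Occ (b ∷ v) T → v ∈ h ∷ ss → In D.nodes (b ∷ v)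
            complete′ o (there v∈) = let p , x∈ = complete o v∈ in p , D.larger x∈
            -- An occurrence of `b ∷ h` starts a suffix `b ∷ x` of T. Its tail x is a suffix, hence
            -- of type 1, and lies below h, hence below the target C. So `b ∷ C` occurs too, is a
            -- node, and its link was among those copied.
            complete′ {b} o (here refl) with occ-suffix o
            ... | _ ∷ x , sf , _ ∷ h≼x with complete {b} (suffix-occ sf (b ∷ proj₂ (proj₂ target) (suffixes (suff-tail sf)) h≼x)) (proj₁ target)
            ...   | q , bC∈ = D.all (WList.complete (wlist links C∈) (b , bC∈)) bC∈

  open Promoting

  -- Itineraries of the walks and their lengths

  module Planning where

    open import Data.List.Membership.DecPropositional _≟*_ using (_∈?_)

    open Shape

    open Fields
    open Links
    open Children
    open Spine

    module _ (ss : List Str) where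

      member : Str → Bool
      member x = does (x ∈? ss)

      ∈⇒member : ∀ {x} → x ∈ ss → member x ≡ true
      ∈⇒member {x} x∈ = dec-true (x ∈? ss) x∈

      member⇒∈ : ∀ {x} → member x ≡ true → x ∈ ss
      member⇒∈ {x} eq with x ∈? ss
      ... | yes x∈ = x∈

      #above : Str → ℕ
      #above = #prefixes member

      #above-nearest : ∀ {x y} → x ∈ ss → Nearest (_∈ ss) y x → #above x ≡ suc (#above y)
      #above-nearest x∈ (y∈ , y≺x , max) = #prefixes-nearest (∈⇒member x∈) (∈⇒member y∈ , y≺x , λ m → max (member⇒∈ m))

      #above-root : [] ∈ ss → #above [] ≡ 1
      #above-root []∈ = cong weight (∈⇒member []∈)

      #above-tail : (∀ {b x} → b ∷ x ∈ ss → x ∈ ss) → ∀ {b} x → #above (b ∷ x) ≤ suc (#above x)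
      #above-tail closed = #prefixes-cons λ m → ∈⇒member (closed (member⇒∈ m))

    #above-insert : ∀ {ss} h x → #above (h ∷ ss) x ≤ suc (#above ss x)
    #above-insert {ss} h = #prefixes-insert h λ m → cases (member⇒∈ (h ∷ ss) m)
      where
      cases : ∀ {t} → t ∈ h ∷ ss → member ss t ≡ true ⊎ t ≡ h
      cases (here t≡h) = inj₂ t≡h
      cases (there t∈) = inj₁ (∈⇒member ss t∈)

    #above-mono : ∀ {ss} h x → #above ss x ≤ #above (h ∷ ss) x
    #above-mono {ss} h = #prefixes-mono λ m → ∈⇒member (h ∷ ss) (there (member⇒∈ ss m))

    #above-prefix : ∀ ss {x y} → x ≼ y → #above ss x ≤ #above ss y
    #above-prefix ss = go (member ss)
      where
      go : ∀ (P : Str → Bool) {x y} → x ≼ y → #prefixes P x ≤ #prefixes P y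
      go P {y = []}    [] = ≤-refl
      go P {y = _ ∷ _} [] = m≤m+n (weight (P [])) _
      go P (a ∷ p) = +-monoʳ-≤ (weight (P [])) (go (λ t → P (a ∷ t)) p)

    In? : ∀ ns x → Dec (In ns x)
    In? ns x = map′ located listed (x ∈? map proj₁ ns)
      where
      located : x ∈ map proj₁ ns → In ns x
      located x∈ with ∈-map⁻ proj₁ x∈
      ... | (_ , p) , e∈ , refl = p , e∈
      listed : In ns x → x ∈ map proj₁ ns
      listed (p , e∈) = ∈-map⁺ proj₁ e∈

    -- The depth of the node where the climb ended; 0 if it went past the root, which is consistent
    -- with the root having depth 1.
    #footing : List Str → Maybe Str → ℕ
    #footing ss nothing  = 0
    #footing ss (just u) = #above ss u

    -- The loops are verified by recursion on an itinerary fixed beforehand: `Climb`, `Redirect` or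
    -- `Path`. Here the itineraries are shown to exist, with lengths measured by the potential; each
    -- step to a type-1 parent lowers the depth by exactly one.
    module Plans {ss : List Str} (rooted : [] ∈ ss)
                 (parent : ∀ {x} → x ∈ ss → x ≡ [] ⊎ (∃ λ y → Nearest (_∈ ss) y x)) where

      Lowest : NodeList → Symbol → Str → Maybe Str → Set
      Lowest ns a v nothing  = ∀ {x} → x ∈ ss → x ≼ v → ¬ In ns (a ∷ x)
      Lowest ns a v (just u) = u ∈ ss × u ≼ v × In ns (a ∷ u) × (∀ {x} → x ∈ ss → u ≺ x → x ≼ v → ¬ In ns (a ∷ x))

      climbPlan : ∀ ns a {v} → v ∈ ss → ∃₂ λ i o → Climb ns ss a v i o × Lowest ns a v o × i + #footing ss o ≤ suc (#above ss v)
      climbPlan ns a {v} v∈ = go v∈ (<-wellFounded (length v))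
        where
        go : ∀ {v} → v ∈ ss → Acc _<_ (length v) → ∃₂ λ i o → Climb ns ss a v i o × Lowest ns a v o × i + #footing ss o ≤ suc (#above ss v)
        go {v} v∈ (acc rec) with In? ns (a ∷ v)
        ... | yes av∈ = 1 , just v , found av∈ ,
          (v∈ , ≼-refl , av∈ , λ _ v≺x x≼v → ⊥-elim (≺-irrefl (≺-≼-trans v≺x x≼v))) , ≤-refl
        ... | no av∉ with parent v∈
        ...   | inj₁ refl = 1 , nothing , exhausted av∉ , (λ { _ [] → av∉ }) , s≤s z≤n
        ...   | inj₂ (y , near@(y∈ , y≺v , max)) with go y∈ (rec (≺-length y≺v))
        ...     | i , o , climb , lowest , bound = suc i , o , higher av∉ near climb , lower o lowest ,
          s≤s (≤-trans bound (≤-reflexive (sym (#above-nearest ss v∈ near))))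
          where
          lower : ∀ o → Lowest ns a y o → Lowest ns a v o
          lower nothing low x∈ x≼v with ≼-split x≼v
          ... | inj₁ refl = av∉
          ... | inj₂ x≺v  = low x∈ (max x∈ x≺v)
          lower (just u) (u∈ , u≼y , au∈ , low) = u∈ , ≼-trans u≼y (≺⇒≼ y≺v) , au∈ , low′
            where
            low′ : ∀ {x} → x ∈ ss → u ≺ x → x ≼ v → ¬ In ns (a ∷ x)
            low′ x∈ u≺x x≼v with ≼-split x≼v
            ... | inj₁ refl = av∉
            ... | inj₂ x≺v  = low x∈ u≺x (max x∈ x≺v)

      module _ (closed : ∀ {b x} → b ∷ x ∈ ss → x ∈ ss) {a : Symbol} {P : Str} (P∈ : P ∈ ss) (P-tail : ∀ {b x} → P ≡ b ∷ x → x ∈ ss) where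

        -- The tail of P is of type 1, so it cannot lie strictly between v and its type-1 parent y.
        above-y : ∀ {v y} → Nearest (_∈ ss) y v → P ≺ a ∷ v → P ≼ a ∷ y
        above-y {v} {y} (_ , _ , max) P≺ = go P≺ P-tail
          where
          go : ∀ {P} → P ≺ a ∷ v → (∀ {b x} → P ≡ b ∷ x → x ∈ ss) → P ≼ a ∷ y
          go []        _    = []
          go (_ ∷ x≺v) tail = a ∷ max (tail refl) x≺v

        private
          redirectPlan : ∀ {v} → v ∈ ss → P ≼ a ∷ v → Acc _<_ (length v) →
            ∃ λ i → Redirect ss a P v i × i + #above ss P ≤ 2 + #above ss v
          redirectPlan {v} v∈ P≼ (acc rec) with ≼-split P≼
          ... | inj₁ refl = 1 , stop refl , s≤s (#above-tail ss closed v)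
          ... | inj₂ P≺ with parent v∈ | P≺
          ...   | inj₁ refl | [] = 1 , last refl , s≤s (n≤1+n _)
          ...   | inj₁ refl | _ ∷ ()
          ...   | inj₂ (y , near@(y∈ , y≺v , max)) | _
            with redirectPlan y∈ (above-y near P≺) (rec (≺-length y≺v))
          ... | i , plan , bound = suc i , more P≺ near plan , s≤s (≤-trans bound (≤-reflexive (cong suc (sym (#above-nearest ss v∈ near)))))

        -- The walk ends at the node v with P = `a ∷ v`, whose depth is at least that of P less one
        -- by `#above-tail`, or else at the root with P empty. So its length is governed by the
        -- difference of the depths of u and P.
        redirectFromPlan : ∀ {u} → u ∈ ss → P ≺ a ∷ u → ∃ λ i → RedirectFrom ss a P u i × i + #above ss P ≤ 1 + #above ss u
        redirectFromPlan {u} u∈ P≺ with parent u∈ | P≺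
        ... | inj₁ refl | []     = 0 , bottom refl , n≤1+n _
        ... | inj₁ refl | _ ∷ ()
        ... | inj₂ (y , near@(y∈ , _)) | _ with redirectPlan y∈ (above-y near P≺) (<-wellFounded _)
        ... | i , plan , bound = i , from near plan , ≤-trans bound (≤-reflexive (cong suc (sym (#above-nearest ss u∈ near))))

      pathPlan : ∀ k o {v} → v ∈ ss → (∀ {u} → o ≡ just u → k ≡ suc (length u) × u ≼ v) →
        ∃ λ i → Path ss k v i × i + #footing ss o ≤ #above ss v
      pathPlan k o {v} v∈ = go v∈ (<-wellFounded (length v))
        where
        foot : ∀ {v} o → (∀ {u} → o ≡ just u → k ≡ suc (length u) × u ≼ v) → #footing ss o ≤ #above ss v
        foot nothing  _ = z≤n
        foot (just u) f = #above-prefix ss (proj₂ (f refl))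
        go : ∀ {v} → v ∈ ss → Acc _<_ (length v) → (∀ {u} → o ≡ just u → k ≡ suc (length u) × u ≼ v) →
          ∃ λ i → Path ss k v i × i + #footing ss o ≤ #above ss v
        go {v} v∈ (acc rec) f with parent v∈
        ... | inj₁ refl = 0 , root , foot o f
        ... | inj₂ (y , near@(y∈ , y≺v , max)) with k <? suc (length y)
        ...   | no ¬k< = 0 , stop near ¬k< , foot o f
        ...   | yes k< with go y∈ (rec (≺-length y≺v)) f′
          where
          f′ : ∀ {u} → o ≡ just u → k ≡ suc (length u) × u ≼ y
          f′ eq with f eq
          ... | k≡ , u≼v with compareUnder u≼v (≺⇒≼ y≺v)
          ...   | inj₁ u≼y = k≡ , u≼y
          ...   | inj₂ y≺u = ⊥-elim (<-irrefl refl (<-trans k< (≤-trans (s≤s (≺-length y≺u)) (≤-reflexive (sym k≡)))))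
        ...     | i , path , bound = suc i , higher near k< path , ≤-trans (s≤s bound) (≤-reflexive (sym (#above-nearest ss v∈ near)))

  open Planning

  -- From the invariant through one update back to the invariant

  module Update where

    open Shape

    open Fields
    open Links
    open Children
    open Spine

    headOf : Symbol → Maybe Str → Str
    headOf a nothing  = []
    headOf a (just u) = a ∷ u

    Foot : NodeList → Maybe Str → ℕ → Set
    Foot ns nothing  U = U ≡ 0
    Foot ns (just u) U = (u , U) ∈ ns

    -- The state in front of the insertion of the new leaf: h is a type-1 node.
    record Prepared (T : Str) (a : Symbol) (o : Maybe Str) (ss : List Str) (k : ℕ) (r : ℕ) (ns : NodeList) (s : HState) : Set where
      field
        world    : World ss ns (fieldsOf s)
        sane     : Sane T ns
        enlarged : k ≤ length ns
        next≡    : get (rn s) next ≡ newN ns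
        tip∈     : (T , get (rn s) tip) ∈ ns
        root∈    : ([] , nodeAddr 0) ∈ ns
        out≡     : get (rn s) out ≡ r
        h∈       : (headOf a o , get (rn s) hr) ∈ ns
        foot     : Foot ns o (get (rn s) ur)
        label    : ∃₂ λ c t → a ∷ T ≡ headOf a o ++ c ∷ t × get (rs s) lab ≡ letter c
        sk≡      : get (rs s) sk ≡ letter a
        inp≡     : get (rs s) inp ≡ letter a
        complete : ∀ {b v} → Occ (b ∷ v) T → v ∈ ss → In ns (b ∷ v)

    -- The invariant between updates. Since the tail of a type-1 node is of type 1, `complete` and
    -- `tailS` together say that the nodes are the root and the occurring strings whose tail is of
    -- type 1, that is, exactly the type-1 and type-2 nodes.
    record Ready (T : Str) (ss : List Str) (ns : NodeList) (s : HState) : Set where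
      field
        world    : World ss ns (fieldsOf s)
        sane     : Sane T ns
        next≡    : get (rn s) next ≡ newN ns
        tip∈     : (T , get (rn s) tip) ∈ ns
        root∈    : ([] , nodeAddr 0) ∈ ns
        out≡     : get (rn s) out ≡ 6 + nodeAddr 0
        complete : ∀ {b v} → Occ (b ∷ v) T → v ∈ ss → In ns (b ∷ v)
        type1    : ∀ {x} → x ∈ ss → Type1′ T x
        type1-in : ∀ {x} → Type1′ T x → x ∈ ss
        small    : length ss ≤ 1 + 2 * length T

    parents : ∀ {ss ns S L D} → Spine ss ns S L D → ∀ {x} → x ∈ ss → x ≡ [] ⊎ (∃ λ y → Nearest (_∈ ss) y x)
    parents spine x∈ with spOk spine x∈ (proj₂ (incl spine x∈))
    ... | inj₁ (x≡ , _) = inj₁ x≡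
    ... | inj₂ (y , _ , _ , _ , near , _) = inj₂ (y , near)

    growPathHeadS : HState → HState
    growPathHeadS s = record s
      { rn = put (put (put (put (put (put (rn s) xr (get (rn s) vr)) wr (get (rn s) yr)) tip (get (rn s) yr))
               above (get (hn s) len (get (rn s) ur))) vr (get (hn s) sp (get (rn s) vr)))
               t₃ (get (hn s) len (get (hn s) sp (get (rn s) vr))) }

    growPathHeadT : ∀ s → Block (get (rn s) ur) → Block (get (rn s) vr) → Block (get (hn s) sp (get (rn s) vr)) →
      Triple growPathHead s 12 (_≡ growPathHeadS s)
    growPathHeadT s bu bv bs = mov⟩ $ mov⟩ $ mov⟩ $ ld⟩ bu $ ld⟩ bv $ ld⟩ bs $ nop⟩ refl

    module Finish {T : Str} {a ω : Symbol} {o : Maybe Str} {ss : List Str} {k : ℕ} {ns : NodeList} {s : HState}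
                  (term : Terminated ω (a ∷ T)) (W≤ : length (a ∷ T) ≤ n) (ss≤ : length ss ≤ 2 * length (a ∷ T))
                  (head : Head a T (headOf a o)) (h∈ss : headOf a o ∈ ss)
                  (prepared : Prepared T a o ss k (6 + nodeAddr 0) ns s)
                  (type1 : ∀ {x} → x ∈ ss → Type1′ T x ⊎ x ≡ headOf a o) (type1-in : ∀ {x} → Type1′ T x → x ∈ ss) where
      open Prepared prepared
      open World world

      private
        h : Str
        h = headOf a o
        W : Str
        W = a ∷ T
        ss′ : List Str
        ss′ = W ∷ ss
        ns′ : NodeList
        ns′ = (W , newN ns) ∷ ns
        T∈ss : T ∈ ss
        T∈ss = type1-in (suffix here)
        ss≤n : length ss ≤ 1 + 2 * n
        ss≤n = ≤-trans ss≤ (≤-trans (*-monoʳ-≤ 2 W≤) (n≤1+n _))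
        ss′≤ : length ss′ ≤ 1 + 2 * n
        ss′≤ = s≤s (≤-trans ss≤ (*-monoʳ-≤ 2 W≤))
        saneW : Sane W ns
        saneW = record { unique = Sane.unique sane ; occurs = λ x∈ → there (Sane.occurs sane x∈) }
        open Bounds W≤ ss≤n world saneW
        occurs : ∀ {x} → In ns x → Occ x T
        occurs = Sane.occurs sane
        too-long : ∀ {x} → W ≼ x → ¬ Occ x T
        too-long W≼x o = <-irrefl refl (≤-trans (≼-length W≼x) (occ-length o))
        new : ¬ In ns W
        new W∈ = too-long ≼-refl (occurs W∈)
        room′ : Room ns′
        room′ = room-cons {p = newN ns} new T∈ss (here ≼-refl)
        c = proj₁ label
        W≡ = proj₁ (proj₂ (proj₂ label))
        nearest : ∀ {t} → In ns t → t ≺ W → t ≼ h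
        nearest t∈ t≺W = Head.max head (≺⇒≼ t≺W) (occurs t∈)
        -- `h ++ c ∷ []` is a prefix of `a ∷ T` longer than h, so it does not occur in T, and
        -- neither does anything below it.
        fresh : ∀ {t} → ¬ In ns (h ++ c ∷ t)
        fresh {t} t∈ = <-irrefl refl (≤-trans (≤-reflexive (sym (trans (length-++ h) (+-comm (length h) 1))))
          (≼-length (Head.max head (subst (h ++ c ∷ [] ≼_) (sym W≡) (short-prefix _))
            (occ-prefix (short-prefix t) (occurs t∈)))))
          where
          short-prefix : ∀ t → h ++ c ∷ [] ≼ h ++ c ∷ t
          short-prefix t = subst (h ++ c ∷ [] ≼_) (++-assoc h (c ∷ []) t) (≼-++ (h ++ c ∷ []))
        footOk : ∀ {ms F} o → (∀ {x p} → (x , p) ∈ ns → (x , p) ∈ ms) → Links ms F → Room ms → ∀ {U} → Foot ns o U →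
          Block U × lenₕ F U ≡ length (headOf a o)
        footOk nothing wider lk rm refl = block0 (blockN ns′ room′ (addrN-new ns (W , newN ns))) , nullLen lk
        footOk {ms} (just u) wider lk rm u∈ = blockN ms rm (address lk (wider u∈)) , lenOk lk (wider u∈)
        foot≢ : ∀ o {U} → Foot ns o U → U ≢ newN ns
        foot≢ nothing  refl eq = addrN≢0 ns′ (addrN-new ns (W , newN ns)) (sym eq)
        foot≢ (just u) u∈   = addrN≢new ns (address links u∈)

        -- The itinerary is planned before the leaf joins the type-1 nodes. It stays valid because
        -- `W` is longer than every string on it.
        lift : ∀ {k v i} → length v ≤ length T → Path ss k v i → Path ss′ k v i
        lift v≤ root = root
        lift v≤ (stop near ¬k<) = stop (lift-near v≤ near) ¬k<
          where
          lift-near : ∀ {y x} → length x ≤ length T → Nearest (_∈ ss) y x → Nearest (_∈ ss′) y x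
          lift-near x≤ (y∈ , y≺x , max) = there y∈ , y≺x , λ where
            (here refl) W≺x → ⊥-elim (<-irrefl refl (≤-trans (≤-trans (n≤1+n _) (≺-length W≺x)) x≤))
            (there t∈) t≺x → max t∈ t≺x
        lift v≤ (higher near@(_ , y≺x , _) k< path) = higher (lift-near v≤ near) k< (lift (≤-trans (<⇒≤ (≺-length y≺x)) v≤) path)
          where
          lift-near : ∀ {y x} → length x ≤ length T → Nearest (_∈ ss) y x → Nearest (_∈ ss′) y x
          lift-near x≤ (y∈ , y≺x , max) = there y∈ , y≺x , λ where
            (here refl) W≺x → ⊥-elim (<-irrefl refl (≤-trans (≤-trans (n≤1+n _) (≺-length W≺x)) x≤))
            (there t∈) t≺x → max t∈ t≺x

        ready : ∀ {s₀ s′} → get (rn s₀) tip ≡ newN ns → get (rn s₀) out ≡ get (rn s) out →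
          Finished W≤ ss′≤ head ns′ s₀ s′ → ∃ λ ms → Ready W ss′ ms s′ × suc k ≤ length ms
        ready {s₀} {s′} tip₀ out₀ f = F.nodes , (record
          { world = F.world
          ; sane = F.sane
          ; next≡ = F.next≡
          ; tip∈ = F.larger (here (cong (W ,_) (trans F.tip≡ tip₀)))
          ; root∈ = F.larger (there root∈)
          ; out≡ = trans F.out≡ (trans out₀ out≡)
          ; complete = complete′
          ; type1 = λ { (here refl) → suffix here ; (there x∈) → type1′ x∈ }
          ; type1-in = type1-in′
          ; small = s≤s ss≤ }) , ≤-trans (s≤s enlarged) F.longer
          where
          module F = Finished f
          type1′ : ∀ {x} → x ∈ ss → Type1′ W x
          type1′ x∈ with type1 x∈
          ... | inj₁ t = type1-mono t
          ... | inj₂ refl = type1-head head term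
          type1-in′ : ∀ {x} → Type1′ W x → x ∈ ss′
          type1-in′ t with type1-cons head t
          ... | inj₁ t′ = there (type1-in t′)
          ... | inj₂ (inj₁ refl) = there h∈ss
          ... | inj₂ (inj₂ refl) = here refl
          old : ∀ {b v} → Occ (b ∷ v) T → v ∈ ss′ → In F.nodes (b ∷ v)
          old oc (here refl) = ⊥-elim (<-irrefl refl (≤-trans (n≤1+n _) (occ-length oc)))
          old oc (there v∈) = let p , x∈ = complete oc v∈ in p , F.larger (there x∈)
          complete′ : ∀ {b v} → Occ (b ∷ v) W → v ∈ ss′ → In F.nodes (b ∷ v)
          complete′ (there oc) v∈ = old oc v∈
          -- A new occurrence is a prefix `a ∷ v` of `W`. Either the walk has made this node, or it
          -- is a prefix of h and so occurs in T already.
          complete′ (here (_ ∷ v≼T)) v∈ with F.done v∈ v≼T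
          ... | inj₁ av∈ = av∈
          ... | inj₂ av≼h = old (occ-prefix av≼h (Head.occurs head)) v∈

      finishT : ∃ λ g → g + #footing ss o ≤ #above ss T ×
        Triple (mov vr tip ⨟ addLeaf ⨟ growPath) s ((103 + 586 * Λ) + (123 + 293 * Λ) * g)
          (λ s′ → ∃ λ ms → Ready W ss′ ms s′ × suc k ≤ length ms)
      finishT with Plans.pathPlan (rootS spine) (parents spine) (length h) o T∈ss footing
        where
        footing : ∀ {u} → o ≡ just u → length h ≡ suc (length u) × u ≼ T
        footing refl = refl , ≼-tail (Head.prefix head)
      ... | g , path , bound = g , bound , (weaken (≤-reflexive time) $ mov⟩ $
        addLeafT (record s { rn = put (rn s) vr (get (rn s) tip) }) world tip∈ T∈ss h∈ h∈ss new W≡ nearest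
          (λ t∈ W≺t → too-long (≺⇒≼ W≺t) (occurs t∈)) fresh (proj₁ (footOk o (λ x∈ → x∈) links room foot)) (foot≢ o foot)
          (proj₂ (footOk o (λ x∈ → x∈) links room foot)) (proj₂ (proj₂ (proj₂ label))) next≡ sk≡ room′ short
        ⟫ λ {s′} → walk {s′})
        where
        time : 1 + ((89 + 586 * Λ) + (12 + (1 + (123 + 293 * Λ) * g))) ≡ (103 + 586 * Λ) + (123 + 293 * Λ) * g
        time = trans (interchange 90 (586 * Λ) 13 ((123 + 293 * Λ) * g)) (sym (+-assoc 103 (586 * Λ) ((123 + 293 * Λ) * g)))
        walk : ∀ {s′} → Leafed (record s { rn = put (rn s) vr (get (rn s) tip) }) ss W ns s′ →
          Triple growPath s′ (12 + (1 + (123 + 293 * Λ) * g)) (λ s″ → ∃ λ ms → Ready W ss′ ms s″ × suc k ≤ length ms)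
        walk {s′} leafed with Leafed.regs≡ leafed | Leafed.syms≡ leafed
        ... | j , y , m , x₁ , x₂ , x₃ , r≡ | w , t≡ =
          growPathHeadT s′ (proj₁ ur-ok) (blockN ns′ room′ (address links′ T∈)) sp-block ⟫ λ { refl →
          mapT (λ {s″} → ready {s₁} {s″} (Leafed.yr≡ leafed) (cong (λ r → get r out) r≡)) $
          growPathT W≤ ss′≤ head (lift ≤-refl path) threaded }
          where
          world′ = Leafed.world leafed
          links′ = World.links world′
          T∈ : (T , get (rn s′) vr) ∈ ns′
          T∈ = subst (λ p → (T , p) ∈ ns′) (sym (cong (λ r → get r vr) r≡)) (there tip∈)
          ur-ok : Block (get (rn s′) ur) × lenₕ (fieldsOf s′) (get (rn s′) ur) ≡ length h
          ur-ok = subst (λ U → Block U × lenₕ (fieldsOf s′) U ≡ length h) (sym (cong (λ r → get r ur) r≡))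
            (footOk o there links′ room′ foot)
          sp-block : Block (get (hn s′) sp (get (rn s′) vr))
          sp-block with spOk (World.spine world′) (there T∈ss) T∈
          ... | inj₁ (_ , sp≡0) = subst Block (sym sp≡0) (block0 (blockN ns′ room′ (address links′ T∈)))
          ... | inj₂ (_ , _ , _ , _ , _ , y∈ , _) = blockN ns′ room′ (address links′ y∈)
          s₁ = growPathHeadS s′
          threaded : Threaded W≤ ss′≤ head T ns′ s₁
          threaded = record
            { world = world′
            ; sane = sane-cons new T∈ss (here ≼-refl)
            ; next≡ = Leafed.next≡ leafed
            ; X∈ = T∈
            ; X∈ss = there T∈ss
            ; X≼T = ≼-refl
            ; aX∈ = here (cong (W ,_) (Leafed.yr≡ leafed))
            ; vr≡ = refl
            ; t₃≡ = refl
            ; above≡ = proj₂ ur-ok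
            ; sk≡ = trans (cong (λ r → get r sk) t≡) inp≡
            ; h∈ = _ , there h∈
            ; only = λ { (_ , here refl) → inj₂ (≼-refl , ≼-refl) ; (p , there t∈) → inj₁ (occurs (p , t∈)) }
            ; done = λ v∈ T≼v v≼T → newN ns , here (cong (λ v → a ∷ v , newN ns) (≼-antisym v≼T T≼v)) }

  open Update

  -- The phases of an update

  module Phases where

    open Shape

    open Fields
    open Links
    open Children
    open Spine

    record Located (ss : List Str) (T : Str) (a : Symbol) (o : Maybe Str) (ns : NodeList) (s s′ : HState) : Set where
      field
        world : World ss ns (fieldsOf s′)
        heap≡ : fieldsOf s′ ≡ fieldsOf s
        next≡ : get (rn s′) next ≡ get (rn s) next
        tip≡  : get (rn s′) tip ≡ get (rn s) tip
        out≡  : get (rn s′) out ≡ get (rn s) out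
        h∈    : (headOf a o , get (rn s′) hr) ∈ ns
        foot  : Foot ns o (get (rn s′) ur)
        label : ∃₂ λ c t → a ∷ T ≡ headOf a o ++ c ∷ t × get (rs s′) lab ≡ letter c
        sk≡   : get (rs s′) sk ≡ letter a
        inp≡  : get (rs s′) inp ≡ letter a

    climbT : ∀ s {ss ns T a i o} → World ss ns (fieldsOf s) → Climb ns ss a T i o →
      (T , get (rn s) tip) ∈ ns → T ∈ ss → ([] , nodeAddr 0) ∈ ns → get (rs s) inp ≡ letter a → ¬ In ns (a ∷ T) → Room ns →
      Triple climb s (8 + (11 + 38 * Λ) * i) (Located ss T a o ns s)
    climbT s {ss} {ns} {T} {a} {i} {o} world plan T∈ T∈ss root∈ inp≡ new room =
      weaken (≤-reflexive (cong (5 +_) (+-comm ((11 + 38 * Λ) * i) 3))) $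
      mov⟩ $ movS⟩ $ lit⟩ $ lit⟩ $ climbLoop plan s₁ world T∈ T∈ss inp≡ refl refl room ⟫ continue o
      where
      open World world
      s₁ = record s { rn = put (put (put (rn s) vr (get (rn s) tip)) hr 0) ur 0 ; rs = put (rs s) sk (get (rs s) inp) }
      continue : ∀ o {s′} → Climbed s₁ ns a T o s′ →
        Triple (test (nonzero hr) nop (lit hr 64 ⨟ movS lab inp ⨟ nop)) s′ 3 (Located ss T a o ns s)
      continue nothing (j , w , H , U , ℓ , refl , H≡0 , U≡0) =
        else⟩ (isZero H≡0) $ lit⟩ $ movS⟩ $ nop⟩ record
          { world = world ; heap≡ = refl ; next≡ = refl ; tip≡ = refl ; out≡ = refl
          ; h∈ = subst (λ p → ([] , p) ∈ ns) nodeAddr-zero root∈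
          ; foot = U≡0 ; label = a , T , refl , inp≡ ; sk≡ = inp≡ ; inp≡ = inp≡ }
      continue (just u) (j , w , H , U , ℓ , refl , H∈ , U∈ , lab?) =
        weaken (m≤m+n 1 2) $ then⟩ (isNonzero (addrN≢0 ns (address links H∈))) $ nop⟩ record
          { world = world ; heap≡ = refl ; next≡ = refl ; tip≡ = refl ; out≡ = refl
          ; h∈ = H∈ ; foot = U∈ ; label = labelled lab? ; sk≡ = inp≡ ; inp≡ = inp≡ }
        where
        labelled : (T ≡ u × ℓ ≡ _) ⊎ (∃₂ λ c t → T ≡ u ++ c ∷ t × ℓ ≡ letter c) →
          ∃₂ λ c t → a ∷ T ≡ (a ∷ u) ++ c ∷ t × ℓ ≡ letter c
        labelled (inj₁ (T≡u , _)) = ⊥-elim (new (subst (λ x → In ns (a ∷ x)) (sym T≡u) (_ , H∈)))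
        labelled (inj₂ (c , t , T≡ , ℓ≡)) = c , t , cong (a ∷_) T≡ , ℓ≡

    -- By `longest` it suffices to compare with type-1 prefixes v of T. For these an occurrence of
    -- `a ∷ v` in T is a node by `complete`, that is, a Weiner link the climb would have met. A
    -- failed climb is the case of the bound 0, which no length is below.
    lowest-head : ∀ {ss ns T a ω o} → Terminated ω (a ∷ T) → (∀ {x} → In ns x → Occ x T) →
      (∀ {b v} → Occ (b ∷ v) T → v ∈ ss → In ns (b ∷ v)) → (∀ {x} → Type1′ T x → x ∈ ss) →
      (rooted : [] ∈ ss) (parent : ∀ {x} → x ∈ ss → x ≡ [] ⊎ (∃ λ y → Nearest (_∈ ss) y x)) →
      Plans.Lowest rooted parent ns a T o → Head a T (headOf a o)
    lowest-head {ss} {ns} {T} {a} {o = nothing} term sound complete type1-in rooted parent low = record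
      { occurs = here [] ; prefix = [] ; max = max′ }
      where
      max′ : ∀ {y} → y ≼ a ∷ T → Occ y T → y ≼ []
      max′ [] _ = []
      max′ (_ ∷ v≼T) o with ≼⇒++ v≼T
      ... | r , T≡ with longest {k = 0} term (λ t1 x≼T ox → ⊥-elim (low (type1-in t1) x≼T (complete ox (type1-in t1)))) _ r T≡ o
      ...   | ()
    lowest-head {ss} {ns} {T} {a} {o = just u} term sound complete type1-in rooted parent (u∈ , u≼T , au∈ , low) = record
      { occurs = sound au∈ ; prefix = a ∷ u≼T ; max = max′ }
      where
      bound : ∀ {v} → Type1′ T v → v ≼ T → Occ (a ∷ v) T → length v < suc (length u)
      bound t1 v≼T o with compareUnder v≼T u≼T
      ... | inj₁ v≼u = s≤s (≼-length v≼u)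
      ... | inj₂ u≺v = ⊥-elim (low (type1-in t1) u≺v v≼T (complete o (type1-in t1)))
      max′ : ∀ {y} → y ≼ a ∷ T → Occ y T → y ≼ a ∷ u
      max′ [] _ = []
      max′ (_ ∷ v≼T) o with ≼⇒++ v≼T
      ... | r , T≡ with compareUnder v≼T u≼T
      ...   | inj₁ v≼u = a ∷ v≼u
      ...   | inj₂ u≺v = ⊥-elim (<-irrefl refl (≤-trans (≤-trans (s≤s (≺-length u≺v)) (longest term bound _ r T≡ o)) ≤-refl))

    -- Item lists are hidden in proofs of `WList`. As the heap determines them, the number of links
    -- to copy can be fixed from the proof available before the climb and agrees with that found
    -- after it.
    linked-unique : ∀ {f xs ys p} → Linked f xs p → Linked f ys p → xs ≡ ys
    linked-unique [] [] = refl
    linked-unique [] (p≢0 ∷ _) = ⊥-elim (p≢0 refl)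
    linked-unique (p≢0 ∷ _) [] = ⊥-elim (p≢0 refl)
    linked-unique (_ ∷ l) (_ ∷ l′) = cong (_ ∷_) (linked-unique l l′)

    target-unique : ∀ {ss x y z} → Target ss x y → Target ss x z → y ≡ z
    target-unique (y∈ , x≼y , y-min) (z∈ , x≼z , z-min) = ≼-antisym (y-min z∈ x≼z) (z-min y∈ x≼y)

    module Phase {T : Str} {a : Symbol} {ss : List Str} {ns : NodeList} {s : HState}
                 (T≤ : length T ≤ n) (ss≤ : suc (length ss) ≤ 1 + 2 * n) (ready : Ready T ss ns s) where
      open Ready ready

      private
        bounded : length ss ≤ 1 + 2 * n
        bounded = ≤-trans (n≤1+n _) ss≤
        saneOk = Sane.occurs sane

      module _ {o : Maybe Str} {s₁ : HState} (located : Located ss T a o ns s s₁) where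
        private
          module L = Located located
          module W = World L.world
          h = headOf a o
          open Bounds T≤ bounded L.world sane using (room)
          bh : Block (get (rn s₁) hr)
          bh = blockN ns room (address W.links L.h∈)
          s₂ = record s₁ { rn = put (rn s₁) cr (get (hn s₁) down (get (rn s₁) hr)) }

        keepT : h ∈ ss → Triple (test (eqN cr hr) nop promote) s₂ 1 (Prepared T a o ss (length ns) (6 + nodeAddr 0) ns)
        keepT h∈ss = then⟩ (isEq same) $ nop⟩ record
          { world = L.world ; sane = sane ; enlarged = ≤-refl ; next≡ = trans L.next≡ next≡
          ; tip∈ = subst (λ p → (T , p) ∈ ns) (sym L.tip≡) tip∈ ; root∈ = root∈ ; out≡ = trans L.out≡ out≡
          ; h∈ = L.h∈ ; foot = L.foot ; label = L.label ; sk≡ = L.sk≡ ; inp≡ = L.inp≡ ; complete = complete }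
          where
          same : get (hn s₁) down (get (rn s₁) hr) ≡ get (rn s₁) hr
          same with downOk W.spine L.h∈
          ... | z , target , z∈ , _ with target-self h∈ss target
          ...   | refl = functional W.links z∈ L.h∈

      module _ {u : Str} (au∉ : a ∷ u ∉ ss) {C P : Str} (target : Target ss (a ∷ u) C) (P-near : Nearest (_∈ ss) P C)
               {r : ℕ} (plan : RedirectFrom ss a P u r) {p : ℕ} (C∈ : (C , p) ∈ ns) {s₁ : HState} (located : Located ss T a (just u) ns s s₁) where
        private
          module L = Located located
          module W = World L.world
          s₂ = record s₁ { rn = put (rn s₁) cr (get (hn s₁) down (get (rn s₁) hr)) }
          M = length (WList.items (wlist (World.links world) C∈))

        promT : Triple (test (eqN cr hr) nop promote) s₂ (1 + (38 + (14 + 38 * Λ) * r + (122 + 293 * Λ) * M))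
          (λ s′ → ∃ λ ms → Prepared T a (just u) ((a ∷ u) ∷ ss) (M + length ns) (6 + nodeAddr 0) ms s′)
        promT with downOk W.spine L.h∈
        ... | z , target′ , z∈ , lab with target-unique target′ target
        ... | refl with ≼-split (proj₁ (proj₂ target))
        ... | inj₁ refl = ⊥-elim (au∉ (proj₁ target))
        ... | inj₂ au≺C with ≺⇒++ au≺C | spOk W.spine (proj₁ target) z∈
        ... | c , t , C≡ | inj₁ (refl , _) = ⊥-elim (none-above P-near)
        ... | c , t , C≡ | inj₂ (P′ , e , t′ , C≡′ , near , P∈ , lab′) with nearest-unique near P-near
        ... | refl = else⟩ (isNeq differ) $ weaken (≤-reflexive (cong (λ m → 38 + (14 + 38 * Λ) * r + (122 + 293 * Λ) * m) same-length)) $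
          mapT finish (promoteT s₂ T≤ ss≤ L.world sane (trans L.next≡ next≡) complete (λ sf → type1-in (suffix sf))
            L.h∈ au∉ L.foot z∈ target C≡ (lab C≡) L.sk≡ L.inp≡ near P∈ C≡′ lab′ plan)
          where
          differ : get (hn s₁) down (get (rn s₁) hr) ≢ get (rn s₁) hr
          differ eq with injective W.links (subst (λ q → (C , q) ∈ ns) eq z∈) L.h∈
          ... | refl = au∉ (proj₁ target)
          same-length : length (WList.items (wlist W.links z∈)) ≡ M
          same-length = cong length (linked-unique
            (WList.linked (wlist W.links z∈))
            (subst₂ (λ F q → Linked (wnextₕ F) (WList.items (wlist (World.links world) C∈)) (wheadₕ F q)) (sym L.heap≡)
              (functional W.links C∈ z∈) (WList.linked (wlist (World.links world) C∈))))
          finish : ∀ {s′} → Promoted s₂ ss T (a ∷ u) a ns (length (WList.items (wlist W.links z∈))) s′ →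
            ∃ λ ms → Prepared T a (just u) ((a ∷ u) ∷ ss) (M + length ns) (6 + nodeAddr 0) ms s′
          finish {s′} pr = R.nodes , record
            { world = R.world ; sane = R.sane
            ; enlarged = ≤-reflexive (trans (cong (_+ length ns) (sym same-length)) (sym R.size))
            ; next≡ = R.next≡
            ; tip∈ = subst (λ q → (T , q) ∈ R.nodes) (sym (trans R.tip≡ L.tip≡)) (R.larger tip∈)
            ; root∈ = R.larger root∈
            ; out≡ = trans R.out≡ (trans L.out≡ out≡)
            ; h∈ = subst (λ q → (a ∷ u , q) ∈ R.nodes) (sym R.hr≡) (R.larger L.h∈)
            ; foot = subst (λ q → (u , q) ∈ R.nodes) (sym R.ur≡) (R.larger L.foot)
            ; label = let c , t , W≡ , lab≡ = L.label in c , t , W≡ , trans R.lab≡ lab≡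
            ; sk≡ = R.sk≡ ; inp≡ = R.inp≡ ; complete = R.complete }
            where module R = Promoted pr

  open Phases

  -- The amortized cost of one update

  module Updating where

    open import Data.List.Membership.DecPropositional _≟*_ using (_∈?_)

    open Links
    open Children
    open Spine

    record Updated (a : Symbol) (T : Str) (ss : List Str) (ns : NodeList) (s : HState) : Set where
      field
        {cost copied} : ℕ
        {spine′}       : List Str
        execution      : Triple update s cost (λ s′ → ∃ λ ns′ → Ready (a ∷ T) spine′ ns′ s′ × suc (copied + length ns) ≤ length ns′)
        amortized      : cost + 1 + 740 * Λ * (2 * #above spine′ (a ∷ T)) ≤ 740 * Λ * (2 * #above ss T + copied + 13)

    module _ {T : Str} {ss : List Str} {ns : NodeList} {s : HState} {a ω : Symbol}
             (term : Terminated ω (a ∷ T)) (W≤ : length (a ∷ T) ≤ n) (ready : Ready T ss ns s) (inp≡ : get (rs s) inp ≡ letter a) where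
      open Ready ready
      open World world

      private
        T≤ : length T ≤ n
        T≤ = ≤-trans (n≤1+n _) W≤
        T∈ss : T ∈ ss
        T∈ss = type1-in (suffix here)
        double : 2 * length (a ∷ T) ≡ 2 + 2 * length T
        double = *-suc 2 (length T)
        ss≤ : suc (length ss) ≤ 1 + 2 * n
        ss≤ = ≤-trans (s≤s small) (≤-trans (≤-reflexive (sym double)) (≤-trans (*-monoʳ-≤ 2 W≤) (n≤1+n _)))
        open Bounds T≤ (≤-trans (n≤1+n _) ss≤) world sane using (room)
        new : ¬ In ns (a ∷ T)
        new W∈ = <-irrefl refl (occ-length (Sane.occurs sane W∈))
        closed : ∀ {b x} → b ∷ x ∈ ss → x ∈ ss
        closed x∈ = type1-in (type1-tail (type1 x∈))

        -- h is the type-1 parent of the new leaf. One unit is the leaf itself, the other the slack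
        -- of `#above-insert`.
        leaf-depth : ∀ {ss₁ h} → (∀ {x} → x ∈ ss₁ → Type1′ T x ⊎ x ≡ h) → h ∈ ss₁ → Head a T h →
          #above ((a ∷ T) ∷ ss₁) (a ∷ T) ≤ 2 + #above ss₁ h
        leaf-depth {ss₁} {h} type1₁ h∈ head = ≤-trans
          (≤-reflexive (#above-nearest ((a ∷ T) ∷ ss₁) (here refl) (there h∈ , head≺ head , nearest)))
          (s≤s (#above-insert {ss₁} (a ∷ T) h))
          where
          nearest : ∀ {t} → t ∈ (a ∷ T) ∷ ss₁ → t ≺ a ∷ T → t ≼ h
          nearest (here refl) t≺ = ⊥-elim (≺-irrefl t≺)
          nearest (there t∈) t≺ with type1₁ t∈
          ... | inj₁ t1 = Head.max head (≺⇒≼ t≺) (type1-occ t1)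
          ... | inj₂ refl = ≼-refl

        module _ {i o} (plan : Climb ns ss a T i o) (i≤ : i + #footing ss o ≤ suc (#above ss T)) (head : Head a T (headOf a o)) where

          assemble : ∀ {ss₁ r M} →
            (∀ {s₁} → Located ss T a o ns s s₁ →
              Triple (test (eqN cr hr) nop promote) (record s₁ { rn = put (rn s₁) cr (get (hn s₁) down (get (rn s₁) hr)) })
                (1 + (38 + (14 + 38 * Λ) * r + (122 + 293 * Λ) * M))
                (λ s′ → ∃ λ ms → Prepared T a o ss₁ (M + length ns) (6 + nodeAddr 0) ms s′)) →
            length ss₁ ≤ 2 * length (a ∷ T) → headOf a o ∈ ss₁ →
            (∀ {x} → x ∈ ss₁ → Type1′ T x ⊎ x ≡ headOf a o) → (∀ {x} → Type1′ T x → x ∈ ss₁) →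
            #above ss₁ T ≤ suc (#above ss T) → #footing ss o ≤ #footing ss₁ o →
            r + #above ss₁ (headOf a o) ≤ 3 + #footing ss o → Updated a T ss ns s
          assemble {ss₁} {r} {M} phase ss₁≤ h∈ type1₁ type1-in₁ T-above foot-mono head-above = record
            { cost = (8 + (11 + 38 * Λ) * i) + (3 + ((1 + (38 + (14 + 38 * Λ) * r + (122 + 293 * Λ) * M)) +
                       ((103 + 586 * Λ) + (123 + 293 * Λ) * G)))
            ; copied = M
            ; execution = climbT s world plan tip∈ T∈ss root∈ inp≡ new room ⟫ λ {s₁} located →
                ld⟩ (blockN ns room (address (World.links (Located.world located)) (Located.h∈ located))) $
                phase located ⟫ λ { (ms , prepared) →
                  let g , g≤ , t = Finish.finishT term W≤ ss₁≤ head h∈ prepared type1₁ type1-in₁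
                  in weaken (+-monoʳ-≤ (103 + 586 * Λ) (*-monoʳ-≤ (123 + 293 * Λ) (m+n≤o⇒m≤o∸n g g≤))) t }
            ; amortized = amortized≤ 1≤Λ {i} {r} {G} {#above ss T} {#above ((a ∷ T) ∷ ss₁) (a ∷ T)} {#footing ss o} M i≤
                (≤-trans (+-monoʳ-≤ G foot-mono) (≤-trans (≤-reflexive (m∸n+n≡m (foot-above o (Head.prefix head)))) T-above))
                (≤-trans (+-monoʳ-≤ r (leaf-depth type1₁ h∈ head))
                  (≤-trans (≤-reflexive (trans (sym (+-assoc r 2 _)) (trans (cong (_+ #above ss₁ (headOf a o)) (+-comm r 2)) (+-assoc 2 r _))))
                    (+-monoʳ-≤ 2 head-above)))
            }
            where
            -- The exact length of the last walk is only known from the state that the preceding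
            -- phases reach; this number bounds it in advance, so that the cost of the update is
            -- fixed.
            G = #above ss₁ T ∸ #footing ss₁ o
            foot-above : ∀ o → headOf a o ≼ a ∷ T → #footing ss₁ o ≤ #above ss₁ T
            foot-above nothing  _ = z≤n
            foot-above (just u) p = #above-prefix ss₁ (≼-tail p)

          keep : headOf a o ∈ ss → Updated a T ss ns s
          keep h∈ = assemble {r = 0} {M = 0}
            (λ located → weaken (s≤s z≤n) (mapT (λ p → ns , p) (Phase.keepT T≤ ss≤ ready located h∈)))
            (≤-trans small (≤-trans (n≤1+n _) (≤-reflexive (sym double)))) h∈ (λ x∈ → inj₁ (type1 x∈)) type1-in (n≤1+n _) ≤-refl (above-head o)
            where
            above-head : ∀ o → #above ss (headOf a o) ≤ 3 + #footing ss o
            above-head nothing  = ≤-trans (≤-reflexive (#above-root ss (rootS spine))) (s≤s z≤n)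
            above-head (just u) = ≤-trans (#above-tail ss closed u) (m≤n+m _ 2)

        lift : ∀ {u i} → Climb ns ss a T i (just u) → i + #footing ss (just u) ≤ suc (#above ss T) → Head a T (a ∷ u) →
          In ns (a ∷ u) → u ∈ ss → a ∷ u ∉ ss → Updated a T ss ns s
        lift {u} plan i≤ head (_ , h∈ns) u∈ h∉ with downOk spine h∈ns
        ... | C , target@(C∈ss , h≼C , minimal) , C∈ , _ with ≼-split h≼C | spOk spine C∈ss C∈
        ... | inj₁ refl | _ = ⊥-elim (h∉ C∈ss)
        ... | inj₂ () | inj₁ (refl , _)
        ... | inj₂ h≺C | inj₂ (P , _ , _ , _ , near@(P∈ , P≺C , max) , _) =
          let r , redirection , r≤ = Plans.redirectFromPlan (rootS spine) (parents spine) closed P∈ (λ { refl → closed P∈ }) u∈ P≺h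
          in assemble plan i≤ head {r = r} (λ located → Phase.promT T≤ ss≤ ready h∉ target near redirection C∈ located)
            (≤-trans (s≤s small) (≤-reflexive (sym double))) (here refl)
            (λ { (here refl) → inj₂ refl ; (there x∈) → inj₁ (type1 x∈) }) (λ t → there (type1-in t))
            (#above-insert {ss} h T) (#above-mono {ss} h u)
            (begin
              r + #above (h ∷ ss) h        ≡⟨ cong (r +_) (#above-nearest (h ∷ ss) (here refl) (there P∈ , P≺h , nearest)) ⟩
              r + suc (#above (h ∷ ss) P)  ≤⟨ +-monoʳ-≤ r (s≤s (#above-insert {ss} h P)) ⟩
              r + (2 + #above ss P)        ≡⟨ trans (sym (+-assoc r 2 _)) (trans (cong (_+ #above ss P) (+-comm r 2)) (+-assoc 2 r _)) ⟩
              2 + (r + #above ss P)        ≤⟨ +-monoʳ-≤ 2 r≤ ⟩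
              3 + #above ss u              ∎)
          where
          open ≤-Reasoning
          h = a ∷ u
          P≺h : P ≺ h
          P≺h with compareUnder (≺⇒≼ P≺C) h≼C
          ... | inj₂ h≺P = ⊥-elim (≺-irrefl (≼-≺-trans (minimal P∈ (≺⇒≼ h≺P)) P≺C))
          ... | inj₁ P≼h with ≼-split P≼h
          ...   | inj₂ P≺h = P≺h
          ...   | inj₁ refl = ⊥-elim (h∉ P∈)
          nearest : ∀ {t} → t ∈ h ∷ ss → t ≺ h → t ≼ P
          nearest (here refl) t≺h = ⊥-elim (≺-irrefl t≺h)
          nearest (there t∈)  t≺h = max t∈ (≺-≼-trans t≺h h≼C)

      updateT : Updated a T ss ns s
      updateT with Plans.climbPlan (rootS spine) (parents spine) ns a T∈ss
      ... | i , o , plan , lowest , i≤ = decide o plan lowest i≤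
        where
        decide : ∀ o → Climb ns ss a T i o → Plans.Lowest (rootS spine) (parents spine) ns a T o →
          i + #footing ss o ≤ suc (#above ss T) → Updated a T ss ns s
        decide o plan lowest i≤ with lowest-head term (λ (_ , x∈) → Sane.occurs sane (_ , x∈)) complete type1-in (rootS spine) (parents spine) lowest
        decide nothing  plan lowest i≤ | head = keep plan i≤ head (rootS spine)
        decide (just u) plan (u∈ , _ , au∈ , _) i≤ | head with a ∷ u ∈? ss
        ... | yes h∈ = keep plan i≤ head h∈
        ... | no  h∉ = lift plan i≤ head au∈ u∈ h∉

  open Updating

  -- The initial state

  module Setup where

    blank : HState
    blank = hstate (constant #num 0) (constant #sym (num 0)) (constant #nf (λ _ → 0)) (constant #sf (λ _ → num 0))

    refines-blank : Refines blank initial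
    refines-blank = record
      { nullOk = lookup-replicate null (num 0)
      ; rnOk   = λ r → trans (lookup-replicate (numReg r) (num 0)) (cong num (sym (get-constant r)))
      ; rsOk   = λ r → trans (lookup-replicate (symReg r) (num 0)) (sym (get-constant r))
      ; hnOk   = λ f {p} _ → cong (λ h → num (h p)) (sym (get-constant f {λ (_ : ℕ) → 0}))
      ; hsOk   = λ f {p} _ → cong (λ h → h p) (sym (get-constant f {λ (_ : ℕ) → num 0})) }

    -- The root occupies the first pair of records behind the one reserved for null, at 64 and 96;
    -- the next pair starts at 128, and 70 is the address of the root in the sense of the
    -- specification.
    rooted : HState
    rooted = record blank
      { rn = put (put (put (put (constant #num 0) tip 64) t₁ 1) next 128) out 70
      ; hn = put (put (constant #nf (λ _ → 0)) len ((λ _ → 0) [ 64 ↦ 1 ])) down ((λ _ → 0) [ 64 ↦ 64 ]) }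

    singleton : NodeList
    singleton = ([] , nodeAddr 0) ∷ []

    private
      at-root : ∀ x → ((λ _ → 0) [ 64 ↦ x ]) (nodeAddr 0) ≡ x
      at-root x = trans (cong ((λ _ → 0) [ 64 ↦ x ]) nodeAddr-zero) (↦-same (λ _ → 0) 64)

      links : Links singleton (fieldsOf rooted)
      links = record
        { functional = λ { (here refl) (here refl) → refl }
        ; injective  = λ { (here refl) (here refl) → refl }
        ; address    = λ { (here refl) → 0 , s≤s z≤n , refl }
        ; slinkOk    = λ { (here ()) ; (there ()) }
        ; lenOk      = λ { (here refl) → at-root 1 }
        ; keyOk      = λ { (here ()) ; (there ()) }
        ; wdict      = λ { (here refl) → dict-empty λ { _ (_ , here ()) ; _ (_ , there ()) } }
        ; wlist      = λ { (here refl) → record { items = [] ; linked = [] ; distinct = [] ; sound = λ ()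
                                                ; complete = λ { (_ , here ()) ; (_ , there ()) } } }
        ; nullTrees  = refl , refl
        ; nullLen    = refl }

      children : Children singleton (fieldsOf rooted)
      children = record
        { crecAt = λ { (here ()) ; (there ()) }
        ; valOk  = λ { (here ()) ; (there ()) }
        ; cdict  = λ { (here refl) → dict-empty λ { _ (_ , _ , (_ , () , _) , here refl , _) } }
        ; edge   = λ { {[]} _ (here ()) ; {[]} _ (there ()) ; {_ ∷ _} _ (here ()) ; {_ ∷ _} _ (there ()) } }

      spine : Spine ([] ∷ []) singleton (get (hn rooted) sp) (get (hs rooted) slab) (get (hn rooted) down)
      spine = record
        { incl   = λ { (here refl) → _ , here refl }
        ; rootS  = here refl
        ; tailS  = λ { (here ()) ; (there ()) }
        ; spOk   = λ { (here refl) (here refl) → inj₁ (refl , refl) }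
        ; downOk = λ { (here refl) → [] , (here refl , [] , λ { (here refl) _ → [] }) ,
                                     here (cong ([] ,_) (trans (at-root 64) (sym nodeAddr-zero))) , λ () } }

      occurs-nowhere : ∀ {b} {v : Str} → Occ (b ∷ v) [] → ∀ {A : Set} → A
      occurs-nowhere (here ())

      extension-nowhere : ∀ (x : Str) {a} → Occ (x ++ a ∷ []) [] → ∀ {A : Set} → A
      extension-nowhere []      = occurs-nowhere
      extension-nowhere (_ ∷ _) = occurs-nowhere

      ready : Ready [] ([] ∷ []) singleton rooted
      ready = record
        { world = record { links = links ; children = children ; spine = spine }
        ; sane = record { unique = [] ∷ [] ; occurs = λ { (_ , here refl) → here [] } }
        ; next≡ = trans (cong (64 +_) (sym nodeAddr-zero)) (nodeAddr-suc 0)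
        ; tip∈ = here (cong ([] ,_) (sym nodeAddr-zero))
        ; root∈ = here refl
        ; out≡ = cong (6 +_) (sym nodeAddr-zero)
        ; complete = λ o → occurs-nowhere o
        ; type1 = λ { (here refl) → root }
        ; type1-in = λ { root → here refl ; (branch {x = x} _ o _) → extension-nowhere x o ; (suffix here) → here refl }
        ; small = s≤s z≤n }

    setupT : Triple setup blank 12 (Ready [] ([] ∷ []) singleton)
    setupT = lit⟩ $ lit⟩ $ st⟩ block $ st⟩ block $ inc⟩ (≤-trans (m≤m+n 129 31) many) $ inc⟩ (≤-trans (m≤m+n 71 89) many) $ nop⟩ ready
      where
      five : 5 ≤ blocks
      five = ≤-trans (s≤s (*-monoˡ-≤ 2 (m≤m+n 2 (3 * n)))) enough
      block : Block 64
      block = 2 , ≤-trans (m≤m+n 3 2) five , refl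
      many : 160 ≤ space
      many = ≤-trans (*-monoˡ-≤ 32 five) fits

  open Setup

  -- The heap stores the linear-size suffix trie

  module Storage where

    open import Data.List.Membership.DecPropositional _≟*_ using (_∈?_)

    open Refines
    open Links
    open Children
    open Spine

    module _ {A : Set} where

      private
        variable
          x y T : List A

      prefix⇒≼ : Prefix _≡_ x y → x ≼ y
      prefix⇒≼ Prefix.[]         = []
      prefix⇒≼ (refl Prefix.∷ p) = _ ∷ prefix⇒≼ p

      ≼⇒prefix : x ≼ y → Prefix _≡_ x y
      ≼⇒prefix []      = Prefix.[]
      ≼⇒prefix (_ ∷ p) = refl Prefix.∷ ≼⇒prefix p

      infix⇒occ : Infix _≡_ x T → Occ x T
      infix⇒occ (Infix.here p)  = here (prefix⇒≼ p)
      infix⇒occ (Infix.there i) = there (infix⇒occ i)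

      occ⇒infix : Occ x T → Infix _≡_ x T
      occ⇒infix (here p)  = Infix.here (≼⇒prefix p)
      occ⇒infix (there o) = Infix.there (occ⇒infix o)

      suffix⇒suff : Suffix _≡_ x T → Suff x T
      suffix⇒suff (Suffix.here eqs) with Pointwise-≡⇒≡ eqs
      ... | refl = here
      suffix⇒suff (Suffix.there s) = there (suffix⇒suff s)

      suff⇒suffix : Suff x T → Suffix _≡_ x T
      suff⇒suffix here      = Suffix.here (≡⇒Pointwise-≡ refl)
      suff⇒suffix (there s) = Suffix.there (suff⇒suffix s)

      open LinearSizeSuffixTrie

      type1⁺ : Type1′ T x → Type1 T x
      type1⁺ {T = T} {x} t = i , i , kind t
        where
        i = occ⇒infix (type1-occ t)
        kind : Type1′ T x → x ≡ [] ⊎ Branching T x ⊎ Suffix _≡_ x T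
        kind root              = inj₁ refl
        kind (branch a≢b o o′) = inj₂ (inj₁ (_ , _ , a≢b , occ⇒infix o , occ⇒infix o′))
        kind (suffix s)        = inj₂ (inj₂ (suff⇒suffix s))

      type1⁻ : Type1 T x → Type1′ T x
      type1⁻ (_ , _ , inj₁ refl)                          = root
      type1⁻ (_ , _ , inj₂ (inj₁ (_ , _ , a≢b , i , i′))) = branch a≢b (infix⇒occ i) (infix⇒occ i′)
      type1⁻ (_ , _ , inj₂ (inj₂ s))                      = suffix (suffix⇒suff s)

    private
      Entry : (ℕ → Word) → (ℕ → ℕ) → Symbol × ℕ → ℕ → Set
      Entry K V (a , v) q = K q ≡ letter a × v ≡ V q

      module _ {K : ℕ → Word} {V : ℕ → ℕ} where

        entries-sorted : ∀ {xs qs} → Pointwise (Entry K V) xs qs → AllPairs _≺⟨ K ⟩_ qs → Sorted xs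
        entries-sorted [] [] = []
        entries-sorted {x ∷ _} {q ∷ _} ((k , _) ∷ es) (lt ∷ lts) = first es lt ∷ entries-sorted es lts
          where
          first : ∀ {xs qs} → Pointwise (Entry K V) xs qs → All (q ≺⟨ K ⟩_) qs → All (λ y → proj₁ x ⊏ proj₁ y) xs
          first [] [] = []
          first ((k′ , _) ∷ es) ((a , b , ka , kb , a⊏b) ∷ lts) =
            subst₂ _⊏_ (letter-injective (trans (sym ka) k)) (letter-injective (trans (sym kb) k′)) a⊏b ∷ first es lts

        entry∈ : ∀ {xs qs e} → Pointwise (Entry K V) xs qs → e ∈ xs → ∃ λ q → q ∈ qs × Entry K V e q
        entry∈ (e ∷ _)  (here refl) = _ , here refl , e
        entry∈ (_ ∷ es) (there e∈)  = let q , q∈ , e = entry∈ es e∈ in q , there q∈ , e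

        ∈entry : ∀ {xs qs q} → Pointwise (Entry K V) xs qs → q ∈ qs → ∃ λ e → e ∈ xs × Entry K V e q
        ∈entry (e ∷ _)  (here refl) = _ , here refl , e
        ∈entry (_ ∷ es) (there q∈)  = let x , x∈ , e = ∈entry es q∈ in x , there x∈ , e

    module _ {s : HState} {μ : State #reg} (ok : Refines s μ) where

      dictionary : ∀ {t} → Rep (shapeOf s) t → (∀ {q} → q ∈ inorder t → Keyed (keys s) q) →
        ∃ λ xs → Dictionary μ (rootOf t) xs × Pointwise (Entry (keys s) (get (hn s) val)) xs (inorder t)
      dictionary leaf keyed = [] , empty , []
      dictionary (node {l} {p} {_} {r} bp p≢0 L R _ repl repr) keyed with keyed (∈-++⁺ʳ (inorder l) (here refl))
        | dictionary repl (λ q∈ → keyed (∈-++⁺ˡ q∈)) | dictionary repr (λ q∈ → keyed (∈-++⁺ʳ (inorder l) (there q∈)))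
      ... | a , k | xs , dl , es | ys , dr , fs = xs ++ (a , get (hn s) val p) ∷ ys ,
        node p≢0 (inSpace (offsetS<32 key) bp , trans (hsOk ok key bp) k)
                 (inSpace (offset<32 val) bp , hnOk ok val bp)
                 (inSpace (offset<32 left) bp , trans (hnOk ok left bp) (cong num L))
                 (inSpace (offset<32 right′) bp , trans (hnOk ok right′ bp) (cong num R)) dl dr ,
        Pointwise.++⁺ es ((k , refl) ∷ fs)

      module _ {W : Str} {ss : List Str} {ns : NodeList} (W≤ : length W ≤ n) (ready : Ready W ss ns s) where
        open Ready ready
        open World world renaming (children to kids)
        open LinearSizeSuffixTrie W
        open Bounds W≤ (≤-trans small (s≤s (*-monoʳ-≤ 2 W≤))) world sane using (room)

        private
          node⇒in : ∀ {x} → Node x → In ns x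
          node⇒in (inj₁ t) = incl spine (type1-in (type1⁻ t))
          node⇒in (inj₂ (i , _ , a , v , refl , t)) = complete (infix⇒occ i) (type1-in (type1⁻ t))

          in⇒node : ∀ {x} → In ns x → Node x
          in⇒node {[]} _ = inj₁ (type1⁺ root)
          in⇒node {a ∷ v} (p , x∈) with a ∷ v ∈? ss
          ... | yes x∈ss = inj₁ (type1⁺ (type1 x∈ss))
          ... | no  x∉ss = inj₂ (occ⇒infix (Sane.occurs sane (p , x∈)) , (λ t → x∉ss (type1-in (type1⁻ t))) ,
            a , v , refl , type1⁺ (type1 (tailS spine x∈)))

          parent⇒child : ∀ {x z} → IsParent x z → Child ns x z
          parent⇒child {x} (X , _ , (_ , _ , refl) , max) = node⇒in X , ≺-++ x ,
            λ y∈ y≺z → prefix⇒≼ (max _ (in⇒node y∈) (≺⇒++ y≺z))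

          child⇒parent : ∀ {x z} → Child ns x z → In ns z → IsParent x z
          child⇒parent (x∈ , x≺z , max) z∈ = in⇒node x∈ , in⇒node z∈ , ≺⇒++ x≺z ,
            λ { y Y (a , w , refl) → ≼⇒prefix (max (node⇒in Y) (≺-++ y)) }

          -- The specification wants dictionary, suffix link and + sign in three consecutive words,
          -- which begin at offset 6 of the main record. Strings that are not nodes get a dummy
          -- address.
          pointer : Str → ℕ
          pointer x with In? ns x
          ... | yes (p , _) = 6 + p
          ... | no _        = 0

          pointer≡ : ∀ {x p} → (x , p) ∈ ns → pointer x ≡ 6 + p
          pointer≡ {x} x∈ with In? ns x
          ... | yes (_ , x∈′) = cong (6 +_) (functional links x∈′ x∈)
          ... | no ∉ = ⊥-elim (∉ (_ , x∈))

          block : ∀ {x p} → (x , p) ∈ ns → Block p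
          block x∈ = blockN ns room (address links x∈)

          stored : ∀ f {x p v} → (x , p) ∈ ns → get (hn s) f p ≡ v → μ [ offset f + p ]↦ num v
          stored f x∈ eq = inSpace (offset<32 f) (block x∈) , trans (hnOk ok f (block x∈)) (cong num eq)

          crec-entry : ∀ {x a w p} → (x ++ a ∷ w , p) ∈ ns → get (hn s) val (get (hn s) crec p) ≡ 6 + p
          crec-entry {[]}    z∈ = valOk kids z∈
          crec-entry {_ ∷ _} z∈ = valOk kids z∈

        stores : StoresLST μ (numReg out) W
        stores = record
          { address   = pointer
          ; nonnull   = λ X eq → let p , x∈ = node⇒in X in contra (trans (sym (pointer≡ x∈)) eq)
          ; injective = λ X Y eq → let p , x∈ = node⇒in X ; q , y∈ = node⇒in Y in
              Links.injective links x∈ (subst (λ q → (_ , q) ∈ ns)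
                (sym (+-cancelˡ-≡ 6 _ _ (trans (sym (pointer≡ x∈)) (trans eq (pointer≡ y∈))))) y∈)
          ; atRoot    = trans (rnOk ok out) (cong num (trans out≡ (sym (pointer≡ root∈))))
          ; children  = λ X → outgoing (node⇒in X)
          ; slink     = λ X → let p , x∈ = node⇒in X ; q , y∈ , eq = slinkOk links x∈ in
              subst₂ (λ i j → μ [ 1 + i ]↦ num j) (sym (pointer≡ x∈)) (sym (pointer≡ y∈)) (stored slink x∈ eq)
          ; plus      = λ { {x} {a} {w} e@(_ , Z , _) → let p , z∈ = node⇒in Z in
              subst (λ i → μ [ 2 + i ]↦ num (plusSign w)) (sym (pointer≡ z∈))
                (stored plus′ z∈ (proj₂ (edge kids (parent⇒child e) z∈))) } }
          where
          contra : ∀ {p} → 6 + p ≢ 0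
          contra ()
          outgoing : ∀ {x} → In ns x → ∃₂ λ d xs → μ [ pointer x ]↦ num d × Dictionary μ d xs × Sorted xs ×
            (∀ a v → (a , v) ∈ xs ⇔ (∃ λ w → Edge x a w × v ≡ pointer (x ++ a ∷ w)))
          outgoing {x} (p , x∈) with cdict kids x∈
          ... | dict with dictionary (Dict.rep dict) (Dict.keyed dict)
          ... | xs , D , es = _ , xs ,
            subst (λ i → μ [ i ]↦ num (rootOf (Dict.tree dict))) (sym (pointer≡ x∈)) (stored croot x∈ (Dict.root≡ dict)) ,
            D , entries-sorted es (Dict.sorted dict) , λ a v → mk⇔ sound′ complete′
            where
            sound′ : ∀ {a v} → (a , v) ∈ xs → ∃ λ w → Edge x a w × v ≡ pointer (x ++ a ∷ w)
            sound′ e∈ with entry∈ es e∈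
            ... | q , q∈ , k , refl with Dict.sound dict q∈
            ... | z , r , child@(_ , x≺z , _) , z∈ , refl with ≺⇒++ x≺z
            ... | c , w , refl with letter-injective (trans (sym k) (proj₁ (edge kids child z∈)))
            ... | refl = w , child⇒parent child (r , z∈) , trans (crec-entry {x} z∈) (sym (pointer≡ z∈))
            complete′ : ∀ {a v} → (∃ λ w → Edge x a w × v ≡ pointer (x ++ a ∷ w)) → (a , v) ∈ xs
            complete′ {a} (w , e@(_ , Z , _) , refl) with node⇒in Z
            ... | r , z∈ with ∈entry es (Dict.complete dict (_ , r , parent⇒child e , z∈ , refl))
            ... | (a′ , v′) , e∈ , k , v≡ with letter-injective (trans (sym k) (proj₁ (edge kids (parent⇒child e) z∈)))
            ... | refl = subst (λ v → (a , v) ∈ xs) (trans v≡ (trans (crec-entry {x} z∈) (sym (pointer≡ z∈)))) e∈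

  open Storage

  -- Summing up over the text

  module Construction where

    -- In `bound` the copied links are paid for by `length ns`: each of them makes the node list
    -- longer by one, so no sum over the updates has to be kept.
    record Built (T : Str) : Set where
      field
        {time}  : ℕ
        {final} : State #reg
        {state} : HState
        {ss}    : List Str
        {ns}    : NodeList
        built   : Constructs algorithm T time final
        ok      : Refines state final
        ready   : Ready T ss ns state
        bound   : time + 740 * Λ * (2 * #above ss T) ≤ 740 * Λ * (length ns + 13 * length T + 2)

    build : ∀ {ω T} → Terminated ω T → length T ≤ n → Built T
    build {T = T} term = from-suffix T term
      where
      initially : Built []
      initially with run setupT refines-blank
      ... | t , μ , s , e , t≤ , ok , ready = record
        { built = start e ; ok = ok ; ready = ready
        -- Of the three units available for the one-node trie, one covers the setup and two the
        -- potential of the root, which has depth 1 and counts twice.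
        ; bound = ≤-trans (+-monoˡ-≤ (740 * Λ * 2) (≤-trans t≤ (≤-trans (m≤m+n 12 728)
            (≤-trans (≤-reflexive (sym (*-identityʳ 740))) (*-monoʳ-≤ 740 1≤Λ)))))
            (≤-reflexive (trans (cong (_+ 740 * Λ * 2) (sym (*-identityʳ (740 * Λ)))) (sym (*-distribˡ-+ (740 * Λ) 1 2)))) }

      extend : ∀ {ω a T} → Terminated ω (a ∷ T) → length (a ∷ T) ≤ n → Built T → Built (a ∷ T)
      extend {a = a} {T} term W≤ b = go (run execution (refines-sym ok inp))
        where
        open Built b
        ready′ : Ready T ss ns (record state { rs = put (rs state) inp (letter a) })
        ready′ = record
          { world = R.world ; sane = R.sane ; next≡ = R.next≡ ; tip∈ = R.tip∈ ; root∈ = R.root∈ ; out≡ = R.out≡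
          ; complete = R.complete ; type1 = R.type1 ; type1-in = R.type1-in ; small = R.small }
          where module R = Ready ready
        open Updated (updateT term W≤ ready′ refl)
        go : (∃₂ λ t μ → ∃ λ s → Exec (compile update) _ t μ × t ≤ cost × Refines s μ ×
               ∃ λ ns′ → Ready (a ∷ T) spine′ ns′ s × suc (copied + length ns) ≤ length ns′) → Built (a ∷ T)
        go (t , μ , s , e , t≤ , ok′ , ns′ , ready″ , longer) = record
          { built = read built e (stores ok′ W≤ ready″)
          ; ok    = ok′
          ; ready = ready″
          ; bound = begin
              time + (1 + t) + K * (2 * D′)                          ≤⟨ +-monoˡ-≤ (K * (2 * D′)) (+-monoʳ-≤ time (s≤s t≤)) ⟩
              time + (1 + cost) + K * (2 * D′)                       ≡⟨ regroup time cost (K * (2 * D′)) ⟩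
              time + (cost + 1 + K * (2 * D′))                       ≤⟨ +-monoʳ-≤ time amortized ⟩
              time + K * (2 * D + copied + 13)                       ≡⟨ distribute time K (2 * D) copied ⟩
              (time + K * (2 * D)) + K * (copied + 13)               ≤⟨ +-monoˡ-≤ (K * (copied + 13)) bound ⟩
              K * (length ns + 13 * length T + 2) + K * (copied + 13) ≡⟨ collect K (length ns) (length T) copied ⟩
              K * ((copied + length ns) + 13 * length (a ∷ T) + 2)
                ≤⟨ *-monoʳ-≤ K (+-monoˡ-≤ 2 (+-monoˡ-≤ (13 * length (a ∷ T)) (<⇒≤ longer))) ⟩
              K * (length ns′ + 13 * length (a ∷ T) + 2)             ∎ }
          where
          open ≤-Reasoning
          K  = 740 * Λ
          D  = #above ss T
          D′ = #above spine′ (a ∷ T)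
          regroup : ∀ t c x → t + (1 + c) + x ≡ t + (c + 1 + x)
          regroup = solve-∀
          distribute : ∀ t k d m → t + k * (d + m + 13) ≡ (t + k * d) + k * (m + 13)
          distribute = solve-∀
          collect : ∀ k l t m → k * (l + 13 * t + 2) + k * (m + 13) ≡ k * ((m + l) + 13 * (1 + t) + 2)
          collect = solve-∀

      from-suffix : ∀ {ω} T → Terminated ω T → length T ≤ n → Built T
      from-suffix (a ∷ []) term W≤ = extend term W≤ initially
      from-suffix (a ∷ T@(_ ∷ _)) term@(_ ∷ term′) W≤ = extend term W≤ (from-suffix T term′ (≤-trans (n≤1+n _) W≤))

    -- With at most 1 + 3 n nodes the bracket is at most 3 + 16 n, hence at most 19 n, and 14060 =
    -- 19 · 740.
    time≤ : ∀ {T} → length T ≡ n → 1 ≤ n → (b : Built T) → Built.time b ≤ 14060 * (n * Λ)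
    time≤ {T} refl 1≤n b = begin
        time                                                ≤⟨ ≤-trans (m≤m+n time _) bound ⟩
        740 * Λ * (length ns + 13 * n + 2)                  ≤⟨ *-monoʳ-≤ (740 * Λ) (+-monoˡ-≤ 2 (+-monoˡ-≤ (13 * n) size-bound)) ⟩
        740 * Λ * (1 + 3 * n + 13 * n + 2)                  ≡⟨ expand Λ n ⟩
        740 * Λ * (3 * 1 + 16 * n)                          ≤⟨ *-monoʳ-≤ (740 * Λ) (+-monoˡ-≤ (16 * n) (*-monoʳ-≤ 3 1≤n)) ⟩
        740 * Λ * (3 * n + 16 * n)                          ≡⟨ collect Λ n ⟩
        14060 * (n * Λ)                                     ∎
        where
        open ≤-Reasoning
        open Built b
        open Ready ready
        open Bounds ≤-refl (≤-trans small ≤-refl) world sane using (size-bound)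
        expand : ∀ l n → 740 * l * (1 + 3 * n + 13 * n + 2) ≡ 740 * l * (3 * 1 + 16 * n)
        expand = solve-∀
        collect : ∀ l n → 740 * l * (3 * n + 16 * n) ≡ 14060 * (n * l)
        collect = solve-∀

    constructs : ∀ {ω T} → Terminated ω T → length T ≡ n → 1 ≤ n →
      ∃₂ λ t μ → Constructs algorithm T t μ × t ≤ 14060 * (n * (1 ⊔ ⌈log₂ σ ⌉))
    constructs term len≡ 1≤n = time , final , built ,
      ≤-trans (time≤ len≡ 1≤n b) (≤-reflexive (cong (λ l → 14060 * (n * l)) Λ≡))
      where
      b = build term (≤-reflexive len≡)
      open Built b

  open Construction

-- Choice of the constants

terminated : ∀ {A : Set} (U : List A) {ω} → ω ∉ U → Terminated ω (U ∷ʳ ω)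
terminated []      _  = end
terminated (_ ∷ U) ω∉ = (λ { refl → ω∉ (here refl) }) ∷ terminated U (ω∉ ∘ there)

nonempty : ∀ {A : Set} {T : List A} {ω} → Terminated ω T → 1 ≤ length T
nonempty end     = s≤s z≤n
nonempty (_ ∷ _) = s≤s z≤n

addressable : ∀ c n → 1 ≤ c → c * n ≤ 2 ^ (c * suc ⌈log₂ n ⌉)
addressable c n 1≤c = begin
  c * n                  ≤⟨ *-mono-≤ (<⇒≤ (n<2^n c)) (n≤2^⌈log₂n⌉ n) ⟩
  2 ^ c * 2 ^ ℓ          ≡⟨ ^-distribˡ-+-* 2 c ℓ ⟨
  2 ^ (c + ℓ)            ≤⟨ ^-monoʳ-≤ 2 (+-monoʳ-≤ c (≤-trans (≤-reflexive (sym (*-identityˡ ℓ))) (*-monoˡ-≤ ℓ 1≤c))) ⟩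
  2 ^ (c + c * ℓ)        ≡⟨ cong (2 ^_) (*-suc c ℓ) ⟨
  2 ^ (c * suc ℓ)        ∎
  where
  open ≤-Reasoning
  ℓ = ⌈log₂ n ⌉

construction : ∀ c → 14060 ≤ c → ∀ {σ} (Σ : OrderedAlphabet σ) (T : List (OrderedAlphabet.Symbol Σ)) →
  EndsWithUniqueTerminal T →
  ∃₂ λ t s → Machine.Constructs Σ (c * length T) (c * suc ⌈log₂ length T ⌉) algorithm T t s ×
             t ≤ c * (length T * (1 ⊔ ⌈log₂ σ ⌉))
construction c c≥ {σ} Σ T (U , ω , refl , ω∉) =
  let t , s , built , t≤ = OnMachine.Construction.constructs setting term refl 1≤n
  in t , s , built , ≤-trans t≤ (*-monoˡ-≤ (n * (1 ⊔ ⌈log₂ σ ⌉)) c≥)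
  where
  n = length T
  term : Terminated ω T
  term = terminated U ω∉
  1≤n : 1 ≤ n
  1≤n = nonempty term
  -- The number of blocks is the least that `enough` admits. Since 1 ≤ n it amounts to at most 11 n
  -- blocks of 32 words, so the space constant 352 is dwarfed by the one needed for the time.
  fits : (5 + 6 * n) * 32 ≤ c * n
  fits = begin
    (5 + 6 * n) * 32      ≤⟨ *-monoˡ-≤ 32 (+-monoˡ-≤ (6 * n) (*-monoʳ-≤ 5 1≤n)) ⟩
    (5 * n + 6 * n) * 32  ≡⟨ collect n ⟩
    352 * n               ≤⟨ *-monoˡ-≤ n (≤-trans (m≤m+n 352 13708) c≥) ⟩
    c * n                 ∎
    where
    open ≤-Reasoning
    collect : ∀ n → (5 * n + 6 * n) * 32 ≡ 352 * n
    collect = solve-∀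
  roomy : 128 ≤ c * n
  roomy = *-mono-≤ (≤-trans (m≤m+n 128 13932) c≥) 1≤n
  enough : (2 + 3 * n) * 2 < 5 + 6 * n
  enough = ≤-reflexive (count n)
    where
    count : ∀ n → 1 + (2 + 3 * n) * 2 ≡ 5 + 6 * n
    count = solve-∀
  setting : Setting
  setting = record
    { Σ = Σ ; space = c * n ; width = c * suc ⌈log₂ n ⌉ ; blocks = 5 + 6 * n
    ; fits = fits ; wide = addressable c n (≤-trans (m≤m+n 1 14059) c≥) ; roomy = roomy ; n = n ; enough = enough }

theorem1 : ∃₂ λ (alg : OnlineAlgorithm) (c : ℕ) →
    ∀ {σ : ℕ} (Σ : OrderedAlphabet σ) (T : List (OrderedAlphabet.Symbol Σ)) →
    EndsWithUniqueTerminal T →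
    let n     = length T
        space = c * n
        width = c * suc ⌈log₂ n ⌉
    in ∃₂ λ t s →
       Machine.Constructs Σ space width alg T t s ×
       t ≤ c * (n * (1 ⊔ ⌈log₂ σ ⌉))
theorem1 = algorithm , 14060 , construction 14060 ≤-refl
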